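{- Let $\alpha$ be a weak composition of length $k$ and $\varphi$ any flag. Then $\mathrm{SSKT}(\alpha,\varphi)$, with the key-tableau raising operators $e_i$, their inverse lowering operators $f_i$, and weight $\mathsf{wt}$, is a Demazure crystal (of type $\mathfrak{gl}_n$ for any $n\ge\varphi(k)$), with character $$\kappa_{(\alpha,\varphi)}=\pi_{\varphi(1)\downarrow1}\,\pi_{\varphi(2)\downarrow2}\cdots\pi_{\varphi(k)\downarrow k}(\kappa_\alpha).$$
   Context: Tableaux: fillings by positive integers of finite sets of boxes (row $r$, column $c\in\mathbb{Z}_{>0}$), rows left-justified, French notation (rows indexed upward); $T_{rc}$ is an entry; shape = weak composition of row lengths. Weight of a word $u$: $\mathsf{wt}(u)=(\beta_1,\beta_2,\dots)$ with $\beta_i$ the multiplicity of $i$; $\mathsf{wt}(T)$ is the weight of the word $\cdots r^{(2)}r^{(1)}$ ($r^{(i)}$ = row $i$ read left to right). A flag is a weakly increasing $\varphi:\mathbb{Z}_{>0}\to\mathbb{Z}_{>0}$ with $\varphi(m)\ge m$. A key tableau: (a) rows weakly decreasing; (b) columns with distinct entries; (c) if boxes $(i,j),(k,j)$ with $i<k$ have $T_{ij}>T_{kj}$ then $(i,j+1)$ is a box with $T_{i,j+1}>T_{kj}$. $\varphi$-flagged: $T_{ij}\le\varphi(i)$. $\mathrm{SSKT}(\alpha,\varphi)$: $\varphi$-flagged key tableaux of shape $\alpha$; $\kappa_{(\alpha,\varphi)}=\sum_{T\in\mathrm{SSKT}(\alpha,\varphi)}x^{\mathsf{wt}(T)}$.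 The length $\ell(\alpha)$ is the least $k$ with $\alpha_i=0$ for $i>k$. Raising operators on key tableaux: for a word $\rho=\rho_1\cdots\rho_m$, $m_i(\rho,j)$ = number of $i+1$'s minus number of $i$'s in $\rho_j\cdots\rho_m$, $m_i(\rho)=\max_jm_i(\rho,j)$; $\mathsf{col}(T)$ reads entries down each column, columns right to left. If $m_i(\mathsf{col}(T))\le0$, $e_i(T)=0$; otherwise with $q$ the largest index with $m_i(\mathsf{col}(T),q)=m_i(\mathsf{col}(T))$, change to $i$ all entries $i+1$ to the right of $\mathsf{col}(T)_q$ in its row, then change to $i+1$ all entries $i$ in the same columns. $f_i$ is defined by $f_i(U)=T$ iff $e_i(T)=U$. Crystals: a $\mathfrak{gl}_n$-crystal is a finite set with $e_i,f_i:\mathcal B\to\mathcal B\sqcup\{0\}$ ($1\le i<n$) and $\mathsf{wt}:\mathcal B\to\mathbb{Z}^n$, $e_i(b)=c\iff f_i(c)=b$, then $\mathsf{wt}(c)=\mathsf{wt}(b)+\mathbf e_i-\mathbf e_{i+1}$; isomorphisms are weight-preserving bijections commuting with $e_i,f_i$; character $\sum_bx^{\mathsf{wt}(b)}$. $\mathrm{RF}_n(w)$ (for $w\in S_\infty$) is the set of factorizations $(r^{(n)}|\cdots|r^{(1)})$ of reduced words for $w$ into $n$ consecutive possibly empty strictly increasing subwords, with Morse–Schilling crystal: take elements $b$ of $r^{(i)}$ in decreasing order, pairing each with the smallest unpaired $a\in r^{(i+1)}$, $a>b$; $R_i$, $L_i$ = unpaired letters of $r^{(i)}$, $r^{(i+1)}$.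 $f_i=0$ if $R_i=\varnothing$, else remove $b=\min R_i$ from $r^{(i)}$ and add $b-t$ to $r^{(i+1)}$, $t=\min\{j\ge0:b-j-1\notin r^{(i)}\}$; $e_i=0$ if $L_i=\varnothing$, else remove $a=\max L_i$ from $r^{(i+1)}$ and add $a+s$ to $r^{(i)}$, $s=\min\{j\ge0:a+j+1\notin r^{(i+1)}\}$; $\mathsf{wt}=(\ell(r^{(1)}),\dots,\ell(r^{(n)}))$. $\mathfrak D_iX=\{b:e_i^k(b)\in X\text{ some }k\ge0\}$. For a highest weight $u$ ($e_i(u)=0$ for all $i$) and $\sigma\in S_n$ with reduced word $i_1\cdots i_m$, $\mathfrak D_\sigma\{u\}=\mathfrak D_{i_1}\cdots\mathfrak D_{i_m}\{u\}$ is a Demazure subcrystal (operators leaving it set to $0$). A Demazure crystal is a crystal isomorphic to a Demazure subcrystal of some $\mathrm{RF}_n(w)$. Polynomials: $\partial_i f=(f-s_if)/(x_i-x_{i+1})$ where $s_i$ swaps $x_i,x_{i+1}$; $\pi_if=\partial_i(x_if)$; $\pi_w=\pi_{i_1}\cdots\pi_{i_m}$ for a reduced word of $w$. $S_\infty$ acts on weak compositions on the right by permuting entries ($\alpha\cdot s_i$ swaps $\alpha_i,\alpha_{i+1}$). $\kappa_\alpha=\pi_wx^\lambda$ where $w$ is of minimal length with $\alpha\cdot w=\lambda$ a partition. $\pi_{t\downarrow s}=\pi_{t-1}\pi_{t-2}\cdots\pi_s$ for $t>s$ and $\pi_{t\downarrow t}=\mathrm{id}$. -}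

module Defs where

open import Data.Bool using (Bool; true; false; _∧_; _∨_; not; if_then_else_; T)
open import Data.Nat using (ℕ; zero; suc; _+_; _∸_; _≤_; _<_; _⊔_; _≡ᵇ_; _≤ᵇ_; _<ᵇ_)
open import Data.Integer using (ℤ; +_; -[1+_]) renaming (_+_ to _+ℤ_; _*_ to _*ℤ_; _⊔_ to _⊔ℤ_; _≤ᵇ_ to _≤ᵇℤ_)
open import Data.List using (List; []; _∷_; length; map; concat; concatMap; reverse; _++_; foldr)
open import Data.List.Relation.Unary.All using (All)
open import Data.Maybe using (Maybe; just; nothing)
open import Data.Product using (Σ; _×_; _,_)
open import Data.Fin using (Fin; toℕ)
open import Data.Vec using (Vec; tabulate) renaming ([] to []ᵛ; _∷_ to _∷ᵛ_)
open import Data.Vec.Properties using (≡-dec)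
open import Data.Nat.Properties using () renaming (_≟_ to _≟ℕ_)
open import Relation.Nullary using (does)
open import Relation.Binary.PropositionalEquality using (_≡_)

-- Generic helpers (all indices 1-based unless said otherwise)

rangeFrom : ℕ → ℕ → List ℕ
rangeFrom s zero    = []
rangeFrom s (suc m) = s ∷ rangeFrom (suc s) m

range1 : ℕ → List ℕ
range1 m = rangeFrom 1 m

allB : {A : Set} → (A → Bool) → List A → Bool
allB p []       = true
allB p (x ∷ xs) = p x ∧ allB p xs

filterB : {A : Set} → (A → Bool) → List A → List A
filterB p []       = []
filterB p (x ∷ xs) = if p x then x ∷ filterB p xs else filterB p xs

nth0 : {A : Set} → List A → ℕ → Maybe A
nth0 []       _       = nothing
nth0 (x ∷ xs) zero    = just x
nth0 (x ∷ xs) (suc i) = nth0 xs i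

nth1 : {A : Set} → List A → ℕ → Maybe A
nth1 xs zero    = nothing
nth1 xs (suc i) = nth0 xs i

nthL : List (List ℕ) → ℕ → List ℕ
nthL xs i with nth1 xs i
... | just r  = r
... | nothing = []

nthN0 : List ℕ → ℕ → ℕ
nthN0 xs i with nth0 xs i
... | just v  = v
... | nothing = 0

setAt1 : {A : Set} → List A → ℕ → A → List A
setAt1 []       _             _ = []
setAt1 (x ∷ xs) zero          _ = x ∷ xs
setAt1 (x ∷ xs) (suc zero)    y = y ∷ xs
setAt1 (x ∷ xs) (suc (suc i)) y = x ∷ setAt1 xs (suc i) y

imapFrom : {A B : Set} → ℕ → (ℕ → A → B) → List A → List B
imapFrom k f []       = []
imapFrom k f (x ∷ xs) = f k x ∷ imapFrom (suc k) f xs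

listEqℕ : List ℕ → List ℕ → Bool
listEqℕ []       []       = true
listEqℕ (x ∷ xs) (y ∷ ys) = (x ≡ᵇ y) ∧ listEqℕ xs ys
listEqℕ _        _        = false

member : ℕ → List ℕ → Bool
member a []       = false
member a (x ∷ xs) = (a ≡ᵇ x) ∨ member a xs

count : ℕ → List ℕ → ℕ
count a []       = 0
count a (x ∷ xs) = if a ≡ᵇ x then suc (count a xs) else count a xs

-- Tableaux: a tableau is the list of its rows r⁽¹⁾, r⁽²⁾, ... (row 1
-- first, French notation), each row read left to right.  Its shape is
-- the weak composition  map length T.

Tab : Set
Tab = List (List ℕ)

entry : Tab → ℕ → ℕ → Maybe ℕ
entry t r c with nth1 t r
... | just row = nth1 row c
... | nothing  = nothing

maxCol : Tab → ℕ
maxCol t = foldr _⊔_ 0 (map length t)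

onE : Maybe ℕ → (ℕ → Bool) → Bool
onE (just v) p = p v
onE nothing  p = true

onE2 : Maybe ℕ → Maybe ℕ → (ℕ → ℕ → Bool) → Bool
onE2 (just u) (just v) p = p u v
onE2 _        _        p = true

allRowPairs : Tab → (ℕ → ℕ → Bool) → Bool
allRowPairs t p =
  allB (λ i → allB (λ k → p i k) (rangeFrom (suc i) (length t ∸ i))) (range1 (length t))

allBoxesIdx : Tab → (ℕ → ℕ → Bool) → Bool
allBoxesIdx t p = allB (λ r → allB (λ c → p r c) (range1 (maxCol t))) (range1 (length t))

shapeOk : List ℕ → Tab → Bool
shapeOk α t = listEqℕ (map length t) α

flaggedB : (ℕ → ℕ) → Tab → Bool
flaggedB φ t = allBoxesIdx t (λ r c → onE (entry t r c) (λ v → (1 ≤ᵇ v) ∧ (v ≤ᵇ φ r)))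

rowsDecB : Tab → Bool
rowsDecB t = allBoxesIdx t (λ r c → onE2 (entry t r c) (entry t r (suc c)) (λ u v → v ≤ᵇ u))

colsDistinctB : Tab → Bool
colsDistinctB t = allRowPairs t (λ i k → allB (λ c →
  onE2 (entry t i c) (entry t k c) (λ u v → not (u ≡ᵇ v))) (range1 (maxCol t)))

keyCondB : Tab → Bool
keyCondB t = allRowPairs t (λ i k → allB (λ j →
  onE2 (entry t i j) (entry t k j) (λ u v →
    if v <ᵇ u then nextOk (entry t i (suc j)) v else true)) (range1 (maxCol t)))
  where
  nextOk : Maybe ℕ → ℕ → Bool
  nextOk (just w) v = v <ᵇ w
  nextOk nothing  v = false

isSSKT : List ℕ → (ℕ → ℕ) → Tab → Bool
isSSKT α φ t = shapeOk α t ∧ flaggedB φ t ∧ rowsDecB t ∧ colsDistinctB t ∧ keyCondB t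

SSKT : List ℕ → (ℕ → ℕ) → Tab → Set
SSKT α φ t = T (isSSKT α φ t)

wtKey : (n : ℕ) → Tab → Vec ℕ n
wtKey n t = tabulate (λ (j : Fin n) → count (suc (toℕ j)) (concat t))

-- col(T): entries read down each column (top row to row 1), columns
-- right to left; each letter remembers its box (value , row , column)
colWord : Tab → List (ℕ × ℕ × ℕ)
colWord t = concatMap (λ c → concatMap (λ r → cell r c (entry t r c))
                                       (reverse (range1 (length t))))
                      (reverse (range1 (maxCol t)))
  where
  cell : ℕ → ℕ → Maybe ℕ → List (ℕ × ℕ × ℕ)
  cell r c (just v) = (v , r , c) ∷ []
  cell r c nothing  = []

deltaI : ℕ → ℕ → ℤ
deltaI i v = if v ≡ᵇ suc i then + 1 else (if v ≡ᵇ i then -[1+ 0 ] else + 0)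

sufs : ℕ → List (ℕ × ℕ × ℕ) → List (ℤ × (ℕ × ℕ × ℕ))
sufs i [] = []
sufs i (x@(v , _) ∷ xs) with sufs i xs
... | []              = (deltaI i v , x) ∷ []
... | ys@((s , _) ∷ _) = (deltaI i v +ℤ s , x) ∷ ys

maxZ : List (ℤ × (ℕ × ℕ × ℕ)) → Maybe ℤ
maxZ []             = nothing
maxZ ((s , _) ∷ xs) with maxZ xs
... | just m  = just (s ⊔ℤ m)
... | nothing = just s

eqZ : ℤ → ℤ → Bool
eqZ a b = (a ≤ᵇℤ b) ∧ (b ≤ᵇℤ a)

lastWith : ℤ → List (ℤ × (ℕ × ℕ × ℕ)) → Maybe (ℕ × ℕ × ℕ)
lastWith m []             = nothing
lastWith m ((s , x) ∷ xs) with lastWith m xs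
... | just y  = just y
... | nothing = if eqZ s m then just x else nothing

applyRaise : ℕ → Tab → ℕ → ℕ → Tab
applyRaise i t r c = imapFrom 1 (λ r' row → imapFrom 1 (λ c' x → newVal r' c' x) row) t
  where
  inC : ℕ → Bool
  inC c' = (c ≤ᵇ c') ∧ isI1 (entry t r c')
    where
    isI1 : Maybe ℕ → Bool
    isI1 (just u) = u ≡ᵇ suc i
    isI1 nothing  = false
  newVal : ℕ → ℕ → ℕ → ℕ
  newVal r' c' x =
    if r' ≡ᵇ r then (if inC c' then i else x)
    else (if inC c' ∧ (x ≡ᵇ i) then suc i else x)

-- e_i(T); nothing stands for 0
eKey : ℕ → Tab → Maybe Tab
eKey i t with maxZ (sufs i (colWord t))
... | nothing = nothing
... | just m  = if m ≤ᵇℤ + 0 then nothing else pick (lastWith m (sufs i (colWord t)))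
  where
  pick : Maybe (ℕ × ℕ × ℕ) → Maybe Tab
  pick (just (_ , r , c)) = just (applyRaise i t r c)
  pick nothing            = nothing

-- Permutations of S_∞ via words in simple transpositions s_a (a ≥ 1)

applyS : ℕ → ℕ → ℕ
applyS a x = if x ≡ᵇ a then suc a else (if x ≡ᵇ suc a then a else x)

permOf : List ℕ → ℕ → ℕ
permOf []       x = x
permOf (a ∷ as) x = applyS a (permOf as x)

PosWord : List ℕ → Set
PosWord u = All (λ a → 1 ≤ a) u

SamePerm : List ℕ → List ℕ → Set
SamePerm u v = ∀ x → permOf u x ≡ permOf v x

Reduced : List ℕ → Set
Reduced u = PosWord u × (∀ v → PosWord v → SamePerm v u → length u ≤ length v)

-- The Morse–Schilling crystal on RF_n(w).
-- A factorization (r⁽ⁿ⁾|⋯|r⁽¹⁾) is stored as the list r⁽¹⁾, …, r⁽ⁿ⁾.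

Fac : Set
Fac = List (List ℕ)

strictIncB : List ℕ → Bool
strictIncB []           = true
strictIncB (x ∷ [])     = true
strictIncB (x ∷ y ∷ xs) = (x <ᵇ y) ∧ strictIncB (y ∷ xs)

-- b ∈ RF_n(w), where w ∈ S_∞ is given by any word w
InRF : ℕ → List ℕ → Fac → Set
InRF n w b = (length b ≡ n) × All (λ r → T (strictIncB r)) b
           × SamePerm (concat (reverse b)) w × Reduced (concat (reverse b))

removeL : ℕ → List ℕ → List ℕ
removeL a []       = []
removeL a (x ∷ xs) = if a ≡ᵇ x then xs else x ∷ removeL a xs

insertSorted : ℕ → List ℕ → List ℕ
insertSorted a []       = a ∷ []
insertSorted a (x ∷ xs) = if a ≤ᵇ x then a ∷ x ∷ xs else x ∷ insertSorted a xs

takeAbove : ℕ → List ℕ → Maybe (List ℕ)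
takeAbove b []       = nothing
takeAbove b (x ∷ xs) with b <ᵇ x
... | true  = just xs
... | false with takeAbove b xs
...   | just ys = just (x ∷ ys)
...   | nothing = nothing

-- pairing: bs = elements of r⁽ⁱ⁾ in decreasing order, avail = r⁽ⁱ⁺¹⁾;
-- returns (R_i , L_i) = (unpaired of r⁽ⁱ⁾ , unpaired of r⁽ⁱ⁺¹⁾)
pairUp : List ℕ → List ℕ → List ℕ × List ℕ
pairUp []       avail = [] , avail
pairUp (b ∷ bs) avail with takeAbove b avail
... | just avail' = pairUp bs avail'
... | nothing with pairUp bs avail
...   | (R , L) = (b ∷ R , L)

minL : List ℕ → Maybe ℕ
minL []       = nothing
minL (x ∷ xs) with minL xs
... | just m  = just (if x ≤ᵇ m then x else m)
... | nothing = just x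

maxL : List ℕ → Maybe ℕ
maxL []       = nothing
maxL (x ∷ xs) with maxL xs
... | just m  = just (if m ≤ᵇ x then x else m)
... | nothing = just x

-- t = min{ j ≥ 0 : b-j-1 ∉ r }  (fuel: length r + 1 suffices)
tDown : ℕ → List ℕ → ℕ
tDown b r = go (suc (length r)) 0
  where
  go : ℕ → ℕ → ℕ
  go zero    j = j
  go (suc f) j = if member (b ∸ suc j) r then go f (suc j) else j

sUp : ℕ → List ℕ → ℕ
sUp a r = go (suc (length r)) 0
  where
  go : ℕ → ℕ → ℕ
  go zero    j = j
  go (suc f) j = if member (a + suc j) r then go f (suc j) else j

inRange : ℕ → ℕ → Bool
inRange n i = (1 ≤ᵇ i) ∧ (i <ᵇ n)

fRF : ℕ → ℕ → Fac → Maybe Fac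
fRF n i b with inRange n i
... | false = nothing
... | true with pairUp (reverse (nthL b i)) (nthL b (suc i))
...   | (R , _) with minL R
...     | nothing = nothing
...     | just x  =
  just (setAt1 (setAt1 b i (removeL x (nthL b i)))
               (suc i) (insertSorted (x ∸ tDown x (nthL b i)) (nthL b (suc i))))

eRF : ℕ → ℕ → Fac → Maybe Fac
eRF n i b with inRange n i
... | false = nothing
... | true with pairUp (reverse (nthL b i)) (nthL b (suc i))
...   | (_ , L) with maxL L
...     | nothing = nothing
...     | just a  =
  just (setAt1 (setAt1 b (suc i) (removeL a (nthL b (suc i))))
               i (insertSorted (a + sUp a (nthL b (suc i))) (nthL b i)))

wtRF : (n : ℕ) → Fac → Vec ℕ n
wtRF n b = tabulate (λ (j : Fin n) → length (nthL b (suc (toℕ j))))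

iterM : {A : Set} → ℕ → (A → Maybe A) → A → Maybe A
iterM zero    g a = just a
iterM (suc k) g a with g a
... | just a' = iterM k g a'
... | nothing = nothing

Dop : ℕ → List ℕ → ℕ → (Fac → Set) → Fac → Set
Dop n w i X b = InRF n w b × Σ ℕ (λ k → Σ Fac (λ c → (iterM k (eRF n i) b ≡ just c) × X c))

Dword : ℕ → List ℕ → List ℕ → (Fac → Set) → Fac → Set
Dword n w []       X = X
Dword n w (i ∷ is) X = Dop n w i (Dword n w is X)

-- Φ is a crystal isomorphism from SSKT(α,φ) (with e_i, f_i = inverse of
-- e_i, wt) onto the Demazure subcrystal D ⊆ RF_n(w) (whose operators are
-- those of RF_n(w), set to 0 when leaving D), for 1 ≤ i < n.
DemIso : ℕ → List ℕ → (ℕ → ℕ) → (Fac → Set) → (Tab → Fac) → Set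
DemIso n α φ D Φ =
    (∀ t → SSKT α φ t → D (Φ t))
  × (∀ t t' → SSKT α φ t → SSKT α φ t' → Φ t ≡ Φ t' → t ≡ t')
  × (∀ b → D b → Σ Tab (λ t → SSKT α φ t × (Φ t ≡ b)))
  × (∀ t → SSKT α φ t → wtRF n (Φ t) ≡ wtKey n t)
  × (∀ i → 1 ≤ i → i < n → ∀ t t' → SSKT α φ t → SSKT α φ t' →
       ((eKey i t ≡ just t' → eRF n i (Φ t) ≡ just (Φ t'))
        × (eRF n i (Φ t) ≡ just (Φ t') → eKey i t ≡ just t')))
  -- f_i(t) = t'  iff  e_i(t') = t
  × (∀ i → 1 ≤ i → i < n → ∀ t t' → SSKT α φ t → SSKT α φ t' →
       ((eKey i t' ≡ just t → fRF n i (Φ t) ≡ just (Φ t'))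
        × (fRF n i (Φ t) ≡ just (Φ t') → eKey i t' ≡ just t)))

IsDemazureSSKT : ℕ → List ℕ → (ℕ → ℕ) → Set
IsDemazureSSKT n α φ =
    (∀ i → 1 ≤ i → i < n → ∀ t t' → SSKT α φ t → eKey i t ≡ just t' → SSKT α φ t')
  × Σ (List ℕ) (λ w → Σ Fac (λ u → Σ (List ℕ) (λ σ →
        InRF n w u
      × (∀ i → 1 ≤ i → i < n → eRF n i u ≡ nothing)
      × All (λ j → (1 ≤ j) × (j < n)) σ × Reduced σ
      × Σ (Tab → Fac) (λ Φ → DemIso n α φ (Dword n w σ (λ c → c ≡ u)) Φ))))

IsFlag : (ℕ → ℕ) → Set
IsFlag φ = (∀ m → 1 ≤ m → φ m ≤ φ (suc m)) × (∀ m → 1 ≤ m → m ≤ φ m)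

-- ℓ(α) = length α, i.e. the last listed part is nonzero
HasLength : List ℕ → Set
HasLength α = Σ (List ℕ) (λ β → Σ ℕ (λ a → α ≡ β ++ (suc a ∷ [])))

-- Polynomials in x₁, …, x_N with integer coefficients:
-- formal sums of terms (c , exponent vector)

Poly : ℕ → Set
Poly N = List (ℤ × Vec ℕ N)

coeff : {N : ℕ} → Poly N → Vec ℕ N → ℤ
coeff []             a = + 0
coeff ((c , b) ∷ ps) a =
  if does (≡-dec _≟ℕ_ b a) then c +ℤ coeff ps a else coeff ps a

_≈P_ : {N : ℕ} → Poly N → Poly N → Set
p ≈P q = ∀ a → coeff p a ≡ coeff q a

getV : {N : ℕ} → Vec ℕ N → ℕ → ℕ   -- 0-based
getV []ᵛ       _       = 0
getV (x ∷ᵛ xs) zero    = x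
getV (x ∷ᵛ xs) (suc i) = getV xs i

setV : {N : ℕ} → Vec ℕ N → ℕ → ℕ → Vec ℕ N   -- 0-based
setV []ᵛ       _       _ = []ᵛ
setV (x ∷ᵛ xs) zero    y = y ∷ᵛ xs
setV (x ∷ᵛ xs) (suc i) y = x ∷ᵛ setV xs i y

mulXmono : {N : ℕ} → ℕ → Vec ℕ N → Vec ℕ N
mulXmono i a = setV a (i ∸ 1) (suc (getV a (i ∸ 1)))

-- ∂_i x^a = (x^a - x^{s_i a}) / (x_i - x_{i+1}), the quotient written out:
-- with p = a_i, q = a_{i+1}:
--   p > q :  Σ_{j=0}^{p-q-1} x^{a with a_i := p-1-j, a_{i+1} := q+j}
--   p < q : -Σ_{j=0}^{q-p-1} x^{a with a_i := q-1-j, a_{i+1} := p+j}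
--   p = q :  0
divDiffMono : {N : ℕ} → ℕ → Vec ℕ N → Poly N
divDiffMono i a =
  if q <ᵇ p then map (λ j → (+ 1 , setV (setV a (i ∸ 1) (p ∸ 1 ∸ j)) i (q + j))) (rangeFrom 0 (p ∸ q))
  else (if p <ᵇ q then map (λ j → (-[1+ 0 ] , setV (setV a (i ∸ 1) (q ∸ 1 ∸ j)) i (p + j))) (rangeFrom 0 (q ∸ p))
        else [])
  where
  p = getV a (i ∸ 1)
  q = getV a i

divDiff : {N : ℕ} → ℕ → Poly N → Poly N
divDiff i f = concatMap (λ { (c , a) → map (λ { (d , b) → (c *ℤ d , b) }) (divDiffMono i a) }) f

piOp : {N : ℕ} → ℕ → Poly N → Poly N
piOp i f = divDiff i (map (λ { (c , a) → (c , mulXmono i a) }) f)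

piWord : {N : ℕ} → List ℕ → Poly N → Poly N
piWord []       f = f
piWord (i ∷ is) f = piOp i (piWord is f)

-- reduced word of π_{t↓s} = π_{t-1} π_{t-2} ⋯ π_s
downWord : ℕ → ℕ → List ℕ
downWord t s = reverse (rangeFrom s (t ∸ s))

flagWord : (ℕ → ℕ) → ℕ → List ℕ
flagWord φ k = concatMap (λ j → downWord (φ j) j) (range1 k)

swapAt1 : ℕ → List ℕ → List ℕ
swapAt1 zero          xs           = xs
swapAt1 (suc zero)    (x ∷ y ∷ xs) = y ∷ x ∷ xs
swapAt1 (suc zero)    xs           = xs
swapAt1 (suc (suc i)) []           = []
swapAt1 (suc (suc i)) (x ∷ xs)     = x ∷ swapAt1 (suc i) xs

actW : List ℕ → List ℕ → List ℕ
actW []       α = α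
actW (i ∷ is) α = actW is (swapAt1 i α)

weaklyDecB : List ℕ → Bool
weaklyDecB []           = true
weaklyDecB (x ∷ [])     = true
weaklyDecB (x ∷ y ∷ xs) = (y ≤ᵇ x) ∧ weaklyDecB (y ∷ xs)

IsPartition : List ℕ → Set
IsPartition λ' = T (weaklyDecB λ')

SkWord : ℕ → List ℕ → Set
SkWord k u = All (λ i → (1 ≤ i) × (suc i ≤ k)) u

-- ws is a word of minimal length with α · ws a partition
-- (hence a reduced word of the minimal w with α·w = λ)
MinSortWord : List ℕ → List ℕ → Set
MinSortWord α ws = SkWord (length α) ws × IsPartition (actW ws α)
  × (∀ v → SkWord (length α) v → IsPartition (actW v α) → length ws ≤ length v)

padV : (N : ℕ) → List ℕ → Vec ℕ N
padV N λ' = tabulate (λ (j : Fin N) → nthN0 λ' (toℕ j))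

-- κ_α = π_w x^λ, computed with the reduced word ws of w
kappa : (N : ℕ) → List ℕ → List ℕ → Poly N
kappa N α ws = piWord ws ((+ 1 , padV N (actW ws α)) ∷ [])

fillRow : ℕ → ℕ → List (List ℕ)
fillRow zero    M = [] ∷ []
fillRow (suc l) M = concatMap (λ v → map (v ∷_) (fillRow l M)) (range1 M)

fillings : List ℕ → ℕ → List Tab
fillings []       M = [] ∷ []
fillings (a ∷ α) M = concatMap (λ row → map (row ∷_) (fillings α M)) (fillRow a M)

-- κ_{(α,φ)} = Σ_{T ∈ SSKT(α,φ)} x^{wt(T)}, in x₁,…,x_N with N = φ(ℓ(α))
-- (every φ-flagged T has entries ≤ φ(ℓ(α)) since φ is weakly increasing)
kappaFlag : (α : List ℕ) (φ : ℕ → ℕ) → Poly (φ (length α))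
kappaFlag α φ = map (λ t → (+ 1 , wtKey (φ (length α)) t))
                    (filterB (isSSKT α φ) (fillings α (φ (length α))))

{-# OPTIONS --safe #-}
module Submission where

-- A key tableau is determined by the sets of entries of its columns.  Let w be a product of decreasing words, one for each
-- column, in pairwise distant alphabets.  A factorization of w distributes the letters of every column over distinct factors,
-- so the factors containing the letters of column c can be any set of the right size, and the bracketing rule on the
-- factorizations is the bracketing rule for i and i + 1 on the sequence of column sets.  On key tableaux, e_i (and f_i) exchange
-- i and i + 1 in an interval of columns, of which only the last column set changes.
--
-- Let X(α, ψ) be the set of column sets of key tableaux of shape α with flag ψ.  Raising the flag of one row from m to m + 1,
-- where no row of the new flag has the value m, replaces X by 𝔇_m X: an element of the larger set with e_m = 0 satisfies
-- the old flag, and f_m can leave X only from the top of an m-string.  If the rows l and l + 1 have lengths a > b, then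
-- X(α, id raised at l) is X(s_l α, id), by exchanging the tails of the two rows, and if a ≤ b it is X(α, id).  Starting from the
-- superstandard tableau of the sorted shape, this builds X(α, id), and then X(α, φ) along the word of the flag; at the same time it
-- rewrites X(α, φ) as X(β, id) for a rearrangement β, whose sorting word is reduced and gives the Demazure subcrystal.
-- Since X meets each m-string in nothing, its top, or all of it, the character of 𝔇_m X is π_m of that of X.

open import Defs
open import Data.Bool using (Bool; true; false; _∧_; _∨_; not; if_then_else_; T)
open import Data.Empty using (⊥; ⊥-elim)
open import Data.Fin using (toℕ)
open import Data.Fin.Properties using (toℕ<n)
open import Data.Integer as ℤ using (ℤ; -[1+_]; _⊖_) renaming (+_ to posℤ; _+_ to _+ℤ_; _*_ to _*ℤ_; -_ to -ℤ_)
open import Data.List using (List; []; _∷_; length; map; concat; concatMap; reverse; _++_; foldr; drop; replicate; [_])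
open import Data.List.Membership.Propositional using (_∈_)
open import Data.List.Properties using (++-assoc; ++-identityʳ; unfold-reverse; length-++; reverse-++; drop-[]; ∷-injectiveˡ; ∷-injectiveʳ; ∷-injective; length-map; length-drop; length-replicate; concat-++)
open import Data.List.Relation.Unary.All using (All; []; _∷_)
open import Data.List.Relation.Unary.All.Properties using (++⁺; ++⁻; concat⁺)
open import Data.List.Relation.Unary.Any using (here; there)
open import Data.Maybe using (Maybe; just; nothing)
open import Data.Maybe.Properties using (just-injective)
open import Data.Nat using (ℕ; zero; suc; _+_; _∸_; _*_; _≤_; _<_; _⊔_; _≡ᵇ_; _≤ᵇ_; _<ᵇ_; z≤n; s≤s; _≤?_; _<?_)
open import Data.Nat.Properties
open import Data.Nat.Solver using (module +-*-Solver)
open import Data.Product using (Σ; ∃; _×_; _,_; proj₁; proj₂)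
open import Data.Sum using (_⊎_; inj₁; inj₂)
open import Data.Unit using (⊤; tt)
open import Data.Vec using (Vec; tabulate) renaming ([] to []ᵛ; _∷_ to _∷ᵛ_)
open import Data.Vec.Properties using (≡-dec; tabulate-cong)
open import Function using (_∘_; id; case_of_)
open import Relation.Binary.Definitions using (tri<; tri≈; tri>)
open import Relation.Binary.PropositionalEquality using (_≡_; _≢_; refl; sym; trans; cong; cong₂; subst; subst₂; module ≡-Reasoning)
open import Relation.Nullary using (¬_; Dec; yes; no; does)
import Data.Integer.Properties as ℤₚ
import Data.List.Properties as Listₚ
open +-*-Solver using (solve; _:+_; _:=_)

-- Key tableaux and exchanges of entries

-- Two obstacles shape the proof. `Dop` ranges over all factorizations of `w`, while the
-- combinatorics speaks of those that come from tableaux; so an `e_i`-preimage of such a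
-- factorization must be recognized as one of the same kind. This is the purpose of the class of
-- `Valid` marked lists, which lies between the tableaux and the arbitrary factorizations. Secondly,
-- the word of the flag followed by a sorting word of the shape need not be reduced: for the shape
-- (0,1) and the flag (2,2) both words consist of the letter 1. A reduced word appears only after
-- every step of the flag has been absorbed into a rearrangement of the shape, which it either
-- leaves alone or changes by one exchange. Sets of tableaux are compared by inclusions in both
-- directions that keep the column sets. Functions of boxes count rows and columns from 0, whereas
-- values and factors count from 1: row `l` has the identity flag `l + 1`, and the exchange of the
-- rows `l` and `l + 1` belongs to the operator of index `l + 1`.

≡ᵇ-yes : ∀ {a b} → a ≡ b → (a ≡ᵇ b) ≡ true
≡ᵇ-yes {zero} refl = refl
≡ᵇ-yes {suc a} refl = ≡ᵇ-yes {a} refl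

≡ᵇ-no : ∀ {a b} → a ≢ b → (a ≡ᵇ b) ≡ false
≡ᵇ-no {zero} {zero} p = ⊥-elim (p refl)
≡ᵇ-no {zero} {suc b} p = refl
≡ᵇ-no {suc a} {zero} p = refl
≡ᵇ-no {suc a} {suc b} p = ≡ᵇ-no {a} {b} (p ∘ cong suc)

applyS-lo : ∀ i → applyS i i ≡ suc i
applyS-lo i rewrite ≡ᵇ-yes {i} refl = refl

applyS-hi : ∀ i → applyS i (suc i) ≡ i
applyS-hi i rewrite ≡ᵇ-no {suc i} {i} 1+n≢n | ≡ᵇ-yes {i} refl = refl

applyS-else : ∀ i {v} → v ≢ i → v ≢ suc i → applyS i v ≡ v
applyS-else i {v} p q rewrite ≡ᵇ-no p | ≡ᵇ-no q = refl

-- The same transposition serves for the entries `i`, `i + 1` and for the rows `l`, `l + 1`. The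
-- view lets one case distinction rewrite the argument and the value together.
data SwapView (i : ℕ) : ℕ → ℕ → Set where
  is-lo : SwapView i i (suc i)
  is-hi : SwapView i (suc i) i
  is-fixed : ∀ {v} → v ≢ i → v ≢ suc i → SwapView i v v

swapView : ∀ i v → SwapView i v (applyS i v)
swapView i v with v ≟ i
... | yes refl = subst (SwapView i v) (sym (applyS-lo i)) is-lo
... | no p with v ≟ suc i
...   | yes refl = subst (SwapView i v) (sym (applyS-hi i)) is-hi
...   | no q = subst (SwapView i v) (sym (applyS-else i p q)) (is-fixed p q)

applyS-invol : ∀ i v → applyS i (applyS i v) ≡ v
applyS-invol i v with applyS i v | swapView i v
... | .(suc i) | is-lo = applyS-hi i
... | .i | is-hi = applyS-lo i
... | .v | is-fixed p q = applyS-else i p q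

-- A transposition of neighbours reverses only the pair `i < i + 1`, so every row or key inequality
-- between other values survives an exchange of entries.
applyS-mono< : ∀ i {a e} → a < e → ¬ (a ≡ i × e ≡ suc i) → applyS i a < applyS i e
applyS-mono< i {a} {e} a<e bad with applyS i a | swapView i a | applyS i e | swapView i e
... | _ | is-lo | _ | is-lo = ⊥-elim (<-irrefl refl a<e)
... | _ | is-lo | _ | is-hi = ⊥-elim (bad (refl , refl))
... | _ | is-lo | _ | is-fixed p q = ≤∧≢⇒< a<e (q ∘ sym)
... | _ | is-hi | _ | is-lo = ⊥-elim (<-asym a<e (n<1+n i))
... | _ | is-hi | _ | is-hi = ⊥-elim (<-irrefl refl a<e)
... | _ | is-hi | _ | is-fixed p q = <-trans (n<1+n i) a<e
... | _ | is-fixed p q | _ | is-lo = m≤n⇒m≤1+n a<e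
... | _ | is-fixed p q | _ | is-hi = ≤∧≢⇒< (≤-pred a<e) p
... | _ | is-fixed p q | _ | is-fixed _ _ = a<e

applyS-mono≤ : ∀ i {a e} → a ≤ e → ¬ (a ≡ i × e ≡ suc i) → applyS i a ≤ applyS i e
applyS-mono≤ i a≤e bad with m≤n⇒m<n∨m≡n a≤e
... | inj₁ a<e = <⇒≤ (applyS-mono< i a<e bad)
... | inj₂ refl = ≤-refl

applyS-mono≤⁻ : ∀ i {a b} → applyS i a ≤ applyS i b → a ≤ b ⊎ (a ≡ suc i × b ≡ i)
applyS-mono≤⁻ i {a} {b} p with a ≤? b
... | yes q = inj₁ q
... | no q with a ≟ suc i | b ≟ i
...   | yes r | yes s = inj₂ (r , s)
...   | no r | _ = ⊥-elim (<⇒≱ (applyS-mono< i (≰⇒> q) (r ∘ proj₂)) p)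
...   | yes _ | no s = ⊥-elim (<⇒≱ (applyS-mono< i (≰⇒> q) (s ∘ proj₁)) p)

applyS-pos : ∀ i {v} → 1 ≤ i → 1 ≤ v → 1 ≤ applyS i v
applyS-pos i {v} 1≤i 1≤v with applyS i v | swapView i v
... | _ | is-lo = s≤s z≤n
... | _ | is-hi = 1≤i
... | _ | is-fixed _ _ = 1≤v

applyS-zero : ∀ i → 1 ≤ i → applyS i 0 ≡ 0
applyS-zero (suc i) _ = refl

cnt : (ℕ → ℕ) → ℕ → ℕ → ℕ
cnt f v zero = 0
cnt f v (suc k) = (if f k ≡ᵇ v then 1 else 0) + cnt f v k

cnt-zero : ∀ f v k → (∀ r → r < k → f r ≢ v) → cnt f v k ≡ 0
cnt-zero f v zero p = refl
cnt-zero f v (suc k) p rewrite ≡ᵇ-no (p k ≤-refl) = cnt-zero f v k (λ r q → p r (m≤n⇒m≤1+n q))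

cnt-one : ∀ f v k r → r < k → f r ≡ v → (∀ r' → f r' ≡ v → r' ≡ r) → cnt f v k ≡ 1
cnt-one f v (suc k) r r<k e u with r ≟ k
... | yes refl rewrite ≡ᵇ-yes e = cong suc (cnt-zero f v k (λ r' q e' → <-irrefl (u r' e') q))
... | no r≢k rewrite ≡ᵇ-no (λ e' → r≢k (sym (u k e'))) = cnt-one f v k r (≤∧≢⇒< (≤-pred r<k) r≢k) e u

cnt-find : ∀ (f : ℕ → ℕ) v k → (∃ λ r → r < k × f r ≡ v) ⊎ (∀ r → r < k → f r ≢ v)
cnt-find f v zero = inj₂ (λ r ())
cnt-find f v (suc k) with f k ≟ v
... | yes e = inj₁ (k , ≤-refl , e)
... | no p with cnt-find f v k
...   | inj₁ (r , q , e) = inj₁ (r , m≤n⇒m≤1+n q , e)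
...   | inj₂ h = inj₂ λ r q → case m≤n⇒m<n∨m≡n (≤-pred q) of λ { (inj₁ r<k) → h r r<k ; (inj₂ refl) → p }

cnt-cong : ∀ f g v w k → (∀ r → r < k → (f r ≡ v → g r ≡ w) × (g r ≡ w → f r ≡ v)) → cnt f v k ≡ cnt g w k
cnt-cong f g v w zero p = refl
cnt-cong f g v w (suc k) p with f k ≟ v
... | yes e rewrite ≡ᵇ-yes e | ≡ᵇ-yes (proj₁ (p k ≤-refl) e) = cong suc (cnt-cong f g v w k (λ r q → p r (m≤n⇒m≤1+n q)))
... | no e rewrite ≡ᵇ-no e | ≡ᵇ-no (e ∘ proj₂ (p k ≤-refl)) = cnt-cong f g v w k (λ r q → p r (m≤n⇒m≤1+n q))

-- A key tableau as a function of the (0-based) row and column, with value 0 outside its shape.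
record KT (n : ℕ) (α ψ : ℕ → ℕ) (x : ℕ → ℕ → ℕ) : Set where
  field
    supp : ∀ r → n ≤ r → α r ≡ 0
    box  : ∀ r c → c < α r → 1 ≤ x r c
    out  : ∀ r c → α r ≤ c → x r c ≡ 0
    row  : ∀ r c → x r (suc c) ≤ x r c
    key  : ∀ l k c → l < k → 1 ≤ x k c → x k c ≤ x l c → x k c < x l (suc c)
    flag : ∀ r → x r 0 ≤ ψ r

occ : ℕ → (ℕ → ℕ → ℕ) → ℕ → ℕ → ℕ
occ n x c v = cnt (λ r → x r c) v n

-- The columns left of `c` form a suffix of the column word; the difference of `hgt` for `i + 1` and
-- for `i` is the excess of that suffix.
hgt : ℕ → (ℕ → ℕ → ℕ) → ℕ → ℕ → ℕ
hgt n x v zero = 0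
hgt n x v (suc c) = occ n x c v + hgt n x v c

module _ {n : ℕ} {α ψ : ℕ → ℕ} {x : ℕ → ℕ → ℕ} (T : KT n α ψ x) where
  open KT T

  inShape : ∀ {r c} → 1 ≤ x r c → c < α r
  inShape {r} {c} p with c <? α r
  ... | yes q = q
  ... | no q rewrite out r c (≮⇒≥ q) = ⊥-elim (<-irrefl refl p)

  inRows : ∀ {r c} → 1 ≤ x r c → r < n
  inRows {r} {c} p with r <? n
  ... | yes q = q
  ... | no q = ⊥-elim (<-irrefl refl (≤-trans p (≤-reflexive (out r c (≤-trans (≤-reflexive (supp r (≮⇒≥ q))) z≤n)))))

  -- `key` is stated with `≤`, so it also governs equal entries: it would put an entry larger than
  -- `x l c` to its right, against `row`.
  distinct< : ∀ {l k c} → l < k → 1 ≤ x k c → x l c ≢ x k c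
  distinct< {l} {k} {c} l<k p e = <⇒≱ (key l k c l<k p (≤-reflexive (sym e))) (≤-trans (row l c) (≤-reflexive e))

  distinct : ∀ {l k c v} → 1 ≤ v → x l c ≡ v → x k c ≡ v → l ≡ k
  distinct {l} {k} 1≤v refl e with <-cmp l k
  ... | tri< l<k _ _ = ⊥-elim (distinct< l<k (≤-trans 1≤v (≤-reflexive (sym e))) (sym e))
  ... | tri≈ _ p _ = p
  ... | tri> _ _ k<l = ⊥-elim (distinct< k<l 1≤v e)

  occ-yes : ∀ {r c v} → 1 ≤ v → x r c ≡ v → occ n x c v ≡ 1
  occ-yes {r} {c} {v} 1≤v e = cnt-one _ v n r (inRows (subst (1 ≤_) (sym e) 1≤v)) e (λ r' e' → distinct 1≤v e' e)

  occ-no : ∀ {c v} → (∀ r → x r c ≢ v) → occ n x c v ≡ 0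
  occ-no h = cnt-zero _ _ n (λ r _ → h r)

  occ-find : ∀ c v → 1 ≤ v → (∃ λ r → x r c ≡ v) ⊎ (∀ r → x r c ≢ v)
  occ-find c v 1≤v with cnt-find (λ r → x r c) v n
  ... | inj₁ (r , _ , e) = inj₁ (r , e)
  ... | inj₂ h = inj₂ λ r e → h r (inRows (subst (1 ≤_) (sym e) 1≤v)) e

  occ≡0 : ∀ {c v} → 1 ≤ v → occ n x c v ≡ 0 → ∀ r → x r c ≢ v
  occ≡0 1≤v z r e with trans (sym (occ-yes 1≤v e)) z
  ... | ()

  occ≡1 : ∀ {c v} → 1 ≤ v → occ n x c v ≡ 1 → ∃ λ r → x r c ≡ v
  occ≡1 {c} {v} 1≤v o with occ-find c v 1≤v
  ... | inj₁ p = p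
  ... | inj₂ h with trans (sym o) (occ-no h)
  ...   | ()

  occ≤1 : ∀ {c v} → 1 ≤ v → occ n x c v ≤ 1
  occ≤1 {c} {v} 1≤v with occ-find c v 1≤v
  ... | inj₁ (r , e) = ≤-reflexive (occ-yes 1≤v e)
  ... | inj₂ h = ≤-trans (≤-reflexive (occ-no h)) z≤n

  row* : ∀ r {c c'} → c ≤ c' → x r c' ≤ x r c
  row* r {c} {c'} p with m≤n⇒m<n∨m≡n p
  ... | inj₂ refl = ≤-refl
  row* r {c} {suc c'} p | inj₁ q = ≤-trans (row r c') (row* r (≤-pred q))

  le-flag : ∀ r c → x r c ≤ ψ r
  le-flag r c = ≤-trans (row* r z≤n) (flag r)

KT-resp : ∀ {n α α' ψ ψ' x x'} → KT n α ψ x → (∀ r → α r ≡ α' r) → (∀ r c → x r c ≡ x' r c) →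
          (∀ r → x r 0 ≤ ψ' r) → KT n α' ψ' x'
KT-resp {x = x} {x'} T eα ex fl = record
  { supp = λ r p → trans (sym (eα r)) (supp r p)
  ; box = λ r c p → subst (1 ≤_) (ex r c) (box r c (subst (c <_) (sym (eα r)) p))
  ; out = λ r c p → trans (sym (ex r c)) (out r c (subst (_≤ c) (sym (eα r)) p))
  ; row = λ r c → subst₂ _≤_ (ex r (suc c)) (ex r c) (row r c)
  ; key = λ l k c p q s → subst₂ _<_ (ex k c) (ex l (suc c))
           (key l k c p (subst (1 ≤_) (sym (ex k c)) q) (subst₂ _≤_ (sym (ex k c)) (sym (ex l c)) s))
  ; flag = λ r → subst (_≤ _) (ex r 0) (fl r) }
  where open KT T

occ-resp : ∀ n x y c v → (∀ r → x r c ≡ y r c) → occ n x c v ≡ occ n y c v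
occ-resp n x y c v e = cnt-cong _ _ v v n (λ r _ → (λ p → trans (sym (e r)) p) , (λ p → trans (e r) p))

swapCols : ℕ → ℕ → ℕ → (ℕ → ℕ → ℕ) → ℕ → ℕ → ℕ
swapCols i a d x r c with a ≤? c | c ≤? d
... | yes _ | yes _ = applyS i (x r c)
... | _     | _     = x r c

module _ (i a d : ℕ) (x : ℕ → ℕ → ℕ) where
  swapCols-in : ∀ {r c} → a ≤ c → c ≤ d → swapCols i a d x r c ≡ applyS i (x r c)
  swapCols-in {r} {c} p q with a ≤? c | c ≤? d
  ... | yes _ | yes _ = refl
  ... | no p' | _ = ⊥-elim (p' p)
  ... | yes _ | no q' = ⊥-elim (q' q)

  swapCols-lt : ∀ {r c} → c < a → swapCols i a d x r c ≡ x r c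
  swapCols-lt {r} {c} p with a ≤? c | c ≤? d
  ... | yes p' | _ = ⊥-elim (<⇒≱ p p')
  ... | no _ | yes _ = refl
  ... | no _ | no _ = refl

  swapCols-gt : ∀ {r c} → d < c → swapCols i a d x r c ≡ x r c
  swapCols-gt {r} {c} p with a ≤? c | c ≤? d
  ... | _ | yes p' = ⊥-elim (<⇒≱ p p')
  ... | yes _ | no _ = refl
  ... | no _ | no _ = refl

  data Where (c : ℕ) : Set where
    left-of : c < a → Where c
    inside : a ≤ c → c ≤ d → Where c
    right-of : d < c → Where c

  where? : ∀ c → Where c
  where? c with a ≤? c | c ≤? d
  ... | no p | _ = left-of (≰⇒> p)
  ... | yes p | yes q = inside p q
  ... | yes _ | no q = right-of (≰⇒> q)

-- One field for each way in which exchanging `i` and `i + 1` in the columns `a` to `d` could break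
-- a condition. The suffix In refers to two columns of the interval, L and R to its left and right
-- border. A field either forbids the configuration or, as `keyIn` and `keyIn′` do, prescribes the
-- neighbour that repairs it.
record Swappable (i a d : ℕ) (ψ : ℕ → ℕ) (x : ℕ → ℕ → ℕ) : Set where
  field
    rowIn : ∀ k c → a ≤ c → c < d → x k c ≡ suc i → x k (suc c) ≡ i → ⊥
    rowL  : ∀ k c → suc c ≡ a → x k a ≡ i → x k c ≡ i → ⊥
    rowR  : ∀ k → x k d ≡ suc i → x k (suc d) ≡ suc i → ⊥
    keyIn : ∀ l k c → l < k → a ≤ c → c < d → x k c ≡ suc i → x l c ≡ i → x l (suc c) ≡ i
    keyIn′ : ∀ l k c → l < k → a ≤ c → c < d → x k c ≡ i → x l (suc c) ≡ suc i → x l c ≡ suc i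
    keyR  : ∀ l k → l < k → x k d ≡ i → suc i < x l d → suc i < x l (suc d)
    keyR′ : ∀ l k → x k d ≡ suc i → x l d ≡ i → ⊥
    keyL  : ∀ l k c → l < k → suc c ≡ a → x k c ≡ i → x l a ≡ suc i → ⊥
    flagL : ∀ k → a ≡ 0 → x k 0 ≡ i → suc i ≤ ψ k

module _ {n : ℕ} {α ψ : ℕ → ℕ} {x : ℕ → ℕ → ℕ} (T : KT n α ψ x) {i a d : ℕ} (1≤i : 1 ≤ i) (a≤d : a ≤ d)
         (S : Swappable i a d ψ x) where
  open KT T
  open Swappable S
  private
    τ = applyS i
    y = swapCols i a d x
    τlo : ∀ {v} → v ≡ i → τ v ≡ suc i
    τlo refl = applyS-lo i
    τhi : ∀ {v} → v ≡ suc i → τ v ≡ i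
    τhi refl = applyS-hi i
    yin : ∀ {r c} → a ≤ c → c ≤ d → y r c ≡ τ (x r c)
    yin = swapCols-in i a d x
    ylt : ∀ {r c} → c < a → y r c ≡ x r c
    ylt = swapCols-lt i a d x
    ygt : ∀ {r c} → d < c → y r c ≡ x r c
    ygt = swapCols-gt i a d x

    row' : ∀ r c → y r (suc c) ≤ y r c
    row' r c with where? i a d x c | where? i a d x (suc c)
    ... | left-of p | left-of q = subst₂ _≤_ (sym (ylt q)) (sym (ylt p)) (row r c)
    ... | left-of p | right-of q = ⊥-elim (<⇒≱ p (≤-trans a≤d (≤-pred q)))
    ... | left-of p | inside q q' with ≤-antisym q p
    ...   | refl rewrite yin {r} q q' | ylt {r} p with x r (suc c) | row r c | swapView i (x r (suc c)) | rowL r c refl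
    ...     | u | u≤ | sv | h with τ u | sv
    ...       | _ | is-lo = ≤∧≢⇒< u≤ (λ e → h refl (sym e))
    ...       | _ | is-hi = ≤-trans (n≤1+n i) u≤
    ...       | _ | is-fixed _ _ = u≤
    row' r c | inside p p' | left-of q = ⊥-elim (<⇒≱ (<-trans (n<1+n c) q) p)
    row' r c | inside p p' | inside q q' rewrite yin {r} p p' | yin {r} q q' =
      applyS-mono≤ i (row r c) (λ { (e , e') → rowIn r c p q' e' e })
    row' r c | inside p p' | right-of q with ≤-antisym p' (≤-pred q)
    ... | refl rewrite yin {r} p p' | ygt {r} q with x r c | row r c | swapView i (x r c) | rowR r
    ...   | u | u≤ | sv | h with τ u | sv
    ...     | _ | is-lo = ≤-trans u≤ (n≤1+n i)
    ...     | _ | is-hi = ≤-pred (≤∧≢⇒< u≤ (h refl))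
    ...     | _ | is-fixed _ _ = u≤
    row' r c | right-of p | left-of q = ⊥-elim (<⇒≱ (<-trans (<-trans p (n<1+n c)) q) a≤d)
    row' r c | right-of p | inside q q' = ⊥-elim (<⇒≱ (<-trans p (n<1+n c)) q')
    row' r c | right-of p | right-of q = subst₂ _≤_ (sym (ygt q)) (sym (ygt p)) (row r c)

    pos : ∀ {u} → 1 ≤ τ u → 1 ≤ u
    pos {zero} p = ⊥-elim (<-irrefl refl (subst (1 ≤_) (applyS-zero i 1≤i) p))
    pos {suc u} p = s≤s z≤n

    key' : ∀ l k c → l < k → 1 ≤ y k c → y k c ≤ y l c → y k c < y l (suc c)
    key' l k c l<k 1≤ le with where? i a d x c | where? i a d x (suc c)
    ... | left-of p | left-of q rewrite ylt {k} p | ylt {l} p | ylt {l} q = key l k c l<k 1≤ le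
    ... | left-of p | right-of q = ⊥-elim (<⇒≱ p (≤-trans a≤d (≤-pred q)))
    ... | left-of p | inside q q' with ≤-antisym q p
    ...   | refl rewrite yin {l} q q' | ylt {k} p | ylt {l} p
            with x l (suc c) | key l k c l<k 1≤ le | swapView i (x l (suc c)) | keyL l k c l<k refl
    ...     | u | u< | sv | h with τ u | sv
    ...       | _ | is-lo = m≤n⇒m≤1+n u<
    ...       | _ | is-hi = ≤∧≢⇒< (≤-pred u<) (λ e → h e refl)
    ...       | _ | is-fixed _ _ = u<
    key' l k c l<k 1≤ le | inside p p' | left-of q = ⊥-elim (<⇒≱ (<-trans (n<1+n c) q) p)
    key' l k c l<k 1≤ le | inside p p' | inside q q' rewrite yin {k} p p' | yin {l} p p' | yin {l} q q' with applyS-mono≤⁻ i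
        {x k c} {x l c} le
    -- Here the exchange itself creates the premise of the key condition: `i + 1` above `i` has
    -- become `i` above `i + 1`.
    ... | inj₂ (e , e') = subst₂ _<_ (sym (τhi e)) (sym (τlo (keyIn l k c l<k p q' e e'))) (n<1+n i)
    ... | inj₁ le' = applyS-mono< i (key l k c l<k (pos 1≤) le') bad
      where
      bad : ¬ (x k c ≡ i × x l (suc c) ≡ suc i)
      bad (e , e') = 1+n≰n (subst₂ _≤_ (τlo e) (τhi (keyIn′ l k c l<k p q' e e')) le)
    key' l k c l<k 1≤ le | inside p p' | right-of q with ≤-antisym p' (≤-pred q)
    ... | refl rewrite yin {k} p p' | yin {l} p p' | ygt {l} q with applyS-mono≤⁻ i {x k c} {x l c} le
    ...   | inj₂ (e , e') = ⊥-elim (keyR′ l k e e')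
    ...   | inj₁ le' = atR (key l k c l<k (pos 1≤) le')
      where
      le₀ = le
      atR : x k c < x l (suc c) → τ (x k c) < x l (suc c)
      atR u< with x k c ≟ i | x k c ≟ suc i
      ... | no e | no e' rewrite applyS-else i e e' = u<
      ... | no _ | yes e = <-trans (subst (_< suc i) (sym (τhi e)) (n<1+n i)) (subst (_< x l (suc c)) e u<)
      ... | yes ek | _ = subst (_< x l (suc c)) (sym (τlo ek)) (keyR l k l<k ek (≤∧≢⇒< (≤∧≢⇒< (subst (_≤ x l c) ek le') i≢) si≢))
        where
        i≢ : i ≢ x l c
        i≢ e = distinct< T l<k (subst (1 ≤_) (sym ek) 1≤i) (trans (sym e) (sym ek))
        si≢ : suc i ≢ x l c
        si≢ e = 1+n≰n (subst₂ _≤_ (τlo ek) (τhi (sym e)) le₀)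
    key' l k c l<k 1≤ le | right-of p | left-of q = ⊥-elim (<⇒≱ (<-trans (<-trans p (n<1+n c)) q) a≤d)
    key' l k c l<k 1≤ le | right-of p | inside q q' = ⊥-elim (<⇒≱ (<-trans p (n<1+n c)) q')
    key' l k c l<k 1≤ le | right-of p | right-of q rewrite ygt {k} p | ygt {l} p | ygt {l} q = key l k c l<k 1≤ le

    flag' : ∀ r → y r 0 ≤ ψ r
    flag' r with where? i a d x 0
    ... | left-of p rewrite ylt {r} p = flag r
    ... | right-of p rewrite ygt {r} p = flag r
    ... | inside z≤n q rewrite yin {r} z≤n q with x r 0 | flag r | swapView i (x r 0) | flagL r refl
    ...   | u | u≤ | sv | h with τ u | sv
    ...     | _ | is-lo = h refl
    ...     | _ | is-hi = ≤-trans (n≤1+n i) u≤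
    ...     | _ | is-fixed _ _ = u≤

    box' : ∀ r c → c < α r → 1 ≤ y r c
    box' r c p with where? i a d x c
    ... | left-of q rewrite ylt {r} q = box r c p
    ... | right-of q rewrite ygt {r} q = box r c p
    ... | inside q q' rewrite yin {r} q q' = applyS-pos i 1≤i (box r c p)

    out' : ∀ r c → α r ≤ c → y r c ≡ 0
    out' r c p with where? i a d x c
    ... | left-of q rewrite ylt {r} q = out r c p
    ... | right-of q rewrite ygt {r} q = out r c p
    ... | inside q q' rewrite yin {r} q q' | out r c p = applyS-zero i 1≤i

  swapCols-KT : KT n α ψ (swapCols i a d x)
  swapCols-KT = record { supp = supp ; box = box' ; out = out' ; row = row' ; key = key' ; flag = flag' }

  swapCols-occ-in : ∀ c v → a ≤ c → c ≤ d → occ n (swapCols i a d x) c v ≡ occ n x c (applyS i v)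
  swapCols-occ-in c v p q = cnt-cong _ _ v (τ v) n λ r _ →
    (λ e → trans (sym (applyS-invol i (x r c))) (cong τ (trans (sym (yin p q)) e))) ,
    (λ e → trans (yin p q) (trans (cong τ e) (applyS-invol i v)))

  swapCols-occ-out : ∀ c v → c < a ⊎ d < c → occ n (swapCols i a d x) c v ≡ occ n x c v
  swapCols-occ-out c v (inj₁ p) = occ-resp n y x c v (λ r → ylt p)
  swapCols-occ-out c v (inj₂ p) = occ-resp n y x c v (λ r → ygt p)

-- Raising, lowering and exchanging rows

module Columns {n : ℕ} {α ψ : ℕ → ℕ} {x : ℕ → ℕ → ℕ} (T : KT n α ψ x) {i : ℕ} (1≤i : 1 ≤ i) where
  open KT T

  P N : ℕ → ℕ
  P = hgt n x (suc i)
  N = hgt n x i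

  1≤si : 1 ≤ suc i
  1≤si = s≤s z≤n

  P-yes : ∀ {r c} → x r c ≡ suc i → P (suc c) ≡ suc (P c)
  P-yes {r} {c} e = cong (_+ P c) (occ-yes T 1≤si e)

  P-no : ∀ {c} → (∀ r → x r c ≢ suc i) → P (suc c) ≡ P c
  P-no {c} e = cong (_+ P c) (occ-no T e)

  N-yes : ∀ {r c} → x r c ≡ i → N (suc c) ≡ suc (N c)
  N-yes {r} {c} e = cong (_+ N c) (occ-yes T 1≤i e)

  N-no : ∀ {c} → (∀ r → x r c ≢ i) → N (suc c) ≡ N c
  N-no {c} e = cong (_+ N c) (occ-no T e)

  lo≢hi : ∀ {k l c} → x k c ≡ i → x l c ≡ suc i → k ≢ l
  lo≢hi e e' refl = 1+n≢n (trans (sym e') e)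

  key-lo : ∀ {l k c} → l < k → x k c ≡ i → i ≤ x l c → i < x l (suc c)
  key-lo {l} {k} {c} l<k e p = subst (_< x l (suc c)) e (key l k c l<k (subst (1 ≤_) (sym e) 1≤i) (subst (_≤ x l c) (sym e) p))

  key-hi : ∀ {l k c} → l < k → x k c ≡ suc i → suc i ≤ x l c → suc i < x l (suc c)
  key-hi {l} {k} {c} l<k e p = subst (_< x l (suc c)) e (key l k c l<k (subst (1 ≤_) (sym e) 1≤si) (subst (_≤ x l c) (sym e) p))

  -- The key condition for the `i` of row `k` puts an entry above `i` to the right of the `i + 1` of
  -- row `l`, and the row condition bounds it by `i + 1`. This is how runs of `i + 1` propagate from
  -- column to column.
  hi-extends : ∀ {l k c} → l < k → x l c ≡ suc i → x k c ≡ i → x l (suc c) ≡ suc i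
  hi-extends {l} {k} {c} l<k e e' = ≤-antisym (subst (x l (suc c) ≤_) e (row l c))
      (key-lo l<k e' (subst (i ≤_) (sym e) (n≤1+n i)))

  no-lo-below : ∀ {l k c} → l < k → x k c ≡ i → x l (suc c) ≢ i
  no-lo-below {l} {k} {c} l<k e e' = <-irrefl refl (subst (i <_) e' (key-lo l<k e (subst (_≤ x l c) e' (row l c))))

  above : ∀ {l k c} → x l c ≡ suc i → (∀ k → k < l → x k c ≢ i) → x k c ≡ i → l < k
  above {l} {k} e h e' with <-cmp l k
  ... | tri< p _ _ = p
  ... | tri≈ _ refl _ = ⊥-elim (lo≢hi e' e refl)
  ... | tri> _ _ p = ⊥-elim (h k p e')

  -- Were there such a run, each of its columns would contain an i above row l, and the key condition would prolong it for ever.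
  hi-run-ends : ∀ f l c → α l ≤ c + f → x l c ≡ suc i → (∀ k → k < l → x k c ≢ i) →
    (∀ c' → c ≤ c' → P c' + N c ≤ P c + N c') → ⊥
  hi-run-ends zero l c p e h b = <⇒≱ (inShape T (subst (1 ≤_) (sym e) 1≤si)) (subst (α l ≤_) (+-identityʳ c) p)
  hi-run-ends (suc f) l c p e h b with occ-find T c i 1≤i
  ... | inj₂ none = 1+n≰n (subst₂ _≤_ (cong (_+ N c) (P-yes e)) (cong (P c +_) (N-no none)) (b (suc c) (n≤1+n c)))
  ... | inj₁ (k , e') = hi-run-ends f l (suc c) (subst (α l ≤_) (+-suc c f) p) (hi-extends l<k e e')
                          (λ k' p' → no-lo-below (<-trans p' l<k) e') b'
    where
    l<k = above e h e'
    b' : ∀ c' → suc c ≤ c' → P c' + N (suc c) ≤ P (suc c) + N c'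
    b' c' q = subst₂ _≤_ (trans (sym (+-suc (P c') (N c))) (cong (P c' +_) (sym (N-yes e')))) (cong (_+ N c') (sym (P-yes e)))
               (s≤s (b c' (≤-trans (n≤1+n c) q)))

-- The effect of one crystal operator on column sets. In the other columns of an exchange both `i`
-- and `i + 1` are present, so their sets stay the same.
record ColStep (n i d : ℕ) (x y : ℕ → ℕ → ℕ) : Set where
  field
    x-hi  : occ n x d (suc i) ≡ 1
    x-lo  : occ n x d i ≡ 0
    y-hi  : occ n y d (suc i) ≡ 0
    y-lo  : occ n y d i ≡ 1
    at    : ∀ v → v ≢ i → v ≢ suc i → occ n y d v ≡ occ n x d v
    away  : ∀ c v → c ≢ d → occ n y c v ≡ occ n x c v

-- In terms of brackets: no `i` in the columns before `d` is unmatched. The excess is compared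
-- without subtraction.
Falling : (P N : ℕ → ℕ) → ℕ → Set
Falling P N d = ∀ c → c ≤ d → N d + P c ≤ P d + N c

-- In terms of brackets: no `i + 1` in the columns from `d` on is unmatched.
Dominated : (P N : ℕ → ℕ) → ℕ → Set
Dominated P N d = ∀ c → d ≤ c → P c + N d ≤ P d + N c

-- The box at which `e_i` starts. The suffix beginning there contains the box, hence the counts up
-- to `suc r₀`; `lt` expresses that the index `q` is the largest one attaining the maximum, that is,
-- no shorter suffix attains it.
record Peak (n : ℕ) (x : ℕ → ℕ → ℕ) (i m r₀ c₀ : ℕ) : Set where
  field
    r₀<n : r₀ < n
    peak : hgt n x (suc i) c₀ + cnt (λ r → x r c₀) (suc i) (suc r₀) ≡ m + (hgt n x i c₀ + cnt (λ r → x r c₀) i (suc r₀))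
    le   : ∀ c r → r ≤ n → hgt n x (suc i) c + cnt (λ r → x r c) (suc i) r ≤ m + (hgt n x i c + cnt (λ r → x r c) i r)
    lt   : ∀ c r → (c < c₀ × r ≤ n) ⊎ (c ≡ c₀ × r ≤ r₀) →
           hgt n x (suc i) c + cnt (λ r → x r c) (suc i) r < m + (hgt n x i c + cnt (λ r → x r c) i r)

module Raise {n : ℕ} {α ψ : ℕ → ℕ} {x : ℕ → ℕ → ℕ} (T : KT n α ψ x) (ψ-mono : ∀ {l k} → l ≤ k → ψ l ≤ ψ k)
             {i : ℕ} (1≤i : 1 ≤ i) {m r₀ c₀ : ℕ} (Q : Peak n x i m r₀ c₀) where
  open KT T
  open Peak Q
  open Columns T 1≤i

  private
    col : ℕ → ℕ → ℕ
    col c r = x r c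

    cnt-none : ∀ c v k → (∀ r → r < k → x r c ≢ v) → cnt (col c) v k ≡ 0
    cnt-none c v k h = cnt-zero _ v k h

    cnt-some : ∀ c v k r → 1 ≤ v → r < k → x r c ≡ v → cnt (col c) v k ≡ 1
    cnt-some c v k r p q e = cnt-one _ v k r q e (λ r' e' → distinct T p e' e)

    lt0 : ∀ c → c ≤ c₀ → P c < m + N c
    lt0 c p with m≤n⇒m<n∨m≡n p
    ... | inj₁ q = subst₂ _<_ (+-identityʳ (P c)) (cong (m +_) (+-identityʳ (N c))) (lt c 0 (inj₁ (q , z≤n)))
    ... | inj₂ q = subst₂ _<_ (+-identityʳ (P c)) (cong (m +_) (+-identityʳ (N c))) (lt c 0 (inj₂ (q , z≤n)))

  -- A letter other than `i + 1` does not increase the excess, so the next shorter suffix would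
  -- attain the maximum already.
  at-peak : x r₀ c₀ ≡ suc i
  at-peak with x r₀ c₀ ≟ suc i
  ... | yes e = e
  ... | no ne = ⊥-elim (<-irrefl eq (<-≤-trans (lt c₀ r₀ (inj₂ (refl , ≤-refl)))
      (+-monoʳ-≤ m (+-monoʳ-≤ (N c₀) (m≤n+m _ (if x r₀ c₀ ≡ᵇ i then 1 else 0))))))
    where
    eq : P c₀ + cnt (col c₀) (suc i) r₀ ≡ m + (N c₀ + cnt (col c₀) i (suc r₀))
    eq = trans (cong (P c₀ +_) (sym (cong (λ b → (if b then 1 else 0) + cnt (col c₀) (suc i) r₀) (≡ᵇ-no ne)))) peak

  -- Such an `i` would cancel the `i + 1` of the peak, so the columns left of `c₀` alone would
  -- attain the maximum.
  no-lo-under : ∀ k → k < r₀ → x k c₀ ≢ i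
  no-lo-under k k<r e = <-irrefl eq (lt0 c₀ ≤-refl)
    where
    eq : P c₀ ≡ m + N c₀
    eq = suc-injective (begin
      suc (P c₀) ≡⟨ +-comm 1 (P c₀) ⟩
      P c₀ + 1 ≡⟨ cong (P c₀ +_) (sym (cnt-some c₀ (suc i) (suc r₀) r₀ 1≤si ≤-refl at-peak)) ⟩
      P c₀ + cnt (col c₀) (suc i) (suc r₀) ≡⟨ peak ⟩
      m + (N c₀ + cnt (col c₀) i (suc r₀)) ≡⟨ cong (λ z → m + (N c₀ + z)) (cnt-some c₀ i (suc r₀) k 1≤i (m≤n⇒m≤1+n k<r) e) ⟩
      m + (N c₀ + 1) ≡⟨ cong (m +_) (+-comm (N c₀) 1) ⟩
      m + suc (N c₀) ≡⟨ +-suc m (N c₀) ⟩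
      suc (m + N c₀) ∎)
      where open ≡-Reasoning

  private
    no-lo-upto : ∀ c → x r₀ c ≡ suc i → (∀ k → k < r₀ → x k c ≢ i) → ∀ k → k < suc r₀ → x k c ≢ i
    no-lo-upto c e h k p e' with m≤n⇒m<n∨m≡n (≤-pred p)
    ... | inj₁ q = h k q e'
    ... | inj₂ refl = lo≢hi e' e refl

  -- `height` says that the excess left of column `c` is `m - 1`, so the `i + 1` of row `r₀` brings
  -- it back to the maximum. A column that also holds an `i` hands the same situation on to the next
  -- one.
  record Run (c : ℕ) : Set where
    constructor run
    field
      hi-at : x r₀ c ≡ suc i
      none-under : ∀ k → k < r₀ → x k c ≢ i
      height : suc (P c) ≡ m + N c
  open Run

  run-start : Run c₀
  run-start = run at-peak no-lo-under (begin
      suc (P c₀) ≡⟨ +-comm 1 (P c₀) ⟩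
      P c₀ + 1 ≡⟨ cong (P c₀ +_) (sym (cnt-some c₀ (suc i) (suc r₀) r₀ 1≤si ≤-refl at-peak)) ⟩
      P c₀ + cnt (col c₀) (suc i) (suc r₀) ≡⟨ peak ⟩
      m + (N c₀ + cnt (col c₀) i (suc r₀)) ≡⟨ cong (λ z → m + (N c₀ + z))
          (cnt-none c₀ i (suc r₀) (no-lo-upto c₀ at-peak no-lo-under)) ⟩
      m + (N c₀ + 0) ≡⟨ cong (m +_) (+-identityʳ (N c₀)) ⟩
      m + N c₀ ∎)
      where open ≡-Reasoning

  run-next : ∀ {c k} → Run c → x k c ≡ i → Run (suc c)
  run-next {c} {k} (run e h t) e' = run (hi-extends r<k e e') (λ k' p → no-lo-below (<-trans p r<k) e')
      (trans (cong suc (P-yes e)) (trans (cong suc t) (trans (sym (+-suc m (N c))) (cong (m +_) (sym (N-yes e'))))))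
    where r<k = above e h e'

  -- Without an `i` in column `c` the excess behind it is the maximum `m`. Another `i + 1` of row
  -- `r₀`, with no `i` below it by the key condition, would exceed `m`.
  run-stop : ∀ {c} → Run c → (∀ k → x k c ≢ i) → x r₀ (suc c) ≢ suc i
  run-stop {c} (run e h t) none e' = 1+n≰n (begin
      suc (suc (P c)) ≡⟨ cong suc (sym (P-yes e)) ⟩
      suc (P (suc c)) ≡⟨ +-comm 1 (P (suc c)) ⟩
      P (suc c) + 1 ≡⟨ cong (P (suc c) +_) (sym (cnt-some (suc c) (suc i) (suc r₀) r₀ 1≤si ≤-refl e')) ⟩
      P (suc c) + cnt (col (suc c)) (suc i) (suc r₀) ≤⟨ le (suc c) (suc r₀) r₀<n ⟩
      m + (N (suc c) + cnt (col (suc c)) i (suc r₀)) ≡⟨ cong (λ z → m + (N (suc c) + z))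
          (cnt-none (suc c) i (suc r₀) (no-lo-upto (suc c) e' h')) ⟩
      m + (N (suc c) + 0) ≡⟨ cong (m +_) (trans (+-identityʳ (N (suc c))) (N-no none)) ⟩
      m + N c ≡⟨ sym t ⟩
      suc (P c) ∎)
    where
    open ≤-Reasoning
    h' : ∀ k → k < r₀ → x k (suc c) ≢ i
    h' k p e'' = <-asym (n<1+n i) (subst (suc i <_) e'' (key-hi p e (≤∧≢⇒< (subst (_≤ x k c) e'' (row k c)) (none k ∘ sym))))

  record Stretch (c : ℕ) : Set where
    field
      end : ℕ
      c≤end : c ≤ end
      runs : ∀ c' → c ≤ c' → c' ≤ end → Run c'
      lows : ∀ c' → c ≤ c' → c' < end → ∃ λ k → x k c' ≡ i
      no-low : ∀ k → x k end ≢ i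
      stops : x r₀ (suc end) ≢ suc i

  -- The interval exchanged by `e_i`. The fuel is the distance to the end of row `r₀`, which the run
  -- cannot leave.
  stretch : ∀ f c → α r₀ ≤ c + f → Run c → Stretch c
  stretch zero c p s = ⊥-elim (<⇒≱ (inShape T (subst (1 ≤_) (sym (hi-at s)) 1≤si)) (subst (α r₀ ≤_) (+-identityʳ c) p))
  stretch (suc f) c p s with occ-find T c i 1≤i
  ... | inj₂ none = record { end = c ; c≤end = ≤-refl ; runs = λ c' p q → subst Run (≤-antisym p q) s
          ; lows = λ c' p q → ⊥-elim (<⇒≱ q p) ; no-low = none ; stops = run-stop s none }
  ... | inj₁ (k , e) = record { end = end ; c≤end = ≤-trans (n≤1+n c) c≤end ; runs = runs' ; lows = lows' ; no-low = no-low ;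
      stops = stops }
    where
    open Stretch (stretch f (suc c) (subst (α r₀ ≤_) (+-suc c f) p) (run-next s e))
    runs' : ∀ c' → c ≤ c' → c' ≤ end → Run c'
    runs' c' p q with m≤n⇒m<n∨m≡n p
    ... | inj₁ p' = runs c' p' q
    ... | inj₂ refl = s
    lows' : ∀ c' → c ≤ c' → c' < end → ∃ λ k → x k c' ≡ i
    lows' c' p q with m≤n⇒m<n∨m≡n p
    ... | inj₁ p' = lows c' p' q
    ... | inj₂ refl = k , e

  private
    -- Needed at the left border. If the column of this `i` has no `i + 1`, or has one in row `r₀`,
    -- a shorter suffix already attains the maximum. An `i + 1` below row `r₀` would extend into
    -- column `c₀` and occur twice there, and one above row `r₀` violates the key condition.
    no-lo-left : ∀ c k → suc c ≡ c₀ → r₀ < k → x k c ≢ i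
    no-lo-left c k refl r<k e with occ-find T c (suc i) 1≤si
    ... | inj₂ none = 1+n≰n (begin
            suc (m + N c) ≡⟨ sym (+-suc m (N c)) ⟩
            m + suc (N c) ≡⟨ cong (m +_) (sym (N-yes e)) ⟩
            m + N (suc c) ≡⟨ sym (height run-start) ⟩
            suc (P (suc c)) ≡⟨ cong suc (P-no none) ⟩
            suc (P c) ≤⟨ lt0 c (n≤1+n c) ⟩
            m + N c ∎)
      where open ≤-Reasoning
    ... | inj₁ (l , e') with <-cmp l r₀
    ...   | tri< l<r _ _ = <-irrefl (distinct T 1≤si (hi-extends (<-trans l<r r<k) e' e) at-peak) l<r
    ...   | tri> _ _ r<l = 1+n≰n (subst (suc i <_) at-peak (key-hi r<l e' (subst (_≤ x r₀ c) at-peak (row r₀ c))))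
    ...   | tri≈ _ refl _ = 1+n≰n (begin
            suc (suc (P c)) ≡⟨ cong suc (+-comm 1 (P c)) ⟩
            suc (P c + 1) ≡⟨ cong (λ z → suc (P c + z)) (sym (cnt-some c (suc i) (suc r₀) r₀ 1≤si ≤-refl e')) ⟩
            suc (P c + cnt (col c) (suc i) (suc r₀)) ≤⟨ lt c (suc r₀) (inj₁ (≤-refl , r₀<n)) ⟩
            m + (N c + cnt (col c) i (suc r₀)) ≡⟨ cong (λ z → m + (N c + z)) (cnt-none c i (suc r₀)
                     (λ k' p e'' → <⇒≱ r<k (subst (_≤ r₀) (distinct T 1≤i e'' e) (≤-pred p)))) ⟩
            m + (N c + 0) ≡⟨ cong (m +_) (+-identityʳ (N c)) ⟩
            m + N c ≡⟨ suc-injective (begin-equality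
              suc (m + N c) ≡⟨ sym (+-suc m (N c)) ⟩
              m + suc (N c) ≡⟨ cong (m +_) (sym (N-yes e)) ⟩
              m + N (suc c) ≡⟨ sym (height run-start) ⟩
              suc (P (suc c)) ≡⟨ cong suc (P-yes e') ⟩
              suc (suc (P c)) ∎) ⟩
            suc (P c) ∎)
      where open ≤-Reasoning

  open Stretch (stretch (α r₀) c₀ (m≤n+m (α r₀) c₀) run-start) public

  private
    hi-unique : ∀ {c k} → c₀ ≤ c → c ≤ end → x k c ≡ suc i → k ≡ r₀
    hi-unique p q e = distinct T 1≤si e (hi-at (runs _ p q))

    lo-above : ∀ {c k} → c₀ ≤ c → c ≤ end → x k c ≡ i → r₀ < k
    lo-above p q e = above (hi-at (runs _ p q)) (none-under (runs _ p q)) e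

  swappable : Swappable i c₀ end ψ x
  swappable = record
    { rowIn = λ k c p q e e' → case hi-unique p (<⇒≤ q) e of λ { refl → lo≢hi e' (hi-at (runs (suc c) (m≤n⇒m≤1+n p) q)) refl }
    ; rowL = λ k c e e' e'' → no-lo-left c k e (lo-above ≤-refl c≤end e') e''
    ; rowR = λ k e e' → case hi-unique c≤end ≤-refl e of λ { refl → stops e' }
    ; keyIn = λ l k c l<k p q e e' → case hi-unique p (<⇒≤ q) e of λ { refl → ⊥-elim (<-asym l<k (lo-above p (<⇒≤ q) e')) }
    ; keyIn′ = λ l k c l<k p q e e' → case hi-unique (m≤n⇒m≤1+n p) q e' of λ { refl → hi-at (runs c p (<⇒≤ q)) }
    ; keyR = λ l k l<k e _ → ⊥-elim (no-low k e)
    ; keyR′ = λ l k _ e → no-low l e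
    ; keyL = λ l k c l<k e e' e'' → case hi-unique ≤-refl c≤end e'' of λ { refl → no-lo-left c k e l<k e' }
    -- The `i` of column 0 that becomes `i + 1` lies above row `r₀`, whose flag admits `i + 1`;
    -- `ψ-mono` carries this upwards.
    ; flagL = λ { k refl e → ≤-trans (subst (_≤ ψ r₀) at-peak (flag r₀)) (ψ-mono (<⇒≤ (lo-above ≤-refl c≤end e))) } }

  raised : ℕ → ℕ → ℕ
  raised = swapCols i c₀ end x

  raised-KT : KT n α ψ raised
  raised-KT = swapCols-KT T 1≤i c≤end swappable

  colStep : ColStep n i end x raised
  colStep = record
    { x-hi = hi-end
    ; x-lo = lo-end
    ; y-hi = trans (in-occ end (suc i) c≤end ≤-refl) (trans (cong (occ n x end) (applyS-hi i)) lo-end)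
    ; y-lo = trans (in-occ end i c≤end ≤-refl) (trans (cong (occ n x end) (applyS-lo i)) hi-end)
    ; at = λ v p q → trans (in-occ end v c≤end ≤-refl) (cong (occ n x end) (applyS-else i p q))
    ; away = off' }
    where
    in-occ = swapCols-occ-in T 1≤i c≤end swappable
    hi-end = occ-yes T 1≤si (hi-at (runs end c≤end ≤-refl))
    lo-end = occ-no T no-low
    off' : ∀ c v → c ≢ end → occ n raised c v ≡ occ n x c v
    off' c v ne with where? i c₀ end x c
    ... | left-of p = swapCols-occ-out T 1≤i c≤end swappable c v (inj₁ p)
    ... | right-of p = swapCols-occ-out T 1≤i c≤end swappable c v (inj₂ p)
    ... | inside p q with v ≟ i | v ≟ suc i
    ...   | no a | no b = trans (in-occ c v p q) (cong (occ n x c) (applyS-else i a b))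
    ...   | yes refl | _ = trans (in-occ c v p q) (trans (cong (occ n x c) (applyS-lo i))
              (trans (occ-yes T 1≤si (hi-at (runs c p q))) (sym (occ-yes T 1≤i (proj₂ (lows c p (≤∧≢⇒< q ne)))))))
    ...   | no _ | yes refl = trans (in-occ c v p q) (trans (cong (occ n x c) (applyS-hi i))
              (trans (occ-yes T 1≤i (proj₂ (lows c p (≤∧≢⇒< q ne)))) (sym (occ-yes T 1≤si (hi-at (runs c p q))))))

  private
    cross : ∀ {a b p q} → suc a ≤ m + b → suc p ≡ m + q → q + a ≤ p + b
    cross {a} {b} {p} {q} h e = +-cancelˡ-≤ m _ _ (≤-pred (begin
      suc (m + (q + a)) ≡⟨ cong suc (sym (+-assoc m q a)) ⟩
      suc (m + q + a) ≡⟨ cong (λ z → suc (z + a)) (sym e) ⟩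
      suc (suc p + a) ≡⟨ sym (+-suc (suc p) a) ⟩
      suc p + suc a ≤⟨ +-monoʳ-≤ (suc p) h ⟩
      suc p + (m + b) ≡⟨ cong suc (trans (sym (+-assoc p m b)) (trans (cong (_+ b) (+-comm p m)) (+-assoc m p b))) ⟩
      suc (m + (p + b)) ∎))
      where open ≤-Reasoning

  falling : Falling P N end
  falling c p with c₀ ≤? c
  ... | yes q = cross (≤-reflexive (height (runs c q p))) (height (runs end c≤end ≤-refl))
  ... | no q = cross (lt0 c (<⇒≤ (≰⇒> q))) (height (runs end c≤end ≤-refl))

  dominated : Dominated P N (suc end)
  dominated c p = +-cancelˡ-≤ m _ _ (begin
      m + (P c + N (suc end)) ≡⟨ cong (λ z → m + (P c + z)) (N-no no-low) ⟩
      m + (P c + N end) ≡⟨ trans (sym (+-assoc m (P c) (N end)))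
          (trans (cong (_+ N end) (+-comm m (P c))) (+-assoc (P c) m (N end))) ⟩
      P c + (m + N end) ≡⟨ cong (P c +_) (sym (trans (P-yes (hi-at (runs end c≤end ≤-refl))) (height (runs end c≤end ≤-refl)))) ⟩
      P c + P (suc end) ≤⟨ +-monoˡ-≤ (P (suc end)) (subst₂ _≤_ (+-identityʳ (P c)) (cong (m +_) (+-identityʳ (N c))) (le c 0 z≤n))
          ⟩
      m + N c + P (suc end) ≡⟨ trans (+-assoc m (N c) (P (suc end))) (cong (m +_) (+-comm (N c) (P (suc end)))) ⟩
      m + (P (suc end) + N c) ∎)
      where open ≤-Reasoning

-- The inverse of `Raise`, starting from the column `d` of the leftmost unmatched `i`. By `flag-ok`
-- either the flags leave room for `i + 1` in column 0, or the excess left of `d` is positive and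
-- the exchange stops before column 0.
module Lower {n : ℕ} {α ψ : ℕ → ℕ} {x : ℕ → ℕ → ℕ} (T : KT n α ψ x) {i : ℕ} (1≤i : 1 ≤ i) {r d : ℕ}
    (lo-d : x r d ≡ i) (no-hi : ∀ k → x k d ≢ suc i)
    (falls : Falling (hgt n x (suc i)) (hgt n x i) d) (dom : Dominated (hgt n x (suc i)) (hgt n x i) (suc d))
    (flag-ok : (∀ k → x k 0 ≡ i → suc i ≤ ψ k) ⊎ hgt n x i d < hgt n x (suc i) d) where
  open KT T
  open Columns T 1≤i

  record LStretch : Set where
    field
      start : ℕ
      start≤d : start ≤ d
      lo-at : ∀ c → start ≤ c → c ≤ d → x r c ≡ i
      highs : ∀ c → start ≤ c → c < d → ∃ λ k → r < k × x k c ≡ suc i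
      left  : ∀ c → suc c ≡ start → x r c ≢ i
      atZero : start ≡ 0 → N d ≡ P d

  -- The last premise is the invariant: the excess left of `c` equals the excess left of `d`. If row
  -- `r` has an `i` in the preceding column too, `falls` forces an `i + 1` into that column, and the
  -- equality is restored.
  lstretch : ∀ c → c ≤ d → (∀ c' → c ≤ c' → c' ≤ d → x r c' ≡ i) → (∀ c' → c ≤ c' → c' < d → ∃ λ k → r < k × x k c' ≡ suc i) →
    N d + P c ≡ P d + N c → LStretch
  lstretch zero p lo hi e = record { start = 0 ; start≤d = p ; lo-at = lo ; highs = hi ; left = λ c () 
    ; atZero = λ _ → trans (sym (+-identityʳ (N d))) (trans e (+-identityʳ (P d))) }
  lstretch (suc c) p lo hi e with x r c ≟ i
  ... | no ne = record { start = suc c ; start≤d = p ; lo-at = lo ; highs = hi ; left = λ { _ refl → ne } ; atZero = λ () }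
  ... | yes e' with occ-find T c (suc i) 1≤si
  ...   | inj₂ none = ⊥-elim (1+n≰n (begin
          suc (P d + N c) ≡⟨ sym (+-suc (P d) (N c)) ⟩
          P d + suc (N c) ≡⟨ cong (P d +_) (sym (N-yes e')) ⟩
          P d + N (suc c) ≡⟨ sym e ⟩
          N d + P (suc c) ≡⟨ cong (N d +_) (P-no none) ⟩
          N d + P c ≤⟨ falls c (<⇒≤ p) ⟩
          P d + N c ∎))
    where open ≤-Reasoning
  ...   | inj₁ (k , ek) = lstretch c (<⇒≤ p) lo' hi' e''
    where
    -- An `i + 1` below row `r` would extend to the next column. There `i + 1` is absent if the
    -- column is `d`, and lies above row `r` otherwise.
    r<k : r < k
    r<k with <-cmp k r
    ... | tri> _ _ q = q
    ... | tri≈ _ refl _ = ⊥-elim (lo≢hi e' ek refl)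
    ... | tri< k<r _ _ with m≤n⇒m<n∨m≡n p
    ...   | inj₂ refl = ⊥-elim (no-hi k (hi-extends k<r ek e'))
    ...   | inj₁ q with hi (suc c) ≤-refl q
    ...     | k' , r<k' , ek' = ⊥-elim (<-asym k<r (subst (r <_) (distinct T 1≤si ek' (hi-extends k<r ek e')) r<k'))
    lo' : ∀ c' → c ≤ c' → c' ≤ d → x r c' ≡ i
    lo' c' q q' with m≤n⇒m<n∨m≡n q
    ... | inj₁ s = lo c' s q'
    ... | inj₂ refl = e'
    hi' : ∀ c' → c ≤ c' → c' < d → ∃ λ k → r < k × x k c' ≡ suc i
    hi' c' q q' with m≤n⇒m<n∨m≡n q
    ... | inj₁ s = hi c' s q'
    ... | inj₂ refl = k , r<k , ek
    e'' : N d + P c ≡ P d + N c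
    e'' = suc-injective (begin
      suc (N d + P c) ≡⟨ sym (+-suc (N d) (P c)) ⟩
      N d + suc (P c) ≡⟨ cong (N d +_) (sym (P-yes ek)) ⟩
      N d + P (suc c) ≡⟨ e ⟩
      P d + N (suc c) ≡⟨ cong (P d +_) (N-yes e') ⟩
      P d + suc (N c) ≡⟨ +-suc (P d) (N c) ⟩
      suc (P d + N c) ∎)
      where open ≡-Reasoning

  open LStretch (lstretch d ≤-refl (λ c' p q → subst (λ c → x r c ≡ i) (≤-antisym p q) lo-d) (λ c' p q → ⊥-elim (<⇒≱ q p))
                          (+-comm (N d) (P d))) public

  private
    lo-unique : ∀ {c k} → start ≤ c → c ≤ d → x k c ≡ i → k ≡ r
    lo-unique p q e = distinct T 1≤i e (lo-at _ p q)

    hi-above : ∀ {c k} → start ≤ c → c ≤ d → x k c ≡ suc i → c < d × r < k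
    hi-above {c} {k} p q e with m≤n⇒m<n∨m≡n q
    ... | inj₂ refl = ⊥-elim (no-hi k e)
    ... | inj₁ q' with highs c p q'
    ...   | k' , r<k' , e' = q' , subst (r <_) (distinct T 1≤si e' e) r<k'

  swappable : Swappable i start d ψ x
  swappable = record
    { rowIn = λ k c p q e e' → case lo-unique (m≤n⇒m≤1+n p) q e' of λ { refl → lo≢hi (lo-at c p (<⇒≤ q)) e refl }
    ; rowL = λ k c e e' e'' → case lo-unique ≤-refl start≤d e' of λ { refl → left c e e'' }
    ; rowR = λ k e _ → no-hi k e
    ; keyIn = λ l k c l<k p q e e' → case lo-unique p (<⇒≤ q) e' of λ { refl → lo-at (suc c) (m≤n⇒m≤1+n p) q }
    ; keyIn′ = λ l k c l<k p q e e' → case lo-unique p (<⇒≤ q) e of λ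
      { refl → ⊥-elim (<-asym l<k (proj₂ (hi-above (m≤n⇒m≤1+n p) q e'))) }
    -- `key-lo` yields only an entry above `i`. If it were `i + 1`, it would begin a run with no `i`
    -- below, which `dom` excludes through `hi-run-ends`.
    ; keyR = λ l k l<k e p → case lo-unique start≤d ≤-refl e of λ { refl → ≤∧≢⇒< (key-lo l<k lo-d (≤-trans (n≤1+n i) (<⇒≤ p)))
               (λ e' → hi-run-ends (α l) l (suc d) (m≤n+m (α l) (suc d)) (sym e') (λ k' q → no-lo-below (<-trans q l<k) lo-d) dom)
                 }
    ; keyR′ = λ l k e _ → no-hi k e
    ; keyL = λ l k c l<k e₀ e e' → let at-start = subst (λ z → x r z ≡ i) (sym e₀) (lo-at start ≤-refl start≤d) in
               1+n≰n (subst (i <_) at-start (key-lo (<-trans (proj₂ (hi-above ≤-refl start≤d e')) l<k) e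
                   (subst (_≤ x r c) at-start (row r c))))
    ; flagL = λ k z e → case flag-ok of λ { (inj₁ h) → h k e ; (inj₂ h) → ⊥-elim (<-irrefl (atZero z) h) } }

  lowered : ℕ → ℕ → ℕ
  lowered = swapCols i start d x

  lowered-KT : KT n α ψ lowered
  lowered-KT = swapCols-KT T 1≤i start≤d swappable

  colStep : ColStep n i d lowered x
  colStep = record
    { x-hi = trans (in-occ d (suc i) start≤d ≤-refl) (trans (cong (occ n x d) (applyS-hi i)) lo-end)
    ; x-lo = trans (in-occ d i start≤d ≤-refl) (trans (cong (occ n x d) (applyS-lo i)) hi-end)
    ; y-hi = hi-end
    ; y-lo = lo-end
    ; at = λ v p q → sym (trans (in-occ d v start≤d ≤-refl) (cong (occ n x d) (applyS-else i p q)))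
    ; away = λ c v ne → sym (off' c v ne) }
    where
    in-occ = swapCols-occ-in T 1≤i start≤d swappable
    lo-end = occ-yes T 1≤i lo-d
    hi-end = occ-no T no-hi
    off' : ∀ c v → c ≢ d → occ n lowered c v ≡ occ n x c v
    off' c v ne with where? i start d x c
    ... | left-of p = swapCols-occ-out T 1≤i start≤d swappable c v (inj₁ p)
    ... | right-of p = swapCols-occ-out T 1≤i start≤d swappable c v (inj₂ p)
    ... | inside p q with v ≟ i | v ≟ suc i
    ...   | no a | no b = trans (in-occ c v p q) (cong (occ n x c) (applyS-else i a b))
    ...   | yes refl | _ = trans (in-occ c v p q) (trans (cong (occ n x c) (applyS-lo i))
              (trans (occ-yes T 1≤si (proj₂ (proj₂ (highs c p (≤∧≢⇒< q ne))))) (sym (occ-yes T 1≤i (lo-at c p q)))))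
    ...   | no _ | yes refl = trans (in-occ c v p q) (trans (cong (occ n x c) (applyS-hi i))
              (trans (occ-yes T 1≤i (lo-at c p q)) (sym (occ-yes T 1≤si (proj₂ (proj₂ (highs c p (≤∧≢⇒< q ne))))))))

bumpAt : ℕ → (ℕ → ℕ) → ℕ → ℕ
bumpAt j ψ r = if r ≡ᵇ j then suc (ψ r) else ψ r

bumpAt-same : ∀ j ψ → bumpAt j ψ j ≡ suc (ψ j)
bumpAt-same j ψ rewrite ≡ᵇ-yes {j} refl = refl

bumpAt-other : ∀ j ψ {r} → r ≢ j → bumpAt j ψ r ≡ ψ r
bumpAt-other j ψ ne rewrite ≡ᵇ-no ne = refl

-- Only an entry `ψ j + 1` at the start of row `j` can break the old flag. The smaller flags below
-- keep `ψ j` out of the rows under it, so it would begin a run that drives the excess above 0.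
highest-flag : ∀ {n α ψ x} j → KT n α (bumpAt j ψ) x → 1 ≤ ψ j → (∀ k → k < j → ψ k < ψ j) →
  (∀ c → hgt n x (suc (ψ j)) c ≤ hgt n x (ψ j) c) → KT n α ψ x
highest-flag {n} {α} {ψ} {x} j T 1≤ below low = KT-resp T (λ _ → refl) (λ _ _ → refl) fl
  where
  open KT T
  open Columns T 1≤
  below' : ∀ k → k < j → ∀ c → x k c ≢ ψ j
  below' k p c e = <⇒≱ (below k p) (≤-trans (≤-reflexive (sym e)) (subst (x k c ≤_) (bumpAt-other j ψ (<⇒≢ p)) (le-flag T k c)))
  fl : ∀ r → x r 0 ≤ ψ r
  fl r with r ≟ j
  ... | no ne = subst (x r 0 ≤_) (bumpAt-other j ψ ne) (flag r)
  ... | yes refl with m≤n⇒m<n∨m≡n (subst (x j 0 ≤_) (bumpAt-same j ψ) (flag j))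
  ...   | inj₁ p = ≤-pred p
  ...   | inj₂ e = ⊥-elim (hi-run-ends (α j) j 0 ≤-refl e (λ k p → below' k p 0)
                     (λ c _ → subst (_≤ N c) (sym (+-identityʳ (P c))) (low c)))

private
  -- The value `x r c` also occurs in the column of `y`, necessarily above row `r`. The key
  -- condition of `y` against the larger `y r c` then makes `y r (suc c)` exceed `x r c`, although
  -- it equals `x r (suc c)`.
  column-le : ∀ {n α ψ ψ' x y} → KT n α ψ x → KT n α ψ' y → ∀ r c → (∀ v → 1 ≤ v → occ n x c v ≡ occ n y c v) →
    (∀ k → k < r → x k c ≡ y k c) → x r (suc c) ≡ y r (suc c) → 1 ≤ x r c → x r c < y r c → ⊥
  column-le {x = x} {y} T U r c oc below nxt pos lt' with occ≡1 U pos (trans (sym (oc (x r c) pos)) (occ-yes T pos refl))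
  ... | k , e with <-cmp k r
  ...   | tri< k<r _ _ = <-irrefl (distinct T pos (trans (below k k<r) e) refl) k<r
  ...   | tri≈ _ refl _ = <-irrefl (sym e) lt'
  ...   | tri> _ _ r<k = <⇒≱ (KT.key U r k c r<k (subst (1 ≤_) (sym e) pos) (≤-trans (≤-reflexive e) (<⇒≤ lt')))
            (≤-trans (≤-reflexive (sym nxt)) (≤-trans (KT.row T r c) (≤-reflexive (sym e))))

-- Read from the right, each column is filled greedily from the bottom row, so the sets of column entries determine the tableau.
KT-unique : ∀ {n α ψ ψ' x y} C → (∀ r → α r ≤ C) → KT n α ψ x → KT n α ψ' y →
  (∀ c v → 1 ≤ v → occ n x c v ≡ occ n y c v) → ∀ r c → x r c ≡ y r c
KT-unique {n} {α} {x = x} {y} C bd T U oc r c = cols C c (m≤n+m C c) r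
  where
  cols : ∀ f c → C ≤ c + f → ∀ r → x r c ≡ y r c
  cols zero c p r = trans (KT.out T r c q) (sym (KT.out U r c q))
    where q = ≤-trans (bd r) (subst (C ≤_) (+-identityʳ c) p)
  cols (suc f) c p r = rows (suc r) r ≤-refl
    where
    nxt : ∀ r → x r (suc c) ≡ y r (suc c)
    nxt = cols f (suc c) (subst (C ≤_) (+-suc c f) p)
    rows : ∀ R r → r < R → x r c ≡ y r c
    rows (suc R) r p with c <? α r
    ... | no q = trans (KT.out T r c (≮⇒≥ q)) (sym (KT.out U r c (≮⇒≥ q)))
    ... | yes q with <-cmp (x r c) (y r c)
    ...   | tri≈ _ e _ = e
    ...   | tri< l _ _ = ⊥-elim (column-le T U r c (oc c) (λ k s → rows R k (≤-trans s (≤-pred p))) (nxt r) (KT.box T r c q) l)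
    ...   | tri> _ _ l = ⊥-elim (column-le U T r c (λ v s → sym (oc c v s)) (λ k s → sym (rows R k (≤-trans s (≤-pred p))))
        (sym (nxt r)) (KT.box U r c q) l)

-- A failure in column `c` gives `x (suc l) c < x l (suc c)` by the key condition, hence a failure
-- in column `suc c`. Row `l` ends, so there is none.
ascending : ∀ {n α ψ x} → KT n α ψ x → ∀ l → α l ≤ α (suc l) → ∀ c → c < α l → x l c < x (suc l) c
ascending {α = α} {x = x} T l le c p = go (α l) c (m≤n+m (α l) c) p
  where
  open KT T
  go : ∀ f c → α l ≤ c + f → c < α l → x l c < x (suc l) c
  go zero c p q = ⊥-elim (<⇒≱ q (subst (α l ≤_) (+-identityʳ c) p))
  go (suc f) c p q with x (suc l) c ≤? x l c
  ... | no h = ≰⇒> h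
  ... | yes h = ⊥-elim (<⇒≱ (go f (suc c) (subst (α l ≤_) (+-suc c f) p) (inShape T (≤-<-trans z≤n k)))
      (≤-trans (row (suc l) c) (<⇒≤ k)))
    where k = key l (suc l) c ≤-refl (box (suc l) c (<-≤-trans q le)) h

-- Exchanging the tails of two neighbouring rows

swapTails : ℕ → ℕ → (ℕ → ℕ → ℕ) → ℕ → ℕ → ℕ
swapTails l s x r c with s ≤? c
... | yes _ = x (applyS l r) c
... | no _ = x r c

swapTails-ge : ∀ l s x {r c} → s ≤ c → swapTails l s x r c ≡ x (applyS l r) c
swapTails-ge l s x {r} {c} p with s ≤? c
... | yes _ = refl
... | no q = ⊥-elim (q p)

swapTails-lt : ∀ l s x {r c} → c < s → swapTails l s x r c ≡ x r c
swapTails-lt l s x {r} {c} p with s ≤? c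
... | yes q = ⊥-elim (<⇒≱ p q)
... | no q = refl

-- `border` glues each row to its new tail at column `s`, and `beyond` is the key condition between
-- the two tails in their new order. The remaining key conditions are inherited after renaming the
-- rows.
module SwapTails {n : ℕ} {α ψ : ℕ → ℕ} {x : ℕ → ℕ → ℕ} (T : KT n α ψ x) (l s : ℕ) (l<n : suc l < n)
    (border : ∀ c → suc c ≡ s → x l c < x (suc l) c × x (suc l) s ≤ x l c)
    (beyond : ∀ c → s ≤ c → 1 ≤ x l c → x l c ≤ x (suc l) c → x l c < x (suc l) (suc c)) where
  open KT T
  private
    y = swapTails l s x
    yge : ∀ {r c} → s ≤ c → y r c ≡ x (applyS l r) c
    yge = swapTails-ge l s x
    ylt : ∀ {r c} → c < s → y r c ≡ x r c
    ylt = swapTails-lt l s x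

    supp' : ∀ r → n ≤ r → α (applyS l r) ≡ 0
    supp' r p with applyS l r | swapView l r
    ... | _ | is-lo = ⊥-elim (<⇒≱ l<n (≤-trans p (n≤1+n l)))
    ... | _ | is-hi = ⊥-elim (<⇒≱ l<n p)
    ... | _ | is-fixed _ _ = supp r p

    keyGe : ∀ a b c → s ≤ c → a < b → 1 ≤ x (applyS l b) c → x (applyS l b) c ≤ x (applyS l a) c → x (applyS l b) c < x
        (applyS l a) (suc c)
    keyGe a b c p a<b q h with applyS l a | swapView l a | applyS l b | swapView l b
    ... | _ | is-lo | _ | is-lo = ⊥-elim (<-irrefl refl a<b)
    ... | _ | is-lo | _ | is-hi = beyond c p q h
    ... | _ | is-lo | _ | is-fixed u v = key _ _ c (≤∧≢⇒< a<b (v ∘ sym)) q h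
    ... | _ | is-hi | _ | is-lo = ⊥-elim (<-asym a<b (n<1+n l))
    ... | _ | is-hi | _ | is-hi = ⊥-elim (<-irrefl refl a<b)
    ... | _ | is-hi | _ | is-fixed u v = key _ _ c (<-trans (n<1+n l) a<b) q h
    ... | _ | is-fixed u v | _ | is-lo = key _ _ c (m≤n⇒m≤1+n a<b) q h
    ... | _ | is-fixed u v | _ | is-hi = key _ _ c (≤∧≢⇒< (≤-pred a<b) u) q h
    ... | _ | is-fixed u v | _ | is-fixed _ _ = key _ _ c a<b q h

    keyBd : ∀ a b c → suc c ≡ s → a < b → 1 ≤ x b c → x b c ≤ x a c → x b c < x (applyS l a) (suc c)
    keyBd a b c refl a<b q h with border c refl | applyS l a | swapView l a
    ... | v<v' , le | _ | is-fixed _ _ = key a b c a<b q h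
    ... | v<v' , le | _ | is-lo with b ≟ suc l
    ...   | yes refl = ⊥-elim (<⇒≱ v<v' h)
    ...   | no ne = key (suc l) b c (≤∧≢⇒< a<b (ne ∘ sym)) q (≤-trans h (<⇒≤ v<v'))
    keyBd a b c refl a<b q h | v<v' , le | _ | is-hi with x b c ≤? x l c
    ...   | yes h' = key l b c (<-trans (n<1+n l) a<b) q h'
    -- The key condition for row `suc l` gives `x b c < x (suc l) (suc c)`, and `le` bounds the
    -- right side by `x l c`.
    ...   | no h' = ⊥-elim (h' (≤-trans (<⇒≤ (key (suc l) b c a<b q h)) le))

    rowBd : ∀ r c → suc c ≡ s → x (applyS l r) (suc c) ≤ x r c
    rowBd r c refl with border c refl | applyS l r | swapView l r
    ... | v<v' , le | _ | is-fixed _ _ = row r c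
    ... | v<v' , le | _ | is-lo = le
    ... | v<v' , le | _ | is-hi = ≤-trans (row l c) (<⇒≤ v<v')

    data Rel (c : ℕ) : Set where
      before : suc c < s → Rel c
      at     : suc c ≡ s → Rel c
      after  : s ≤ c → Rel c

    rel? : ∀ c → Rel c
    rel? c with <-cmp (suc c) s
    ... | tri< p _ _ = before p
    ... | tri≈ _ p _ = at p
    ... | tri> _ _ p = after (≤-pred p)

    row' : ∀ r c → y r (suc c) ≤ y r c
    row' r c with rel? c
    ... | before p rewrite ylt {r} p | ylt {r} (<-trans (n<1+n c) p) = row r c
    ... | at refl rewrite yge {r} {suc c} ≤-refl | ylt {r} {c} ≤-refl = rowBd r c refl
    ... | after p rewrite yge {r} p | yge {r} (m≤n⇒m≤1+n p) = row (applyS l r) c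

    key' : ∀ a b c → a < b → 1 ≤ y b c → y b c ≤ y a c → y b c < y a (suc c)
    key' a b c a<b q h with rel? c
    ... | before p rewrite ylt {b} (<-trans (n<1+n c) p) | ylt {a} (<-trans (n<1+n c) p) | ylt {a} p = key a b c a<b q h
    ... | at refl rewrite ylt {b} {c} ≤-refl | ylt {a} {c} ≤-refl | yge {a} {suc c} ≤-refl = keyBd a b c refl a<b q h
    ... | after p rewrite yge {b} p | yge {a} p | yge {a} (m≤n⇒m≤1+n p) = keyGe a b c p a<b q h

    box' : ∀ (sh : ∀ c → c < s → c < α l × c < α (suc l)) r c → c < α (applyS l r) → 1 ≤ y r c
    box' sh r c p with s ≤? c
    ... | yes q = box (applyS l r) c p
    ... | no q with applyS l r | swapView l r
    ...   | _ | is-lo = box l c (proj₁ (sh c (≰⇒> q)))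
    ...   | _ | is-hi = box (suc l) c (proj₂ (sh c (≰⇒> q)))
    ...   | _ | is-fixed _ _ = box r c p

    out' : ∀ (sh : ∀ c → c < s → c < α l × c < α (suc l)) r c → α (applyS l r) ≤ c → y r c ≡ 0
    out' sh r c p with s ≤? c
    ... | yes q = out (applyS l r) c p
    ... | no q with applyS l r | swapView l r
    ...   | _ | is-lo = ⊥-elim (<⇒≱ (proj₂ (sh c (≰⇒> q))) p)
    ...   | _ | is-hi = ⊥-elim (<⇒≱ (proj₁ (sh c (≰⇒> q))) p)
    ...   | _ | is-fixed _ _ = out r c p

  swapTails-KT : ∀ {ψ'} → (∀ c → c < s → c < α l × c < α (suc l)) → (∀ r → swapTails l s x r 0 ≤ ψ' r) →
    KT n (α ∘ applyS l) ψ' (swapTails l s x)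
  swapTails-KT sh fl = record { supp = supp' ; box = box' sh ; out = out' sh ; row = row' ; key = key' ; flag = fl }

  swapTails-occ : ∀ {α' ψ'} → KT n α' ψ' (swapTails l s x) → ∀ c v → 1 ≤ v → occ n x c v ≡ occ n (swapTails l s x) c v
  swapTails-occ U c v 1≤v with ≤-<-connex s c
  ... | inj₂ q = occ-resp n x y c v (λ r → sym (ylt q))
  ... | inj₁ q with occ-find T c v 1≤v
  ...   | inj₁ (r , e) = trans (occ-yes T 1≤v e)
      (sym (occ-yes U {applyS l r} 1≤v (trans (yge q) (trans (cong (λ k → x k c) (applyS-invol l r)) e))))
  ...   | inj₂ h = trans (occ-no T h) (sym (occ-no U (λ r e → h (applyS l r) (trans (sym (yge q)) e))))

data RowCase (l r : ℕ) : Set where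
  isL : r ≡ l → RowCase l r
  isS : r ≡ suc l → RowCase l r
  neither : r ≢ l → r ≢ suc l → RowCase l r

rowCase : ∀ l r → RowCase l r
rowCase l r with r ≟ l | r ≟ suc l
... | yes p | _ = isL p
... | no _ | yes p = isS p
... | no p | no q = neither p q

-- The cut is the first column from which on row `l` is weakly above row `l + 1`; left of it row `l`
-- is strictly smaller. In either position of the cut the new row `l` starts with the smaller of two
-- distinct entries that are at most `l + 2`, so it meets the identity flag `l + 1`.
exchange-down : ∀ {n α x} l → suc l < n → α (suc l) ≤ α l → KT n α (bumpAt l suc) x →
  ∃ λ y → KT n (α ∘ applyS l) suc y × (∀ c v → 1 ≤ v → occ n x c v ≡ occ n y c v)
exchange-down {n} {α} {x} l l<n dec T = build (search (α (suc l)) (λ c p → subst (_≤ x l c) (sym (out (suc l) c p)) z≤n))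
  where
  open KT T
  data Found : Set where
    found : ∀ s (right : ∀ c → s ≤ c → x (suc l) c ≤ x l c) (bd : ∀ c → suc c ≡ s → x l c < x (suc l) c) → Found
  search : ∀ k → (∀ c → k ≤ c → x (suc l) c ≤ x l c) → Found
  search zero h = found 0 h (λ c ())
  search (suc k) h with x (suc l) k ≤? x l k
  ... | no p = found (suc k) h (λ { c refl → ≰⇒> p })
  ... | yes p = search k (λ c q → case m≤n⇒m<n∨m≡n q of λ { (inj₁ q') → h c q' ; (inj₂ refl) → p })
  -- A failure in column `s` would give `x (suc l) s < x l (suc s)` by the key condition, hence a
  -- failure in column `suc s`.
  asc-left : ∀ s → x l s < x (suc l) s → ∀ c → c ≤ s → x l c < x (suc l) c
  asc-left s p c q with m≤n⇒m<n∨m≡n q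
  ... | inj₂ refl = p
  asc-left (suc s) p c q | inj₁ q' = asc-left s step c (≤-pred q')
    where
    step : x l s < x (suc l) s
    step with x (suc l) s ≤? x l s
    ... | no h = ≰⇒> h
    ... | yes h = ⊥-elim (<⇒≱ p (≤-trans (row (suc l) s)
        (<⇒≤ (key l (suc l) s ≤-refl (≤-trans (≤-<-trans z≤n p) (row (suc l) s)) h))))
  asc-all : ∀ s → (∀ c → suc c ≡ s → x l c < x (suc l) c) → ∀ c → c < s → x l c < x (suc l) c
  asc-all (suc s) bd c p = asc-left s (bd s refl) c (≤-pred p)
  build : Found → ∃ λ y → KT n (α ∘ applyS l) suc y × (∀ c v → 1 ≤ v → occ n x c v ≡ occ n y c v)
  build (found s right bd) = swapTails l s x , U , swapTails-occ U
    where
    border : ∀ c → suc c ≡ s → x l c < x (suc l) c × x (suc l) s ≤ x l c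
    border c refl = bd c refl , ≤-trans (right (suc c) ≤-refl) (row l c)
    open SwapTails T l s l<n border (λ c p q h → ⊥-elim (distinct< T (n<1+n l) (≤-trans q h) (≤-antisym h (right c p))))
    flagL : x l 0 ≤ suc (suc l)
    flagL = subst (x l 0 ≤_) (bumpAt-same l suc) (flag l)
    flagS : x (suc l) 0 ≤ suc (suc l)
    flagS = subst (x (suc l) 0 ≤_) (bumpAt-other l suc 1+n≢n) (flag (suc l))
    fl : ∀ r → swapTails l s x r 0 ≤ suc r
    fl r with s ≤? 0 | rowCase l r
    ... | yes p | isL refl rewrite applyS-lo l = go (x (suc l) 0 ≟ 0)
      where
      go : Dec (x (suc l) 0 ≡ 0) → x (suc l) 0 ≤ suc l
      go (yes e) rewrite e = z≤n
      go (no ne) = ≤-pred (≤-trans (≤∧≢⇒< (right 0 p) (λ e → distinct< T (n<1+n l) (n≢0⇒n>0 ne) (sym e))) flagL)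
    ... | yes p | isS refl rewrite applyS-hi l = flagL
    ... | yes p | neither u v rewrite applyS-else l u v = subst (x r 0 ≤_) (bumpAt-other l suc u) (flag r)
    ... | no p | isS refl = flagS
    ... | no p | neither u v = subst (x r 0 ≤_) (bumpAt-other l suc u) (flag r)
    ... | no p | isL refl = ≤-pred (≤-trans (asc-all s bd 0 (≰⇒> p)) flagS)
    sh : ∀ c → c < s → c < α l × c < α (suc l)
    sh c c<s = <-≤-trans shs dec , shs
      where shs = inShape T (≤-<-trans z≤n (asc-all s bd c c<s))
    U : KT n (α ∘ applyS l) suc (swapTails l s x)
    U = swapTails-KT sh fl

-- The cut differs from that of `exchange-down`: here the rows ascend in every column of row `l`. It
-- is the first column from which on `x l c < x (suc l) (suc c)`, which is the key condition of the
-- exchanged tails; minimality gives the row condition at the border.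
exchange-up : ∀ {n α x} l → suc l < n → α l ≤ α (suc l) → KT n α suc x →
  ∃ λ y → KT n (α ∘ applyS l) (bumpAt l suc) y × (∀ c v → 1 ≤ v → occ n x c v ≡ occ n y c v)
exchange-up {n} {α} {x} l l<n inc T = build (search (α l) ≤-refl (λ c p q → ⊥-elim (<⇒≱ q p)))
  where
  open KT T
  data Found : Set where
    found : ∀ s (s≤ : s ≤ α l) (right : ∀ c → s ≤ c → c < α l → x l c < x (suc l) (suc c))
            (bd : ∀ c → suc c ≡ s → x (suc l) (suc c) ≤ x l c) → Found
  search : ∀ k → k ≤ α l → (∀ c → k ≤ c → c < α l → x l c < x (suc l) (suc c)) → Found
  search zero p h = found 0 p h (λ c ())
  search (suc k) p h with x (suc l) (suc k) ≤? x l k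
  ... | yes q = found (suc k) p h (λ { c refl → q })
  ... | no q = search k (<⇒≤ p) (λ c q' → case m≤n⇒m<n∨m≡n q' of λ { (inj₁ q'') → h c q'' ; (inj₂ refl) → λ _ → ≰⇒> q })
  build : Found → ∃ λ y → KT n (α ∘ applyS l) (bumpAt l suc) y × (∀ c v → 1 ≤ v → occ n x c v ≡ occ n y c v)
  build (found s s≤ right bd) = swapTails l s x , U , swapTails-occ U
    where
    border : ∀ c → suc c ≡ s → x l c < x (suc l) c × x (suc l) s ≤ x l c
    border c refl = ascending T l inc c s≤ , bd c refl
    open SwapTails T l s l<n border (λ c p q h → right c p (inShape T q))
    fl : ∀ r → swapTails l s x r 0 ≤ bumpAt l suc r
    fl r with s ≤? 0 | rowCase l r
    ... | yes p | isL refl rewrite applyS-lo l | bumpAt-same l suc = flag (suc l)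
    ... | yes p | isS refl rewrite applyS-hi l | bumpAt-other l suc {suc l} 1+n≢n = ≤-trans (flag l) (n≤1+n _)
    ... | yes p | neither u v rewrite applyS-else l u v | bumpAt-other l suc u = flag r
    ... | no p | isS refl rewrite bumpAt-other l suc {suc l} 1+n≢n = flag (suc l)
    ... | no p | neither u v rewrite bumpAt-other l suc u = flag r
    ... | no p | isL refl rewrite bumpAt-same l suc = ≤-trans (flag l) (n≤1+n _)
    U : KT n (α ∘ applyS l) (bumpAt l suc) (swapTails l s x)
    U = swapTails-KT (λ c c<s → <-≤-trans c<s s≤ , <-≤-trans c<s (≤-trans s≤ inc)) fl

-- By `ascending` the first entry of row `l` is below that of row `l + 1`, so raising the flag of
-- row `l` admits nothing new. This is the case in which the Demazure operator acts trivially.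
ascending-flag : ∀ {n α x} l → α l ≤ α (suc l) → KT n α (bumpAt l suc) x → KT n α suc x
ascending-flag {n} {α} {x} l inc T = KT-resp T (λ _ → refl) (λ _ _ → refl) fl
  where
  open KT T
  fl : ∀ r → x r 0 ≤ suc r
  fl r with r ≟ l
  ... | no ne = subst (x r 0 ≤_) (bumpAt-other l suc ne) (flag r)
  ... | yes refl with 0 <? α l
  ...   | no p = subst (_≤ suc l) (sym (out l 0 (≮⇒≥ p))) z≤n
  ...   | yes p = ≤-pred (≤-trans (ascending T l inc 0 p) (subst (x (suc l) 0 ≤_) (bumpAt-other l suc 1+n≢n) (flag (suc l))))

superstandard : (ℕ → ℕ) → ℕ → ℕ → ℕ
superstandard α r c = if c <ᵇ α r then suc r else 0

<ᵇ-yes : ∀ {a b} → a < b → (a <ᵇ b) ≡ true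
<ᵇ-yes {zero} {suc b} p = refl
<ᵇ-yes {suc a} {suc b} (s≤s p) = <ᵇ-yes p

<ᵇ-no : ∀ {a b} → b ≤ a → (a <ᵇ b) ≡ false
<ᵇ-no {a} {zero} p = refl
<ᵇ-no {suc a} {suc b} (s≤s p) = <ᵇ-no p

superstandard-in : ∀ α {r c} → c < α r → superstandard α r c ≡ suc r
superstandard-in α p rewrite <ᵇ-yes p = refl

superstandard-out : ∀ α {r c} → α r ≤ c → superstandard α r c ≡ 0
superstandard-out α p rewrite <ᵇ-no p = refl

antitone : ∀ (α : ℕ → ℕ) → (∀ r → α (suc r) ≤ α r) → ∀ {l k} → l ≤ k → α k ≤ α l
antitone α dec {l} {k} p with m≤n⇒m<n∨m≡n p
... | inj₂ refl = ≤-refl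
antitone α dec {l} {suc k} p | inj₁ q = ≤-trans (dec k) (antitone α dec (≤-pred q))

superstandard-KT : ∀ {n} α → (∀ r → n ≤ r → α r ≡ 0) → (∀ r → α (suc r) ≤ α r) → KT n α suc (superstandard α)
superstandard-KT α sp dec = record
  { supp = sp
  ; box = λ r c p → subst (1 ≤_) (sym (superstandard-in α p)) (s≤s z≤n)
  ; out = λ r c p → superstandard-out α p
  ; row = row'
  ; key = key'
  ; flag = flag' }
  where
  row' : ∀ r c → superstandard α r (suc c) ≤ superstandard α r c
  row' r c with suc c <? α r
  ... | yes p rewrite superstandard-in α p | superstandard-in α (<-trans (n<1+n c) p) = ≤-refl
  ... | no p rewrite superstandard-out α (≮⇒≥ p) = z≤n
  key' : ∀ l k c → l < k → 1 ≤ superstandard α k c → superstandard α k c ≤ superstandard α l c → superstandard α k c <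
      superstandard α l (suc c)
  key' l k c l<k p h with c <? α k
  ... | no q rewrite superstandard-out α (≮⇒≥ q) = ⊥-elim (<-irrefl refl p)
  ... | yes q rewrite superstandard-in α q | superstandard-in α {l} (<-≤-trans q (antitone α dec (<⇒≤ l<k))) = ⊥-elim
      (<⇒≱ l<k (≤-pred h))
  flag' : ∀ r → superstandard α r 0 ≤ suc r
  flag' r with 0 <? α r
  ... | yes p rewrite superstandard-in α p = ≤-refl
  ... | no p rewrite superstandard-out α (≮⇒≥ p) = z≤n

-- By induction on the rows, the rows below, which are at least as long, put 1 to `r` into the
-- column. The entry of row `r` differs from these and is at most `r + 1`.
superstandard-unique : ∀ {n α x} → (∀ r → α (suc r) ≤ α r) → KT n α suc x → ∀ r c → x r c ≡ superstandard α r c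
superstandard-unique {n} {α} {x} dec T r c = rows (suc r) r c ≤-refl
  where
  open KT T
  rows : ∀ R r c → r < R → x r c ≡ superstandard α r c
  rows (suc R) r c p with c <? α r
  ... | no q = trans (out r c (≮⇒≥ q)) (sym (superstandard-out α (≮⇒≥ q)))
  ... | yes q = trans (≤-antisym (le-flag T r c) (≰⇒> nle)) (sym (superstandard-in α q))
    where
    nle : ¬ (x r c ≤ r)
    nle h with x r c in e | box r c q
    ... | suc k | _ = <-irrefl (distinct T (s≤s z≤n) ek e) h
      where
      ek : x k c ≡ suc k
      ek = trans (rows R k c (<-≤-trans h (≤-pred p))) (superstandard-in α (<-≤-trans q (antitone α dec (<⇒≤ h))))

-- Bracketing

-- `p c` and `m c` are the numbers of closing and opening brackets of column `c`, the opening ones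
-- standing first; `P` and `N` are their partial sums. `lcF c k` and `rcF c k` count the unmatched
-- closing and opening brackets among the `k` columns from `c` on.
module Brackets (p m P N : ℕ → ℕ) (P-suc : ∀ c → P (suc c) ≡ p c + P c) (N-suc : ∀ c → N (suc c) ≡ m c + N c) where

  lcF rcF : ℕ → ℕ → ℕ
  lcF c zero = 0
  lcF c (suc k) = (p c + lcF (suc c) k) ∸ m c
  rcF c zero = 0
  rcF c (suc k) = rcF (suc c) k + (m c ∸ (p c + lcF (suc c) k))

  private
    swap-max : ∀ a b → (a ∸ b) + b ≡ a + (b ∸ a)
    swap-max a b with ≤-total a b
    ... | inj₁ h rewrite m≤n⇒m∸n≡0 h = sym (m+[n∸m]≡n h)
    ... | inj₂ h rewrite m≤n⇒m∸n≡0 h = trans (m∸n+n≡m h) (sym (+-identityʳ a))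

  -- Matching removes brackets in pairs, so it preserves the difference of closing and opening ones;
  -- both sides are arranged to avoid subtraction.
  balance : ∀ c k → lcF c k + (N (c + k) + P c) ≡ rcF c k + (P (c + k) + N c)
  balance c zero rewrite +-identityʳ c = +-comm (N c) (P c)
  balance c (suc k) = +-cancelˡ-≡ (m c) _ _ (begin
    m c + ((q ∸ m c) + (E + P c)) ≡⟨ solve 4 (λ x y z w → x :+ (y :+ (z :+ w)) := (y :+ x) :+ (z :+ w)) refl (m c) (q ∸ m c) E
        (P c) ⟩
    ((q ∸ m c) + m c) + (E + P c) ≡⟨ cong (_+ (E + P c)) (swap-max q (m c)) ⟩
    (q + (m c ∸ q)) + (E + P c) ≡⟨ solve 5 (λ a b c d e → ((a :+ b) :+ c) :+ (d :+ e) := (b :+ (d :+ (a :+ e))) :+ c) refl (p c) l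
      (m c ∸ q) E (P c) ⟩
    (l + (E + (p c + P c))) + (m c ∸ q) ≡⟨ cong (_+ (m c ∸ q)) ih ⟩
    (rcF (suc c) k + (F + (m c + N c))) + (m c ∸ q) ≡⟨ solve 5
      (λ a b c d e → (a :+ (b :+ (c :+ d))) :+ e := c :+ ((a :+ e) :+ (b :+ d))) refl (rcF (suc c) k) F (m c) (N c) (m c ∸ q) ⟩
    m c + (rcF (suc c) k + (m c ∸ q) + (F + N c)) ∎)
    where
    open ≡-Reasoning
    l = lcF (suc c) k
    q = p c + l
    E = N (c + suc k)
    F = P (c + suc k)
    ih : l + (E + (p c + P c)) ≡ rcF (suc c) k + (F + (m c + N c))
    ih = subst₂ (λ u v → l + (E + u) ≡ rcF (suc c) k + (F + v)) (P-suc c) (N-suc c)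
           (subst (λ z → l + (N z + P (suc c)) ≡ rcF (suc c) k + (P z + N (suc c))) (sym (+-suc c k)) (balance (suc c) k))

  Falls : ℕ → ℕ → Set
  Falls c k = ∀ j → j ≤ k → N (c + k) + P (c + j) ≤ P (c + k) + N (c + j)

  private
    Falls-tail : ∀ c k → Falls c (suc k) → Falls (suc c) k
    Falls-tail c k h j p = subst₂ (λ z w → N z + P w ≤ P z + N w) (+-suc c k) (+-suc c j) (h (suc j) (s≤s p))

    rc-step : ∀ c k → rcF (suc c) k ≡ 0 → N (c + suc k) + P c ≤ P (c + suc k) + N c → m c ≤ p c + lcF (suc c) k
    rc-step c k e h = +-cancelʳ-≤ (F + N c) _ _ (begin
      m c + (F + N c) ≡⟨ solve 3 (λ a b c → a :+ (b :+ c) := b :+ (a :+ c)) refl (m c) F (N c) ⟩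
      F + (m c + N c) ≡⟨ cong (F +_) (sym (N-suc c)) ⟩
      F + N (suc c) ≡⟨ cong (λ z → P z + N (suc c)) (+-suc c k) ⟩
      P (suc c + k) + N (suc c) ≡⟨ cong (_+ (P (suc c + k) + N (suc c))) (sym e) ⟩
      rcF (suc c) k + (P (suc c + k) + N (suc c)) ≡⟨ sym (balance (suc c) k) ⟩
      l + (N (suc c + k) + P (suc c)) ≡⟨ cong₂ (λ z w → l + (N z + w)) (sym (+-suc c k)) (P-suc c) ⟩
      l + (E + (p c + P c)) ≡⟨ solve 4 (λ a b c d → a :+ (b :+ (c :+ d)) := (c :+ a) :+ (b :+ d)) refl l E (p c) (P c) ⟩
      (p c + l) + (E + P c) ≤⟨ +-monoʳ-≤ (p c + l) h ⟩
      (p c + l) + (F + N c) ∎)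
      where
      open ≤-Reasoning
      l = lcF (suc c) k
      E = N (c + suc k)
      F = P (c + suc k)

  falls⇒rc≡0 : ∀ c k → Falls c k → rcF c k ≡ 0
  falls⇒rc≡0 c zero h = refl
  falls⇒rc≡0 c (suc k) h = cong₂ _+_ ih (m≤n⇒m∸n≡0
      (rc-step c k ih (subst (λ z → N (c + suc k) + P z ≤ P (c + suc k) + N z) (+-identityʳ c) (h 0 z≤n))))
    where ih = falls⇒rc≡0 (suc c) k (Falls-tail c k h)

  rc≡0⇒falls : ∀ c k → rcF c k ≡ 0 → Falls c k
  rc≡0⇒falls c k e zero p = subst (λ z → N (c + k) + P z ≤ P (c + k) + N z) (sym (+-identityʳ c))
    (m+n≤o⇒n≤o (lcF c k) (≤-reflexive (trans (balance c k) (cong (_+ (P (c + k) + N c)) e))))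
  rc≡0⇒falls c (suc k) e (suc j) (s≤s p) = subst₂ (λ z w → N z + P w ≤ P z + N w) (sym (+-suc c k)) (sym (+-suc c j))
    (rc≡0⇒falls (suc c) k (m+n≡0⇒m≡0 (rcF (suc c) k) e) j p)

  -- The slack `e` makes the induction possible: behind column `c` the number of unmatched closing
  -- brackets that can be tolerated is `m c + e - p c`.
  Dom : ℕ → ℕ → ℕ → Set
  Dom c k e = ∀ j → j ≤ k → P (c + j) + N c ≤ P c + (N (c + j) + e)

  dom⇒lc≤ : ∀ c k e → Dom c k e → lcF c k ≤ e
  dom⇒lc≤ c zero e h = z≤n
  dom⇒lc≤ c (suc k) e h = m≤n+o⇒m∸n≤o _ (m c) (subst (p c + lcF (suc c) k ≤_) pe' (+-monoʳ-≤ (p c) (dom⇒lc≤ (suc c) k e' h')))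
    where
    open ≤-Reasoning
    p≤ : p c ≤ m c + e
    p≤ = +-cancelʳ-≤ (P c + N c) _ _ (begin
      p c + (P c + N c) ≡⟨ sym (+-assoc (p c) (P c) (N c)) ⟩
      (p c + P c) + N c ≡⟨ cong (_+ N c) (trans (sym (P-suc c)) (cong P (sym (trans (+-suc c 0) (cong suc (+-identityʳ c)))))) ⟩
      P (c + 1) + N c ≤⟨ h 1 (s≤s z≤n) ⟩
      P c + (N (c + 1) + e) ≡⟨ cong (λ z → P c + (z + e))
          (trans (cong N (trans (+-suc c 0) (cong suc (+-identityʳ c)))) (N-suc c)) ⟩
      P c + ((m c + N c) + e) ≡⟨ solve 4 (λ a b c d → a :+ ((b :+ c) :+ d) := (b :+ d) :+ (a :+ c)) refl (P c) (m c) (N c) e ⟩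
      (m c + e) + (P c + N c) ∎)
    e' = (m c + e) ∸ p c
    pe' : p c + e' ≡ m c + e
    pe' = m+[n∸m]≡n p≤
    h' : Dom (suc c) k e'
    h' j q = begin
      P (suc c + j) + N (suc c) ≡⟨ cong₂ _+_ (cong P (sym (+-suc c j))) (N-suc c) ⟩
      P (c + suc j) + (m c + N c) ≡⟨ solve 3 (λ a b c → a :+ (b :+ c) := b :+ (a :+ c)) refl (P (c + suc j)) (m c) (N c) ⟩
      m c + (P (c + suc j) + N c) ≤⟨ +-monoʳ-≤ (m c) (h (suc j) (s≤s q)) ⟩
      m c + (P c + (N (c + suc j) + e)) ≡⟨ solve 4 (λ a b c d → a :+ (b :+ (c :+ d)) := b :+ (c :+ (a :+ d))) refl (m c) (P c)
          (N (c + suc j)) e ⟩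
      P c + (N (c + suc j) + (m c + e)) ≡⟨ cong (λ z → P c + (N (c + suc j) + z)) (sym pe') ⟩
      P c + (N (c + suc j) + (p c + e')) ≡⟨ solve 4 (λ a b c d → b :+ (c :+ (a :+ d)) := (a :+ b) :+ (c :+ d)) refl (p c) (P c)
          (N (c + suc j)) e' ⟩
      (p c + P c) + (N (c + suc j) + e') ≡⟨ cong₂ (λ z w → z + (N w + e')) (sym (P-suc c)) (+-suc c j) ⟩
      P (suc c) + (N (suc c + j) + e') ∎

  lc≤⇒dom : ∀ c k e → lcF c k ≤ e → Dom c k e
  lc≤⇒dom c k e h zero q = subst (λ z → P z + N c ≤ P c + (N z + e)) (sym (+-identityʳ c)) (+-monoʳ-≤ (P c) (m≤m+n (N c) e))
  lc≤⇒dom c (suc k) e h (suc j) (s≤s q) = +-cancelˡ-≤ (m c) _ _ (begin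
      m c + (P (c + suc j) + N c) ≡⟨ solve 3 (λ a b c → b :+ (a :+ c) := a :+ (b :+ c)) refl (P (c + suc j)) (m c) (N c) ⟩
      P (c + suc j) + (m c + N c) ≡⟨ cong₂ _+_ (cong P (+-suc c j)) (sym (N-suc c)) ⟩
      P (suc c + j) + N (suc c) ≤⟨ lc≤⇒dom (suc c) k e' l≤ j q ⟩
      P (suc c) + (N (suc c + j) + e') ≡⟨ cong₂ (λ z w → z + (N w + e')) (P-suc c) (sym (+-suc c j)) ⟩
      (p c + P c) + (N (c + suc j) + e') ≡⟨ solve 4 (λ a b c d → (a :+ b) :+ (c :+ d) := b :+ (c :+ (a :+ d))) refl (p c) (P c)
        (N (c + suc j)) e' ⟩
      P c + (N (c + suc j) + (p c + e')) ≡⟨ cong (λ z → P c + (N (c + suc j) + z)) (m+[n∸m]≡n (≤-trans (m≤m+n (p c) l) pl≤)) ⟩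
      P c + (N (c + suc j) + (m c + e)) ≡⟨ solve 4 (λ a b c d → b :+ (c :+ (a :+ d)) := a :+ (b :+ (c :+ d))) refl (m c) (P c)
          (N (c + suc j)) e ⟩
      m c + (P c + (N (c + suc j) + e)) ∎)
    where
    open ≤-Reasoning
    l = lcF (suc c) k
    pl≤ : p c + l ≤ m c + e
    pl≤ = m∸n≤o⇒m≤n+o _ (m c) h
      where
      m∸n≤o⇒m≤n+o : ∀ a b {o} → a ∸ b ≤ o → a ≤ b + o
      m∸n≤o⇒m≤n+o a b q = ≤-trans (m≤n+m∸n a b) (+-monoʳ-≤ b q)
    e' = (m c + e) ∸ p c
    l≤ : l ≤ e'
    l≤ = m+n≤o⇒m≤o∸n l (subst (_≤ m c + e) (+-comm (p c) l) pl≤)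

  -- Unmatched opening brackets of the first part would consume closing ones of the second; in their
  -- absence the counts add.
  lcF-+ : ∀ c j k → rcF c j ≡ 0 → lcF c (j + k) ≡ lcF c j + lcF (c + j) k
  lcF-+ c zero k e = cong (λ z → lcF z k) (sym (+-identityʳ c))
  lcF-+ c (suc j) k e = trans (cong (λ z → (p c + z) ∸ m c) (lcF-+ (suc c) j k e₁))
    (trans (cong (_∸ m c) (sym (+-assoc (p c) (lcF (suc c) j) _)))
    (trans (+-∸-comm {p c + lcF (suc c) j} (lcF (suc c + j) k) {m c} m≤)
      (cong (λ z → (p c + lcF (suc c) j ∸ m c) + lcF z k) (sym (+-suc c j)))))
    where
    e₁ = m+n≡0⇒m≡0 (rcF (suc c) j) e
    m≤ : m c ≤ p c + lcF (suc c) j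
    m≤ = m∸n≡0⇒m≤n (m+n≡0⇒n≡0 (rcF (suc c) j) e)

  -- The leftmost unmatched opening column.
  record OpenColumn (c k : ℕ) : Set where
    constructor openColumn
    field
      j k' : ℕ
      len : k ≡ j + suc k'
      m≡1 : m (c + j) ≡ 1
      p≡0 : p (c + j) ≡ 0
      rc≡0 : rcF c j ≡ 0
      lc≡0 : lcF (suc (c + j)) k' ≡ 0

  -- Since a column opens at most one bracket, an unmatched one leaves no closing bracket over in
  -- its own column or behind it.
  findLo : (∀ c → m c ≤ 1) → ∀ c k → rcF c k ≡ 0 ⊎ OpenColumn c k
  findLo m≤1 c zero = inj₁ refl
  findLo m≤1 c (suc k) with m c ≤? p c + lcF (suc c) k
  ... | no h = inj₂ (openColumn 0 k refl (trans (cong m (+-identityʳ c)) (≤-antisym (m≤1 c) (≤-trans (s≤s z≤n) (≰⇒> h))))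
                 (trans (cong p (+-identityʳ c)) (m+n≡0⇒m≡0 (p c) z0)) refl
                   (trans (cong (λ z → lcF (suc z) k) (+-identityʳ c)) (m+n≡0⇒n≡0 (p c) z0)))
    where
    z0 : p c + lcF (suc c) k ≡ 0
    z0 = n≤0⇒n≡0 (≤-pred (≤-trans (≰⇒> h) (m≤1 c)))
  ... | yes h with findLo m≤1 (suc c) k
  ...   | inj₁ e = inj₁ (cong₂ _+_ e (m≤n⇒m∸n≡0 h))
  ...   | inj₂ (openColumn j k' refl e1 e2 e3 e4) = inj₂
      (openColumn (suc j) k' refl (trans (cong m (+-suc c j)) e1) (trans (cong p (+-suc c j)) e2)
            (cong₂ _+_ e3 (m≤n⇒m∸n≡0 (subst (λ z → m c ≤ p c + z) lc≡ h))) (trans (cong (λ z → lcF (suc z) k') (+-suc c j)) e4))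
    where
    lc≡ : lcF (suc c) (j + suc k') ≡ lcF (suc c) j
    lc≡ = trans (lcF-+ (suc c) j (suc k') e3) (trans (cong (lcF (suc c) j +_) last0) (+-identityʳ _))
      where
      last0 : (p (suc c + j) + lcF (suc (suc c + j)) k') ∸ m (suc c + j) ≡ 0
      last0 rewrite e1 | e2 | e4 = refl

data Kind (i v : ℕ) : Set where
  hi  : v ≡ suc i → Kind i v
  lo  : v ≡ i → Kind i v
  off : v ≢ i → v ≢ suc i → Kind i v

kind? : ∀ i v → Kind i v
kind? i v with v ≟ i | v ≟ suc i
... | yes p | _ = lo p
... | no _ | yes q = hi q
... | no p | no q = off p q

-- A letter together with the index of the factor that holds it, listed by increasing letters. The
-- factors are recovered by `rowOf`.
Marked : Set
Marked = List (ℕ × ℕ)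

openMark : List ℕ → List ℕ → ℕ → List ℕ
openMark [] R a = R ++ [ a ]
openMark (_ ∷ _) R a = R

-- A letter of value i opens a bracket and a letter of value i + 1 closes one; Ls and Rs list the unmatched
-- closing letters from left to right and the unmatched opening letters from right to left.
Ls : ℕ → Marked → List ℕ
Ls i [] = []
Ls i ((a , v) ∷ Z) = if v ≡ᵇ suc i then a ∷ Ls i Z else (if v ≡ᵇ i then drop 1 (Ls i Z) else Ls i Z)

Rs : ℕ → Marked → List ℕ
Rs i [] = []
Rs i ((a , v) ∷ Z) = if v ≡ᵇ suc i then Rs i Z else (if v ≡ᵇ i then openMark (Ls i Z) (Rs i Z) a else Rs i Z)

module _ {i a v : ℕ} (Z : Marked) where
  Ls-hi : v ≡ suc i → Ls i ((a , v) ∷ Z) ≡ a ∷ Ls i Z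
  Ls-hi e rewrite ≡ᵇ-yes e = refl
  Ls-lo : v ≡ i → Ls i ((a , v) ∷ Z) ≡ drop 1 (Ls i Z)
  Ls-lo refl rewrite ≡ᵇ-no {v} {suc v} (λ ()) | ≡ᵇ-yes {v} refl = refl
  Ls-off : v ≢ i → v ≢ suc i → Ls i ((a , v) ∷ Z) ≡ Ls i Z
  Ls-off p q rewrite ≡ᵇ-no p | ≡ᵇ-no q = refl
  Rs-hi : v ≡ suc i → Rs i ((a , v) ∷ Z) ≡ Rs i Z
  Rs-hi e rewrite ≡ᵇ-yes e = refl
  Rs-lo : v ≡ i → Rs i ((a , v) ∷ Z) ≡ openMark (Ls i Z) (Rs i Z) a
  Rs-lo refl rewrite ≡ᵇ-no {v} {suc v} (λ ()) | ≡ᵇ-yes {v} refl = refl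
  Rs-off : v ≢ i → v ≢ suc i → Rs i ((a , v) ∷ Z) ≡ Rs i Z
  Rs-off p q rewrite ≡ᵇ-no p | ≡ᵇ-no q = refl

drop-drop1 : ∀ {A : Set} k (xs : List A) → drop 1 (drop k xs) ≡ drop (suc k) xs
drop-drop1 zero xs = refl
drop-drop1 (suc k) [] = refl
drop-drop1 (suc k) (x ∷ xs) = drop-drop1 k xs

drop-snoc : ∀ {A : Set} k (xs : List A) a → (drop k xs ++ [ a ] ≡ drop k (xs ++ [ a ]) × k ≤ length xs)
  ⊎ (drop k xs ≡ [] × drop k (xs ++ [ a ]) ≡ [] × length xs < k)
drop-snoc zero xs a = inj₁ (refl , z≤n)
drop-snoc (suc k) [] a = inj₂ (refl , drop-[] k , s≤s z≤n)
drop-snoc (suc k) (x ∷ xs) a with drop-snoc k xs a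
... | inj₁ (e , p) = inj₁ (e , s≤s p)
... | inj₂ (e , e' , p) = inj₂ (e , e' , s≤s p)

drop-short : ∀ {A : Set} k (xs : List A) → length xs ≤ k → drop k xs ≡ []
drop-short zero [] p = refl
drop-short (suc k) [] p = refl
drop-short (suc k) (x ∷ xs) (s≤s p) = drop-short k xs p

drop-long : ∀ {A : Set} k (xs : List A) → k < length xs → ∃ λ y → ∃ λ ys → drop k xs ≡ y ∷ ys
drop-long zero (x ∷ xs) p = x , xs , refl
drop-long (suc k) (x ∷ xs) (s≤s p) = drop-long k xs p

openMark-cons : ∀ {L y ys} R a → L ≡ y ∷ ys → openMark L R a ≡ R
openMark-cons R a refl = refl

-- The unmatched opening letters of `A` are matched with the first unmatched closing letters of `C`.
Ls-++ : ∀ i A C → Ls i (A ++ C) ≡ Ls i A ++ drop (length (Rs i A)) (Ls i C)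
Ls-++ i [] C = refl
Ls-++ i ((a , v) ∷ A) C with kind? i v
... | hi e rewrite Ls-hi {a = a} (A ++ C) e | Ls-hi {a = a} A e | Rs-hi {a = a} A e = cong (a ∷_) (Ls-++ i A C)
... | off p q rewrite Ls-off {a = a} (A ++ C) p q | Ls-off {a = a} A p q | Rs-off {a = a} A p q = Ls-++ i A C
... | lo e rewrite Ls-lo {a = a} (A ++ C) e | Ls-lo {a = a} A e | Rs-lo {a = a} A e | Ls-++ i A C with Ls i A
...   | y ∷ ys = refl
...   | [] rewrite length-++ (Rs i A) {[ a ]} | +-comm (length (Rs i A)) 1 = drop-drop1 (length (Rs i A)) (Ls i C)

-- The opening letters of `A` that find a partner in `C` are the rightmost ones, and these stand
-- first in `Rs i A`.
Rs-++ : ∀ i A C → Rs i (A ++ C) ≡ Rs i C ++ drop (length (Ls i C)) (Rs i A)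
Rs-++ i [] C rewrite drop-[] {A = ℕ} (length (Ls i C)) = sym (++-identityʳ _)
Rs-++ i ((a , v) ∷ A) C with kind? i v
... | hi e rewrite Rs-hi {a = a} (A ++ C) e | Rs-hi {a = a} A e = Rs-++ i A C
... | off p q rewrite Rs-off {a = a} (A ++ C) p q | Rs-off {a = a} A p q = Rs-++ i A C
... | lo e rewrite Rs-lo {a = a} (A ++ C) e | Rs-lo {a = a} A e | Ls-++ i A C | Rs-++ i A C with Ls i A
...   | y ∷ ys = refl
...   | [] with drop-snoc (length (Ls i C)) (Rs i A) a
...     | inj₁ (e' , p) rewrite drop-short (length (Rs i A)) (Ls i C) p = trans (++-assoc (Rs i C) _ [ a ]) (cong (Rs i C ++_) e')
...     | inj₂ (e' , e'' , p) = trans (openMark-cons _ a (proj₂ (proj₂ (drop-long (length (Rs i A)) (Ls i C) p))))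
    (cong (Rs i C ++_) (trans e' (sym e'')))

Ls-split : ∀ i A a B → Rs i A ≡ [] → Ls i B ≡ [] → Ls i (A ++ (a , suc i) ∷ B) ≡ Ls i A ++ [ a ]
Ls-split i A a B ra lb rewrite Ls-++ i A ((a , suc i) ∷ B) | ra | Ls-hi {i} {a} B refl | lb = refl

-- With no unmatched opening letter before it and no unmatched closing letter after it, `a` is the
-- rightmost unmatched closing letter, the maximum that `e_i` selects.
data HiSplit (i : ℕ) (Z : Marked) : Set where
  none  : Ls i Z ≡ [] → HiSplit i Z
  split : ∀ A a B → Z ≡ A ++ (a , suc i) ∷ B → Rs i A ≡ [] → Ls i B ≡ [] → HiSplit i Z

hiSplit : ∀ i Z → HiSplit i Z
hiSplit i [] = none refl
hiSplit i ((a , v) ∷ Z) with hiSplit i Z | kind? i v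
... | none e | hi refl = split [] a Z refl refl e
... | none e | lo e' = none (trans (Ls-lo Z e') (cong (drop 1) e))
... | none e | off p q = none (trans (Ls-off Z p q) e)
... | split A b B refl ra lb | hi e = split ((a , v) ∷ A) b B refl (trans (Rs-hi A e) ra) lb
... | split A b B refl ra lb | off p q = split ((a , v) ∷ A) b B refl (trans (Rs-off A p q) ra) lb
... | split A b B refl ra lb | lo e with Ls i A in la
...   | y ∷ ys = split ((a , v) ∷ A) b B refl (trans (Rs-lo A e) (trans (openMark-cons _ a la) ra)) lb
...   | [] = none (trans (Ls-lo (A ++ (b , suc i) ∷ B) e) (cong (drop 1) (trans (Ls-split i A b B ra lb) (cong (_++ [ b ]) la))))

Rs-split : ∀ i A a B → Rs i A ≡ [] → Ls i B ≡ [] → Rs i (A ++ (a , i) ∷ B) ≡ Rs i B ++ [ a ]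
Rs-split i A a B ra lb = trans (Rs-++ i A ((a , i) ∷ B))
  (trans (cong (λ R → Rs i ((a , i) ∷ B) ++ drop (length (Ls i ((a , i) ∷ B))) R) ra)
  (trans (cong (Rs i ((a , i) ∷ B) ++_) (drop-[] (length (Ls i ((a , i) ∷ B)))))
  (trans (++-identityʳ _) (trans (Rs-lo B refl) (cong (λ L → openMark L (Rs i B) a) lb)))))

data LoSplit (i : ℕ) (Z : Marked) : Set where
  none  : Rs i Z ≡ [] → LoSplit i Z
  split : ∀ A a B → Z ≡ A ++ (a , i) ∷ B → Rs i A ≡ [] → Ls i B ≡ [] → LoSplit i Z

loSplit : ∀ i Z → LoSplit i Z
loSplit i [] = none refl
loSplit i ((a , v) ∷ Z) with loSplit i Z | kind? i v
... | none e | hi e' = none (trans (Rs-hi Z e') e)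
... | none e | off p q = none (trans (Rs-off Z p q) e)
... | split A b B refl ra lb | hi e = split ((a , v) ∷ A) b B refl (trans (Rs-hi A e) ra) lb
... | split A b B refl ra lb | off p q = split ((a , v) ∷ A) b B refl (trans (Rs-off A p q) ra) lb
... | none e | lo refl with Ls i Z in lz
...   | [] = split [] a Z refl refl lz
...   | y ∷ ys = none (trans (Rs-lo Z refl) (trans (openMark-cons _ a lz) e))
loSplit i ((a , v) ∷ Z) | split A b B refl ra lb | lo refl with Ls i A in la
...   | y ∷ ys = split ((a , v) ∷ A) b B refl (trans (Rs-lo A refl) (trans (openMark-cons _ a la) ra)) lb
...   | [] = split [] a (A ++ (b , v) ∷ B) refl refl
    (trans (Ls-++ i A ((b , v) ∷ B)) (trans (cong₂ (λ L R → L ++ drop (length R) (Ls i ((b , v) ∷ B))) la ra)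
    (trans (Ls-lo B refl) (cong (drop 1) lb))))

rowOf : ℕ → Marked → List ℕ
rowOf j [] = []
rowOf j ((a , v) ∷ Z) = if v ≡ᵇ j then a ∷ rowOf j Z else rowOf j Z

rowOf-yes : ∀ {j a v} Z → v ≡ j → rowOf j ((a , v) ∷ Z) ≡ a ∷ rowOf j Z
rowOf-yes Z e rewrite ≡ᵇ-yes e = refl

rowOf-no : ∀ {j a v} Z → v ≢ j → rowOf j ((a , v) ∷ Z) ≡ rowOf j Z
rowOf-no Z e rewrite ≡ᵇ-no e = refl

rowOf-++ : ∀ j A B → rowOf j (A ++ B) ≡ rowOf j A ++ rowOf j B
rowOf-++ j [] B = refl
rowOf-++ j ((a , v) ∷ A) B with v ≡ᵇ j
... | true = cong (a ∷_) (rowOf-++ j A B)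
... | false = rowOf-++ j A B

-- Neighbouring letters which are consecutive integers carry increasing values; p and u are the letter and the value before the list.
data Valid (p u : ℕ) : Marked → Set where
  []  : Valid p u []
  _∷_ : ∀ {a v Z} → p < a × (a ≡ suc p → u < v) → Valid a v Z → Valid p u ((a , v) ∷ Z)

Valid-lower : ∀ {p u Z} → Valid p u Z → ∀ q → q ≤ p → All (λ z → q < proj₁ z) Z
Valid-lower [] q h = []
Valid-lower ((p<a , _) ∷ V) q h = <-transʳ' h p<a ∷ Valid-lower V q (≤-trans h (<⇒≤ p<a))
  where <-transʳ' = ≤-<-trans

Valid-tail : ∀ {p u} A {a v B} → Valid p u (A ++ (a , v) ∷ B) → Valid a v B
Valid-tail [] (_ ∷ V) = V
Valid-tail (_ ∷ A) (_ ∷ V) = Valid-tail A V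

Valid-before : ∀ {p u} A {a v B} → Valid p u (A ++ (a , v) ∷ B) → All (λ z → proj₁ z < a) A × p < a
Valid-before [] ((p<a , _) ∷ V) = [] , p<a
Valid-before ((b , w) ∷ A) ((p<b , _) ∷ V) with Valid-before A V
... | h , b<a = (b<a ∷ h) , <-trans p<b b<a

module _ {P : ℕ → Set} where
  rowOf-All : ∀ j {Z} → All (λ z → P (proj₁ z)) Z → All P (rowOf j Z)
  rowOf-All j [] = []
  rowOf-All j {(a , v) ∷ Z} (p ∷ h) with v ≡ᵇ j
  ... | true = p ∷ rowOf-All j h
  ... | false = rowOf-All j h

  Ls-All : ∀ i {Z} → All (λ z → P (proj₁ z)) Z → All P (Ls i Z)
  Ls-All i [] = []
  Ls-All i {(a , v) ∷ Z} (p ∷ h) with kind? i v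
  ... | hi e rewrite Ls-hi {a = a} Z e = p ∷ Ls-All i h
  ... | off q q' rewrite Ls-off {a = a} Z q q' = Ls-All i h
  ... | lo e rewrite Ls-lo {a = a} Z e with Ls i Z | Ls-All i h
  ...   | [] | [] = []
  ...   | _ ∷ _ | _ ∷ k = k

  Rs-All : ∀ i {Z} → All (λ z → P (proj₁ z)) Z → All P (Rs i Z)
  Rs-All i [] = []
  Rs-All i {(a , v) ∷ Z} (p ∷ h) with kind? i v
  ... | hi e rewrite Rs-hi {a = a} Z e = Rs-All i h
  ... | off q q' rewrite Rs-off {a = a} Z q q' = Rs-All i h
  ... | lo e rewrite Rs-lo {a = a} Z e with Ls i Z
  ...   | [] = snoc (Rs-All i h)
    where
    snoc : ∀ {xs} → All P xs → All P (xs ++ [ a ])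
    snoc [] = p ∷ []
    snoc (q ∷ qs) = q ∷ snoc qs
  ...   | _ ∷ _ = Rs-All i h

-- The letters of a Marked list strictly increase, so the rows determine it.
rowOf-injective : ∀ {p u p' u'} n Z Z' → Valid p u Z → Valid p' u' Z' →
  All (λ z → 1 ≤ proj₂ z × proj₂ z ≤ n) Z → All (λ z → 1 ≤ proj₂ z × proj₂ z ≤ n) Z' →
  (∀ j → 1 ≤ j → j ≤ n → rowOf j Z ≡ rowOf j Z') → Z ≡ Z'
rowOf-injective n [] [] _ _ _ _ h = refl
rowOf-injective n [] ((a , v) ∷ Z') _ _ _ ((p , q) ∷ _) h with trans (h v p q) (rowOf-yes {a = a} Z' refl)
... | ()
rowOf-injective n ((a , v) ∷ Z) [] _ _ ((p , q) ∷ _) _ h with trans (sym (h v p q)) (rowOf-yes {a = a} Z refl)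
... | ()
rowOf-injective n ((a , v) ∷ Z) ((b , w) ∷ Z') (_ ∷ V) (_ ∷ V') ((p , q) ∷ r) ((p' , q') ∷ r') h
  with v ≟ w
... | yes refl with ∷-injectiveˡ (trans (sym (rowOf-yes {a = a} Z refl)) (trans (h v p q) (rowOf-yes {a = b} Z' refl)))
...   | refl = cong ((a , v) ∷_) (rowOf-injective n Z Z' V V' r r' tails)
  where
  tails : ∀ j → 1 ≤ j → j ≤ n → rowOf j Z ≡ rowOf j Z'
  tails j 1≤j j≤n with v ≟ j
  ... | no ne = trans (sym (rowOf-no Z ne)) (trans (h j 1≤j j≤n) (rowOf-no Z' ne))
  ... | yes e' = cong (drop 1) (trans (sym (rowOf-yes {a = a} Z e')) (trans (h j 1≤j j≤n) (rowOf-yes Z' e')))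
rowOf-injective n ((a , v) ∷ Z) ((b , w) ∷ Z') (_ ∷ V) (_ ∷ V') ((p , q) ∷ r) ((p' , q') ∷ r') h
  | no ne = ⊥-elim (<-asym (below V' (trans (sym (rowOf-yes {a = a} Z refl)) (trans (h v p q) (rowOf-no Z' (ne ∘ sym)))))
                           (below V (trans (sym (rowOf-yes {a = b} Z' refl)) (trans (sym (h w p' q')) (rowOf-no Z ne)))))
  where
  below : ∀ {b w Y a as v} → Valid b w Y → a ∷ as ≡ rowOf v Y → b < a
  below {b} {w} {Y} {a} {as} {v} V e with rowOf-All v (Valid-lower V b ≤-refl)
  ... | k rewrite sym e with k
  ...   | l ∷ _ = l

-- The crystal operators on factorizations

eRF-just : ∀ n i b {R L a} → inRange n i ≡ true → pairUp (reverse (nthL b i)) (nthL b (suc i)) ≡ (R , L) → maxL L ≡ just a →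
  eRF n i b ≡ just (setAt1 (setAt1 b (suc i) (removeL a (nthL b (suc i)))) i
      (insertSorted (a + sUp a (nthL b (suc i))) (nthL b i)))
eRF-just n i b p q r rewrite p | q | r = refl

eRF-nothing : ∀ n i b {R} → inRange n i ≡ true → pairUp (reverse (nthL b i)) (nthL b (suc i)) ≡ (R , []) → eRF n i b ≡ nothing
eRF-nothing n i b p q rewrite p | q = refl

fRF-just : ∀ n i b {R L a} → inRange n i ≡ true → pairUp (reverse (nthL b i)) (nthL b (suc i)) ≡ (R , L) → minL R ≡ just a →
  fRF n i b ≡ just (setAt1 (setAt1 b i (removeL a (nthL b i))) (suc i) (insertSorted (a ∸ tDown a (nthL b i)) (nthL b (suc i))))
fRF-just n i b p q r rewrite p | q | r = refl

fRF-nothing : ∀ n i b {L} → inRange n i ≡ true → pairUp (reverse (nthL b i)) (nthL b (suc i)) ≡ ([] , L) → fRF n i b ≡ nothing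
fRF-nothing n i b p q rewrite p | q = refl

eRF-inv : ∀ n i b c → eRF n i b ≡ just c → ∃ λ a → ∃ λ R → ∃ λ L → pairUp (reverse (nthL b i)) (nthL b (suc i)) ≡ (R , L) × maxL L
    ≡ just a ×
  c ≡ setAt1 (setAt1 b (suc i) (removeL a (nthL b (suc i)))) i (insertSorted (a + sUp a (nthL b (suc i))) (nthL b i))
eRF-inv n i b c e with inRange n i
eRF-inv n i b c () | false
... | true with pairUp (reverse (nthL b i)) (nthL b (suc i))
...   | (R , L) with maxL L in m
eRF-inv n i b c () | true | (R , L) | nothing
...     | just a = a , R , L , refl , m , sym (just-injective e)

inRange-yes : ∀ {n i} → 1 ≤ i → i < n → inRange n i ≡ true
inRange-yes {n} {suc i} p q = <ᵇ-yes q

maxL-snoc : ∀ xs a → All (_< a) xs → maxL (xs ++ [ a ]) ≡ just a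
maxL-snoc [] a h = refl
maxL-snoc (x ∷ xs) a (p ∷ h) rewrite maxL-snoc xs a h with a ≤ᵇ x | ≤ᵇ⇒≤ a x
... | true | q = ⊥-elim (<⇒≱ p (q tt))
... | false | _ = refl

minL-snoc : ∀ xs a → All (a <_) xs → minL (xs ++ [ a ]) ≡ just a
minL-snoc [] a h = refl
minL-snoc (x ∷ xs) a (p ∷ h) rewrite minL-snoc xs a h with x ≤ᵇ a | ≤ᵇ⇒≤ x a
... | true | q = ⊥-elim (<⇒≱ p (q tt))
... | false | _ = refl

takeAbove-skip-just : ∀ b ys L L' → All (_≤ b) ys → takeAbove b L ≡ just L' → takeAbove b (ys ++ L) ≡ just (ys ++ L')
takeAbove-skip-just b [] L L' h e = e
takeAbove-skip-just b (y ∷ ys) L L' (p ∷ h) e rewrite <ᵇ-no p | takeAbove-skip-just b ys L L' h e = refl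

takeAbove-none : ∀ b ys → All (_≤ b) ys → takeAbove b ys ≡ nothing
takeAbove-none b [] h = refl
takeAbove-none b (y ∷ ys) (p ∷ h) rewrite <ᵇ-no p | takeAbove-none b ys h = refl

takeAbove-head : ∀ b y ys → b < y → takeAbove b (y ∷ ys) ≡ just ys
takeAbove-head b y ys p rewrite <ᵇ-yes p = refl

pairUp-just : ∀ b bs L {L'} → takeAbove b L ≡ just L' → pairUp (b ∷ bs) L ≡ pairUp bs L'
pairUp-just b bs L e rewrite e = refl

pairUp-none : ∀ b bs L → takeAbove b L ≡ nothing → pairUp (b ∷ bs) L ≡ (b ∷ proj₁ (pairUp bs L) , proj₂ (pairUp bs L))
pairUp-none b bs L e rewrite e = refl

_◂_ : List ℕ → List ℕ × List ℕ → List ℕ × List ℕ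
R ◂ (R' , L') = R ++ R' , L'

All-snoc : ∀ {P : ℕ → Set} {xs a} → All P xs → P a → All P (xs ++ [ a ])
All-snoc [] p = p ∷ []
All-snoc (q ∷ qs) p = q ∷ All-snoc qs p

All-map : ∀ {A : Set} {P Q : A → Set} → (∀ {a} → P a → Q a) → ∀ {xs} → All P xs → All Q xs
All-map f [] = []
All-map f (p ∷ ps) = f p ∷ All-map f ps

reverse-∷-++ : ∀ (a : ℕ) xs ys → reverse (a ∷ xs) ++ ys ≡ reverse xs ++ (a ∷ ys)
reverse-∷-++ a xs ys = trans (cong (_++ ys) (unfold-reverse a xs)) (++-assoc (reverse xs) [ a ] ys)

-- Generalized for induction from the left: `rest` holds smaller letters of the lower factor,
-- processed afterwards, and `ys` holds letters of the upper factor too small to be partners of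
-- letters of `Z`. The head of `Z` is processed after everything behind it, so its partner is the
-- first of the closing letters left over there.
pairUp-marked : ∀ i Z {p u} rest ys → Valid p u Z → All (_≤ p) ys →
  pairUp (reverse (rowOf i Z) ++ rest) (ys ++ rowOf (suc i) Z) ≡ Rs i Z ◂ pairUp rest (ys ++ Ls i Z)
pairUp-marked i [] rest ys V h = refl
pairUp-marked i ((a , v) ∷ Z) rest ys ((p<a , _) ∷ V) h with kind? i v
... | off q q' rewrite rowOf-no {a = a} Z q | rowOf-no {a = a} Z q' | Rs-off {a = a} Z q q' | Ls-off {a = a} Z q q' =
  pairUp-marked i Z rest ys V (All-map (λ l → ≤-trans l (<⇒≤ p<a)) h)
... | hi e rewrite rowOf-yes {a = a} Z e | rowOf-no {i} {a} Z (λ e' → 1+n≢n (trans (sym e) e')) | Rs-hi {a = a} Z e | Ls-hi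
    {a = a} Z e
  | sym (++-assoc ys [ a ] (rowOf (suc i) Z)) | sym (++-assoc ys [ a ] (Ls i Z)) =
  pairUp-marked i Z rest (ys ++ [ a ]) V (All-snoc (All-map (λ l → ≤-trans l (<⇒≤ p<a)) h) ≤-refl)
... | lo e rewrite rowOf-yes {a = a} Z e | rowOf-no {suc i} {a} Z (λ e' → 1+n≢n (trans (sym e') e)) | Rs-lo {a = a} Z e | Ls-lo
    {a = a} Z e
  | reverse-∷-++ a (rowOf i Z) rest =
  trans (pairUp-marked i Z (a ∷ rest) ys V ys≤) (go (Ls i Z) (Ls-All i (Valid-lower V a ≤-refl)))
  where
  ys≤ : All (_≤ a) ys
  ys≤ = All-map (λ l → ≤-trans l (<⇒≤ p<a)) h
  go : ∀ L → All (a <_) L → Rs i Z ◂ pairUp (a ∷ rest) (ys ++ L) ≡ openMark L (Rs i Z) a ◂ pairUp rest (ys ++ drop 1 L)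
  go [] _ rewrite ++-identityʳ ys | pairUp-none a rest ys (takeAbove-none a ys ys≤) = cong (_, _)
      (sym (++-assoc (Rs i Z) [ a ] _))
  go (y ∷ L) (q ∷ _) rewrite pairUp-just a rest (ys ++ y ∷ L) (takeAbove-skip-just a ys (y ∷ L) L ys≤ (takeAbove-head a y L q)) =
      refl

pairUp-rows : ∀ i Z {p u} → Valid p u Z → pairUp (reverse (rowOf i Z)) (rowOf (suc i) Z) ≡ (Rs i Z , Ls i Z)
pairUp-rows i Z V = trans (cong (λ xs → pairUp xs (rowOf (suc i) Z)) (sym (++-identityʳ (reverse (rowOf i Z)))))
  (trans (pairUp-marked i Z [] [] V []) (cong (_, Ls i Z) (++-identityʳ (Rs i Z))))

upd : {A : Set} → (ℕ → A) → ℕ → A → ℕ → A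
upd f j y k = if k ≡ᵇ j then y else f k

upd-same : ∀ {A : Set} (f : ℕ → A) {j k} y → k ≡ j → upd f j y k ≡ y
upd-same f y e rewrite ≡ᵇ-yes e = refl

upd-other : ∀ {A : Set} (f : ℕ → A) {j k} y → k ≢ j → upd f j y k ≡ f k
upd-other f y e rewrite ≡ᵇ-no e = refl

module _ {A : Set} (f g : ℕ → A) (i : ℕ) where
  upd-lo-hi : ∀ {y z} → y ≡ g (suc i) → z ≡ g i → (∀ k → k ≢ i → k ≢ suc i → f k ≡ g k) → ∀ k → upd (upd f (suc i) y) i z k ≡ g k
  upd-lo-hi {y} {z} ey ez h k with kind? i k
  ... | lo refl = trans (upd-same (upd f (suc i) y) {i} {i} z refl) ez
  ... | hi refl = trans (upd-other (upd f (suc i) y) {i} {suc i} z 1+n≢n) (trans (upd-same f {suc i} {suc i} y refl) ey)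
  ... | off p q = trans (upd-other (upd f (suc i) y) {i} {k} z p) (trans (upd-other f {suc i} {k} y q) (h k p q))

  upd-hi-lo : ∀ {y z} → y ≡ g (suc i) → z ≡ g i → (∀ k → k ≢ i → k ≢ suc i → f k ≡ g k) → ∀ k → upd (upd f i z) (suc i) y k ≡ g k
  upd-hi-lo {y} {z} ey ez h k with kind? i k
  ... | lo refl = trans (upd-other (upd f i z) {suc i} {i} y (1+n≢n ∘ sym)) (trans (upd-same f {i} {i} z refl) ez)
  ... | hi refl = trans (upd-same (upd f i z) {suc i} {suc i} y refl) ey
  ... | off p q = trans (upd-other (upd f i z) {suc i} {k} y q) (trans (upd-other f {i} {k} z p) (h k p q))

module _ {A : Set} where
  nth0-range : ∀ (f : ℕ → A) s m k → k < m → nth0 (map f (rangeFrom s m)) k ≡ just (f (s + k))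
  nth0-range f s (suc m) zero p = cong (just ∘ f) (sym (+-identityʳ s))
  nth0-range f s (suc m) (suc k) (s≤s p) = trans (nth0-range f (suc s) m k p) (cong (just ∘ f) (sym (+-suc s k)))

  map-range-cong : ∀ (f g : ℕ → A) s m → (∀ k → s ≤ k → k < s + m → f k ≡ g k) → map f (rangeFrom s m) ≡ map g (rangeFrom s m)
  map-range-cong f g s zero h = refl
  map-range-cong f g s (suc m) h = cong₂ _∷_ (h s ≤-refl (m<m+n s (s≤s z≤n)))
    (map-range-cong f g (suc s) m (λ k p q → h k (<⇒≤ p) (subst (k <_) (sym (+-suc s m)) q)))

  map-range-inj : ∀ (f g : ℕ → A) s m → map f (rangeFrom s m) ≡ map g (rangeFrom s m) → ∀ k → s ≤ k → k < s + m → f k ≡ g k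
  map-range-inj f g s zero e k p q = ⊥-elim (<⇒≱ q (subst (_≤ k) (sym (+-identityʳ s)) p))
  map-range-inj f g s (suc m) e k p q with ∷-injective e | m≤n⇒m<n∨m≡n p
  ... | e₁ , e₂ | inj₂ refl = e₁
  ... | e₁ , e₂ | inj₁ p' = map-range-inj f g (suc s) m e₂ k p' (subst (k <_) (+-suc s m) q)

  setAt1-range : ∀ (f : ℕ → A) s m k y → setAt1 (map f (rangeFrom s m)) (suc k) y ≡ map (upd f (s + k) y) (rangeFrom s m)
  setAt1-range f s zero k y = refl
  setAt1-range f s (suc m) zero y rewrite +-identityʳ s | ≡ᵇ-yes {s} refl =
    cong (y ∷_) (map-range-cong f (upd f s y) (suc s) m (λ k p q → sym (upd-other f y (λ e → <-irrefl (sym e) p))))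
  setAt1-range f s (suc m) (suc k) y rewrite upd-other f {s + suc k} {s} y (λ e → <-irrefl e (m<m+n s (s≤s z≤n))) | +-suc s k =
    cong (f s ∷_) (setAt1-range f (suc s) m k y)

  tab : ℕ → (ℕ → A) → List A
  tab n f = map f (range1 n)

  tab-cong : ∀ n (f g : ℕ → A) → (∀ k → 1 ≤ k → k ≤ n → f k ≡ g k) → tab n f ≡ tab n g
  tab-cong n f g h = map-range-cong f g 1 n (λ k p q → h k p (≤-pred q))

  tab-inj : ∀ n (f g : ℕ → A) → tab n f ≡ tab n g → ∀ k → 1 ≤ k → k ≤ n → f k ≡ g k
  tab-inj n f g e k p q = map-range-inj f g 1 n e k p (s≤s q)

  setAt1-tab : ∀ n (f : ℕ → A) k y → 1 ≤ k → setAt1 (tab n f) k y ≡ tab n (upd f k y)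
  setAt1-tab n f (suc k) y p = setAt1-range f 1 n k y

nthL-tab : ∀ n (f : ℕ → List ℕ) k → 1 ≤ k → k ≤ n → nthL (tab n f) k ≡ f k
nthL-tab n f (suc k) p q rewrite nth0-range f 1 n k q = refl

tab-nthL : ∀ (b : List (List ℕ)) → tab (length b) (nthL b) ≡ b
tab-nthL b = go b [] 
  where
  nthL-++ : ∀ (pre b : List (List ℕ)) x → nthL (pre ++ x ∷ b) (suc (length pre)) ≡ x
  nthL-++ [] b x = refl
  nthL-++ (_ ∷ []) b x = refl
  nthL-++ (_ ∷ p ∷ pre) b x = nthL-++ (p ∷ pre) b x
  go : ∀ b pre → map (nthL (pre ++ b)) (rangeFrom (suc (length pre)) (length b)) ≡ b
  go [] pre = refl
  go (x ∷ b) pre = cong₂ _∷_ (nthL-++ pre b x)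
    (trans (cong₂ (λ q k → map (nthL q) (rangeFrom (suc k) (length b))) (sym (++-assoc pre [ x ] b))
            (trans (+-comm 1 (length pre)) (sym (length-++ pre {[ x ]})))) (go b (pre ++ [ x ])))

fac : ℕ → Marked → Fac
fac n Z = tab n (λ j → rowOf j Z)

member-All : ∀ {a xs} → All (a ≢_) xs → member a xs ≡ false
member-All [] = refl
member-All (p ∷ ps) rewrite ≡ᵇ-no p = member-All ps

member-++ : ∀ {a} xs ys → member a xs ≡ false → member a ys ≡ false → member a (xs ++ ys) ≡ false
member-++ [] ys p q = q
member-++ {a} (x ∷ xs) ys p q with a ≡ᵇ x
... | false = member-++ xs ys p q

removeL-mid : ∀ a xs ys → All (_< a) xs → removeL a (xs ++ a ∷ ys) ≡ xs ++ ys
removeL-mid a [] ys h rewrite ≡ᵇ-yes {a} refl = refl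
removeL-mid a (x ∷ xs) ys (p ∷ h) rewrite ≡ᵇ-no (λ e → <-irrefl (sym e) p) = cong (x ∷_) (removeL-mid a xs ys h)

≤ᵇ-yes : ∀ {a b} → a ≤ b → (a ≤ᵇ b) ≡ true
≤ᵇ-yes {zero} p = refl
≤ᵇ-yes {suc a} p = <ᵇ-yes p

≤ᵇ-no : ∀ {a b} → b < a → (a ≤ᵇ b) ≡ false
≤ᵇ-no {suc a} p = <ᵇ-no (≤-pred p)

insertSorted-mid : ∀ a xs ys → All (_< a) xs → All (a <_) ys → insertSorted a (xs ++ ys) ≡ xs ++ a ∷ ys
insertSorted-mid a [] [] h k = refl
insertSorted-mid a [] (y ∷ ys) h (q ∷ k) rewrite ≤ᵇ-yes (<⇒≤ q) = refl
insertSorted-mid a (x ∷ xs) ys (p ∷ h) k rewrite ≤ᵇ-no p = cong (x ∷_) (insertSorted-mid a xs ys h k)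

sUp-zero : ∀ a r → member (suc a) r ≡ false → sUp a r ≡ 0
sUp-zero a r e rewrite +-comm a 1 | e = refl

tDown-zero : ∀ a r → member (a ∸ 1) r ≡ false → tDown a r ≡ 0
tDown-zero a r e rewrite e = refl

-- Only the next letter can be `a + 1`, and then its value exceeds `v`, so it lies in no row
-- `j ≤ v`. This makes the shift of `e_i` vanish.
successor-free : ∀ {a v j B} → Valid a v B → j ≤ v → member (suc a) (rowOf j B) ≡ false
successor-free [] p = refl
successor-free {a} {v} {j} {(b , w) ∷ B} ((a<b , h) ∷ V) p with suc a ≟ b
... | yes refl rewrite rowOf-no {j} {b} B (λ e → <-irrefl (sym e) (≤-<-trans p (h refl))) =
  member-All (rowOf-All j (All-map (λ l → <⇒≢ l) (Valid-lower V b ≤-refl)))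
... | no ne = member-All (rowOf-All j {(b , w) ∷ B} (ne ∷ All-map (λ l → <⇒≢ (<-≤-trans (s≤s a<b) l)) (Valid-lower V b ≤-refl)))

pred-≢ : ∀ {b w a} A {B} → Valid b w (A ++ (a , w) ∷ B) → a ∸ 1 ≢ b
pred-≢ {b} {w} {suc a} [] ((q , h) ∷ _) refl = <-irrefl refl (h refl)
pred-≢ {b} {w} {suc a} ((b' , w') ∷ A) ((q , h) ∷ V) refl = <⇒≱ q (≤-pred (proj₂ (Valid-before A V)))
pred-≢ {b} {w} {zero} A V e with proj₂ (Valid-before A V)
... | ()

predecessor-free : ∀ {p u} A {a v B} → Valid p u (A ++ (a , v) ∷ B) → member (a ∸ 1) (rowOf v A) ≡ false
predecessor-free [] V = refl
predecessor-free ((b , w) ∷ A) {a} {v} (_ ∷ V) with w ≟ v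
... | no ne rewrite rowOf-no {v} {b} A ne = predecessor-free A V
... | yes refl rewrite rowOf-yes {v} {b} A refl | ≡ᵇ-no (pred-≢ {a = a} A V) = predecessor-free A V

-- One description for both operators: `a` is the rightmost unmatched closing letter of `Z` and the
-- leftmost unmatched opening letter of `Z'`. Hence `e_i` leads from `Z` to `Z'` and `f_i` back.
record EStep (i : ℕ) (Z Z' : Marked) : Set where
  constructor estep
  field
    {A B} : Marked
    {a} : ℕ
    src : Z ≡ A ++ (a , suc i) ∷ B
    tgt : Z' ≡ A ++ (a , i) ∷ B
    noOpen : Rs i A ≡ []
    noClose : Ls i B ≡ []

module _ (i : ℕ) (A : Marked) (a : ℕ) (B : Marked) where
  private
    Z = A ++ (a , suc i) ∷ B
    Z' = A ++ (a , i) ∷ B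
  flip-src-hi : rowOf (suc i) Z ≡ rowOf (suc i) A ++ a ∷ rowOf (suc i) B
  flip-src-hi = trans (rowOf-++ (suc i) A _) (cong (rowOf (suc i) A ++_) (rowOf-yes B refl))
  flip-src-lo : rowOf i Z ≡ rowOf i A ++ rowOf i B
  flip-src-lo = trans (rowOf-++ i A _) (cong (rowOf i A ++_) (rowOf-no B 1+n≢n))
  flip-tgt-hi : rowOf (suc i) Z' ≡ rowOf (suc i) A ++ rowOf (suc i) B
  flip-tgt-hi = trans (rowOf-++ (suc i) A _) (cong (rowOf (suc i) A ++_) (rowOf-no B (1+n≢n ∘ sym)))
  flip-tgt-lo : rowOf i Z' ≡ rowOf i A ++ a ∷ rowOf i B
  flip-tgt-lo = trans (rowOf-++ i A _) (cong (rowOf i A ++_) (rowOf-yes B refl))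
  flip-other : ∀ j → j ≢ i → j ≢ suc i → rowOf j Z ≡ rowOf j Z'
  flip-other j p q = trans (rowOf-++ j A _) (trans
      (cong (rowOf j A ++_) (trans (rowOf-no B (q ∘ sym)) (sym (rowOf-no B (p ∘ sym))))) (sym (rowOf-++ j A _)))

module _ {n i : ℕ} (1≤i : 1 ≤ i) (i<n : i < n) where
  private
    pairUp-fac : ∀ Z → Valid 0 0 Z → pairUp (reverse (nthL (fac n Z) i)) (nthL (fac n Z) (suc i)) ≡ (Rs i Z , Ls i Z)
    pairUp-fac Z V = trans (cong₂ (λ x y → pairUp (reverse x) y) (nthL-tab n _ i 1≤i (<⇒≤ i<n))
        (nthL-tab n _ (suc i) (s≤s z≤n) i<n)) (pairUp-rows i Z V)

  eRF-fac-none : ∀ Z → Valid 0 0 Z → Ls i Z ≡ [] → eRF n i (fac n Z) ≡ nothing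
  eRF-fac-none Z V e = eRF-nothing n i (fac n Z) (inRange-yes 1≤i i<n) (trans (pairUp-fac Z V) (cong (Rs i Z ,_) e))

  fRF-fac-none : ∀ Z → Valid 0 0 Z → Rs i Z ≡ [] → fRF n i (fac n Z) ≡ nothing
  fRF-fac-none Z V e = fRF-nothing n i (fac n Z) (inRange-yes 1≤i i<n) (trans (pairUp-fac Z V) (cong (_, Ls i Z) e))

  eRF-fac : ∀ {Z Z'} → Valid 0 0 Z → EStep i Z Z' → eRF n i (fac n Z) ≡ just (fac n Z')
  eRF-fac V (estep {A} {B} {a} refl refl ra lb) =
    trans (eRF-just n i (fac n Z) (inRange-yes 1≤i i<n) (pairUp-fac Z V)
            (trans (cong maxL (Ls-split i A a B ra lb)) (maxL-snoc (Ls i A) a (Ls-All i (proj₁ (Valid-before A V))))))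
      (cong just (trans (cong₂ (λ x y → setAt1 (setAt1 (fac n Z) (suc i) (removeL a y)) i (insertSorted (a + sUp a y) x))
                    (nthL-tab n _ i 1≤i (<⇒≤ i<n)) (nthL-tab n _ (suc i) (s≤s z≤n) i<n))
                 (trans (cong (λ q → setAt1 q i lowRow) (setAt1-tab n _ (suc i) (removeL a (rowOf (suc i) Z)) (s≤s z≤n)))
                 (trans (setAt1-tab n _ i lowRow 1≤i) (tab-cong n _ _ rows)))))
    where
    Z = A ++ (a , suc i) ∷ B
    Z' = A ++ (a , i) ∷ B
    lowRow = insertSorted (a + sUp a (rowOf (suc i) Z)) (rowOf i Z)
    A< = proj₁ (Valid-before A V)
    VB = Valid-tail A V
    s0 : sUp a (rowOf (suc i) Z) ≡ 0
    s0 = sUp-zero a (rowOf (suc i) Z) (trans (cong (member (suc a)) (flip-src-hi i A a B))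
           (member-++ (rowOf (suc i) A) _ (member-All (rowOf-All (suc i) (All-map (λ l e → <-asym l (≤-reflexive e)) A<)))
             (trans (cong (_∨ member (suc a) (rowOf (suc i) B)) (≡ᵇ-no {suc a} 1+n≢n)) (successor-free VB ≤-refl))))
    low-eq : lowRow ≡ rowOf i Z'
    low-eq = trans (cong₂ insertSorted (trans (cong (a +_) s0) (+-identityʳ a)) (flip-src-lo i A a B))
               (trans (insertSorted-mid a (rowOf i A) (rowOf i B) (rowOf-All i A<) (rowOf-All i (Valid-lower VB a ≤-refl)))
                 (sym (flip-tgt-lo i A a B)))
    high-eq : removeL a (rowOf (suc i) Z) ≡ rowOf (suc i) Z'
    high-eq = trans (cong (removeL a) (flip-src-hi i A a B))
        (trans (removeL-mid a _ _ (rowOf-All (suc i) A<)) (sym (flip-tgt-hi i A a B)))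
    rows : ∀ k → 1 ≤ k → k ≤ n → upd (upd (λ j → rowOf j Z) (suc i) (removeL a (rowOf (suc i) Z))) i lowRow k ≡ rowOf k Z'
    rows k _ _ = upd-lo-hi (λ j → rowOf j Z) (λ j → rowOf j Z') i high-eq low-eq (flip-other i A a B) k

  fRF-fac : ∀ {Z Z'} → Valid 0 0 Z' → EStep i Z Z' → fRF n i (fac n Z') ≡ just (fac n Z)
  fRF-fac V (estep {A} {B} {a} refl refl ra lb) =
    trans (fRF-just n i (fac n Z') (inRange-yes 1≤i i<n) (pairUp-fac Z' V)
            (trans (cong minL (Rs-split i A a B ra lb)) (minL-snoc (Rs i B) a (Rs-All i (Valid-lower VB a ≤-refl)))))
      (cong just (trans (cong₂ (λ x y → setAt1 (setAt1 (fac n Z') i (removeL a x)) (suc i) (insertSorted (a ∸ tDown a x) y))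
                    (nthL-tab n _ i 1≤i (<⇒≤ i<n)) (nthL-tab n _ (suc i) (s≤s z≤n) i<n))
                 (trans (cong (λ q → setAt1 q (suc i) highRow) (setAt1-tab n _ i (removeL a (rowOf i Z')) 1≤i))
                 (trans (setAt1-tab n _ (suc i) highRow (s≤s z≤n)) (tab-cong n _ _ rows)))))
    where
    Z = A ++ (a , suc i) ∷ B
    Z' = A ++ (a , i) ∷ B
    highRow = insertSorted (a ∸ tDown a (rowOf i Z')) (rowOf (suc i) Z')
    A< = proj₁ (Valid-before A V)
    VB = Valid-tail A V
    pred-not : ∀ {b} → a < b → a ∸ 1 ≢ b
    pred-not l e = <⇒≱ l (≤-trans (≤-reflexive (sym e)) (m∸n≤m a 1))
    a≢ : (a ∸ 1 ≡ᵇ a) ≡ false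
    a≢ = ≡ᵇ-no (λ e → <-irrefl e (m∸1< (proj₂ (Valid-before A V))))
      where
      m∸1< : ∀ {m} → 0 < m → m ∸ 1 < m
      m∸1< {suc m} _ = ≤-refl
    t0 : tDown a (rowOf i Z') ≡ 0
    t0 = tDown-zero a (rowOf i Z') (trans (cong (member (a ∸ 1)) (flip-tgt-lo i A a B))
           (member-++ (rowOf i A) _ (predecessor-free A V)
             (trans (cong (_∨ member (a ∸ 1) (rowOf i B)) a≢)
               (member-All (rowOf-All i (All-map pred-not (Valid-lower VB a ≤-refl)))))))
    high-eq : highRow ≡ rowOf (suc i) Z
    high-eq = trans (cong₂ insertSorted (cong (a ∸_) t0) (flip-tgt-hi i A a B))
               (trans (insertSorted-mid a (rowOf (suc i) A) (rowOf (suc i) B) (rowOf-All (suc i) A<)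
                 (rowOf-All (suc i) (Valid-lower VB a ≤-refl)))
                 (sym (flip-src-hi i A a B)))
    low-eq : removeL a (rowOf i Z') ≡ rowOf i Z
    low-eq = trans (cong (removeL a) (flip-tgt-lo i A a B))
        (trans (removeL-mid a _ _ (rowOf-All i A<)) (sym (flip-src-lo i A a B)))
    rows : ∀ k → 1 ≤ k → k ≤ n → upd (upd (λ j → rowOf j Z') i (removeL a (rowOf i Z'))) (suc i) highRow k ≡ rowOf k Z
    rows k _ _ = upd-hi-lo (λ j → rowOf j Z') (λ j → rowOf j Z) i high-eq low-eq (λ j p q → sym (flip-other i A a B j p q)) k

-- Preimages under the raising operators of factorizations

T⇒≡ : ∀ {b} → T b → b ≡ true
T⇒≡ {true} _ = refl

≡⇒T : ∀ {b} → b ≡ true → T b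
≡⇒T refl = tt

T-∧⁻ : ∀ {a b} → T (a ∧ b) → T a × T b
T-∧⁻ {true} {true} _ = tt , tt

T-∧⁺ : ∀ {a b} → T a → T b → T (a ∧ b)
T-∧⁺ {true} {true} _ _ = tt

takeAbove-⊆ : ∀ {Q : ℕ → Set} b L {L'} → All Q L → takeAbove b L ≡ just L' → All Q L'
takeAbove-⊆ b (x ∷ L) (q ∷ qs) e with b <ᵇ x
takeAbove-⊆ b (x ∷ L) (q ∷ qs) refl | true = qs
... | false with takeAbove b L in e'
takeAbove-⊆ b (x ∷ L) (q ∷ qs) refl | false | just L'' = q ∷ takeAbove-⊆ b L qs e'

pairUp-⊆ : ∀ {Q : ℕ → Set} bs L → All Q L → All Q (proj₂ (pairUp bs L))
pairUp-⊆ [] L h = h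
pairUp-⊆ (b ∷ bs) L h with takeAbove b L in e
... | just L' = pairUp-⊆ bs L' (takeAbove-⊆ b L h e)
... | nothing = pairUp-⊆ bs L h

maxL-⊆ : ∀ {Q : ℕ → Set} L {a} → All Q L → maxL L ≡ just a → Q a
maxL-⊆ (x ∷ L) (q ∷ qs) e with maxL L in e'
maxL-⊆ (x ∷ L) (q ∷ qs) refl | nothing = q
... | just m with m ≤ᵇ x
maxL-⊆ (x ∷ L) (q ∷ qs) refl | just m | true = q
maxL-⊆ (x ∷ L) (q ∷ qs) refl | just m | false = maxL-⊆ L qs e'

member-cons : ∀ a x xs → (a ≡ x × member a (x ∷ xs) ≡ true) ⊎ (a ≢ x × member a (x ∷ xs) ≡ member a xs)
member-cons a x xs with a ≟ x
... | yes e rewrite ≡ᵇ-yes e = inj₁ (e , refl)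
... | no e rewrite ≡ᵇ-no e = inj₂ (e , refl)

all-members : ∀ xs → All (λ z → member z xs ≡ true) xs
all-members [] = []
all-members (x ∷ xs) = head ∷ All-map tail' (all-members xs)
  where
  head : member x (x ∷ xs) ≡ true
  head rewrite ≡ᵇ-yes {x} refl = refl
  tail' : ∀ {z} → member z xs ≡ true → member z (x ∷ xs) ≡ true
  tail' {z} e with z ≡ᵇ x
  ... | true = refl
  ... | false = e

member-removeL : ∀ {z a} xs → z ≢ a → member z (removeL a xs) ≡ member z xs
member-removeL [] ne = refl
member-removeL {z} {a} (x ∷ xs) ne with a ≟ x
... | yes refl rewrite ≡ᵇ-yes {a} refl | ≡ᵇ-no ne = refl
... | no e rewrite ≡ᵇ-no e with z ≡ᵇ x
...   | true = refl
...   | false = member-removeL xs ne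

member-insertSorted : ∀ a xs → member a (insertSorted a xs) ≡ true
member-insertSorted a [] rewrite ≡ᵇ-yes {a} refl = refl
member-insertSorted a (x ∷ xs) with a ≤ᵇ x
... | true rewrite ≡ᵇ-yes {a} refl = refl
... | false with a ≡ᵇ x
...   | true = refl
...   | false = member-insertSorted a xs

removeL-insertSorted : ∀ a xs → removeL a (insertSorted a xs) ≡ xs
removeL-insertSorted a [] rewrite ≡ᵇ-yes {a} refl = refl
removeL-insertSorted a (x ∷ xs) with a ≤? x
... | yes p rewrite ≤ᵇ-yes p | ≡ᵇ-yes {a} refl = refl
... | no p rewrite ≤ᵇ-no (≰⇒> p) | ≡ᵇ-no {a} {x} (λ e → p (≤-reflexive e)) = cong (x ∷_) (removeL-insertSorted a xs)

strictInc-tail : ∀ x xs → T (strictIncB (x ∷ xs)) → All (x <_) xs × T (strictIncB xs)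
strictInc-tail x [] h = [] , tt
strictInc-tail x (y ∷ xs) h with T-∧⁻ {x <ᵇ y} h
... | p , q = (x<y ∷ All-map (<-trans x<y) (proj₁ (strictInc-tail y xs q))) , q
  where x<y = <ᵇ⇒< x y p

member-above : ∀ {x a} ys → All (x ≤_) ys → member a ys ≡ true → x ≤ a
member-above {a = a} (y ∷ ys) (p ∷ ps) m with member-cons a y ys
... | inj₁ (refl , _) = p
... | inj₂ (_ , e) = member-above ys ps (trans (sym e) m)

-- Weak on purpose: inserting a letter that is already present keeps the order weakly but not
-- strictly, so this is the form that survives `e_i` on an arbitrary factorization.
Increasing : List ℕ → Set
Increasing [] = ⊤
Increasing (x ∷ xs) = All (x ≤_) xs × Increasing xs

strictInc⇒Increasing : ∀ xs → T (strictIncB xs) → Increasing xs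
strictInc⇒Increasing [] h = tt
strictInc⇒Increasing (x ∷ xs) h with strictInc-tail x xs h
... | l , h' = All-map <⇒≤ l , strictInc⇒Increasing xs h'

insertSorted-head : ∀ a xs → All (a ≤_) xs → insertSorted a xs ≡ a ∷ xs
insertSorted-head a [] h = refl
insertSorted-head a (x ∷ xs) (p ∷ h) rewrite ≤ᵇ-yes p = refl

insertSorted-removeL : ∀ a xs → Increasing xs → member a xs ≡ true → insertSorted a (removeL a xs) ≡ xs
insertSorted-removeL a (x ∷ xs) (lt , h') m with member-cons a x xs
... | inj₁ (refl , _) rewrite ≡ᵇ-yes {a} refl = insertSorted-head a xs lt
... | inj₂ (ne , e) with trans (sym e) m
...   | m' rewrite ≡ᵇ-no ne | ≤ᵇ-no (≤∧≢⇒< (member-above xs lt m') (ne ∘ sym)) = cong (x ∷_) (insertSorted-removeL a xs h' m')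

removeL-All : ∀ {P : ℕ → Set} a xs → All P xs → All P (removeL a xs)
removeL-All a [] [] = []
removeL-All a (x ∷ xs) (p ∷ ps) with a ≡ᵇ x
... | true = ps
... | false = p ∷ removeL-All a xs ps

removeL-Increasing : ∀ a xs → Increasing xs → Increasing (removeL a xs)
removeL-Increasing a [] h = tt
removeL-Increasing a (x ∷ xs) (p , h) with a ≡ᵇ x
... | true = h
... | false = removeL-All a xs p , removeL-Increasing a xs h

insertSorted-All : ∀ {P : ℕ → Set} a xs → P a → All P xs → All P (insertSorted a xs)
insertSorted-All a [] q [] = q ∷ []
insertSorted-All a (x ∷ xs) q (p ∷ ps) with a ≤ᵇ x
... | true = q ∷ p ∷ ps
... | false = p ∷ insertSorted-All a xs q ps

insertSorted-Increasing : ∀ a xs → Increasing xs → Increasing (insertSorted a xs)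
insertSorted-Increasing a [] h = [] , tt
insertSorted-Increasing a (x ∷ xs) (p , h) with a ≤? x
... | yes q rewrite ≤ᵇ-yes q = (q ∷ All-map (≤-trans q) p) , p , h
... | no q rewrite ≤ᵇ-no (≰⇒> q) = insertSorted-All a xs (<⇒≤ (≰⇒> q)) p , insertSorted-Increasing a xs h

setAt1-All : ∀ {A : Set} {P : A → Set} xs k {y} → All P xs → P y → All P (setAt1 xs k y)
setAt1-All [] k [] q = []
setAt1-All (x ∷ xs) zero ps q = ps
setAt1-All (x ∷ xs) (suc zero) (p ∷ ps) q = q ∷ ps
setAt1-All (x ∷ xs) (suc (suc k)) (p ∷ ps) q = p ∷ setAt1-All xs (suc k) ps q

setAt1-length : ∀ {A : Set} (xs : List A) k y → length (setAt1 xs k y) ≡ length xs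
setAt1-length [] k y = refl
setAt1-length (x ∷ xs) zero y = refl
setAt1-length (x ∷ xs) (suc zero) y = refl
setAt1-length (x ∷ xs) (suc (suc k)) y = cong suc (setAt1-length xs (suc k) y)

nthL-All : ∀ {P : List ℕ → Set} b k → P [] → All P b → P (nthL b k)
nthL-All b zero d h = d
nthL-All [] (suc k) d h = d
nthL-All (r ∷ b) (suc zero) d (p ∷ h) = p
nthL-All (r ∷ b) (suc (suc k)) d (p ∷ h) = nthL-All b (suc k) d h

eRF-Increasing : ∀ n i b c → eRF n i b ≡ just c → All Increasing b → length c ≡ length b × All Increasing c
eRF-Increasing n i b c e h with eRF-inv n i b c e
... | a , R , L , _ , _ , refl = trans (setAt1-length (setAt1 b (suc i) _) i _) (setAt1-length b (suc i) _) ,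
  setAt1-All (setAt1 b (suc i) _) i (setAt1-All b (suc i) h (removeL-Increasing a _ (nthL-All b (suc i) tt h)))
      (insertSorted-Increasing _ _ (nthL-All b i tt h))

sUp-one : ∀ a r → member (suc a) r ≡ true → member (suc (suc a)) r ≡ false → sUp a r ≡ 1
sUp-one a (x ∷ r) p q rewrite +-comm a 1 | p | +-comm a 2 | q = refl

rowOf-split : ∀ a j Z → member a (rowOf j Z) ≡ true → ∃ λ A → ∃ λ B → Z ≡ A ++ (a , j) ∷ B
rowOf-split a j ((b , v) ∷ Z) m with v ≟ j
... | no ne with rowOf-split a j Z (trans (cong (member a) (sym (rowOf-no Z ne))) m)
...   | A , B , e = (b , v) ∷ A , B , cong ((b , v) ∷_) e
rowOf-split a j ((b , v) ∷ Z) m | yes refl with member-cons a b (rowOf j Z)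
... | inj₁ (refl , _) = [] , Z , refl
... | inj₂ (_ , e) with rowOf-split a j Z (trans (sym e) (trans (cong (member a) (sym (rowOf-yes {v} {b} Z refl))) m))
...   | A , B , e' = (b , v) ∷ A , B , cong ((b , v) ∷_) e'

module _ {p u} A {a j B} (V : Valid p u (A ++ (a , j) ∷ B)) where
  letter-elsewhere : ∀ k → k ≢ j → member a (rowOf k (A ++ (a , j) ∷ B)) ≡ false
  letter-elsewhere k ne = trans (cong (member a) (trans (rowOf-++ k A _) (cong (rowOf k A ++_) (rowOf-no B (ne ∘ sym)))))
    (member-++ (rowOf k A) _ (member-All (rowOf-All k (All-map (λ l e → <-irrefl (sym e) l) (proj₁ (Valid-before A V)))))
      (member-All (rowOf-All k (All-map <⇒≢ (Valid-lower (Valid-tail A V) a ≤-refl)))))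

  successor-elsewhere : member (suc a) (rowOf j (A ++ (a , j) ∷ B)) ≡ false
  successor-elsewhere = trans (cong (member (suc a)) (trans (rowOf-++ j A _) (cong (rowOf j A ++_) (rowOf-yes B refl))))
    (member-++ (rowOf j A) _ (member-All (rowOf-All j (All-map (λ l e → <-asym l (≤-reflexive e)) (proj₁ (Valid-before A V)))))
      (trans (cong (_∨ member (suc a) (rowOf j B)) (≡ᵇ-no {suc a} 1+n≢n)) (successor-free (Valid-tail A V) ≤-refl)))

-- Raising the value of `a` endangers only the step to a letter `a + 1`, whose value was above `i`
-- and has to avoid `i + 1`.
Valid-flip-up : ∀ {p u i} A {a B} → Valid p u (A ++ (a , i) ∷ B) → member (suc a) (rowOf (suc i) B) ≡ false → Valid p u
    (A ++ (a , suc i) ∷ B)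
Valid-flip-up (z ∷ A) (h ∷ V) m = h ∷ Valid-flip-up A V m
Valid-flip-up [] ((l , h) ∷ []) m = (l , m≤n⇒m≤1+n ∘ h) ∷ []
Valid-flip-up {i = i} [] {a} {(b , w) ∷ B} ((l , h) ∷ ((l' , h') ∷ V)) m = (l , m≤n⇒m≤1+n ∘ h) ∷ ((l' , up) ∷ V)
  where
  up : b ≡ suc a → suc i < w
  up refl = ≤∧≢⇒< (h' refl) λ { refl → case trans
      (sym (trans (cong (member b) (rowOf-yes {w} {b} B refl)) (cong (_∨ member b (rowOf w B)) (≡ᵇ-yes {b} refl)))) m of λ () }

closing-free : ∀ {a i B} → Valid a i B → Ls i B ≡ [] → member (suc a) (rowOf (suc i) B) ≡ false
closing-free [] e = refl
closing-free {a} {i} {(b , w) ∷ B} ((l , h) ∷ V) e with w ≟ suc i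
... | yes refl = case trans (sym (Ls-hi {i} {b} {suc i} B refl)) e of λ ()
... | no ne = trans (cong (member (suc a)) (rowOf-no B ne))
    (member-All (rowOf-All (suc i) (All-map (λ l' → <⇒≢ (≤-<-trans l l')) (Valid-lower V b ≤-refl))))

openMark-[] : ∀ L R a → openMark L R a ≡ [] → R ≡ []
openMark-[] [] [] a ()
openMark-[] (_ ∷ _) R a e = e

Rs-tail : ∀ i a v A → Rs i ((a , v) ∷ A) ≡ [] → Rs i A ≡ []
Rs-tail i a v A e with kind? i v
... | hi p = trans (sym (Rs-hi A p)) e
... | lo p = openMark-[] (Ls i A) (Rs i A) a (trans (sym (Rs-lo A p)) e)
... | off p q = trans (sym (Rs-off A p q)) e

-- Lowering the value of `a` endangers only the step from a letter `a - 1`. If that letter had value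
-- `i`, it would be an unmatched opening letter at the end of `A`.
Valid-flip-down : ∀ {p u i} A {a B} → Valid p u (A ++ (a , suc i) ∷ B) → Rs i A ≡ [] → (A ≡ [] → u ≢ i) → Valid p u
    (A ++ (a , i) ∷ B)
Valid-flip-down ((b , v) ∷ A) {a} (h ∷ V) e _ = h ∷ Valid-flip-down A V (Rs-tail _ b v A e) last
  where
  last : A ≡ [] → v ≢ _
  last refl refl with trans (sym (Rs-lo {v} {b} {v} [] refl)) e
  ... | ()
Valid-flip-down [] ((l , h) ∷ V) e ne = (l , λ e' → ≤∧≢⇒< (≤-pred (h e')) (ne refl)) ∷ relax V
  where
  relax : ∀ {a i B} → Valid a (suc i) B → Valid a i B
  relax [] = []
  relax ((l , h) ∷ V) = (l , λ e → <-trans (n<1+n _) (h e)) ∷ V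

Bounded : ℕ → Marked → Set
Bounded n Z = All (λ z → 1 ≤ proj₂ z × proj₂ z ≤ n) Z

Bounded-flip : ∀ {n} A {a v w B} → Bounded n (A ++ (a , v) ∷ B) → 1 ≤ w → w ≤ n → Bounded n (A ++ (a , w) ∷ B)
Bounded-flip A h p q with ++⁻ A h
... | hA , (_ ∷ hB) = ++⁺ hA ((p , q) ∷ hB)

fac-injective : ∀ n Z Z' → Valid 0 0 Z → Valid 0 0 Z' → Bounded n Z → Bounded n Z' → fac n Z ≡ fac n Z' → Z ≡ Z'
fac-injective n Z Z' V V' b b' e = rowOf-injective n Z Z' V V' b b' (tab-inj n _ _ e)

module _ {n i : ℕ} (1≤i : 1 ≤ i) (i<n : i < n) where
  -- Here `b` is not known to be a marked list. Let `a` be the letter moved. If `a + 1` stood in the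
  -- same factor, the shift would insert `a + 1` into factor `i` while it also remains in factor
  -- `i + 1`, but `fac n Z` has no letter in two factors. So the shift is 0, and restoring the value
  -- of `a` in `Z` gives `b`.
  eRF-preimage : ∀ b Z → length b ≡ n → All Increasing b → Valid 0 0 Z → Bounded n Z → eRF n i b ≡ just (fac n Z) →
    ∃ λ Z' → Valid 0 0 Z' × Bounded n Z' × EStep i Z' Z × b ≡ fac n Z'
  eRF-preimage b Z len str V bd eb with eRF-inv n i b (fac n Z) eb
  ... | a , R , L , pu , mx , eq = finish (member (suc a) y) refl
    where
    x = nthL b i
    y = nthL b (suc i)
    z = insertSorted (a + sUp a y) x
    b-tab : tab n (nthL b) ≡ b
    b-tab = trans (cong (λ k → tab k (nthL b)) (sym len)) (tab-nthL b)
    rows : ∀ k → 1 ≤ k → k ≤ n → rowOf k Z ≡ upd (upd (nthL b) (suc i) (removeL a y)) i z k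
    rows = tab-inj n _ _ (trans eq (trans (cong (λ q → setAt1 (setAt1 q (suc i) (removeL a y)) i z) (sym b-tab))
             (trans (cong (λ q → setAt1 q i z) (setAt1-tab n (nthL b) (suc i) (removeL a y) (s≤s z≤n)))
               (setAt1-tab n _ i z 1≤i))))
    low : rowOf i Z ≡ z
    low = trans (rows i 1≤i (<⇒≤ i<n)) (upd-same (upd (nthL b) (suc i) (removeL a y)) {i} {i} z refl)
    high : rowOf (suc i) Z ≡ removeL a y
    high = trans (rows (suc i) (s≤s z≤n) i<n) (trans (upd-other (upd (nthL b) (suc i) (removeL a y)) {i} {suc i} z 1+n≢n)
        (upd-same (nthL b) {suc i} {suc i} (removeL a y) refl))
    others : ∀ k → 1 ≤ k → k ≤ n → k ≢ i → k ≢ suc i → rowOf k Z ≡ nthL b k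
    others k p q ne ne' = trans (rows k p q) (trans (upd-other (upd (nthL b) (suc i) (removeL a y)) {i} {k} z ne)
        (upd-other (nthL b) {suc i} {k} (removeL a y) ne'))
    a∈y : member a y ≡ true
    a∈y = maxL-⊆ L (subst (All _) (cong proj₂ pu) (pairUp-⊆ (reverse x) y (all-members y))) mx
    y-strict : Increasing y
    y-strict = nthL-All b (suc i) tt str
    suc≢ : suc a ≢ a
    suc≢ = 1+n≢n
    inLow₀ : member (suc a) y ≡ false → member a (rowOf i Z) ≡ true
    inLow₀ m = trans (cong (member a) low) (trans
        (cong (λ k → member a (insertSorted k x)) (trans (cong (a +_) (sUp-zero a y m)) (+-identityʳ a)))
        (member-insertSorted a x))
    finish : ∀ m → member (suc a) y ≡ m → ∃ λ Z' → Valid 0 0 Z' × Bounded n Z' × EStep i Z' Z × b ≡ fac n Z'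
    finish true m with rowOf-split (suc a) (suc i) Z (trans (cong (member (suc a)) high) (trans (member-removeL y suc≢) m))
    ... | A , B , refl = ⊥-elim (contra (trans (sym inLow) (letter-elsewhere A V i (1+n≢n ∘ sym))))
      where
      contra : true ≢ false
      contra ()
      s1 : sUp a y ≡ 1
      s1 = sUp-one a y m (trans (sym (member-removeL y (λ e → <-irrefl (sym e) (m≤n⇒m≤1+n ≤-refl))))
          (trans (cong (member (suc (suc a))) (sym high)) (successor-elsewhere A V)))
      inLow : member (suc a) (rowOf i Z) ≡ true
      inLow = trans (cong (member (suc a)) low) (trans
          (cong (λ k → member (suc a) (insertSorted k x)) (trans (cong (a +_) s1) (+-comm a 1))) (member-insertSorted (suc a) x))
    finish false m with rowOf-split a i Z (inLow₀ m)
    ... | A , B , refl = Z' , V' , bd' , step (hiSplit i Z') , b≡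
      where
      Z' = A ++ (a , suc i) ∷ B
      A< = proj₁ (Valid-before A V)
      VB = Valid-tail A V
      z≡ : z ≡ insertSorted a x
      z≡ = cong (λ k → insertSorted k x) (trans (cong (a +_) (sUp-zero a y m)) (+-identityʳ a))
      V' : Valid 0 0 Z'
      V' = Valid-flip-up A V (proj₂ (member-++⁻ (rowOf (suc i) A) _
          (trans (cong (member (suc a)) (trans (sym (flip-tgt-hi i A a B)) high)) (trans (member-removeL y suc≢) m))))
        where
        member-++⁻ : ∀ {a} xs ys → member a (xs ++ ys) ≡ false → member a xs ≡ false × member a ys ≡ false
        member-++⁻ [] ys e = refl , e
        member-++⁻ {a} (x ∷ xs) ys e with a ≡ᵇ x
        ... | false = member-++⁻ xs ys e
      bd' : Bounded n Z'
      bd' = Bounded-flip A bd (s≤s z≤n) i<n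
      x≡ : nthL b i ≡ rowOf i Z'
      x≡ = trans (sym (removeL-insertSorted a x)) (trans
          (cong (removeL a) (trans (sym z≡) (trans (sym low) (flip-tgt-lo i A a B))))
             (trans (removeL-mid a _ _ (rowOf-All i A<)) (sym (flip-src-lo i A a B))))
      y≡ : nthL b (suc i) ≡ rowOf (suc i) Z'
      y≡ = trans (sym (insertSorted-removeL a y y-strict a∈y))
          (trans (cong (insertSorted a) (trans (sym high) (flip-tgt-hi i A a B)))
             (trans (insertSorted-mid a _ _ (rowOf-All (suc i) A<) (rowOf-All (suc i) (Valid-lower VB a ≤-refl)))
               (sym (flip-src-hi i A a B))))
      b≡ : b ≡ fac n Z'
      b≡ = trans (sym b-tab) (tab-cong n _ _ same)
        where
        same : ∀ k → 1 ≤ k → k ≤ n → nthL b k ≡ rowOf k Z'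
        same k p q with kind? i k
        ... | lo refl = x≡
        ... | hi refl = y≡
        ... | off ne ne' = trans (sym (others k p q ne ne')) (sym (flip-other i A a B k ne ne'))
      -- That the right letter was moved is not read off from the pairing in `b`: the value of `e_i`
      -- at `fac n Z'` is computed a second time from the splitting, and `fac` is injective.
      step : HiSplit i Z' → EStep i Z' Z
      step (none e) with trans (sym eb) (trans (cong (eRF n i) b≡) (eRF-fac-none 1≤i i<n Z' V' e))
      ... | ()
      step (split A₁ a₁ B₁ e ra lb) = estep e (fac-injective n Z Z″ V V″ bd bd″ fac≡) ra lb
        where
        Z″ = A₁ ++ (a₁ , i) ∷ B₁
        V″ = Valid-flip-down A₁ (subst (Valid 0 0) e V') ra (λ _ z → <-irrefl z 1≤i)
        bd″ = Bounded-flip A₁ (subst (Bounded n) e bd') 1≤i (<⇒≤ i<n)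
        fac≡ : fac n Z ≡ fac n Z″
        fac≡ = just-injective (trans (sym eb) (trans (cong (eRF n i) b≡) (eRF-fac 1≤i i<n V' (estep e refl ra lb))))

-- Commutations and the word of a factorization

Far : ℕ → ℕ → Set
Far a b = suc a < b ⊎ suc b < a

applyS-comm : ∀ a b → Far a b → ∀ x → applyS a (applyS b x) ≡ applyS b (applyS a x)
applyS-comm a b f x with kind? a x | kind? b x
... | lo refl | lo refl = refl
... | lo refl | hi refl = ⊥-elim (far-⊥ f)
  where
  far-⊥ : ¬ Far (suc b) b
  far-⊥ (inj₁ p) = <-asym p (m≤n⇒m≤1+n ≤-refl)
  far-⊥ (inj₂ p) = <-irrefl refl p
... | hi refl | lo refl = ⊥-elim (far-⊥ f)
  where
  far-⊥ : ¬ Far a (suc a)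
  far-⊥ (inj₁ p) = <-irrefl refl p
  far-⊥ (inj₂ p) = <-asym p (m≤n⇒m≤1+n ≤-refl)
... | hi refl | hi refl = refl
... | off p q | off p' q' rewrite applyS-else b p' q' | applyS-else a p q | applyS-else b p' q' = refl
... | lo refl | off p q rewrite applyS-else b p q | applyS-lo a = sym (applyS-else b (s≢ f) (p ∘ suc-injective))
  where
  s≢ : Far a b → suc a ≢ b
  s≢ (inj₁ h) refl = <-irrefl refl h
  s≢ (inj₂ h) refl = <-asym h (m≤n⇒m≤1+n ≤-refl)
... | hi refl | off p q rewrite applyS-else b p q | applyS-hi a = sym (applyS-else b (λ e → q (cong suc e)) (s≢ f))
  where
  s≢ : Far a b → a ≢ suc b
  s≢ (inj₁ h) refl = <-asym h (m≤n⇒m≤1+n ≤-refl)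
  s≢ (inj₂ h) refl = <-irrefl refl h
... | off p q | lo refl rewrite applyS-else a p q | applyS-lo b = applyS-else a (s≢ f) (p ∘ suc-injective)
  where
  s≢ : Far a b → suc b ≢ a
  s≢ (inj₁ h) refl = <-asym h (m≤n⇒m≤1+n ≤-refl)
  s≢ (inj₂ h) refl = <-irrefl refl h
... | off p q | hi refl rewrite applyS-else a p q | applyS-hi b = applyS-else a (λ e → q (cong suc e)) (s≢ f)
  where
  s≢ : Far a b → b ≢ suc a
  s≢ (inj₁ h) refl = <-irrefl refl h
  s≢ (inj₂ h) refl = <-asym h (m≤n⇒m≤1+n ≤-refl)

permOf-++ : ∀ u v x → permOf (u ++ v) x ≡ permOf u (permOf v x)
permOf-++ [] v x = refl
permOf-++ (a ∷ u) v x = cong (applyS a) (permOf-++ u v x)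

permOf-move : ∀ a xs → All (Far a) xs → ∀ v x → permOf (a ∷ xs ++ v) x ≡ permOf (xs ++ a ∷ v) x
permOf-move a [] h v x = refl
permOf-move a (b ∷ xs) (f ∷ h) v x = trans (applyS-comm a b f (permOf (xs ++ v) x)) (cong (applyS b) (permOf-move a xs h v x))

record _≃ʷ_ (u v : List ℕ) : Set where
  field
    same-length : length u ≡ length v
    same-perm : SamePerm u v
    positive : PosWord u → PosWord v
    positive⁻ : PosWord v → PosWord u

≃ʷ-sym : ∀ {u v} → u ≃ʷ v → v ≃ʷ u
≃ʷ-sym e = record { same-length = sym same-length ; same-perm = λ x → sym (same-perm x) ; positive = positive⁻ ; positive⁻ =
  positive }
  where open _≃ʷ_ e

≃ʷ-Reduced : ∀ {u v} → u ≃ʷ v → Reduced u → Reduced v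
≃ʷ-Reduced e (p , m) = positive p , λ w pw sw → subst (_≤ length w) same-length (m w pw (λ x → trans (sw x) (sym (same-perm x))))
  where open _≃ʷ_ e

move-≃ʷ : ∀ u a xs v → All (Far a) xs → (u ++ a ∷ xs ++ v) ≃ʷ (u ++ xs ++ a ∷ v)
move-≃ʷ u a xs v h = record
  { same-length = trans (length-++ u) (trans (cong (length u +_) len) (sym (length-++ u)))
  ; same-perm = λ x → trans (permOf-++ u _ x) (trans (cong (permOf u) (permOf-move a xs h v x)) (sym (permOf-++ u _ x)))
  ; positive = pos
  ; positive⁻ = pos⁻ }
  where
  len : suc (length (xs ++ v)) ≡ length (xs ++ a ∷ v)
  len = trans (cong suc (length-++ xs)) (trans (sym (+-suc (length xs) (length v))) (sym (length-++ xs)))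
  pos : PosWord (u ++ a ∷ xs ++ v) → PosWord (u ++ xs ++ a ∷ v)
  pos p with ++⁻ u p
  ... | pu , (pa ∷ pr) with ++⁻ xs pr
  ...   | px , pv = ++⁺ pu (++⁺ px (pa ∷ pv))
  pos⁻ : PosWord (u ++ xs ++ a ∷ v) → PosWord (u ++ a ∷ xs ++ v)
  pos⁻ p with ++⁻ u p
  ... | pu , pr with ++⁻ xs pr
  ...   | px , (pa ∷ pv) = ++⁺ pu (pa ∷ ++⁺ px pv)

wordOf : ℕ → (ℕ → List ℕ) → List ℕ
wordOf n f = concat (reverse (tab n f))

rangeFrom-++ : ∀ s k m → rangeFrom s (k + m) ≡ rangeFrom s k ++ rangeFrom (s + k) m
rangeFrom-++ s zero m = cong (λ z → rangeFrom z m) (sym (+-identityʳ s))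
rangeFrom-++ s (suc k) m = cong (s ∷_) (trans (rangeFrom-++ (suc s) k m)
    (cong (λ z → rangeFrom (suc s) k ++ rangeFrom z m) (sym (+-suc s k))))

module _ {n i : ℕ} (1≤i : 1 ≤ i) (i<n : i < n) where
  private
    k = i ∸ 1
    m = n ∸ suc i
    n≡ : n ≡ k + suc (suc m)
    n≡ = sym (trans (+-suc k (suc m)) (trans (cong suc (+-suc k m))
        (trans (cong (λ z → suc (z + m)) (trans (+-comm 1 k) (m∸n+n≡m 1≤i)))
           (m+[n∸m]≡n i<n))))
    i≡ : 1 + k ≡ i
    i≡ = trans (+-comm 1 k) (m∸n+n≡m 1≤i)

  wordOf-split : ∀ f → wordOf n f ≡ concat (reverse (map f (rangeFrom (suc (suc i)) m))) ++ f (suc i) ++ f i ++ concat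
      (reverse (map f (range1 k)))
  wordOf-split f = trans (cong (concat ∘ reverse) tab≡) (trans (cong concat (reverse-++ (map f (range1 k)) _))
      (trans (cong concat (cong (_++ reverse (map f (range1 k)))
        (trans (unfold-reverse (f i) (f (suc i) ∷ W)) (cong (_++ [ f i ]) (unfold-reverse (f (suc i)) W)))))
      (trans (cong concat (trans (++-assoc (X ++ [ f (suc i) ]) [ f i ] Y) (++-assoc X [ f (suc i) ] (f i ∷ Y))))
        (sym (concat-++ X (f (suc i) ∷ f i ∷ Y))))))
    where
    W = map f (rangeFrom (suc (suc i)) m)
    X = reverse W
    Y = reverse (map f (range1 k))
    map-++' : ∀ xs ys → map f (xs ++ ys) ≡ map f xs ++ map f ys
    map-++' [] ys = refl
    map-++' (x ∷ xs) ys = cong (f x ∷_) (map-++' xs ys)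
    tab≡ : tab n f ≡ map f (range1 k) ++ f i ∷ f (suc i) ∷ map f (rangeFrom (suc (suc i)) m)
    tab≡ = trans (cong (λ z → tab z f) n≡) (trans (cong (map f) (rangeFrom-++ 1 k (suc (suc m)))) (trans (map-++' (range1 k) _)
             (cong (λ z → map f (range1 k) ++ map f (rangeFrom z (suc (suc m)))) i≡)))

  private
    ys-far : ∀ {a v j B} → Valid a v B → j ≤ v → All (Far a) (rowOf j B)
    ys-far {a} {v} {j} {B} V p = zipAll (rowOf j B) (rowOf-All j (Valid-lower V a ≤-refl)) (successor-free V p)
      where
      zipAll : ∀ xs → All (a <_) xs → member (suc a) xs ≡ false → All (Far a) xs
      zipAll [] _ _ = []
      zipAll (x ∷ xs) (l ∷ ls) e with suc a ≟ x
      ... | yes refl rewrite ≡ᵇ-yes {a} refl = case e of λ ()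
      ... | no ne rewrite ≡ᵇ-no ne = inj₁ (≤∧≢⇒< l ne) ∷ zipAll xs ls e

    xs-far : ∀ {p u} A {a v B} → Valid p u (A ++ (a , v) ∷ B) → All (Far a) (rowOf v A)
    xs-far A {a} {v} V = zipAll (rowOf v A) (rowOf-All v (proj₁ (Valid-before A V))) (predecessor-free A V)
      where
      zipAll : ∀ xs → All (_< a) xs → member (a ∸ 1) xs ≡ false → All (Far a) xs
      zipAll [] _ _ = []
      zipAll (x ∷ xs) (l ∷ ls) e with a ∸ 1 ≟ x
      ... | yes refl rewrite ≡ᵇ-yes {a ∸ 1} refl = case e of λ ()
      ... | no ne rewrite ≡ᵇ-no ne = inj₂ (≤∧≢⇒< l (λ { refl → ne refl })) ∷ zipAll xs ls e

  -- Factor `i + 1` precedes factor `i` in the word. Moving `a` carries it past the letters of `B`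
  -- in factor `i + 1` and those of `A` in factor `i`; validity of `Z` and of `Z'` keeps these at
  -- distance at least two, so only commutations occur.
  EStep-≃ʷ : ∀ {Z Z'} → Valid 0 0 Z → Valid 0 0 Z' → EStep i Z Z' → wordOf n (λ j → rowOf j Z') ≃ʷ wordOf n (λ j → rowOf j Z)
  EStep-≃ʷ V V' (estep {A} {B} {a} refl refl _ _) = ≃ʷ-sym
      (subst₂ _≃ʷ_ (sym left) (sym right) (move-≃ʷ (pre ++ yA) a (yB ++ xA) (xB ++ post) far))
    where
    Z = A ++ (a , suc i) ∷ B
    Z' = A ++ (a , i) ∷ B
    yA = rowOf (suc i) A
    yB = rowOf (suc i) B
    xA = rowOf i A
    xB = rowOf i B
    pre = concat (reverse (map (λ j → rowOf j Z) (rangeFrom (suc (suc i)) m)))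
    post = concat (reverse (map (λ j → rowOf j Z) (range1 k)))
    pre≡ : concat (reverse (map (λ j → rowOf j Z') (rangeFrom (suc (suc i)) m))) ≡ pre
    pre≡ = cong (concat ∘ reverse) (map-range-cong _ _ (suc (suc i)) m
        (λ j p _ → sym (flip-other i A a B j (λ e → <-irrefl (sym e) (<-trans (n<1+n i) p)) (λ e → <-irrefl (sym e) p))))
    post≡ : concat (reverse (map (λ j → rowOf j Z') (range1 k))) ≡ post
    post≡ = cong (concat ∘ reverse) (map-range-cong _ _ 1 k
        (λ j _ p → sym (flip-other i A a B j (λ e → <-irrefl e (subst (j <_) i≡ p))
        (λ e → <-irrefl e (<-trans (subst (j <_) i≡ p) (n<1+n i))))))
    far = ++⁺ (ys-far (Valid-tail A V) ≤-refl) (xs-far A V')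
    left : wordOf n (λ j → rowOf j Z) ≡ (pre ++ yA) ++ a ∷ (yB ++ xA) ++ (xB ++ post)
    left = trans (wordOf-split (λ j → rowOf j Z))
        (trans (cong₂ (λ p q → pre ++ p ++ q ++ post) (flip-src-hi i A a B) (flip-src-lo i A a B))
             (trans (cong (pre ++_) (trans (++-assoc yA (a ∷ yB) _)
               (cong (λ q → yA ++ a ∷ q) (trans (cong (yB ++_) (++-assoc xA xB post)) (sym (++-assoc yB xA _))))))
               (sym (++-assoc pre yA _))))
    right : wordOf n (λ j → rowOf j Z') ≡ (pre ++ yA) ++ (yB ++ xA) ++ a ∷ (xB ++ post)
    right = trans (wordOf-split (λ j → rowOf j Z')) (trans (cong₂ (λ p q → p ++ rowOf (suc i) Z' ++ rowOf i Z' ++ q) pre≡ post≡)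
             (trans (cong₂ (λ p q → pre ++ p ++ q ++ post) (flip-tgt-hi i A a B) (flip-tgt-lo i A a B))
             (trans (cong (pre ++_) (trans (++-assoc yA yB _)
               (cong (yA ++_) (trans (cong (yB ++_) (++-assoc xA (a ∷ xB) post)) (sym (++-assoc yB xA _))))))
               (sym (++-assoc pre yA _)))))

-- The factorization of a key tableau

b2n : Bool → ℕ
b2n b = if b then 1 else 0

-- The letters are consecutive from `b` on, whatever the values are, and grow with them. Read from
-- factor `n` down to factor 1 they form the decreasing word of the column.
colMarks : ℕ → (ℕ → Bool) → ℕ → ℕ → Marked
colMarks b f s zero = []
colMarks b f s (suc m) = if f s then (b , s) ∷ colMarks (suc b) f (suc s) m else colMarks b f (suc s) m

nextLetter : ℕ → (ℕ → Bool) → ℕ → ℕ → ℕ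
nextLetter b f s zero = b
nextLetter b f s (suc k) = nextLetter (b2n (f s) + b) f (suc s) k

colMarks-cong : ∀ b f g s m → (∀ v → s ≤ v → v < s + m → f v ≡ g v) → colMarks b f s m ≡ colMarks b g s m
colMarks-cong b f g s zero h = refl
colMarks-cong b f g s (suc m) h rewrite h s ≤-refl (m<m+n s (s≤s z≤n)) with g s
... | true = cong ((b , s) ∷_) (colMarks-cong (suc b) f g (suc s) m (λ v p q → h v (<⇒≤ p) (subst (v <_) (sym (+-suc s m)) q)))
... | false = colMarks-cong b f g (suc s) m (λ v p q → h v (<⇒≤ p) (subst (v <_) (sym (+-suc s m)) q))

nextLetter-cong : ∀ b f g s m → (∀ v → s ≤ v → v < s + m → f v ≡ g v) → nextLetter b f s m ≡ nextLetter b g s m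
nextLetter-cong b f g s zero h = refl
nextLetter-cong b f g s (suc m) h rewrite h s ≤-refl (m<m+n s (s≤s z≤n)) =
  nextLetter-cong _ f g (suc s) m (λ v p q → h v (<⇒≤ p) (subst (v <_) (sym (+-suc s m)) q))

colMarks-+ : ∀ b f s k m → colMarks b f s (k + m) ≡ colMarks b f s k ++ colMarks (nextLetter b f s k) f (s + k) m
colMarks-+ b f s zero m rewrite +-identityʳ s = refl
colMarks-+ b f s (suc k) m rewrite +-suc s k with f s
... | true = cong ((b , s) ∷_) (colMarks-+ (suc b) f (suc s) k m)
... | false = colMarks-+ b f (suc s) k m

colMarks-values : ∀ b f s m → All (λ z → s ≤ proj₂ z × proj₂ z < s + m) (colMarks b f s m)
colMarks-values b f s zero = []
colMarks-values b f s (suc m) with f s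
... | true = (≤-refl , m<m+n s (s≤s z≤n)) ∷ All-map (λ { (p , q) → <⇒≤ p , ≤-trans q (≤-reflexive (sym (+-suc s m))) })
    (colMarks-values (suc b) f (suc s) m)
... | false = All-map (λ { (p , q) → <⇒≤ p , ≤-trans q (≤-reflexive (sym (+-suc s m))) }) (colMarks-values b f (suc s) m)

colMarks-letters : ∀ b f s m → All (λ z → b ≤ proj₁ z × proj₁ z < b + m) (colMarks b f s m)
colMarks-letters b f s zero = []
colMarks-letters b f s (suc m) with f s
... | true = (≤-refl , m<m+n b (s≤s z≤n)) ∷ All-map (λ { (p , q) → <⇒≤ p , ≤-trans q (≤-reflexive (sym (+-suc b m))) })
    (colMarks-letters (suc b) f (suc s) m)
... | false = All-map (λ { (p , q) → p , <-trans q (+-monoʳ-< b ≤-refl) }) (colMarks-letters b f (suc s) m)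

colMarks-Valid : ∀ {p u} b f s m R → p < b → (b ≡ suc p → u < s) → (∀ q w → q < b + m → Valid q w R) → Valid p u
    (colMarks b f s m ++ R)
colMarks-Valid {p} {u} b f s zero R h h' k = k p u (subst (p <_) (sym (+-identityʳ b)) h)
colMarks-Valid b f s (suc m) R h h' k with f s
... | true = (h , h') ∷ colMarks-Valid (suc b) f (suc s) m R ≤-refl (λ _ → ≤-refl)
    (λ q w l → k q w (subst (q <_) (sym (+-suc b m)) l))
... | false = colMarks-Valid b f (suc s) m R h (λ e → m≤n⇒m≤1+n (h' e)) (λ q w l → k q w (<-trans l (+-monoʳ-< b ≤-refl)))

colMarks-injective : ∀ b f g s m → colMarks b f s m ≡ colMarks b g s m → ∀ v → s ≤ v → v < s + m → f v ≡ g v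
colMarks-injective b f g s zero e v p q = ⊥-elim (<⇒≱ q (subst (_≤ v) (sym (+-identityʳ s)) p))
colMarks-injective b f g s (suc m) e v p q with f s in ef | g s in eg
... | true | true = head (m≤n⇒m<n∨m≡n p)
  where
  head : s < v ⊎ s ≡ v → f v ≡ g v
  head (inj₁ l) = colMarks-injective (suc b) f g (suc s) m (∷-injectiveʳ e) v l (subst (v <_) (+-suc s m) q)
  head (inj₂ refl) = trans ef (sym eg)
... | false | false = head (m≤n⇒m<n∨m≡n p)
  where
  head : s < v ⊎ s ≡ v → f v ≡ g v
  head (inj₁ l) = colMarks-injective b f g (suc s) m e v l (subst (v <_) (+-suc s m) q)
  head (inj₂ refl) = trans ef (sym eg)
... | true | false with subst (All _) (sym e) (colMarks-values b g (suc s) m)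
...   | (l , _) ∷ _ = ⊥-elim (<-irrefl refl l)
colMarks-injective b f g s (suc m) e v p q | false | true with subst (All _) e (colMarks-values b f (suc s) m)
...   | (l , _) ∷ _ = ⊥-elim (<-irrefl refl l)

none-row : ∀ {s Z} → All (λ z → proj₂ z ≢ s) Z → length (rowOf s Z) ≡ 0
none-row [] = refl
none-row {s} {(a , w) ∷ Z} (ne ∷ h) rewrite rowOf-no {s} {a} Z ne = none-row h

colMarks-row : ∀ b f s m v → s ≤ v → v < s + m → length (rowOf v (colMarks b f s m)) ≡ b2n (f v)
colMarks-row b f s zero v p q = ⊥-elim (<⇒≱ q (subst (_≤ v) (sym (+-identityʳ s)) p))
colMarks-row b f s (suc m) v p q with m≤n⇒m<n∨m≡n p
colMarks-row b f s (suc m) v p q | inj₁ l with f s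
... | true rewrite rowOf-no {v} {b} (colMarks (suc b) f (suc s) m) (<⇒≢ l) = colMarks-row (suc b) f (suc s) m v l
    (subst (v <_) (+-suc s m) q)
... | false = colMarks-row b f (suc s) m v l (subst (v <_) (+-suc s m) q)
colMarks-row b f s (suc m) v p q | inj₂ refl with f s
... | true rewrite rowOf-yes {s} {b} (colMarks (suc b) f (suc s) m) refl =
  cong suc (none-row (All-map (λ { (l , _) e → <-irrefl (sym e) l }) (colMarks-values (suc b) f (suc s) m)))
... | false = none-row (All-map (λ { (l , _) e → <-irrefl (sym e) l }) (colMarks-values b f (suc s) m))

module _ (i : ℕ) where
  Neutral : Marked → Set
  Neutral = All (λ z → proj₂ z ≢ i × proj₂ z ≢ suc i)

  Ls-neutral : ∀ {A} R → Neutral A → Ls i (A ++ R) ≡ Ls i R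
  Ls-neutral R [] = refl
  Ls-neutral {(a , v) ∷ A} R ((p , q) ∷ h) = trans (Ls-off (A ++ R) p q) (Ls-neutral R h)

  Rs-neutral : ∀ {A} R → Neutral A → Rs i (A ++ R) ≡ Rs i R
  Rs-neutral R [] = refl
  Rs-neutral {(a , v) ∷ A} R ((p , q) ∷ h) = trans (Rs-off (A ++ R) p q) (Rs-neutral R h)

  Rs-neutralʳ : ∀ Y {A} → Neutral A → Rs i (Y ++ A) ≡ Rs i Y
  Rs-neutralʳ Y {A} h = trans (Rs-++ i Y A) (cong₂ (λ R L → R ++ drop (length L) (Rs i Y))
    (trans (cong (Rs i) (sym (++-identityʳ A))) (Rs-neutral [] h)) (trans (cong (Ls i) (sym (++-identityʳ A))) (Ls-neutral [] h)))

module _ {n i : ℕ} (1≤i : 1 ≤ i) (i<n : i < n) (b : ℕ) (f : ℕ → Bool) where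
  private
    k = i ∸ 1
    m = n ∸ suc i
    i≡ : 1 + k ≡ i
    i≡ = trans (+-comm 1 k) (m∸n+n≡m 1≤i)
    n≡ : n ≡ k + suc (suc m)
    n≡ = sym (trans (+-suc k (suc m)) (trans (cong suc (+-suc k m)) (trans (cong (λ z → suc (z + m)) i≡) (m+[n∸m]≡n i<n))))

  lowPart : Marked
  lowPart = colMarks b f 1 k

  midLetter : ℕ
  midLetter = nextLetter b f 1 k

  highPart : ℕ → Marked
  highPart b' = colMarks b' f (suc (suc i)) m

  column-split : colMarks b f 1 n ≡ lowPart ++ colMarks midLetter f i (suc (suc m))
  column-split = trans (cong (colMarks b f 1) n≡)
      (trans (colMarks-+ b f 1 k (suc (suc m))) (cong (λ z → lowPart ++ colMarks midLetter f z (suc (suc m))) i≡))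

  lowPart-neutral : Neutral i lowPart
  lowPart-neutral = All-map (λ { (_ , q) → (λ e → <-irrefl e (subst (_ <_) i≡ q)) ,
      (λ e → <-irrefl e (<-trans (subst (_ <_) i≡ q) (n<1+n i))) }) (colMarks-values b f 1 k)

  highPart-neutral : ∀ b' → Neutral i (highPart b')
  highPart-neutral b' = All-map (λ { (p , _) → (λ e → <-irrefl (sym e) (<-trans (n<1+n i) p)) , (λ e → <-irrefl (sym e) p) })
      (colMarks-values b' f (suc (suc i)) m)

  -- Marks with values other than `i` and `i + 1` are neutral, and the `i` of a column precedes its
  -- `i + 1`; this is the recursion of `lcF`.
  column-lc : ∀ R → length (Ls i (colMarks b f 1 n ++ R)) ≡ (b2n (f (suc i)) + length (Ls i R)) ∸ b2n (f i)
  column-lc R = trans (cong length (trans (cong (Ls i) (trans (cong (_++ R) column-split) (++-assoc lowPart _ R)))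
      (Ls-neutral i _ lowPart-neutral))) mid
    where
    a = midLetter
    mid : length (Ls i (colMarks a f i (suc (suc m)) ++ R)) ≡ (b2n (f (suc i)) + length (Ls i R)) ∸ b2n (f i)
    mid with f i | f (suc i)
    ... | true | true = cong length (trans (Ls-lo {i} {a} {i} ((suc a , suc i) ∷ highPart (suc (suc a)) ++ R) refl)
        (cong (drop 1) (trans (Ls-hi {i} {suc a} {suc i} (highPart (suc (suc a)) ++ R) refl)
        (cong (suc a ∷_) (Ls-neutral i R (highPart-neutral _))))))
    ... | true | false = trans (cong length (trans (Ls-lo {i} {a} {i} (highPart (suc a) ++ R) refl)
        (cong (drop 1) (Ls-neutral i R (highPart-neutral _))))) (length-drop 1 (Ls i R))
    ... | false | true = cong length (trans (Ls-hi {i} {a} {suc i} (highPart (suc a) ++ R) refl)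
        (cong (a ∷_) (Ls-neutral i R (highPart-neutral _))))
    ... | false | false = cong length (Ls-neutral i R (highPart-neutral _))

  column-rc : ∀ R → length (Rs i (colMarks b f 1 n ++ R)) ≡ length (Rs i R) + (b2n (f i) ∸ (b2n (f (suc i)) + length (Ls i R)))
  column-rc R = trans (cong length (trans (cong (Rs i) (trans (cong (_++ R) column-split) (++-assoc lowPart _ R)))
      (Rs-neutral i _ lowPart-neutral))) mid
    where
    a = midLetter
    openLen : ∀ L S → length (openMark L S a) ≡ length S + (1 ∸ length L)
    openLen [] S = length-++ S
    openLen (x ∷ L) S = sym (trans (cong (length S +_) (0∸n≡0 (length L))) (+-identityʳ _))
    mid : length (Rs i (colMarks a f i (suc (suc m)) ++ R)) ≡ length (Rs i R) + (b2n (f i) ∸ (b2n (f (suc i)) + length (Ls i R)))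
    mid with f i | f (suc i)
    ... | true | true = trans (cong length (trans (Rs-lo {i} {a} {i} ((suc a , suc i) ∷ highPart (suc (suc a)) ++ R) refl)
        (trans (openMark-cons _ a (Ls-hi {i} {suc a} {suc i} (highPart (suc (suc a)) ++ R) refl))
        (trans (Rs-hi {i} {suc a} {suc i} (highPart (suc (suc a)) ++ R) refl) (Rs-neutral i R (highPart-neutral _))))))
            (sym (trans (cong (length (Rs i R) +_) (0∸n≡0 (length (Ls i R)))) (+-identityʳ _)))
    ... | true | false = trans (cong length (trans (Rs-lo {i} {a} {i} (highPart (suc a) ++ R) refl)
        (cong₂ (λ L S → openMark L S a) (Ls-neutral i R (highPart-neutral _)) (Rs-neutral i R (highPart-neutral _)))))
        (openLen (Ls i R) (Rs i R))
    ... | false | true = trans (cong length (trans (Rs-hi {i} {a} {suc i} (highPart (suc a) ++ R) refl)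
        (Rs-neutral i R (highPart-neutral _)))) (sym (+-identityʳ _))
    ... | false | false = trans (cong length (Rs-neutral i R (highPart-neutral _)))
        (sym (trans (cong (length (Rs i R) +_) (0∸n≡0 (length (Ls i R)))) (+-identityʳ _)))

  column-hi : f i ≡ false → f (suc i) ≡ true → colMarks b f 1 n ≡ lowPart ++ (midLetter , suc i) ∷ highPart (suc midLetter)
  column-hi e e' = trans column-split (cong (lowPart ++_) mid)
    where
    mid : colMarks midLetter f i (suc (suc m)) ≡ (midLetter , suc i) ∷ highPart (suc midLetter)
    mid rewrite e | e' = refl

  column-lo : f i ≡ true → f (suc i) ≡ false → colMarks b f 1 n ≡ lowPart ++ (midLetter , i) ∷ highPart (suc midLetter)
  column-lo e e' = trans column-split (cong (lowPart ++_) mid)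
    where
    mid : colMarks midLetter f i (suc (suc m)) ≡ (midLetter , i) ∷ highPart (suc midLetter)
    mid rewrite e | e' = refl

column-parts-cong : ∀ {n i} (1≤i : 1 ≤ i) (i<n : i < n) b f g → (∀ v → v ≢ i → v ≢ suc i → f v ≡ g v) →
  lowPart 1≤i i<n b f ≡ lowPart 1≤i i<n b g × midLetter 1≤i i<n b f ≡ midLetter 1≤i i<n b g ×
  (∀ b' → highPart 1≤i i<n b f b' ≡ highPart 1≤i i<n b g b')
column-parts-cong {n} {i} 1≤i i<n b f g h = colMarks-cong b f g 1 (i ∸ 1) lows , nextLetter-cong b f g 1 (i ∸ 1) lows ,
  (λ b' → colMarks-cong b' f g (suc (suc i)) (n ∸ suc i)
    (λ v p _ → h v (λ e → <-irrefl (sym e) (<-trans (n<1+n i) p)) (λ e → <-irrefl (sym e) p)))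
  where
  i≡ : 1 + (i ∸ 1) ≡ i
  i≡ = trans (+-comm 1 (i ∸ 1)) (m∸n+n≡m 1≤i)
  lows : ∀ v → 1 ≤ v → v < 1 + (i ∸ 1) → f v ≡ g v
  lows v _ q = h v (λ e → <-irrefl e (subst (v <_) i≡ q)) (λ e → <-irrefl e (<-trans (subst (v <_) i≡ q) (n<1+n i)))

-- The letters of different columns are never consecutive, and every letter is used once: the word of a factorization is reduced,
-- and the shifts t and s of the crystal operators vanish.
firstLetter : ℕ → ℕ → ℕ
firstLetter n c = suc c * suc (suc n)

Zfrom : ℕ → (ℕ → ℕ → Bool) → ℕ → ℕ → Marked
Zfrom n g c zero = []
Zfrom n g c (suc k) = colMarks (firstLetter n c) (g c) 1 n ++ Zfrom n g (suc c) k

Zfrom-cong : ∀ n g h c k → (∀ c' v → c ≤ c' → c' < c + k → 1 ≤ v → g c' v ≡ h c' v) → Zfrom n g c k ≡ Zfrom n h c k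
Zfrom-cong n g h c zero e = refl
Zfrom-cong n g h c (suc k) e = cong₂ _++_ (colMarks-cong _ (g c) (h c) 1 n (λ v p _ → e c v ≤-refl (m<m+n c (s≤s z≤n)) p))
  (Zfrom-cong n g h (suc c) k (λ c' v p q → e c' v (<⇒≤ p) (subst (c' <_) (sym (+-suc c k)) q)))

Zfrom-+ : ∀ n g c j k → Zfrom n g c (j + k) ≡ Zfrom n g c j ++ Zfrom n g (c + j) k
Zfrom-+ n g c zero k = cong (λ z → Zfrom n g z k) (sym (+-identityʳ c))
Zfrom-+ n g c (suc j) k = trans (cong (colMarks (firstLetter n c) (g c) 1 n ++_)
    (trans (Zfrom-+ n g (suc c) j k) (cong (λ z → Zfrom n g (suc c) j ++ Zfrom n g z k) (sym (+-suc c j)))))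
  (sym (++-assoc (colMarks (firstLetter n c) (g c) 1 n) _ _))

private
  -- A column takes at most `n` letters from a block of `n + 2`, so letters of different columns
  -- differ by at least two.
  next-gap : ∀ n c {q} → q < firstLetter n c + n → suc q < firstLetter n (suc c)
  next-gap n c {q} l = s≤s (s≤s (subst (q ≤_) (+-comm (firstLetter n c) n) (<⇒≤ l)))

Zfrom-Valid : ∀ n g c k {p u} → suc p < firstLetter n c → Valid p u (Zfrom n g c k)
Zfrom-Valid n g c zero l = []
Zfrom-Valid n g c (suc k) {p} l = colMarks-Valid (firstLetter n c) (g c) 1 n _ (<-trans (n<1+n p) l)
    (λ e → ⊥-elim (<-irrefl (sym e) l))
  (λ q w h → Zfrom-Valid n g (suc c) k (next-gap n c h))

Zfrom-Bounded : ∀ n g c k → Bounded n (Zfrom n g c k)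
Zfrom-Bounded n g c zero = []
Zfrom-Bounded n g c (suc k) = ++⁺ (All-map (λ { (p , q) → p , ≤-pred q }) (colMarks-values _ (g c) 1 n))
    (Zfrom-Bounded n g (suc c) k)

++-split : ∀ B (A A' R R' : Marked) → All (λ z → proj₁ z < B) A → All (λ z → proj₁ z < B) A' → All (λ z → B ≤ proj₁ z) R → All
  (λ z → B ≤ proj₁ z) R' →
  A ++ R ≡ A' ++ R' → A ≡ A' × R ≡ R'
++-split B [] [] R R' _ _ _ _ e = refl , e
++-split B [] (z ∷ A') (y ∷ R) R' _ (p ∷ _) (q ∷ _) _ refl = ⊥-elim (<⇒≱ p q)
++-split B (z ∷ A) [] R (y ∷ R') (p ∷ _) _ _ (q ∷ _) refl = ⊥-elim (<⇒≱ p q)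
++-split B (z ∷ A) (z' ∷ A') R R' (_ ∷ h) (_ ∷ h') r r' e with ∷-injective e
... | refl , e' with ++-split B A A' R R' h h' r r' e'
...   | refl , refl = refl , refl

Zfrom-letters : ∀ n g c k → All (λ z → firstLetter n c ≤ proj₁ z) (Zfrom n g c k)
Zfrom-letters n g c zero = []
Zfrom-letters n g c (suc k) = ++⁺ (All-map proj₁ (colMarks-letters _ (g c) 1 n))
  (All-map (≤-trans (m≤n+m (firstLetter n c) (suc (suc n)))) (Zfrom-letters n g (suc c) k))

column-letters : ∀ n f c → All (λ z → proj₁ z < firstLetter n (suc c)) (colMarks (firstLetter n c) f 1 n)
column-letters n f c = All-map (λ { (_ , l) → <-trans (n<1+n _) (next-gap n c l) }) (colMarks-letters (firstLetter n c) f 1 n)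

Zfrom-injective : ∀ n g h c k → Zfrom n g c k ≡ Zfrom n h c k → ∀ c' v → c ≤ c' → c' < c + k → 1 ≤ v → v ≤ n → g c' v ≡ h c' v
Zfrom-injective n g h c zero e c' v p q = ⊥-elim (<⇒≱ q (subst (_≤ c') (sym (+-identityʳ c)) p))
Zfrom-injective n g h c (suc k) e c' v p q 1≤v v≤n
  with ++-split (firstLetter n (suc c)) _ _ _ _ (column-letters n (g c) c) (column-letters n (h c) c)
      (Zfrom-letters n g (suc c) k) (Zfrom-letters n h (suc c) k) e
... | e₁ , e₂ with m≤n⇒m<n∨m≡n p
...   | inj₂ refl = colMarks-injective _ (g c) (h c) 1 n e₁ v 1≤v (s≤s v≤n)
...   | inj₁ l = Zfrom-injective n g h (suc c) k e₂ c' v l (subst (c' <_) (+-suc c k) q) 1≤v v≤n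

pres : ℕ → (ℕ → ℕ → ℕ) → ℕ → ℕ → Bool
pres n x c v = 0 <ᵇ occ n x c v

marks : ℕ → ℕ → (ℕ → ℕ → ℕ) → Marked
marks n C x = Zfrom n (pres n x) 0 C

marks-Valid : ∀ n C x → Valid 0 0 (marks n C x)
marks-Valid n C x = Zfrom-Valid n _ 0 C (s≤s (s≤s z≤n))

marks-Bounded : ∀ n C x → Bounded n (marks n C x)
marks-Bounded n C x = Zfrom-Bounded n _ 0 C

marks-cong : ∀ n C x y → (∀ c v → 1 ≤ v → occ n x c v ≡ occ n y c v) → marks n C x ≡ marks n C y
marks-cong n C x y h = Zfrom-cong n _ _ 0 C (λ c v _ _ p → cong (0 <ᵇ_) (h c v p))

b2n-pres : ∀ {n x c v} → occ n x c v ≤ 1 → b2n (pres n x c v) ≡ occ n x c v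
b2n-pres {n} {x} {c} {v} h with occ n x c v
... | zero = refl
... | suc zero = refl
b2n-pres (s≤s ()) | suc (suc _)

length≡0 : ∀ {A : Set} {xs : List A} → length xs ≡ 0 → xs ≡ []
length≡0 {xs = []} _ = refl

module Sig (n : ℕ) (x : ℕ → ℕ → ℕ) (i : ℕ) =
  Brackets (λ c → occ n x c (suc i)) (λ c → occ n x c i) (hgt n x (suc i)) (hgt n x i) (λ _ → refl) (λ _ → refl)

module _ {n i : ℕ} (1≤i : 1 ≤ i) (i<n : i < n) (x : ℕ → ℕ → ℕ) (occ≤ : ∀ c v → 1 ≤ v → occ n x c v ≤ 1) where
  open Sig n x i

  Zfrom-lc : ∀ c k → length (Ls i (Zfrom n (pres n x) c k)) ≡ lcF c k
  Zfrom-lc c zero = refl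
  Zfrom-lc c (suc k) = trans (column-lc 1≤i i<n (firstLetter n c) (pres n x c) _)
    (cong₂ _∸_ (cong₂ _+_ (b2n-pres {n} {x} {c} (occ≤ c (suc i) (s≤s z≤n))) (Zfrom-lc (suc c) k))
      (b2n-pres {n} {x} {c} (occ≤ c i 1≤i)))

  Zfrom-rc : ∀ c k → length (Rs i (Zfrom n (pres n x) c k)) ≡ rcF c k
  Zfrom-rc c zero = refl
  Zfrom-rc c (suc k) = trans (column-rc 1≤i i<n (firstLetter n c) (pres n x c) _)
    (cong₂ _+_ (Zfrom-rc (suc c) k) (cong₂ _∸_ (b2n-pres {n} {x} {c} (occ≤ c i 1≤i))
      (cong₂ _+_ (b2n-pres {n} {x} {c} (occ≤ c (suc i) (s≤s z≤n))) (Zfrom-lc (suc c) k))))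

  -- Column `d` has exactly one of `i` and `i + 1` before and after, so it keeps its number of
  -- entries below and above this pair: no letter is renamed, and one letter changes its value.
  colStep⇒EStep : ∀ {C d k y} → C ≡ d + suc k → ColStep n i d x y → Rs i (Zfrom n (pres n x) 0 d) ≡ [] → Ls i
      (Zfrom n (pres n x) (suc d) k) ≡ [] →
    EStep i (marks n C x) (marks n C y)
  colStep⇒EStep {C} {d} {k} {y} refl S r l = estep src tgt
      (trans (Rs-neutralʳ i Z₁ (lowPart-neutral 1≤i i<n b f)) r)
      (trans (Ls-neutral i Z₂ (highPart-neutral 1≤i i<n b f _)) l)
    where
    open ColStep S
    f = pres n x d
    g = pres n y d
    b = firstLetter n d
    Z₁ = Zfrom n (pres n x) 0 d
    Z₂ = Zfrom n (pres n x) (suc d) k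
    a = midLetter 1≤i i<n b f
    A = Z₁ ++ lowPart 1≤i i<n b f
    B = highPart 1≤i i<n b f (suc a) ++ Z₂
    src : marks n (d + suc k) x ≡ A ++ (a , suc i) ∷ B
    src = trans (Zfrom-+ n _ 0 d (suc k)) (trans (cong (λ z → Z₁ ++ (z ++ Z₂))
        (column-hi 1≤i i<n b f (cong (0 <ᵇ_) x-lo) (cong (0 <ᵇ_) x-hi)))
            (trans (cong (Z₁ ++_) (++-assoc (lowPart 1≤i i<n b f) _ Z₂)) (sym (++-assoc Z₁ _ _))))
    parts = column-parts-cong 1≤i i<n b g f (λ v p q → cong (0 <ᵇ_) (at v p q))
    tgt : marks n (d + suc k) y ≡ A ++ (a , i) ∷ B
    tgt = trans (Zfrom-+ n _ 0 d (suc k)) (trans (cong₂ (λ p q → p ++ colMarks b g 1 n ++ q)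
              (Zfrom-cong n _ _ 0 d (λ c v _ q _ → cong (0 <ᵇ_) (away c v (λ e → <-irrefl e q))))
              (Zfrom-cong n _ _ (suc d) k (λ c v q _ _ → cong (0 <ᵇ_) (away c v (λ e → <-irrefl (sym e) q)))))
            (trans (cong (λ z → Z₁ ++ (z ++ Z₂)) (trans (column-lo 1≤i i<n b g (cong (0 <ᵇ_) y-lo) (cong (0 <ᵇ_) y-hi))
                     (trans (cong₂ (λ p q → p ++ (q , i) ∷ highPart 1≤i i<n b g (suc q)) (proj₁ parts) (proj₁ (proj₂ parts)))
                            (cong (λ z → lowPart 1≤i i<n b f ++ (a , i) ∷ z) (proj₂ (proj₂ parts) (suc a))))))
            (trans (cong (Z₁ ++_) (++-assoc (lowPart 1≤i i<n b f) _ Z₂)) (sym (++-assoc Z₁ _ _)))))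

Zfrom-row : ∀ n x v → 1 ≤ v → v ≤ n → (∀ c → occ n x c v ≤ 1) → ∀ c k → length (rowOf v (Zfrom n (pres n x) c k)) + hgt n x v c ≡
    hgt n x v (c + k)
Zfrom-row n x v p q h c zero = cong (hgt n x v) (sym (+-identityʳ c))
Zfrom-row n x v p q h c (suc k) = begin
  length (rowOf v (col ++ rest)) + hgt n x v c ≡⟨ cong (λ z → length z + hgt n x v c) (rowOf-++ v col rest) ⟩
  length (rowOf v col ++ rowOf v rest) + hgt n x v c ≡⟨ cong (_+ hgt n x v c) (length-++ (rowOf v col)) ⟩
  (length (rowOf v col) + length (rowOf v rest)) + hgt n x v c ≡⟨ cong (λ z → (z + length (rowOf v rest)) + hgt n x v c)
    (trans (colMarks-row _ (pres n x c) 1 n v p (s≤s q)) (b2n-pres {n} {x} {c} (h c))) ⟩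
  (occ n x c v + length (rowOf v rest)) + hgt n x v c ≡⟨ cong (_+ hgt n x v c) (+-comm (occ n x c v) _) ⟩
  (length (rowOf v rest) + occ n x c v) + hgt n x v c ≡⟨ +-assoc (length (rowOf v rest)) (occ n x c v) (hgt n x v c) ⟩
  length (rowOf v rest) + hgt n x v (suc c) ≡⟨ Zfrom-row n x v p q h (suc c) k ⟩
  hgt n x v (suc c + k) ≡⟨ cong (hgt n x v) (sym (+-suc c k)) ⟩
  hgt n x v (c + suc k) ∎
  where
  open ≡-Reasoning
  col = colMarks (firstLetter n c) (pres n x c) 1 n
  rest = Zfrom n (pres n x) (suc c) k

marks-row : ∀ n C x v → 1 ≤ v → v ≤ n → (∀ c → occ n x c v ≤ 1) → length (rowOf v (marks n C x)) ≡ hgt n x v C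
marks-row n C x v p q h = trans (sym (+-identityʳ _)) (Zfrom-row n x v p q h 0 C)

-- Tableaux given by rows and their raising operators

val : Tab → ℕ → ℕ → ℕ
val t r c = nthN0 (nthL t (suc r)) c

rowLen : Tab → ℕ → ℕ
rowLen t r = length (nthL t (suc r))

data NthView {A : Set} (xs : List A) (k : ℕ) : Maybe A → Set where
  inside  : ∀ {v} → k < length xs → NthView xs k (just v)
  outside : length xs ≤ k → NthView xs k nothing

nthView : ∀ {A : Set} (xs : List A) k → NthView xs k (nth0 xs k)
nthView [] k = outside z≤n
nthView (x ∷ xs) zero = inside (s≤s z≤n)
nthView (x ∷ xs) (suc k) with nth0 xs k | nthView xs k
... | _ | inside p = inside (s≤s p)
... | _ | outside p = outside (s≤s p)

data EntryView (t : Tab) (r c : ℕ) : Maybe ℕ → ℕ → Set where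
  box  : ∀ {v} → r < length t → c < rowLen t r → EntryView t r c (just v) v
  void : rowLen t r ≤ c → EntryView t r c nothing 0

entryView : ∀ t r c → EntryView t r c (entry t (suc r) (suc c)) (val t r c)
entryView t r c with nth0 t r in e | nthView t r
... | nothing | outside p = void (subst (λ z → z ≤ c) (sym len) z≤n)
  where
  len : rowLen t r ≡ 0
  len rewrite e = refl
... | just row | inside p with nth0 row c | nthView row c
...   | just v | inside q = box p (subst (c <_) (sym len) q)
  where
  len : rowLen t r ≡ length row
  len rewrite e = refl
...   | nothing | outside q = void (subst (_≤ c) (sym len) q)
  where
  len : rowLen t r ≡ length row
  len rewrite e = refl

rowLen-shape : ∀ t r → nthN0 (map length t) r ≡ rowLen t r
rowLen-shape [] r = refl
rowLen-shape (x ∷ t) zero = refl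
rowLen-shape (x ∷ t) (suc r) = rowLen-shape t r

rowLen≤maxCol : ∀ t r → rowLen t r ≤ maxCol t
rowLen≤maxCol [] r = z≤n
rowLen≤maxCol (x ∷ t) zero = m≤m⊔n (length x) (maxCol t)
rowLen≤maxCol (x ∷ t) (suc r) = ≤-trans (rowLen≤maxCol t r) (m≤n⊔m (length x) (maxCol t))

val-out : ∀ t r c → rowLen t r ≤ c → val t r c ≡ 0
val-out t r c p with entry t (suc r) (suc c) | val t r c | entryView t r c
... | _ | _ | box _ q = ⊥-elim (<⇒≱ q p)
... | _ | _ | void _ = refl

entry-just : ∀ t r c → c < rowLen t r → entry t (suc r) (suc c) ≡ just (val t r c) × r < length t
entry-just t r c p with entry t (suc r) (suc c) | val t r c | entryView t r c
... | _ | _ | box q _ = refl , q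
... | _ | _ | void q = ⊥-elim (<⇒≱ p q)

allB-range⁻ : ∀ p s m → T (allB p (rangeFrom s m)) → ∀ j → s ≤ j → j < s + m → T (p j)
allB-range⁻ p s zero h j a b = ⊥-elim (<⇒≱ b (subst (_≤ j) (sym (+-identityʳ s)) a))
allB-range⁻ p s (suc m) h j a b with T-∧⁻ {p s} h | m≤n⇒m<n∨m≡n a
... | h₁ , h₂ | inj₂ refl = h₁
... | h₁ , h₂ | inj₁ l = allB-range⁻ p (suc s) m h₂ j l (subst (j <_) (+-suc s m) b)

allB-range⁺ : ∀ p s m → (∀ j → s ≤ j → j < s + m → T (p j)) → T (allB p (rangeFrom s m))
allB-range⁺ p s zero h = tt
allB-range⁺ p s (suc m) h = T-∧⁺ (h s ≤-refl (m<m+n s (s≤s z≤n)))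
    (allB-range⁺ p (suc s) m (λ j a b → h j (<⇒≤ a) (subst (j <_) (sym (+-suc s m)) b)))

listEq⁻ : ∀ xs ys → T (listEqℕ xs ys) → xs ≡ ys
listEq⁻ [] [] h = refl
listEq⁻ (x ∷ xs) (y ∷ ys) h with T-∧⁻ {x ≡ᵇ y} h
... | a , b = cong₂ _∷_ (≡ᵇ⇒≡ x y a) (listEq⁻ xs ys b)

listEq⁺ : ∀ xs → T (listEqℕ xs xs)
listEq⁺ [] = tt
listEq⁺ (x ∷ xs) = T-∧⁺ {x ≡ᵇ x} (≡⇒≡ᵇ x x refl) (listEq⁺ xs)

boxes⁻ : ∀ t p → T (allBoxesIdx t p) → ∀ r c → r < length t → c < maxCol t → T (p (suc r) (suc c))
boxes⁻ t p h r c a b = allB-range⁻ _ 1 _ (allB-range⁻ _ 1 _ h (suc r) (s≤s z≤n) (s≤s a)) (suc c) (s≤s z≤n) (s≤s b)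

boxes⁺ : ∀ t p → (∀ r c → T (p (suc r) (suc c))) → T (allBoxesIdx t p)
boxes⁺ t p h = allB-range⁺ _ 1 (length t) λ { (suc r) _ _ → allB-range⁺ _ 1 (maxCol t) λ { (suc c) _ _ → h r c } }

pairs⁻ : ∀ t (p : ℕ → ℕ → ℕ → Bool) → T (allRowPairs t (λ i k → allB (p i k) (range1 (maxCol t)))) →
  ∀ l k c → l < k → k < length t → c < maxCol t → T (p (suc l) (suc k) (suc c))
pairs⁻ t p h l k c a b d = allB-range⁻ _ 1 _ (allB-range⁻ _ (suc (suc l)) _
    (allB-range⁻ _ 1 _ h (suc l) (s≤s z≤n) (s≤s (<-trans a b)))
  (suc k) (s≤s a) (s≤s (subst (suc k ≤_) (sym (m+[n∸m]≡n (<-trans a b))) b))) (suc c) (s≤s z≤n) (s≤s d)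

pairs⁺ : ∀ t (p : ℕ → ℕ → ℕ → Bool) → (∀ l k c → l < k → T (p (suc l) (suc k) (suc c))) →
  T (allRowPairs t (λ i k → allB (p i k) (range1 (maxCol t))))
pairs⁺ t p h = allB-range⁺ _ 1 (length t) λ { (suc l) _ _ → allB-range⁺ _ (suc (suc l)) (length t ∸ suc l)
  λ { (suc k) a _ → allB-range⁺ _ 1 (maxCol t) λ { (suc c) _ _ → h l k c (≤-pred a) } } }

-- The predicates of the key condition are reached through a unification variable, since its local function is not exported.
keyCond-pred : ∀ t → Σ (ℕ → ℕ → ℕ → ℕ → ℕ → Bool) λ F →
  keyCondB t ≡ allRowPairs t (λ i k → allB (λ j → onE2 (entry t i j) (entry t k j) (λ u v → F i k j u v)) (range1 (maxCol t)))
keyCond-pred t = _ , refl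

keyNext : Maybe ℕ → ℕ → Bool
keyNext (just w) v = v <ᵇ w
keyNext nothing v = false

keyCond-unfold : ∀ t i k j u v → proj₁ (keyCond-pred t) i k j u v ≡ (if v <ᵇ u then keyNext (entry t i (suc j)) v else true)
keyCond-unfold t i k j u v with entry t i (suc j)
... | just w = refl
... | nothing = refl

module _ {n : ℕ} {α : List ℕ} {φ : ℕ → ℕ} {t : Tab} (len : length α ≤ n) where

  SSKT-shape : SSKT α φ t → map length t ≡ α
  SSKT-shape h = listEq⁻ _ _ (proj₁ (T-∧⁻ {shapeOk α t} h))

  SSKT⇒KT : SSKT α φ t → KT n (nthN0 α) (φ ∘ suc) (val t)
  SSKT⇒KT h = record { supp = supp' ; box = box' ; out = out' ; row = row' ; key = key' ; flag = flag' }
    where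
    sh = SSKT-shape h
    h₁ = proj₂ (T-∧⁻ {shapeOk α t} h)
    hflag = proj₁ (T-∧⁻ {flaggedB φ t} h₁)
    h₂ = proj₂ (T-∧⁻ {flaggedB φ t} h₁)
    hrow = proj₁ (T-∧⁻ {rowsDecB t} h₂)
    h₃ = proj₂ (T-∧⁻ {rowsDecB t} h₂)
    hcol = proj₁ (T-∧⁻ {colsDistinctB t} h₃)
    hkey = proj₂ (T-∧⁻ {colsDistinctB t} h₃)
    α-row : ∀ r → nthN0 α r ≡ rowLen t r
    α-row r = trans (cong (λ z → nthN0 z r) (sym sh)) (rowLen-shape t r)
    tlen : length t ≤ n
    tlen = subst (_≤ n) (trans (cong length (sym sh)) (length-map length t)) len
    supp' : ∀ r → n ≤ r → nthN0 α r ≡ 0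
    supp' r p with nth0 α r | nthView α r
    ... | _ | inside q = ⊥-elim (<⇒≱ (<-≤-trans q len) p)
    ... | _ | outside q = refl
    inFlag : ∀ r c → c < rowLen t r → T ((1 ≤ᵇ val t r c) ∧ (val t r c ≤ᵇ φ (suc r)))
    inFlag r c p with entry-just t r c p
    ... | e , q = subst (λ z → T (onE z (λ v → (1 ≤ᵇ v) ∧ (v ≤ᵇ φ (suc r))))) e
        (boxes⁻ t _ hflag r c q (<-≤-trans p (rowLen≤maxCol t r)))
    box' : ∀ r c → c < nthN0 α r → 1 ≤ val t r c
    box' r c p = ≤ᵇ⇒≤ 1 _ (proj₁ (T-∧⁻ {1 ≤ᵇ val t r c} (inFlag r c (subst (c <_) (α-row r) p))))
    out' : ∀ r c → nthN0 α r ≤ c → val t r c ≡ 0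
    out' r c p = val-out t r c (subst (_≤ c) (α-row r) p)
    inShp : ∀ r c → 1 ≤ val t r c → c < rowLen t r
    inShp r c p with c <? rowLen t r
    ... | yes q = q
    ... | no q = ⊥-elim (<-irrefl refl (subst (1 ≤_) (val-out t r c (≮⇒≥ q)) p))
    row' : ∀ r c → val t r (suc c) ≤ val t r c
    row' r c with suc c <? rowLen t r
    ... | no q = subst (_≤ val t r c) (sym (val-out t r (suc c) (≮⇒≥ q))) z≤n
    ... | yes q with entry-just t r (suc c) q | entry-just t r c (<-trans (n<1+n c) q)
    ...   | e , _ | e' , l = ≤ᵇ⇒≤ _ _ (subst₂ (λ y z → T (onE2 y z (λ u v → v ≤ᵇ u))) e' e
        (boxes⁻ t _ hrow r c l (<-≤-trans (<-trans (n<1+n c) q) (rowLen≤maxCol t r))))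
    key' : ∀ l k c → l < k → 1 ≤ val t k c → val t k c ≤ val t l c → val t k c < val t l (suc c)
    key' l k c l<k 1≤ le with entry-just t k c (inShp k c 1≤) | entry-just t l c (inShp l c (≤-trans 1≤ le))
    ... | ek , k< | el , _ = next (entryView t l (suc c)) kc
      where
      c< = <-≤-trans (inShp k c 1≤) (rowLen≤maxCol t k)
      -- Distinctness of columns turns the `≤` of `key` into the strict inequality that `keyCondB`
      -- tests.
      ne : val t l c ≢ val t k c
      ne e with subst₂ (λ y z → T (onE2 y z (λ u v → not (u ≡ᵇ v)))) el ek
          (pairs⁻ t (λ i k c → onE2 (entry t i c) (entry t k c) (λ u v → not (u ≡ᵇ v))) hcol l k c l<k k< c<)
      ... | q rewrite ≡ᵇ-yes e = q
      kc : T (keyNext (entry t (suc l) (suc (suc c))) (val t k c))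
      kc = subst T (trans (keyCond-unfold t (suc l) (suc k) (suc c) (val t l c) (val t k c))
          (cong (λ z → if z then keyNext (entry t (suc l) (suc (suc c))) (val t k c) else true) (<ᵇ-yes (≤∧≢⇒< le (ne ∘ sym)))))
             (subst₂ (λ y z → T (onE2 y z (proj₁ (keyCond-pred t) (suc l) (suc k) (suc c)))) el ek
               (pairs⁻ t (λ i k j → onE2 (entry t i j) (entry t k j) (λ u v → proj₁ (keyCond-pred t) i k j u v))
                 (subst T (proj₂ (keyCond-pred t)) hkey) l k c l<k k< c<))
      next : ∀ {m w v} → EntryView t l (suc c) m w → T (keyNext m v) → v < w
      next {just w} (box _ _) q = <ᵇ⇒< _ w q
    flag' : ∀ r → val t r 0 ≤ φ (suc r)
    flag' r with 0 <? rowLen t r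
    ... | yes p = ≤ᵇ⇒≤ _ _ (proj₂ (T-∧⁻ {1 ≤ᵇ val t r 0} (inFlag r 0 p)))
    ... | no p = subst (_≤ φ (suc r)) (sym (val-out t r 0 (≮⇒≥ p))) z≤n

  KT⇒SSKT : map length t ≡ α → KT n (nthN0 α) (φ ∘ suc) (val t) → SSKT α φ t
  KT⇒SSKT sh K = T-∧⁺ {shapeOk α t} (subst (λ z → T (listEqℕ (map length t) z)) sh (listEq⁺ (map length t)))
     (T-∧⁺ {flaggedB φ t} (boxes⁺ t _ flags) (T-∧⁺ {rowsDecB t} (boxes⁺ t _ rows)
       (T-∧⁺ {colsDistinctB t} (pairs⁺ t (λ i k c → onE2 (entry t i c) (entry t k c) (λ u v → not (u ≡ᵇ v))) cols)
         (subst T (sym (proj₂ (keyCond-pred t))) (pairs⁺ t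
           (λ i k j → onE2 (entry t i j) (entry t k j) (λ u v → proj₁ (keyCond-pred t) i k j u v)) keys)))))
    where
    module K = KT K
    α-row : ∀ r → nthN0 α r ≡ rowLen t r
    α-row r = trans (cong (λ z → nthN0 z r) (sym sh)) (rowLen-shape t r)
    flags : ∀ r c → T (onE (entry t (suc r) (suc c)) (λ v → (1 ≤ᵇ v) ∧ (v ≤ᵇ φ (suc r))))
    flags r c with entry t (suc r) (suc c) | val t r c | entryView t r c | K.box r c | le-flag K r c
    ... | _ | _ | void _ | _ | _ = tt
    ... | _ | v | box _ q | b | f = T-∧⁺ {1 ≤ᵇ v} (≤⇒≤ᵇ (b (subst (c <_) (sym (α-row r)) q))) (≤⇒≤ᵇ f)
    rows : ∀ r c → T (onE2 (entry t (suc r) (suc c)) (entry t (suc r) (suc (suc c))) (λ u v → v ≤ᵇ u))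
    rows r c with entry t (suc r) (suc c) | val t r c | entryView t r c | entry t (suc r) (suc (suc c)) | val t r (suc c) |
        entryView t r (suc c) | K.row r c
    ... | _ | _ | void _ | _ | _ | _ | _ = tt
    ... | _ | _ | box _ _ | _ | _ | void _ | _ = tt
    ... | _ | _ | box _ _ | _ | _ | box _ _ | le = ≤⇒≤ᵇ le
    cols : ∀ l k c → l < k → T (onE2 (entry t (suc l) (suc c)) (entry t (suc k) (suc c)) (λ u v → not (u ≡ᵇ v)))
    cols l k c l<k with entry t (suc l) (suc c) | val t l c | entryView t l c | entry t (suc k) (suc c) | val t k c | entryView t
        k c | K.box k c | distinct< K {l} {k} {c} l<k
    ... | _ | _ | void _ | _ | _ | _ | _ | _ = tt
    ... | _ | _ | box _ _ | _ | _ | void _ | _ | _ = tt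
    ... | _ | _ | box _ _ | _ | _ | box _ q | b | d rewrite ≡ᵇ-no (d (b (subst (c <_) (sym (α-row k)) q))) = tt
    keys : ∀ l k c → l < k → T (onE2 (entry t (suc l) (suc c)) (entry t (suc k) (suc c))
        (λ u v → proj₁ (keyCond-pred t) (suc l) (suc k) (suc c) u v))
    keys l k c l<k with entry t (suc l) (suc c) | val t l c | entryView t l c | entry t (suc k) (suc c) | val t k c | entryView t
        k c | K.box k c | K.key l k c l<k
    ... | _ | _ | void _ | _ | _ | _ | _ | _ = tt
    ... | _ | _ | box _ _ | _ | _ | void _ | _ | _ = tt
    ... | _ | u | box _ _ | _ | v | box _ q | b | d = subst T (sym (keyCond-unfold t (suc l) (suc k) (suc c) u v)) go
      where
      pos = b (subst (c <_) (sym (α-row k)) q)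
      nx : ∀ {m w} → EntryView t l (suc c) m w → v < w → T (keyNext m v)
      nx (box _ _) p = <⇒<ᵇ p
      go : T (if v <ᵇ u then keyNext (entry t (suc l) (suc (suc c))) v else true)
      go with v <? u
      ... | yes p rewrite <ᵇ-yes p = nx (entryView t l (suc c)) (d pos (<⇒≤ p))
      ... | no p rewrite <ᵇ-no (≮⇒≥ p) = tt

nthN0-map : ∀ (f : ℕ → ℕ) s a c → nthN0 (map f (rangeFrom s a)) c ≡ (if c <ᵇ a then f (s + c) else 0)
nthN0-map f s zero c = refl
nthN0-map f s (suc a) zero = cong f (sym (+-identityʳ s))
nthN0-map f s (suc a) (suc c) = trans (nthN0-map f (suc s) a c) (cong (λ z → if c <ᵇ a then f z else 0) (sym (+-suc s c)))

mkTab : (ℕ → ℕ → ℕ) → ℕ → List ℕ → Tab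
mkTab x s [] = []
mkTab x s (a ∷ α) = map (x s) (rangeFrom 0 a) ∷ mkTab x (suc s) α

length-rangeFrom : ∀ s m → length (rangeFrom s m) ≡ m
length-rangeFrom s zero = refl
length-rangeFrom s (suc m) = cong suc (length-rangeFrom (suc s) m)

mkTab-shape : ∀ x s α → map length (mkTab x s α) ≡ α
mkTab-shape x s [] = refl
mkTab-shape x s (a ∷ α) = cong₂ _∷_ (trans (length-map (x s) (rangeFrom 0 a)) (length-rangeFrom 0 a)) (mkTab-shape x (suc s) α)

mkTab-val : ∀ x s α r c → val (mkTab x s α) r c ≡ (if c <ᵇ nthN0 α r then x (s + r) c else 0)
mkTab-val x s [] r c = refl
mkTab-val x s (a ∷ α) zero c = trans (nthN0-map (x s) 0 a c) (cong (λ z → if c <ᵇ a then x z c else 0) (sym (+-identityʳ s)))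
mkTab-val x s (a ∷ α) (suc r) c = trans (mkTab-val x (suc s) α r c)
    (cong (λ z → if c <ᵇ nthN0 α r then x z c else 0) (sym (+-suc s r)))

val-mkTab : ∀ {n ψ} α x → KT n (nthN0 α) ψ x → ∀ r c → val (mkTab x 0 α) r c ≡ x r c
val-mkTab α x K r c with c <? nthN0 α r
... | yes p = trans (mkTab-val x 0 α r c) (cong (λ z → if z then x r c else 0) (<ᵇ-yes p))
... | no p = trans (mkTab-val x 0 α r c) (trans (cong (λ z → if z then x r c else 0) (<ᵇ-no (≮⇒≥ p)))
    (sym (KT.out K r c (≮⇒≥ p))))

row-ext : ∀ xs ys → length xs ≡ length ys → (∀ c → nthN0 xs c ≡ nthN0 ys c) → xs ≡ ys
row-ext [] [] e h = refl
row-ext (x ∷ xs) (y ∷ ys) e h = cong₂ _∷_ (h 0) (row-ext xs ys (suc-injective e) (h ∘ suc))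

tab-ext : ∀ t t' → map length t ≡ map length t' → (∀ r c → val t r c ≡ val t' r c) → t ≡ t'
tab-ext [] [] e h = refl
tab-ext (x ∷ t) (y ∷ t') e h = cong₂ _∷_ (row-ext x y (∷-injectiveˡ e) (h 0)) (tab-ext t t' (∷-injectiveʳ e) (h ∘ suc))

-- The column word and its largest excess

Cell : Set
Cell = ℕ × ℕ × ℕ

pc nc : ℕ → List Cell → ℕ
pc i [] = 0
pc i ((v , _) ∷ w) = (if v ≡ᵇ suc i then 1 else 0) + pc i w
nc i [] = 0
nc i ((v , _) ∷ w) = (if v ≡ᵇ i then 1 else 0) + nc i w

-- The largest positive excess pc ∸ nc over the suffixes of a word, and the first letter of the shortest suffix attaining it.
best : ℕ → List Cell → ℕ × Maybe Cell
best i [] = 0 , nothing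
best i (x ∷ w) = if proj₁ (best i w) + nc i (x ∷ w) <ᵇ pc i (x ∷ w) then (pc i (x ∷ w) ∸ nc i (x ∷ w) , just x) else best i w

-- Turns the running integer sum into a difference of two counts, so that the maximum can be
-- followed with natural numbers.
sufs-cons : ∀ i x w → sufs i (x ∷ w) ≡ (pc i (x ∷ w) ⊖ nc i (x ∷ w) , x) ∷ sufs i w
sufs-cons i x@(v , b) w = go w
  where
  shift : ∀ p n → deltaI i v ℤ.+ (p ⊖ n) ≡ ((if v ≡ᵇ suc i then 1 else 0) + p) ⊖ ((if v ≡ᵇ i then 1 else 0) + n)
  shift p n with kind? i v
  ... | hi e rewrite ≡ᵇ-yes e | ≡ᵇ-no {v} {i} (λ e' → 1+n≢n (trans (sym e) e')) = trans (ℤₚ.+-comm (posℤ 1) (p ⊖ n))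
      (trans (ℤₚ.distribˡ-⊖-+-pos 1 p n) (cong (_⊖ n) (+-comm p 1)))
  ... | lo e rewrite ≡ᵇ-yes e | ≡ᵇ-no {v} {suc i} (λ e' → 1+n≢n (trans (sym e') e)) = trans (ℤₚ.+-comm (-[1+ 0 ]) (p ⊖ n))
      (trans (ℤₚ.distribˡ-⊖-+-neg 0 p n) (cong (p ⊖_) (cong suc (+-identityʳ n))))
  ... | off q q' rewrite ≡ᵇ-no q | ≡ᵇ-no q' = ℤₚ.+-identityˡ (p ⊖ n)
  go : ∀ w → sufs i (x ∷ w) ≡ (pc i (x ∷ w) ⊖ nc i (x ∷ w) , x) ∷ sufs i w
  go [] = cong (λ z → (z , x) ∷ []) (trans (sym (ℤₚ.+-identityʳ (deltaI i v))) (shift 0 0))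
  go (y ∷ w) rewrite sufs-cons i y w = cong (λ z → (z , x) ∷ _) (shift (pc i (y ∷ w)) (nc i (y ∷ w)))

-- `flat` unites the empty word and a maximum of at most 0, the cases with `e_i = 0`.
data BestSpec (i : ℕ) (w : List Cell) : ℕ × Maybe Cell → Set where
  flat : (maxZ (sufs i w) ≡ nothing ⊎ ∃ λ m → maxZ (sufs i w) ≡ just m × m ℤ.≤ posℤ 0) → BestSpec i w (0 , nothing)
  peak : ∀ {m x} → maxZ (sufs i w) ≡ just (posℤ (suc m)) → lastWith (posℤ (suc m)) (sufs i w) ≡ just x → BestSpec i w
      (suc m , just x)

private
  eqZ-refl : ∀ a → eqZ a a ≡ true
  eqZ-refl a rewrite T⇒≡ (ℤₚ.≤⇒≤ᵇ (ℤₚ.≤-refl {a})) = refl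

  eqZ-< : ∀ {a b} → a ℤ.< b → eqZ a b ≡ false
  eqZ-< {a} {b} l with b ℤ.≤ᵇ a in e
  ... | true = ⊥-elim (ℤₚ.<⇒≱ l (ℤₚ.≤ᵇ⇒≤ (≡⇒T e)))
  ... | false with a ℤ.≤ᵇ b
  ...   | true = refl
  ...   | false = refl

  max-just : ∀ s x ys {m} → maxZ ys ≡ just m → maxZ ((s , x) ∷ ys) ≡ just (s ℤ.⊔ m)
  max-just s x ys e rewrite e = refl

  max-nothing : ∀ s x ys → maxZ ys ≡ nothing → maxZ ((s , x) ∷ ys) ≡ just s
  max-nothing s x ys e rewrite e = refl

  max-empty : ∀ ys → maxZ ys ≡ nothing → ys ≡ []
  max-empty [] e = refl
  max-empty ((s , x) ∷ ys) e with maxZ ys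
  max-empty ((s , x) ∷ ys) () | just _
  max-empty ((s , x) ∷ ys) () | nothing

  last-none : ∀ m ys {m'} → maxZ ys ≡ just m' → m' ℤ.< m → lastWith m ys ≡ nothing
  last-none m ((s , x) ∷ ys) e l with maxZ ys in e'
  ... | nothing with max-empty ys e'
  ...   | refl rewrite eqZ-< {s} {m} (subst (ℤ._< m) (sym (just-injective e)) l) = refl
  last-none m ((s , x) ∷ ys) refl l | just m'' rewrite last-none m ys e' (ℤₚ.≤-<-trans (ℤₚ.i≤j⊔i s m'') l)
    | eqZ-< {s} {m} (ℤₚ.≤-<-trans (ℤₚ.i≤i⊔j s m'') l) = refl

  last-new : ∀ m x ys → lastWith m ys ≡ nothing → lastWith m ((m , x) ∷ ys) ≡ just x
  last-new m x ys e rewrite e | eqZ-refl m = refl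

  last-old : ∀ m s x ys {y} → lastWith m ys ≡ just y → lastWith m ((s , x) ∷ ys) ≡ just y
  last-old m s x ys e rewrite e = refl

  diff-pos : ∀ m p n → m + n < p → ∃ λ k → p ∸ n ≡ suc k × m ≤ k × p ⊖ n ≡ posℤ (suc k)
  diff-pos m p n l = (p ∸ n) ∸ 1 , eq , mk , trans (ℤₚ.⊖-≥ (≤-trans (m≤n+m n m) (<⇒≤ l))) (cong posℤ eq)
    where
    m< : m < p ∸ n
    m< = m+n≤o⇒m≤o∸n (suc m) l
    eq : p ∸ n ≡ suc ((p ∸ n) ∸ 1)
    eq = trans (sym (m∸n+n≡m (≤-trans (s≤s z≤n) m<))) (+-comm _ 1)
    mk : m ≤ (p ∸ n) ∸ 1
    mk = ≤-pred (subst (m <_) eq m<)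

  diff-le : ∀ m p n → p ≤ m + n → p ⊖ n ℤ.≤ posℤ m
  diff-le m p n l = ℤₚ.≤-trans (ℤₚ.⊖-monoˡ-≤ n l)
      (ℤₚ.≤-reflexive (trans (cong₂ _⊖_ (+-comm m n) (sym (+-identityʳ n))) (ℤₚ.+-cancelˡ-⊖ n m 0)))

best-spec : ∀ i w → BestSpec i w (best i w)
best-spec i [] = flat (inj₁ refl)
best-spec i (x ∷ w) with proj₁ (best i w) + nc i (x ∷ w) <? pc i (x ∷ w)
... | yes l rewrite <ᵇ-yes l with diff-pos _ _ (nc i (x ∷ w)) l
...   | k , e , mk , ez = subst (λ z → BestSpec i (x ∷ w) (z , just x)) (sym e) (new (best i w) (best-spec i w) mk)
  where
  new : ∀ b → BestSpec i w b → proj₁ b ≤ k → BestSpec i (x ∷ w) (suc k , just x)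
  new _ (flat (inj₁ mz)) _ = peak (trans (cong maxZ eqs) refl)
      (trans (cong (lastWith (posℤ (suc k))) eqs) (last-new (posℤ (suc k)) x [] refl))
    where
    eqs : sufs i (x ∷ w) ≡ (posℤ (suc k) , x) ∷ []
    eqs = trans (sufs-cons i x w) (cong₂ (λ a b → (a , x) ∷ b) ez (max-empty (sufs i w) mz))
  new _ (flat (inj₂ (m , mz , m≤))) _ = peak
      (trans (cong maxZ eqs) (trans (max-just (posℤ (suc k)) x (sufs i w) mz) (cong just (ℤₚ.i≥j⇒i⊔j≡i (ℤₚ.<⇒≤ m<)))))
      (trans (cong (lastWith (posℤ (suc k))) eqs) (last-new (posℤ (suc k)) x (sufs i w)
        (last-none (posℤ (suc k)) (sufs i w) mz m<)))
    where
    eqs = trans (sufs-cons i x w) (cong (λ a → (a , x) ∷ sufs i w) ez)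
    m< : m ℤ.< posℤ (suc k)
    m< = ℤₚ.≤-<-trans m≤ (ℤ.+<+ (s≤s z≤n))
  new _ (peak {m} mz lw) mk = peak
      (trans (cong maxZ eqs) (trans (max-just (posℤ (suc k)) x (sufs i w) mz) (cong just (ℤₚ.i≥j⇒i⊔j≡i (ℤₚ.<⇒≤ m<)))))
      (trans (cong (lastWith (posℤ (suc k))) eqs) (last-new (posℤ (suc k)) x (sufs i w)
        (last-none (posℤ (suc k)) (sufs i w) mz m<)))
    where
    eqs = trans (sufs-cons i x w) (cong (λ a → (a , x) ∷ sufs i w) ez)
    m< : posℤ (suc m) ℤ.< posℤ (suc k)
    m< = ℤ.+<+ (s≤s mk)
best-spec i (x ∷ w) | no l rewrite <ᵇ-no (≮⇒≥ l) = old (best i w) (best-spec i w) (diff-le _ _ _ (≮⇒≥ l))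
  where
  s = pc i (x ∷ w) ⊖ nc i (x ∷ w)
  old : ∀ b → BestSpec i w b → s ℤ.≤ posℤ (proj₁ b) → BestSpec i (x ∷ w) b
  old _ (flat (inj₁ mz)) s≤ = flat (inj₂ (s , trans (cong maxZ (sufs-cons i x w)) (max-nothing s x (sufs i w) mz) , s≤))
  old _ (flat (inj₂ (m , mz , m≤))) s≤ = flat (inj₂
      (s ℤ.⊔ m , trans (cong maxZ (sufs-cons i x w)) (max-just s x (sufs i w) mz) , ℤₚ.⊔-lub s≤ m≤))
  old _ (peak {m} mz lw) s≤ = peak (trans (cong maxZ (sufs-cons i x w))
      (trans (max-just s x (sufs i w) mz) (cong just (ℤₚ.i≤j⇒i⊔j≡j s≤))))
    (trans (cong (lastWith (posℤ (suc m))) (sufs-cons i x w)) (last-old (posℤ (suc m)) s x (sufs i w) lw))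

eKey-flat : ∀ i t → best i (colWord t) ≡ (0 , nothing) → eKey i t ≡ nothing
eKey-flat i t e with subst (BestSpec i (colWord t)) e (best-spec i (colWord t))
... | flat (inj₁ mz) rewrite mz = refl
... | flat (inj₂ (m , mz , m≤)) rewrite mz | T⇒≡ (ℤₚ.≤⇒≤ᵇ m≤) = refl

eKey-peak : ∀ i t {m v r c} → best i (colWord t) ≡ (suc m , just (v , r , c)) → eKey i t ≡ just (applyRaise i t r c)
eKey-peak i t e with subst (BestSpec i (colWord t)) e (best-spec i (colWord t))
... | peak mz lw rewrite mz | lw = refl

cell : ℕ → ℕ → Maybe ℕ → List Cell
cell r c (just v) = (v , r , c) ∷ []
cell r c nothing = []

colWord-cells : ∀ t → Σ (ℕ → ℕ → List Cell) λ F →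
  colWord t ≡ concatMap (λ c → concatMap (λ r → F c r) (reverse (range1 (length t)))) (reverse (range1 (maxCol t)))
colWord-cells t = _ , refl

colWord-cell : ∀ t r c → proj₁ (colWord-cells t) c r ≡ cell r c (entry t r c)
colWord-cell t r c with entry t r c
... | just v = refl
... | nothing = refl

Wcol : Tab → ℕ → ℕ → List Cell
Wcol t c zero = []
Wcol t c (suc r) = cell (suc r) (suc c) (entry t (suc r) (suc c)) ++ Wcol t c r

-- The bounds are parameters, and a suffix of such a word is described by its own bounds; the
-- induction over suffixes relies on this.
Wtab : Tab → ℕ → ℕ → List Cell
Wtab t n zero = []
Wtab t n (suc c) = Wcol t c n ++ Wtab t n c

reverse-range : ∀ m → reverse (range1 (suc m)) ≡ suc m ∷ reverse (range1 m)
reverse-range m = trans (cong reverse (trans (cong (rangeFrom 1) (+-comm 1 m)) (rangeFrom-++ 1 m 1)))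
    (reverse-++ (range1 m) [ suc m ])

colWord-Wtab : ∀ t → colWord t ≡ Wtab t (length t) (maxCol t)
colWord-Wtab t = trans (proj₂ (colWord-cells t)) (cols (maxCol t))
  where
  rows : ∀ c r → concatMap (λ r → proj₁ (colWord-cells t) (suc c) r) (reverse (range1 r)) ≡ Wcol t c r
  rows c zero = refl
  rows c (suc r) = trans (cong (concatMap _) (reverse-range r)) (cong₂ _++_ (colWord-cell t (suc r) (suc c)) (rows c r))
  cols : ∀ k → concatMap (λ c → concatMap (λ r → proj₁ (colWord-cells t) c r) (reverse (range1 (length t)))) (reverse (range1 k))
      ≡ Wtab t (length t) k
  cols zero = refl
  cols (suc k) = trans (cong (concatMap _) (reverse-range k)) (cong₂ _++_ (rows k (length t)) (cols k))

entry-nothing : ∀ t r c → length t ≤ r ⊎ maxCol t ≤ c → entry t (suc r) (suc c) ≡ nothing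
entry-nothing t r c h with entry t (suc r) (suc c) | val t r c | entryView t r c
... | _ | _ | void _ = refl
entry-nothing t r c (inj₁ p) | _ | _ | box q _ = ⊥-elim (<⇒≱ q p)
entry-nothing t r c (inj₂ p) | _ | _ | box _ q = ⊥-elim (<⇒≱ (<-≤-trans q (rowLen≤maxCol t r)) p)

-- Positions without a box contribute no letter, so the bounds can be enlarged freely.
Wtab-extend : ∀ t {n C} → length t ≤ n → maxCol t ≤ C → Wtab t n C ≡ colWord t
Wtab-extend t {n} {C} p q = trans (cols C q) (trans (rows* (maxCol t)) (sym (colWord-Wtab t)))
  where
  empty : ∀ c r → maxCol t ≤ c → Wcol t c r ≡ []
  empty c zero h = refl
  empty c (suc r) h rewrite entry-nothing t r c (inj₂ h) = empty c r h
  cols : ∀ C → maxCol t ≤ C → Wtab t n C ≡ Wtab t n (maxCol t)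
  cols C h with m≤n⇒m<n∨m≡n h
  ... | inj₂ refl = refl
  cols (suc C) h | inj₁ l = trans (cong (_++ Wtab t n C) (empty C n (≤-pred l))) (cols C (≤-pred l))
  rows : ∀ c n → length t ≤ n → Wcol t c n ≡ Wcol t c (length t)
  rows c n h with m≤n⇒m<n∨m≡n h
  ... | inj₂ refl = refl
  rows c (suc n) h | inj₁ l rewrite entry-nothing t n c (inj₁ (≤-pred l)) = rows c n (≤-pred l)
  rows* : ∀ C → Wtab t n C ≡ Wtab t (length t) C
  rows* zero = refl
  rows* (suc C) = cong₂ _++_ (rows C n p) (rows* C)

-- Follows `best` along the suffixes `word c r`, made of the columns left of `c` and of the lowest
-- `r` rows of column `c`. The invariant `Inv` remembers where the maximum was first attained.
module Scan (t : Tab) (n i : ℕ) (1≤i : 1 ≤ i) where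
  x = val t

  sp sn : ℕ → ℕ → ℕ
  sp c r = hgt n x (suc i) c + cnt (λ r → x r c) (suc i) r
  sn c r = hgt n x i c + cnt (λ r → x r c) i r

  word : ℕ → ℕ → List Cell
  word c r = Wcol t c r ++ Wtab t n c

  private
    step-count : ∀ c r w → (pc i (cell (suc r) (suc c) (entry t (suc r) (suc c)) ++ w) ≡ (if x r c ≡ᵇ suc i then 1 else 0) + pc i
        w) ×
                           (nc i (cell (suc r) (suc c) (entry t (suc r) (suc c)) ++ w) ≡ (if x r c ≡ᵇ i then 1 else 0) + nc i w)
    step-count c r w with entry t (suc r) (suc c) | val t r c | entryView t r c
    ... | _ | _ | box _ _ = refl , refl
    -- The default value 0 of a missing box is neither `i` nor `i + 1`, because `1 ≤ i`.
    ... | _ | _ | void _ rewrite ≡ᵇ-no {0} {i} (<⇒≢ 1≤i) = refl , refl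

    add : ∀ d h k q → q ≡ h + k → d + q ≡ h + (d + k)
    add d h k q e = trans (cong (d +_) e) (trans (sym (+-assoc d h k)) (trans (cong (_+ k) (+-comm d h)) (+-assoc h d k)))

    step-word : ∀ c r → word c (suc r) ≡ cell (suc r) (suc c) (entry t (suc r) (suc c)) ++ word c r
    step-word c r = ++-assoc (cell (suc r) (suc c) (entry t (suc r) (suc c))) (Wcol t c r) (Wtab t n c)

  counts : ∀ c r → pc i (word c r) ≡ sp c r × nc i (word c r) ≡ sn c r
  counts c (suc r) = trans (cong (pc i) (step-word c r))
      (trans (proj₁ (step-count c r (word c r))) (add _ (hgt n x (suc i) c) (cnt (λ r → x r c) (suc i) r) _ (proj₁ (counts c r))))
      ,
                     trans (cong (nc i) (step-word c r)) (trans (proj₂ (step-count c r (word c r)))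
                         (add _ (hgt n x i c) (cnt (λ r → x r c) i r) _ (proj₂ (counts c r))))
  counts zero zero = refl , refl
  counts (suc c) zero = trans (proj₁ (counts c n)) (trans (+-comm (hgt n x (suc i) c) _) (sym (+-identityʳ _))) ,
                        trans (proj₂ (counts c n)) (trans (+-comm (hgt n x i c) _) (sym (+-identityʳ _)))

  Upto : ℕ → ℕ → ℕ → ℕ → Set
  Upto c r c' r' = (c' < c × r' ≤ n) ⊎ (c' ≡ c × r' ≤ r)

  data Inv (c r : ℕ) : ℕ × Maybe Cell → Set where
    low  : (∀ c' r' → Upto c r c' r' → sp c' r' ≤ sn c' r') → Inv c r (0 , nothing)
    high : ∀ {m v r₀ c₀} → r₀ < n → sp c₀ (suc r₀) ≡ suc m + sn c₀ (suc r₀) →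
        (∀ c' r' → Upto c r c' r' → sp c' r' ≤ suc m + sn c' r') →
           (∀ c' r' → Upto c₀ r₀ c' r' → sp c' r' < suc m + sn c' r') → Inv c r (suc m , just (v , suc r₀ , suc c₀))

  private
    bound : ∀ {c r b} → Inv c r b → ∀ c' r' → Upto c r c' r' → sp c' r' ≤ proj₁ b + sn c' r'
    bound (low h) = h
    bound (high _ _ h _) = h

    extend : ∀ {c r b} → Inv c r b → ∀ c₂ r₂ → (∀ c' r' → Upto c₂ r₂ c' r' → Upto c r c' r' ⊎ sp c' r' ≤ proj₁ b + sn c' r') → Inv
        c₂ r₂ b
    extend I@(low h) c₂ r₂ e = low (λ c' r' u → case e c' r' u of λ { (inj₁ u') → h c' r' u' ; (inj₂ q) → q })
    extend I@(high a b h l) c₂ r₂ e = high a b (λ c' r' u → case e c' r' u of λ { (inj₁ u') → h c' r' u' ; (inj₂ q) → q }) l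

    split-row : ∀ c r c' r' → Upto c (suc r) c' r' → Upto c r c' r' ⊎ (c' ≡ c × r' ≡ suc r)
    split-row c r c' r' (inj₁ u) = inj₁ (inj₁ u)
    split-row c r c' r' (inj₂ (e , u)) with m≤n⇒m<n∨m≡n u
    ... | inj₁ l = inj₁ (inj₂ (e , ≤-pred l))
    ... | inj₂ e' = inj₂ (e , e')

  inv : ∀ c r → r ≤ n → Inv c r (best i (word c r))
  inv zero zero _ = low λ { c' r' (inj₁ (() , _)) ; .zero .zero (inj₂ (refl , z≤n)) → ≤-refl }
  inv (suc c) zero _ = extend (inv c n ≤-refl) (suc c) 0 λ
    { c' r' (inj₁ (s≤s l , q)) → inj₁ (case m≤n⇒m<n∨m≡n l of λ { (inj₁ l') → inj₁ (l' , q) ; (inj₂ e) → inj₂ (e , q) })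
    ; .(suc c) .zero (inj₂ (refl , z≤n)) → inj₂ (subst₂ (λ a b → a ≤ proj₁ (best i (word c n)) + b)
         (trans (+-comm (hgt n x (suc i) c) _) (sym (+-identityʳ _))) (trans (+-comm (hgt n x i c) _) (sym (+-identityʳ _)))
         (bound (inv c n ≤-refl) c n (inj₂ (refl , ≤-refl)))) }
  inv c (suc r) r<n = subst (λ w → Inv c (suc r) (best i w)) (sym (step-word c r)) (go (entry t (suc r) (suc c)) refl)
    where
    w = word c r
    I = inv c r (<⇒≤ r<n)
    go : ∀ e → entry t (suc r) (suc c) ≡ e → Inv c (suc r) (best i (cell (suc r) (suc c) e ++ w))
    go nothing eq = extend I c (suc r) λ c' r' u → case split-row c r c' r' u of λ
      { (inj₁ u') → inj₁ u' ; (inj₂ (refl , refl)) → inj₂ (subst₂ (λ a b → a ≤ proj₁ (best i w) + b)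
          (trans (sym (proj₁ (counts c r))) (trans (cong (λ e → pc i (cell (suc r) (suc c) e ++ w)) (sym eq))
            (trans (cong (pc i) (sym (step-word c r))) (proj₁ (counts c (suc r))))))
          (trans (sym (proj₂ (counts c r))) (trans (cong (λ e → nc i (cell (suc r) (suc c) e ++ w)) (sym eq))
            (trans (cong (nc i) (sym (step-word c r))) (proj₂ (counts c (suc r))))))
          (bound I c r (inj₂ (refl , ≤-refl)))) }
    go (just v) eq with proj₁ (best i w) + nc i ((v , suc r , suc c) ∷ w) <? pc i ((v , suc r , suc c) ∷ w)
    ... | no l rewrite <ᵇ-no (≮⇒≥ l) = extend I c (suc r) λ c' r' u → case split-row c r c' r' u of λ
      { (inj₁ u') → inj₁ u' ; (inj₂ (refl , refl)) → inj₂ (subst₂ (λ a b → a ≤ proj₁ (best i w) + b) pc≡ nc≡ (≮⇒≥ l)) }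
      where
      pc≡ : pc i ((v , suc r , suc c) ∷ w) ≡ sp c (suc r)
      pc≡ = trans (cong (λ e → pc i (cell (suc r) (suc c) e ++ w)) (sym eq))
          (trans (cong (pc i) (sym (step-word c r))) (proj₁ (counts c (suc r))))
      nc≡ : nc i ((v , suc r , suc c) ∷ w) ≡ sn c (suc r)
      nc≡ = trans (cong (λ e → nc i (cell (suc r) (suc c) e ++ w)) (sym eq))
          (trans (cong (nc i) (sym (step-word c r))) (proj₂ (counts c (suc r))))
    ... | yes l rewrite <ᵇ-yes l with diff-pos (proj₁ (best i w)) (pc i ((v , suc r , suc c) ∷ w))
        (nc i ((v , suc r , suc c) ∷ w)) l
    ...   | k , e , mk , _ = subst (λ z → Inv c (suc r) (z , just (v , suc r , suc c))) (sym e) (high r<n top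
             (λ c' r' u → case split-row c r c' r' u of λ { (inj₁ u') → <⇒≤ (lower c' r' u') ; (inj₂ (refl , refl)) → ≤-reflexive
               top }) lower)
      where
      pc≡ : pc i ((v , suc r , suc c) ∷ w) ≡ sp c (suc r)
      pc≡ = trans (cong (λ e → pc i (cell (suc r) (suc c) e ++ w)) (sym eq))
          (trans (cong (pc i) (sym (step-word c r))) (proj₁ (counts c (suc r))))
      nc≡ : nc i ((v , suc r , suc c) ∷ w) ≡ sn c (suc r)
      nc≡ = trans (cong (λ e → nc i (cell (suc r) (suc c) e ++ w)) (sym eq))
          (trans (cong (nc i) (sym (step-word c r))) (proj₂ (counts c (suc r))))
      top : sp c (suc r) ≡ suc k + sn c (suc r)
      top = trans (sym pc≡) (trans (sym (m∸n+n≡m (≤-trans (m≤n+m _ (proj₁ (best i w))) (<⇒≤ l)))) (cong₂ _+_ e nc≡))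
      lower : ∀ c' r' → Upto c r c' r' → sp c' r' < suc k + sn c' r'
      lower c' r' u = s≤s (≤-trans (bound I c' r' u) (+-monoˡ-≤ (sn c' r') mk))

data RaiseView (n i : ℕ) (t : Tab) : Set where
  none : eKey i t ≡ nothing → (∀ c → hgt n (val t) (suc i) c ≤ hgt n (val t) i c) → RaiseView n i t
  some : ∀ m r₀ c₀ → eKey i t ≡ just (applyRaise i t (suc r₀) (suc c₀)) → Peak n (val t) i m r₀ c₀ → RaiseView n i t

raiseView : ∀ n i t → 1 ≤ i → length t ≤ n → RaiseView n i t
raiseView n i t 1≤i len = go (best i (colWord t)) refl
  where
  open Scan t n i 1≤i
  -- `Peak` speaks of every column, also beyond the shape; for a given column the word is read with
  -- a width exceeding it, without changing `best`.
  at : ∀ C → maxCol t ≤ C → Inv C 0 (best i (colWord t))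
  at C p = subst (λ w → Inv C 0 (best i w)) (Wtab-extend t len p) (inv C 0 z≤n)
  big : ∀ c → maxCol t ≤ suc c + maxCol t
  big c = m≤n+m (maxCol t) (suc c)
  early : ∀ c → c < suc c + maxCol t
  early c = s≤s (m≤m+n c (maxCol t))
  go : ∀ b → best i (colWord t) ≡ b → RaiseView n i t
  go b e with subst (Inv (maxCol t) 0) e (at (maxCol t) ≤-refl)
  ... | low _ = none (eKey-flat i t e) heights
    where
    heights : ∀ c → hgt n x (suc i) c ≤ hgt n x i c
    heights c with subst (Inv (suc c + maxCol t) 0) e (at _ (big c))
    ... | low h = subst₂ _≤_ (+-identityʳ _) (+-identityʳ _) (h c 0 (inj₁ (early c , z≤n)))
  ... | high {m} {v} {r₀} {c₀} r₀<n top _ lower = some (suc m) r₀ c₀ (eKey-peak i t e)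
      (record { r₀<n = r₀<n ; peak = top ; le = le' ; lt = lower })
    where
    le' : ∀ c r → r ≤ n → sp c r ≤ suc m + sn c r
    le' c r q with subst (Inv (suc c + maxCol t) 0) e (at _ (big c))
    ... | high _ _ h _ = h c r (inj₁ (early c , q))

imap-val : ∀ k (f : ℕ → ℕ → ℕ) xs c → nthN0 (imapFrom k f xs) c ≡ (if c <ᵇ length xs then f (k + c) (nthN0 xs c) else 0)
imap-val k f [] c = refl
imap-val k f (x ∷ xs) zero = cong (λ z → f z x) (sym (+-identityʳ k))
imap-val k f (x ∷ xs) (suc c) = trans (imap-val (suc k) f xs c)
    (cong (λ z → if c <ᵇ length xs then f z (nthN0 xs c) else 0) (sym (+-suc k c)))

imap-length : ∀ {A B : Set} k (f : ℕ → A → B) xs → length (imapFrom k f xs) ≡ length xs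
imap-length k f [] = refl
imap-length k f (x ∷ xs) = cong suc (imap-length (suc k) f xs)

imap-tab : ∀ k (F : ℕ → ℕ → ℕ → ℕ) t r c → val (imapFrom k (λ r' row → imapFrom 1 (F r') row) t) r c ≡
    (if c <ᵇ rowLen t r then F (k + r) (suc c) (val t r c) else 0)
imap-tab k F [] r c = refl
imap-tab k F (row ∷ t) zero c = trans (imap-val 1 (F k) row c)
    (cong (λ z → if c <ᵇ length row then F z (suc c) (nthN0 row c) else 0) (sym (+-identityʳ k)))
imap-tab k F (row ∷ t) (suc r) c = trans (imap-tab (suc k) F t r c)
    (cong (λ z → if c <ᵇ rowLen t r then F z (suc c) (val t r c) else 0) (sym (+-suc k r)))

imap-shape : ∀ k (F : ℕ → ℕ → ℕ → ℕ) t → map length (imapFrom k (λ r' row → imapFrom 1 (F r') row) t) ≡ map length t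
imap-shape k F [] = refl
imap-shape k F (row ∷ t) = cong₂ _∷_ (imap-length 1 (F k) row) (imap-shape (suc k) F t)

applyRaise-fun : ∀ i t r c → Σ (ℕ → ℕ → ℕ → ℕ) λ F → applyRaise i t r c ≡ imapFrom 1 (λ r' row → imapFrom 1 (F r') row) t
applyRaise-fun i t r c = _ , refl

isHi : ℕ → Maybe ℕ → Bool
isHi i (just u) = u ≡ᵇ suc i
isHi i nothing = false

applyRaise-unfold : ∀ i t r c r' c' x → proj₁ (applyRaise-fun i t r c) r' c' x ≡
  (if r' ≡ᵇ r then (if (c ≤ᵇ c') ∧ isHi i (entry t r c') then i else x)
   else (if ((c ≤ᵇ c') ∧ isHi i (entry t r c')) ∧ (x ≡ᵇ i) then suc i else x))
applyRaise-unfold i t r c r' c' x with entry t r c'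
... | just v = refl
... | nothing = refl

isHi-entry : ∀ i t r c → isHi i (entry t (suc r) (suc c)) ≡ (val t r c ≡ᵇ suc i)
isHi-entry i t r c with entry t (suc r) (suc c) | val t r c | entryView t r c
... | _ | _ | box _ _ = refl
... | _ | _ | void _ = refl

applyRaise-shape : ∀ i t r c → map length (applyRaise i t r c) ≡ map length t
applyRaise-shape i t r c = trans (cong (map length) (proj₂ (applyRaise-fun i t r c)))
    (imap-shape 1 (proj₁ (applyRaise-fun i t r c)) t)

module _ {n : ℕ} {α ψ : ℕ → ℕ} {t : Tab} (K : KT n α ψ (val t)) (ψ-mono : ∀ {l k} → l ≤ k → ψ l ≤ ψ k)
         {i : ℕ} (1≤i : 1 ≤ i) {m r₀ c₀ : ℕ} (Q : Peak n (val t) i m r₀ c₀) where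
  open Raise K ψ-mono 1≤i Q
  open Run

  -- Rows decrease weakly and row `r₀` has no `i + 1` in the column after `end`, so the entries
  -- `i + 1` of row `r₀` from `c₀` on fill exactly the columns `c₀` to `end`. There the two
  -- replacements of `e_i` amount to the exchange of `i` and `i + 1`.
  applyRaise-val : ∀ r c → val (applyRaise i t (suc r₀) (suc c₀)) r c ≡ raised r c
  applyRaise-val r c with c <? rowLen t r
  ... | no p = trans (cong (λ u → val u r c) (proj₂ (applyRaise-fun i t (suc r₀) (suc c₀)))) (trans (imap-tab 1 F t r c)
      (trans (cong (λ b → if b then F (suc r) (suc c) (val t r c) else 0) (<ᵇ-no (≮⇒≥ p))) (sym zero-out)))
    where
    F = proj₁ (applyRaise-fun i t (suc r₀) (suc c₀))
    v0 : val t r c ≡ 0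
    v0 = val-out t r c (≮⇒≥ p)
    zero-out : raised r c ≡ 0
    zero-out with where? i c₀ end (val t) c
    ... | left-of q = trans (swapCols-lt i c₀ end (val t) q) v0
    ... | right-of q = trans (swapCols-gt i c₀ end (val t) q) v0
    ... | inside p' q = trans (swapCols-in i c₀ end (val t) p' q) (trans (cong (applyS i) v0) (applyS-zero i 1≤i))
  ... | yes p = trans (cong (λ u → val u r c) (proj₂ (applyRaise-fun i t (suc r₀) (suc c₀)))) (trans (imap-tab 1 F t r c)
      (trans (cong (λ b → if b then F (suc r) (suc c) (val t r c) else 0) (<ᵇ-yes p))
      (trans (applyRaise-unfold i t (suc r₀) (suc c₀) (suc r) (suc c) (val t r c))
        (trans (cong body inC≡) (cases (where? i c₀ end (val t) c))))))
    where
    F = proj₁ (applyRaise-fun i t (suc r₀) (suc c₀))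
    body : Bool → ℕ
    body b = if r ≡ᵇ r₀ then (if b then i else val t r c) else (if b ∧ (val t r c ≡ᵇ i) then suc i else val t r c)
    inC≡ : ((suc c₀ ≤ᵇ suc c) ∧ isHi i (entry t (suc r₀) (suc c))) ≡ ((suc c₀ ≤ᵇ suc c) ∧ (val t r₀ c ≡ᵇ suc i))
    inC≡ = cong ((suc c₀ ≤ᵇ suc c) ∧_) (isHi-entry i t r₀ c)
    unchanged : body false ≡ val t r c
    unchanged with r ≡ᵇ r₀
    ... | true = refl
    ... | false = refl
    ∧-false : ∀ b → b ∧ false ≡ false
    ∧-false true = refl
    ∧-false false = refl
    cases : Where i c₀ end (val t) c → body ((suc c₀ ≤ᵇ suc c) ∧ (val t r₀ c ≡ᵇ suc i)) ≡ raised r c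
    cases (left-of q) = trans (cong (λ b → body (b ∧ (val t r₀ c ≡ᵇ suc i))) (≤ᵇ-no (s≤s q)))
        (trans unchanged (sym (swapCols-lt i c₀ end (val t) q)))
    cases (right-of q) = trans (cong (λ b → body ((suc c₀ ≤ᵇ suc c) ∧ b)) (≡ᵇ-no ne))
        (trans (cong body (∧-false (suc c₀ ≤ᵇ suc c))) (trans unchanged (sym (swapCols-gt i c₀ end (val t) q))))
      where
      ne : val t r₀ c ≢ suc i
      ne e = stops (≤-antisym (subst (val t r₀ (suc end) ≤_) (hi-at (runs end c≤end ≤-refl)) (KT.row K r₀ end))
          (subst (_≤ val t r₀ (suc end)) e (row* K r₀ q)))
    cases (inside p' q) = trans (cong₂ (λ b b' → body (b ∧ b')) (≤ᵇ-yes (s≤s p')) (≡ᵇ-yes (hi-at (runs c p' q))))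
        (trans changed (sym (swapCols-in i c₀ end (val t) p' q)))
      where
      changed : body true ≡ applyS i (val t r c)
      changed with r ≟ r₀ | val t r c ≟ i
      ... | yes e | _ = trans (cong (λ b → if b then i else (if val t r c ≡ᵇ i then suc i else val t r c)) (≡ᵇ-yes e))
              (sym (trans (cong (applyS i) (trans (cong (λ k → val t k c) e) (hi-at (runs c p' q)))) (applyS-hi i)))
      ... | no ne | yes e = trans (cong (λ b → if b then i else (if val t r c ≡ᵇ i then suc i else val t r c)) (≡ᵇ-no ne))
              (trans (cong (λ b → if b then suc i else val t r c) (≡ᵇ-yes e)) (sym (trans (cong (applyS i) e) (applyS-lo i))))
      ... | no ne | no e = trans (cong (λ b → if b then i else (if val t r c ≡ᵇ i then suc i else val t r c)) (≡ᵇ-no ne))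
              (trans (cong (λ b → if b then suc i else val t r c) (≡ᵇ-no e))
                (sym (applyS-else i e (λ e' → ne (distinct K (s≤s z≤n) e' (hi-at (runs c p' q)))))))

-- Crystal operators on key tableaux and on their marked lists

record Ok (n C : ℕ) (α : List ℕ) (φ : ℕ → ℕ) : Set where
  field
    len   : length α ≤ n
    parts : ∀ r → nthN0 α r ≤ C
    bound : ∀ r → r < length α → φ (suc r) ≤ n
    mono  : ∀ {l k} → l ≤ k → φ (suc l) ≤ φ (suc k)

data EView (n C i : ℕ) (α : List ℕ) (φ : ℕ → ℕ) (t : Tab) : Set where
  none : eKey i t ≡ nothing → Ls i (marks n C (val t)) ≡ [] → EView n C i α φ t
  some : ∀ t' → eKey i t ≡ just t' → SSKT α φ t' → EStep i (marks n C (val t)) (marks n C (val t')) → EView n C i α φ t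

module Crystal {n C : ℕ} {α : List ℕ} {φ : ℕ → ℕ} (ok : Ok n C α φ) where
  open Ok ok

  kt : ∀ {t} → SSKT α φ t → KT n (nthN0 α) (φ ∘ suc) (val t)
  kt {t} = SSKT⇒KT {α = α} {φ} {t} len

  private
    tlen : ∀ {t} → SSKT α φ t → length t ≤ n
    tlen {t} h = subst (_≤ n) (trans (cong length (sym (SSKT-shape {α = α} {φ} {t} len h))) (length-map length t)) len

  eView : ∀ {i t} → 1 ≤ i → i < n → SSKT α φ t → EView n C i α φ t
  eView {i} {t} 1≤i i<n h with raiseView n i t 1≤i (tlen {t} h)
  ... | none e hs = none e (length≡0 (trans (Zfrom-lc 1≤i i<n (val t) (λ c v p → occ≤1 (kt {t} h) p) 0 C)
          (n≤0⇒n≡0 (Sig.dom⇒lc≤ n (val t) i 0 C 0 (λ j _ → subst₂ _≤_ (sym (+-identityʳ _)) (sym (+-identityʳ _)) (hs j))))))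
  ... | some m r₀ c₀ e Q = some t' e sskt (subst (λ z → EStep i (marks n C x) z) (marks-cong n C raised (val t') occ≡) st)
    where
    K = kt {t} h
    x = val t
    open Raise K mono 1≤i Q
    t' = applyRaise i t (suc r₀) (suc c₀)
    sskt : SSKT α φ t'
    sskt = KT⇒SSKT {α = α} {φ} {t'} len (trans (applyRaise-shape i t (suc r₀) (suc c₀)) (SSKT-shape {α = α} {φ} {t} len h))
             (KT-resp raised-KT (λ _ → refl) (λ r c → sym (applyRaise-val {t = t} K mono 1≤i Q r c)) (KT.flag raised-KT))
    occ≡ : ∀ c v → 1 ≤ v → occ n raised c v ≡ occ n (val t') c v
    occ≡ c v _ = occ-resp n raised (val t') c v (λ r → sym (applyRaise-val {t = t} K mono 1≤i Q r c))
    end<C : end < C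
    end<C = <-≤-trans (inShape K (subst (1 ≤_) (sym (Run.hi-at (runs end c≤end ≤-refl))) (s≤s z≤n))) (parts r₀)
    k = C ∸ suc end
    C≡ : C ≡ end + suc k
    C≡ = sym (trans (+-suc end k) (m+[n∸m]≡n end<C))
    occ≤ : ∀ c v → 1 ≤ v → occ n x c v ≤ 1
    occ≤ c v p = occ≤1 K p
    st : EStep i (marks n C x) (marks n C raised)
    st = colStep⇒EStep 1≤i i<n x occ≤ C≡ colStep
           (length≡0 (trans (Zfrom-rc 1≤i i<n x occ≤ 0 end) (Sig.falls⇒rc≡0 n x i 0 end (λ j q → falling j q))))
           (length≡0 (trans (Zfrom-lc 1≤i i<n x occ≤ (suc end) k) (n≤0⇒n≡0 (Sig.dom⇒lc≤ n x i (suc end) k 0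
              (λ j q → subst (λ z → hgt n x (suc i) (suc end + j) + hgt n x i (suc end) ≤ hgt n x (suc i) (suc end) + z)
                (sym (+-identityʳ _)) (dominated (suc end + j) (m≤m+n (suc end) j)))))))

  hgt-const : ∀ {t} → SSKT α φ t → ∀ v → 1 ≤ v → ∀ c → C ≤ c → hgt n (val t) v c ≡ hgt n (val t) v C
  hgt-const {t} h v 1≤v c p with m≤n⇒m<n∨m≡n p
  ... | inj₂ refl = refl
  hgt-const {t} h v 1≤v (suc c) p | inj₁ q = trans
      (cong (_+ hgt n (val t) v c) (occ-no (kt {t} h)
      (λ r e → <-irrefl (trans (sym (KT.out (kt {t} h) r c (≤-trans (parts r) (≤-pred q)))) e) 1≤v)))
    (hgt-const {t} h v 1≤v c (≤-pred q))

  heights-of-none : ∀ {i t} → 1 ≤ i → i < n → SSKT α φ t → Ls i (marks n C (val t)) ≡ [] → ∀ c → hgt n (val t) (suc i) c ≤ hgt n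
      (val t) i c
  heights-of-none {i} {t} 1≤i i<n h e c with ≤-total c C
  ... | inj₁ p = below c p
    where
    below : ∀ c → c ≤ C → hgt n (val t) (suc i) c ≤ hgt n (val t) i c
    below c p = subst₂ _≤_ (+-identityʳ _) (+-identityʳ _)
        (Sig.lc≤⇒dom n (val t) i 0 C 0 (≤-reflexive (trans (sym (Zfrom-lc 1≤i i<n (val t) (λ c v p → occ≤1 (kt {t} h) p) 0 C))
          (cong length e))) c p)
  ... | inj₂ p = subst₂ _≤_ (sym (hgt-const {t} h (suc i) (s≤s z≤n) c p)) (sym (hgt-const {t} h i 1≤i c p))
      (subst₂ _≤_ (+-identityʳ _) (+-identityʳ _)
        (Sig.lc≤⇒dom n (val t) i 0 C 0 (≤-reflexive (trans (sym (Zfrom-lc 1≤i i<n (val t) (λ c v p → occ≤1 (kt {t} h) p) 0 C))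
          (cong length e))) C ≤-refl))

  -- `findLo` gives the column of the leftmost unmatched `i`, where `Lower` applies. All unmatched
  -- `i + 1` lie to the left of that column, so by `balance` the existence of one makes the excess
  -- there positive; otherwise the flags avoid `i`. This is the alternative in the last premise.
  lower : ∀ {i t} → 1 ≤ i → i < n → SSKT α φ t → Rs i (marks n C (val t)) ≢ [] →
    (∀ r → φ (suc r) ≢ i) ⊎ Ls i (marks n C (val t)) ≢ [] → ∃ λ t' → SSKT α φ t' × EStep i (marks n C (val t'))
      (marks n C (val t))
  lower {i} {t} 1≤i i<n h rs fl with Sig.findLo n (val t) i (λ c → occ≤1 (kt {t} h) 1≤i) 0 C
  ... | inj₁ z = ⊥-elim (rs (length≡0 (trans (Zfrom-rc 1≤i i<n (val t) (λ c v p → occ≤1 (kt {t} h) p) 0 C) z)))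
  ... | inj₂ (Brackets.openColumn d k C≡ m1 p0 r0 l0) = t' , sskt , subst (λ z → EStep i z (marks n C x))
      (marks-cong n C L.lowered (val t') occ≡) st
    where
    K = kt {t} h
    x = val t
    open Sig n x i
    row = proj₁ (occ≡1 K 1≤i m1)
    P = hgt n x (suc i)
    N = hgt n x i
    dom : Dominated P N (suc d)
    dom c q with ≤-total c C
    ... | inj₁ c≤ = subst₂ (λ z w → P z + N (suc d) ≤ P (suc d) + w) (m+[n∸m]≡n q) (trans (+-identityʳ _) (cong N (m+[n∸m]≡n q)))
           (lc≤⇒dom (suc d) k 0 (≤-reflexive l0) (c ∸ suc d) (subst (c ∸ suc d ≤_) kk (∸-monoˡ-≤ (suc d) c≤)))
      where
      kk : C ∸ suc d ≡ k
      kk = trans (cong (_∸ suc d) (trans C≡ (+-suc d k))) (m+n∸m≡n (suc d) k)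
    ... | inj₂ C≤ = subst₂ (λ z w → z + N (suc d) ≤ P (suc d) + w)
        (trans (cong P kk) (sym (hgt-const {t} h (suc i) (s≤s z≤n) c C≤)))
        (trans (+-identityʳ _) (trans (cong N kk) (sym (hgt-const {t} h i 1≤i c C≤))))
           (lc≤⇒dom (suc d) k 0 (≤-reflexive l0) k ≤-refl)
      where
      kk : suc d + k ≡ C
      kk = sym (trans C≡ (+-suc d k))
    flagOk : (∀ r → φ (suc r) ≢ i) ⊎ Ls i (marks n C x) ≢ [] → (∀ k → x k 0 ≡ i → suc i ≤ φ (suc k)) ⊎ N d < P d
    flagOk (inj₁ f) = inj₁ (λ k e → ≤∧≢⇒< (subst (_≤ φ (suc k)) e (KT.flag K k)) (f k ∘ sym))
    flagOk (inj₂ f) = inj₂ (subst (N d <_) bal (m<n+m (N d) (n≢0⇒n>0 lc≢0)))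
      where
      lastZero : lcF d (suc k) ≡ 0
      lastZero rewrite m1 | p0 | l0 = refl
      lc≡ : length (Ls i (marks n C x)) ≡ lcF 0 d
      lc≡ = trans (Zfrom-lc 1≤i i<n x (λ c v p → occ≤1 K p) 0 C)
          (trans (cong (lcF 0) C≡) (trans (lcF-+ 0 d (suc k) r0) (trans (cong (lcF 0 d +_) lastZero) (+-identityʳ _))))
      lc≢0 : lcF 0 d ≢ 0
      lc≢0 z = f (length≡0 (trans lc≡ z))
      bal : lcF 0 d + N d ≡ P d
      bal = trans (cong (lcF 0 d +_) (sym (+-identityʳ (N d))))
          (trans (balance 0 d) (trans (cong (_+ (P d + 0)) r0) (+-identityʳ (P d))))
    module L = Lower K 1≤i (proj₂ (occ≡1 K 1≤i m1)) (occ≡0 K (s≤s z≤n) p0) (λ c q → rc≡0⇒falls 0 d r0 c q) dom (flagOk fl)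
    t' = mkTab L.lowered 0 α
    v≡ : ∀ r c → val t' r c ≡ L.lowered r c
    v≡ = val-mkTab α L.lowered L.lowered-KT
    sskt : SSKT α φ t'
    sskt = KT⇒SSKT {α = α} {φ} {t'} len (mkTab-shape L.lowered 0 α)
        (KT-resp L.lowered-KT (λ _ → refl) (λ r c → sym (v≡ r c)) (KT.flag L.lowered-KT))
    occ≡ : ∀ c v → 1 ≤ v → occ n L.lowered c v ≡ occ n (val t') c v
    occ≡ c v _ = occ-resp n L.lowered (val t') c v (λ r → sym (v≡ r c))
    occ≤ : ∀ c v → 1 ≤ v → occ n x c v ≤ 1
    occ≤ c v p = occ≤1 K p
    off≡ : ∀ c v → c ≢ d → pres n L.lowered c v ≡ pres n x c v
    off≡ c v ne = cong (0 <ᵇ_) (sym (ColStep.away L.colStep c v ne))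
    st : EStep i (marks n C L.lowered) (marks n C x)
    st = colStep⇒EStep 1≤i i<n L.lowered (λ c v p → occ≤1 L.lowered-KT p) C≡ L.colStep
          (trans (cong (Rs i) (Zfrom-cong n _ _ 0 d (λ c v _ q _ → off≡ c v (<⇒≢ q))))
            (length≡0 (trans (Zfrom-rc 1≤i i<n x occ≤ 0 d) r0)))
          (trans (cong (Ls i) (Zfrom-cong n _ _ (suc d) k (λ c v q _ _ → off≡ c v (λ e → <-irrefl (sym e) q))))
            (length≡0 (trans (Zfrom-lc 1≤i i<n x occ≤ (suc d) k) l0)))

  val-bound : ∀ {t} → SSKT α φ t → ∀ r c → val t r c ≤ n
  val-bound {t} h r c with r <? length α
  ... | yes p = ≤-trans (le-flag (kt {t} h) r c) (bound r p)
  ... | no p = subst (_≤ n) (sym (KT.out (kt {t} h) r c (subst (_≤ c) (sym zeroRow) z≤n))) z≤n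
    where
    zeroRow : nthN0 α r ≡ 0
    zeroRow with nth0 α r | nthView α r
    ... | _ | inside q = ⊥-elim (p q)
    ... | _ | outside _ = refl

-- A marked list records the columns before `C` and the values 1 to `n`; beyond these bounds both
-- tableaux are empty.
marks-occ : ∀ {n C α α' φ φ' t t'} (ok : Ok n C α φ) (ok' : Ok n C α' φ') → SSKT α φ t → SSKT α' φ' t' → marks n C (val t) ≡ marks
    n C (val t') →
  ∀ c v → 1 ≤ v → occ n (val t) c v ≡ occ n (val t') c v
marks-occ {n} {C} {t = t} {t'} ok ok' h h' e c v 1≤v with c <? C | v ≤? n
... | yes p | yes q = trans (sym (b2n-pres {n} {val t} {c} (occ≤1 (kt ok {t} h) 1≤v)))
        (trans (cong b2n (Zfrom-injective n _ _ 0 C e c v z≤n p 1≤v q)) (b2n-pres {n} {val t'} {c} (occ≤1 (kt ok' {t'} h') 1≤v)))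
  where open Crystal
... | no p | _ = trans (empty {u = t} ok h) (sym (empty {u = t'} ok' h'))
  where
  empty : ∀ {α φ} {u} (ok : Ok n C α φ) → SSKT α φ u → occ n (val u) c v ≡ 0
  empty {u = u} ok h = occ-no (Crystal.kt ok {u} h)
      (λ r e → <-irrefl (trans (sym (KT.out (Crystal.kt ok {u} h) r c (≤-trans (Ok.parts ok r) (≮⇒≥ p)))) e) 1≤v)
... | yes _ | no q = trans (empty {u = t} ok h) (sym (empty {u = t'} ok' h'))
  where
  empty : ∀ {α φ} {u} (ok : Ok n C α φ) → SSKT α φ u → occ n (val u) c v ≡ 0
  empty {u = u} ok h = occ-no (Crystal.kt ok {u} h) (λ r e → q (subst (_≤ n) e (Crystal.val-bound ok {u} h r c)))

marks-injective : ∀ {n C α φ φ' t t'} (ok : Ok n C α φ) (ok' : Ok n C α φ') → SSKT α φ t → SSKT α φ' t' → marks n C (val t) ≡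
    marks n C (val t') → t ≡ t'
marks-injective {C = C} {α} {φ} {φ'} {t} {t'} ok ok' h h' e = tab-ext t t'
  (trans (SSKT-shape {α = α} {φ} {t} (Ok.len ok) h) (sym (SSKT-shape {α = α} {φ'} {t'} (Ok.len ok) h')))
  (KT-unique C (Ok.parts ok) (Crystal.kt ok {t} h) (Crystal.kt ok' {t'} h') (marks-occ {t = t} {t'} ok ok' h h' e))

-- Reduced words and inversions

All-reverse : ∀ {A : Set} {P : A → Set} {xs} → All P xs → All P (reverse xs)
All-reverse [] = []
All-reverse {P = P} {x ∷ xs} (p ∷ ps) = subst (All P) (sym (unfold-reverse x xs)) (++⁺ (All-reverse ps) (p ∷ []))

count-++ : ∀ a xs ys → count a (xs ++ ys) ≡ count a xs + count a ys
count-++ a [] ys = refl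
count-++ a (x ∷ xs) ys with a ≡ᵇ x
... | true = cong suc (count-++ a xs ys)
... | false = count-++ a xs ys

count-cons : ∀ a x xs → count a (x ∷ xs) ≡ b2n (a ≡ᵇ x) + count a xs
count-cons a x xs with a ≡ᵇ x
... | true = refl
... | false = refl

count-0 : ∀ {a xs} → All (a ≢_) xs → count a xs ≡ 0
count-0 [] = refl
count-0 {a} {x ∷ xs} (p ∷ ps) rewrite ≡ᵇ-no p = count-0 ps

count⇒∉ : ∀ {a} xs → count a xs ≡ 0 → All (a ≢_) xs
count⇒∉ [] e = []
count⇒∉ {a} (x ∷ xs) e with a ≟ x
... | yes p rewrite ≡ᵇ-yes p = case e of λ ()
... | no p rewrite ≡ᵇ-no p = p ∷ count⇒∉ xs e

∈-split : ∀ {A : Set} {a : A} {xs} → a ∈ xs → ∃ λ ys → ∃ λ zs → xs ≡ ys ++ a ∷ zs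
∈-split {xs = x ∷ xs} (here refl) = [] , xs , refl
∈-split {xs = x ∷ xs} (there p) with ∈-split p
... | ys , zs , refl = x ∷ ys , zs , refl

∈-All : ∀ {A : Set} {P : A → Set} xs → (∀ a → a ∈ xs → P a) → All P xs
∈-All [] f = []
∈-All (x ∷ xs) f = f x (here refl) ∷ ∈-All xs (λ a p → f a (there p))

applyS-le : ∀ {a b} x → b ≢ a → x ≤ a → applyS b x ≤ a
applyS-le {a} {b} x ne p with applyS b x | swapView b x
... | _ | is-lo = ≤∧≢⇒< p ne
... | _ | is-hi = ≤-trans (n≤1+n b) p
... | _ | is-fixed _ _ = p

applyS-gt : ∀ {a b} x → b ≢ a → a < x → a < applyS b x
applyS-gt {a} {b} x ne p with applyS b x | swapView b x
... | _ | is-lo = m≤n⇒m≤1+n p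
... | _ | is-hi = ≤∧≢⇒< (≤-pred p) (ne ∘ sym)
... | _ | is-fixed _ _ = p

permOf-le : ∀ {a} u x → All (a ≢_) u → x ≤ a → permOf u x ≤ a
permOf-le [] x h p = p
permOf-le (b ∷ u) x (ne ∷ h) p = applyS-le (permOf u x) (ne ∘ sym) (permOf-le u x h p)

permOf-gt : ∀ {a} u x → All (a ≢_) u → a < x → a < permOf u x
permOf-gt [] x h p = p
permOf-gt (b ∷ u) x (ne ∷ h) p = applyS-gt (permOf u x) (ne ∘ sym) (permOf-gt u x h p)

permOf-reverse : ∀ u x → permOf u (permOf (reverse u) x) ≡ x
permOf-reverse [] x = refl
permOf-reverse (a ∷ u) x = trans (cong (permOf (a ∷ u))
    (trans (cong (λ w → permOf w x) (unfold-reverse a u)) (permOf-++ (reverse u) [ a ] x)))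
  (trans (cong (applyS a) (permOf-reverse u (applyS a x))) (applyS-invol a x))

-- A letter occurring exactly once moves some number across a, which words avoiding a cannot do.
letter-needed : ∀ {a} u₁ u₂ v → All (a ≢_) u₁ → All (a ≢_) u₂ → SamePerm v (u₁ ++ a ∷ u₂) → ¬ All (a ≢_) v
letter-needed {a} u₁ u₂ v h₁ h₂ same hv = <⇒≱ crossed (permOf-le v x hv x≤)
  where
  x = permOf (reverse u₂) a
  x≤ : x ≤ a
  x≤ = permOf-le (reverse u₂) a (All-reverse h₂) ≤-refl
  crossed : a < permOf v x
  crossed = subst (a <_) (sym (trans (same x) (trans (permOf-++ u₁ (a ∷ u₂) x)
      (cong (λ z → permOf u₁ (applyS a z)) (permOf-reverse u₂ a)))))
    (permOf-gt u₁ _ h₁ (subst (a <_) (sym (applyS-lo a)) ≤-refl))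

∈? : ∀ (a : ℕ) v → a ∈ v ⊎ All (a ≢_) v
∈? a [] = inj₂ []
∈? a (x ∷ v) with a ≟ x | ∈? a v
... | yes p | _ = inj₁ (here p)
... | no _ | inj₁ q = inj₁ (there q)
... | no p | inj₂ q = inj₂ (p ∷ q)

∈-remove : ∀ {A : Set} {a b : A} ys {zs} → b ∈ ys ++ a ∷ zs → b ≢ a → b ∈ ys ++ zs
∈-remove [] (here e) ne = ⊥-elim (ne e)
∈-remove [] (there p) ne = p
∈-remove (y ∷ ys) (here e) ne = here e
∈-remove (y ∷ ys) (there p) ne = there (∈-remove ys p ne)

distinct-length : ∀ u v → (∀ a → count a u ≤ 1) → All (_∈ v) u → length u ≤ length v
distinct-length [] v h m = z≤n
distinct-length (a ∷ u) v h (p ∷ m) with ∈-split p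
... | ys , zs , refl = subst (suc (length u) ≤_)
    (sym (trans (length-++ ys) (trans (+-suc (length ys) (length zs)) (cong suc (sym (length-++ ys))))))
    (s≤s (distinct-length u (ys ++ zs) (λ b → ≤-trans (subst (count b u ≤_) (sym (count-cons b a u)) (m≤n+m _ _)) (h b))
      (sub u m a∉u)))
  where
  a∉u : All (a ≢_) u
  a∉u = count⇒∉ u (n≤0⇒n≡0 (≤-pred (subst (_≤ 1) (trans (count-cons a a u) (cong (λ b → b2n b + count a u) (≡ᵇ-yes {a} refl)))
      (h a))))
  sub : ∀ u → All (_∈ ys ++ a ∷ zs) u → All (a ≢_) u → All (_∈ ys ++ zs) u
  sub [] _ _ = []
  sub (b ∷ u) (q ∷ qs) (ne ∷ nes) = ∈-remove ys q (ne ∘ sym) ∷ sub u qs nes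

-- By `letter-needed` every word of the same permutation contains each letter of `u`; as `u` has no
-- repetition, that word is at least as long.
distinct-Reduced : ∀ u → PosWord u → (∀ a → count a u ≤ 1) → Reduced u
distinct-Reduced u pos h = pos , λ v pv same → distinct-length u v h (∈-All u (λ a p → inV v same a p))
  where
  inV : ∀ v → SamePerm v u → ∀ a → a ∈ u → a ∈ v
  inV v same a p with ∈? a v
  ... | inj₁ q = q
  ... | inj₂ q with ∈-split p
  ...   | u₁ , u₂ , refl = ⊥-elim (letter-needed u₁ u₂ v (count⇒∉ u₁ (m+n≡0⇒m≡0 _ z)) (count⇒∉ u₂ (m+n≡0⇒n≡0 (count a u₁) z)) same
      q)
    where
    z : count a u₁ + count a u₂ ≡ 0
    z = n≤0⇒n≡0 (≤-pred (subst (_≤ 1) (trans (count-++ a u₁ (a ∷ u₂))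
        (trans (cong (count a u₁ +_) (trans (count-cons a a u₂) (cong (λ b → b2n b + count a u₂) (≡ᵇ-yes {a} refl))))
        (+-suc (count a u₁) (count a u₂)))) (h a)))

rowsWord : ℕ → ℕ → Marked → List ℕ
rowsWord s m Z = concat (reverse (map (λ j → rowOf j Z) (rangeFrom s m)))

rowsWord-suc : ∀ s m Z → rowsWord s (suc m) Z ≡ rowsWord (suc s) m Z ++ rowOf s Z
rowsWord-suc s m Z = trans (cong concat (unfold-reverse (rowOf s Z) (map (λ j → rowOf j Z) (rangeFrom (suc s) m))))
  (trans (sym (concat-++ (reverse (map (λ j → rowOf j Z) (rangeFrom (suc s) m))) _))
    (cong (rowsWord (suc s) m Z ++_) (++-identityʳ (rowOf s Z))))

rowsWord-skip : ∀ s m a v Z → v < s → rowsWord s m ((a , v) ∷ Z) ≡ rowsWord s m Z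
rowsWord-skip s m a v Z p = cong (concat ∘ reverse)
    (map-range-cong _ _ s m (λ k q _ → rowOf-no Z (λ e → <⇒≱ p (≤-trans q (≤-reflexive (sym e))))))

count-rowsWord : ∀ x s m a v Z → count x (rowsWord s m ((a , v) ∷ Z)) ≤ b2n (x ≡ᵇ a) + count x (rowsWord s m Z)
count-rowsWord x s zero a v Z = z≤n
count-rowsWord x s (suc m) a v Z = subst₂ _≤_
    (sym (trans (cong (count x) (rowsWord-suc s m ((a , v) ∷ Z))) (count-++ x (rowsWord (suc s) m ((a , v) ∷ Z)) _)))
  (cong (b2n (x ≡ᵇ a) +_) (sym (trans (cong (count x) (rowsWord-suc s m Z)) (count-++ x (rowsWord (suc s) m Z) _)))) go
  where
  W = rowsWord (suc s) m Z
  go : count x (rowsWord (suc s) m ((a , v) ∷ Z)) + count x (rowOf s ((a , v) ∷ Z)) ≤ b2n (x ≡ᵇ a) +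
      (count x W + count x (rowOf s Z))
  go with v ≟ s
  ... | yes refl = ≤-reflexive (trans (cong₂ (λ p q → count x p + count x q) (rowsWord-skip (suc s) m a v Z ≤-refl)
      (rowOf-yes Z refl))
         (trans (cong (count x W +_) (count-cons x a (rowOf s Z)))
           (solve 3 (λ p q r → p :+ (q :+ r) := q :+ (p :+ r)) refl (count x W) (b2n (x ≡ᵇ a)) (count x (rowOf s Z)))))
  ... | no ne = ≤-trans (+-mono-≤ (count-rowsWord x (suc s) m a v Z) (≤-reflexive (cong (count x) (rowOf-no Z ne))))
      (≤-reflexive (+-assoc (b2n (x ≡ᵇ a)) _ _))

rowsWord-[] : ∀ s m → rowsWord s m [] ≡ []
rowsWord-[] s zero = refl
rowsWord-[] s (suc m) = trans (rowsWord-suc s m []) (trans (++-identityʳ _) (rowsWord-[] (suc s) m))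

count-word : ∀ x s m Z → count x (rowsWord s m Z) ≤ count x (map proj₁ Z)
count-word x s m [] = ≤-reflexive (cong (count x) (rowsWord-[] s m))
count-word x s m ((a , v) ∷ Z) = ≤-trans (count-rowsWord x s m a v Z)
    (subst (b2n (x ≡ᵇ a) + count x (rowsWord s m Z) ≤_) (sym (count-cons x a (map proj₁ Z)))
    (+-monoʳ-≤ (b2n (x ≡ᵇ a)) (count-word x s m Z)))

count-letters : ∀ {p u} Z → Valid p u Z → ∀ x → count x (map proj₁ Z) ≤ 1
count-letters [] V x = z≤n
count-letters ((a , v) ∷ Z) (_ ∷ V) x with x ≟ a
... | no ne rewrite ≡ᵇ-no ne = count-letters Z V x
... | yes refl rewrite ≡ᵇ-yes {x} refl = s≤s (≤-reflexive (count-0 (letters (Valid-lower V x ≤-refl))))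
  where
  letters : ∀ {Z} → All (λ z → x < proj₁ z) Z → All (x ≢_) (map proj₁ Z)
  letters [] = []
  letters (p ∷ ps) = <⇒≢ p ∷ letters ps

word-Reduced : ∀ n Z → Valid 0 0 Z → Reduced (wordOf n (λ j → rowOf j Z))
word-Reduced n Z V = distinct-Reduced _ (concat⁺ (All-reverse (rows (range1 n))))
    (λ a → ≤-trans (count-word a 1 n Z) (count-letters Z V a))
  where
  rows : ∀ js → All (All (1 ≤_)) (map (λ j → rowOf j Z) js)
  rows [] = []
  rows (j ∷ js) = rowOf-All j (Valid-lower V 0 ≤-refl) ∷ rows js

-- Ascending pairs and sorting words

greater : ℕ → List ℕ → ℕ
greater x [] = 0
greater x (y ∷ ys) = b2n (x <ᵇ y) + greater x ys

-- Inversions with respect to the weakly decreasing order: an exchange at an ascent lowers the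
-- number by one, any other exchange of neighbours does not lower it.
inv : List ℕ → ℕ
inv [] = 0
inv (x ∷ xs) = greater x xs + inv xs

greater-swap : ∀ x l ys → greater x (swapAt1 (suc l) ys) ≡ greater x ys
greater-swap x zero [] = refl
greater-swap x zero (y ∷ []) = refl
greater-swap x zero (y ∷ z ∷ ys) = solve 3 (λ a b c → a :+ (b :+ c) := b :+ (a :+ c)) refl (b2n (x <ᵇ z)) (b2n (x <ᵇ y))
    (greater x ys)
greater-swap x (suc l) [] = refl
greater-swap x (suc l) (y ∷ ys) = cong (b2n (x <ᵇ y) +_) (greater-swap x l ys)

inv-swap-< : ∀ l β → suc l < length β → nthN0 β l < nthN0 β (suc l) → inv β ≡ suc (inv (swapAt1 (suc l) β))
inv-swap-< zero (x ∷ y ∷ β) p q rewrite <ᵇ-yes q | <ᵇ-no (<⇒≤ q) = cong suc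
    (solve 3 (λ a b c → a :+ (b :+ c) := b :+ (a :+ c)) refl (greater x β) (greater y β) (inv β))
inv-swap-< zero (x ∷ []) (s≤s ()) q
inv-swap-< (suc l) (x ∷ β) (s≤s p) q = trans (cong₂ _+_ (sym (greater-swap x l β)) (inv-swap-< l β p q)) (+-suc _ _)

inv-swap-≥ : ∀ l β → suc l < length β → nthN0 β (suc l) ≤ nthN0 β l → inv β ≤ inv (swapAt1 (suc l) β)
inv-swap-≥ zero (x ∷ y ∷ β) p q rewrite <ᵇ-no q = ≤-trans (m≤n+m _ (b2n (y <ᵇ x)))
  (≤-reflexive (solve 4 (λ a b c d → d :+ (a :+ (b :+ c)) := (d :+ b) :+ (a :+ c)) refl (greater x β) (greater y β) (inv β)
    (b2n (y <ᵇ x))))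
inv-swap-≥ zero (x ∷ []) (s≤s ()) q
inv-swap-≥ (suc l) (x ∷ β) (s≤s p) q = +-mono-≤ (≤-reflexive (sym (greater-swap x l β))) (inv-swap-≥ l β p q)

inv-swap-≤ : ∀ l β → suc l < length β → inv β ≤ suc (inv (swapAt1 (suc l) β))
inv-swap-≤ l β p with nthN0 β l <? nthN0 β (suc l)
... | yes q = ≤-reflexive (inv-swap-< l β p q)
... | no q = m≤n⇒m≤1+n (inv-swap-≥ l β p (≮⇒≥ q))

swap-length : ∀ i (β : List ℕ) → length (swapAt1 i β) ≡ length β
swap-length zero β = refl
swap-length (suc zero) [] = refl
swap-length (suc zero) (x ∷ []) = refl
swap-length (suc zero) (x ∷ y ∷ β) = refl
swap-length (suc (suc i)) [] = refl
swap-length (suc (suc i)) (x ∷ β) = cong suc (swap-length (suc i) β)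

nthN0-swap : ∀ l β r → suc l < length β → nthN0 (swapAt1 (suc l) β) r ≡ nthN0 β (applyS l r)
nthN0-swap zero (x ∷ []) r (s≤s ())
nthN0-swap zero (x ∷ y ∷ β) zero p = refl
nthN0-swap zero (x ∷ y ∷ β) (suc zero) p = refl
nthN0-swap zero (x ∷ y ∷ β) (suc (suc r)) p = refl
nthN0-swap (suc l) (x ∷ β) zero p = refl
nthN0-swap (suc l) (x ∷ β) (suc r) (s≤s p) = trans (nthN0-swap l β r p) (sym (lem l r))
  where
  lem : ∀ l r → nthN0 (x ∷ β) (applyS (suc l) (suc r)) ≡ nthN0 β (applyS l r)
  lem l r with r ≡ᵇ l
  ... | true = refl
  ... | false with r ≡ᵇ suc l
  ...   | true = refl
  ...   | false = refl

data Sorts (lam : List ℕ) : List ℕ → List ℕ → Set where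
  done : Sorts lam [] lam
  step : ∀ {l σ β} → suc l < length β → nthN0 β l < nthN0 β (suc l) → Sorts lam σ (swapAt1 (suc l) β) → Sorts lam (suc l ∷ σ) β

-- The padding `zs` makes room for competing words whose letters go beyond the length of `β`.
Sorts-inv : ∀ {lam σ β} zs → Sorts lam σ β → inv (β ++ zs) ≡ length σ + inv (actW σ (β ++ zs))
Sorts-inv zs done = refl
Sorts-inv {σ = suc l ∷ σ} {β} zs (step p q S) = trans
    (inv-swap-< l (β ++ zs) (subst (suc l <_) (sym (length-++ β)) (m≤n⇒m≤n+o (length zs) p))
      (subst₂ _<_ (sym (nth-++ β l (<-trans (n<1+n l) p))) (sym (nth-++ β (suc l) p)) q))
    (cong suc (trans (cong inv (swap-++ l β p)) (trans (Sorts-inv zs S)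
      (cong (λ γ → length σ + inv (actW σ γ)) (sym (swap-++ l β p))))))
  where
  nth-++ : ∀ β r → r < length β → nthN0 (β ++ zs) r ≡ nthN0 β r
  nth-++ (x ∷ β) zero _ = refl
  nth-++ (x ∷ β) (suc r) (s≤s h) = nth-++ β r h
  swap-++ : ∀ l β → suc l < length β → swapAt1 (suc l) (β ++ zs) ≡ swapAt1 (suc l) β ++ zs
  swap-++ zero (x ∷ []) (s≤s ())
  swap-++ zero (x ∷ y ∷ β) h = refl
  swap-++ (suc l) (x ∷ β) (s≤s h) = cong (x ∷_) (swap-++ l β h)

actW-length : ∀ v (β : List ℕ) → length (actW v β) ≡ length β
actW-length [] β = refl
actW-length (i ∷ v) β = trans (actW-length v (swapAt1 i β)) (swap-length i β)

inv-actW : ∀ v β → PosWord v → All (_< length β) v → inv β ≤ length v + inv (actW v β)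
inv-actW [] β _ _ = ≤-refl
inv-actW (suc l ∷ v) β (_ ∷ pos) (p ∷ h) = ≤-trans (inv-swap-≤ l β p)
  (s≤s (inv-actW v (swapAt1 (suc l) β) pos (subst (λ n → All (_< n) v) (sym (swap-length (suc l) β)) h)))

permOf-pos : ∀ v x → PosWord v → 1 ≤ x → 1 ≤ permOf v x
permOf-pos [] x h p = p
permOf-pos (a ∷ v) x (q ∷ h) p = applyS-pos a q (permOf-pos v x h p)

-- Shows that the action of a word depends only on its permutation. The shift by one translates
-- between 0-based positions and permutations of the positive integers.
actW-nth : ∀ v β → PosWord v → All (_< length β) v → ∀ r → nthN0 (actW v β) r ≡ nthN0 β (permOf v (suc r) ∸ 1)
actW-nth [] β _ _ r = refl
actW-nth (suc l ∷ v) β (_ ∷ pos) (p ∷ h) r = trans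
    (actW-nth v (swapAt1 (suc l) β) pos (subst (λ n → All (_< n) v) (sym (swap-length (suc l) β)) h) r)
  (trans (nthN0-swap l β _ p) (cong (nthN0 β) (lem (permOf v (suc r)) (permOf-pos v (suc r) pos (s≤s z≤n)))))
  where
  lem : ∀ y → 1 ≤ y → applyS l (y ∸ 1) ≡ applyS (suc l) y ∸ 1
  lem (suc y) _ with y ≡ᵇ l
  ... | true = refl
  ... | false with y ≡ᵇ suc l
  ...   | true = refl
  ...   | false = refl

Sorts-letters : ∀ {lam σ β} → Sorts lam σ β → All (λ j → 1 ≤ j × j < length β) σ
Sorts-letters done = []
Sorts-letters {β = β} (step {l} {σ} p q S) = (s≤s z≤n , p) ∷ All-map (λ { (a , b) → a , subst (_ <_) (swap-length (suc l) β) b })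
    (Sorts-letters S)

sumL : List ℕ → ℕ
sumL [] = 0
sumL (x ∷ xs) = suc x + sumL xs

All-<-sum : ∀ v → All (_< sumL v) v
All-<-sum [] = []
All-<-sum (x ∷ v) = s≤s (m≤m+n x (sumL v)) ∷ All-map (λ l → ≤-trans l (m≤n+m (sumL v) (suc x))) (All-<-sum v)

list-ext : ∀ (xs ys : List ℕ) → length xs ≡ length ys → (∀ r → nthN0 xs r ≡ nthN0 ys r) → xs ≡ ys
list-ext [] [] e h = refl
list-ext (x ∷ xs) (y ∷ ys) e h = cong₂ _∷_ (h 0) (list-ext xs ys (suc-injective e) (h ∘ suc))

-- Let `v` be a word of the same permutation. On `β` padded with `sumL v` zeros, a number exceeding
-- every letter of `v`, it acts as `σ` does and thus lowers `inv` by the length of `σ`; each letter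
-- of `v` lowers it by at most one.
Sorts-Reduced : ∀ {lam σ β} → Sorts lam σ β → Reduced σ
Sorts-Reduced {lam} {σ} {β} S = All-map proj₁ (Sorts-letters S) , λ v pv same → +-cancelʳ-≤ (inv (actW σ (β ++ zs v))) _ _
    (subst₂ _≤_ (Sorts-inv (zs v) S) (cong (λ γ → length v + inv γ) (same-act v pv same)) (inv-actW v (β ++ zs v) pv (lt v)))
  where
  zs : List ℕ → List ℕ
  zs v = replicate (sumL v) 0
  len : ∀ v → length (β ++ zs v) ≡ length β + sumL v
  len v = trans (length-++ β) (cong (length β +_) (length-replicate (sumL v)))
  lt : ∀ v → All (_< length (β ++ zs v)) v
  lt v = All-map (λ l → subst (_ <_) (sym (len v)) (≤-trans l (m≤n+m (sumL v) (length β)))) (All-<-sum v)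
  ltσ : ∀ v → All (_< length (β ++ zs v)) σ
  ltσ v = All-map (λ { (_ , l) → subst (_ <_) (sym (len v)) (≤-trans l (m≤m+n (length β) (sumL v))) }) (Sorts-letters S)
  same-act : ∀ v → PosWord v → SamePerm v σ → actW v (β ++ zs v) ≡ actW σ (β ++ zs v)
  same-act v pv same = list-ext _ _ (trans (actW-length v _) (sym (actW-length σ _)))
    (λ r → trans (actW-nth v _ pv (lt v) r) (trans (cong (λ y → nthN0 (β ++ zs v) (y ∸ 1)) (same (suc r)))
      (sym (actW-nth σ _ (All-map proj₁ (Sorts-letters S)) (ltσ v) r))))

WeaklyDec : List ℕ → Set
WeaklyDec β = ∀ r → nthN0 β (suc r) ≤ nthN0 β r

weaklyDec⁻ : ∀ β → T (weaklyDecB β) → WeaklyDec β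
weaklyDec⁻ [] h r = z≤n
weaklyDec⁻ (x ∷ []) h r = z≤n
weaklyDec⁻ (x ∷ y ∷ β) h zero = ≤ᵇ⇒≤ y x (proj₁ (T-∧⁻ {y ≤ᵇ x} h))
weaklyDec⁻ (x ∷ y ∷ β) h (suc r) = weaklyDec⁻ (y ∷ β) (proj₂ (T-∧⁻ {y ≤ᵇ x} h)) r

weaklyDec⁺ : ∀ β → WeaklyDec β → T (weaklyDecB β)
weaklyDec⁺ [] h = tt
weaklyDec⁺ (x ∷ []) h = tt
weaklyDec⁺ (x ∷ y ∷ β) h = T-∧⁺ {y ≤ᵇ x} (≤⇒≤ᵇ (h 0)) (weaklyDec⁺ (y ∷ β) (h ∘ suc))

ascent? : ∀ β → WeaklyDec β ⊎ ∃ λ l → suc l < length β × nthN0 β l < nthN0 β (suc l)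
ascent? [] = inj₁ (λ r → z≤n)
ascent? (x ∷ []) = inj₁ (λ r → z≤n)
ascent? (x ∷ y ∷ β) with x <? y | ascent? (y ∷ β)
... | yes p | _ = inj₂ (0 , s≤s (s≤s z≤n) , p)
... | no _ | inj₂ (l , p , q) = inj₂ (suc l , s≤s p , q)
... | no p | inj₁ h = inj₁ λ { zero → ≮⇒≥ p ; (suc r) → h r }

bubble : ∀ k β → inv β ≤ k → ∃ λ σ → ∃ λ lam → Sorts lam σ β × WeaklyDec lam
bubble k β p with ascent? β
... | inj₁ h = [] , β , done , h
bubble zero β p | inj₂ (l , a , b) = ⊥-elim (1+n≰n (≤-trans (≤-reflexive (sym (inv-swap-< l β a b))) (≤-trans p z≤n)))
bubble (suc k) β p | inj₂ (l , a , b) with bubble k (swapAt1 (suc l) β) (≤-pred (subst (_≤ suc k) (inv-swap-< l β a b) p))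
... | σ , lam , S , h = suc l ∷ σ , lam , step a b S , h

greater-dec : ∀ x β → (∀ r → nthN0 β r ≤ x) → greater x β ≡ 0
greater-dec x [] h = refl
greater-dec x (y ∷ β) h rewrite <ᵇ-no (h 0) = greater-dec x β (h ∘ suc)

inv-dec : ∀ β → WeaklyDec β → inv β ≡ 0
inv-dec [] h = refl
inv-dec (x ∷ β) h = cong₂ _+_ (greater-dec x β (bound β x (h 0) (h ∘ suc))) (inv-dec β (h ∘ suc))
  where
  bound : ∀ β x → nthN0 β 0 ≤ x → WeaklyDec β → ∀ r → nthN0 β r ≤ x
  bound β x p h zero = p
  bound β x p h (suc r) = ≤-trans (h r) (bound β x p h r)

-- Each letter lowers `inv` by at most one and the sorted end has `inv` equal to 0, so a word of
-- length at most `inv β` cannot afford an exchange at a non-ascent.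
minimal-Sorts : ∀ ws β → All (λ i → 1 ≤ i × suc i ≤ length β) ws → WeaklyDec (actW ws β) → length ws ≤ inv β → Sorts (actW ws β)
    ws β
minimal-Sorts [] β _ _ _ = done
minimal-Sorts (suc l ∷ ws) β ((_ , p) ∷ h) d le with nthN0 β l <? nthN0 β (suc l)
... | yes q = step p q (minimal-Sorts ws (swapAt1 (suc l) β) h' d (≤-pred (subst (suc (length ws) ≤_) (inv-swap-< l β p q) le)))
  where h' = subst (λ n → All (λ i → 1 ≤ i × suc i ≤ n) ws) (sym (swap-length (suc l) β)) h
... | no q = ⊥-elim (<⇒≱ le (≤-trans (inv-swap-≥ l β p (≮⇒≥ q))
        (≤-trans (inv-actW ws (swapAt1 (suc l) β) (All-map proj₁ h') (All-map proj₂ h'))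
          (≤-reflexive (trans (cong (length ws +_) (inv-dec (actW ws (swapAt1 (suc l) β)) d)) (+-identityʳ _))))))
  where h' = subst (λ n → All (λ i → 1 ≤ i × suc i ≤ n) ws) (sym (swap-length (suc l) β)) h

Sorts-act : ∀ {lam σ β} → Sorts lam σ β → actW σ β ≡ lam
Sorts-act done = refl
Sorts-act (step _ _ S) = Sorts-act S

-- Bubble sort supplies a competitor of length at most `inv α`, which bounds the minimal word.
MinSortWord⇒Sorts : ∀ α ws → MinSortWord α ws → Sorts (actW ws α) ws α × WeaklyDec (actW ws α)
MinSortWord⇒Sorts α ws (sk , part , min) = minimal-Sorts ws α sk dec len , dec
  where
  dec = weaklyDec⁻ (actW ws α) part
  len : length ws ≤ inv α
  len with bubble (inv α) α ≤-refl
  ... | σ , lam , S , d = ≤-trans (min σ (All-map id (Sorts-letters S))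
      (subst (λ γ → T (weaklyDecB γ)) (sym (Sorts-act S)) (weaklyDec⁺ lam d)))
        (subst (length σ ≤_) (sym (trans (cong inv (sym (++-identityʳ α))) (Sorts-inv [] S))) (m≤m+n _ _))

Sorts-same : ∀ {lam σ β} → Sorts lam σ β → length lam ≡ length β × (∀ r → ∃ λ r' → nthN0 lam r ≡ nthN0 β r')
Sorts-same done = refl , λ r → r , refl
Sorts-same (step {l} {σ} {β} p q S) with Sorts-same S
... | e , f = trans e (swap-length (suc l) β) , λ r → applyS l (proj₁ (f r)) , trans (proj₂ (f r))
    (nthN0-swap l β (proj₁ (f r)) p)

-- Demazure operators

SSKT-reflag : ∀ {α φ φ' t} → SSKT α φ t → (∀ r → r < length α → val t r 0 ≤ φ' (suc r)) → SSKT α φ' t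
SSKT-reflag {α} {φ} {φ'} {t} h f = KT⇒SSKT {α = α} {φ'} {t} ≤-refl (SSKT-shape {α = α} {φ} {t} ≤-refl h)
    (KT-resp K (λ _ → refl) (λ _ _ → refl) fl)
  where
  K = SSKT⇒KT {α = α} {φ} {t} ≤-refl h
  fl : ∀ r → val t r 0 ≤ φ' (suc r)
  fl r with r <? length α
  ... | yes p = f r p
  ... | no p = subst (_≤ φ' (suc r)) (sym (KT.out K r 0 (≤-reflexive (KT.supp K r (≮⇒≥ p))))) z≤n

SSKT-flag≤ : ∀ {α φ φ' t} → SSKT α φ t → (∀ r → r < length α → φ (suc r) ≤ φ' (suc r)) → SSKT α φ' t
SSKT-flag≤ {α} {φ} {φ'} {t} h f = SSKT-reflag {α} {φ} {φ'} {t} h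
    (λ r p → ≤-trans (KT.flag (SSKT⇒KT {α = α} {φ} {t} ≤-refl h) r) (f r p))

Φ : ℕ → ℕ → Tab → Fac
Φ n C t = fac n (marks n C (val t))

Im : ℕ → ℕ → List ℕ → (ℕ → ℕ) → Fac → Set
Im n C α φ b = Σ Tab λ t → SSKT α φ t × Φ n C t ≡ b

-- `Φ` depends on the column sets alone, so a map of tableaux that keeps them gives an inclusion of
-- images.
Im-transfer : ∀ {n C α φ α' φ'} → length α ≤ n → length α' ≤ n →
  (∀ {x} → KT n (nthN0 α) (φ ∘ suc) x → ∃ λ y → KT n (nthN0 α') (φ' ∘ suc) y × (∀ c v → 1 ≤ v → occ n x c v ≡ occ n y c v)) →
  ∀ {b} → Im n C α φ b → Im n C α' φ' b
Im-transfer {n} {C} {α} {φ} {α'} {φ'} l l' f (t , h , e) with f (SSKT⇒KT {α = α} {φ} {t} l h)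
... | y , K , oc = t' , KT⇒SSKT {α = α'} {φ'} {t'} l' (mkTab-shape y 0 α')
    (KT-resp K (λ _ → refl) (λ r c → sym (v≡ r c)) (KT.flag K)) ,
    trans (cong (fac n) (sym (marks-cong n C (val t) (val t')
        (λ c v p → trans (oc c v p) (occ-resp n y (val t') c v (λ r → sym (v≡ r c))))))) e
  where
  t' = mkTab y 0 α'
  v≡ : ∀ r c → val t' r c ≡ y r c
  v≡ = val-mkTab α' y K

rowOf-strict : ∀ {p u} j Z → Valid p u Z → T (strictIncB (rowOf j Z))
rowOf-strict j [] V = tt
rowOf-strict j ((a , v) ∷ Z) (_ ∷ V) with v ≡ᵇ j
... | false = rowOf-strict j Z V
... | true = cons (rowOf j Z) (rowOf-All j (Valid-lower V a ≤-refl)) (rowOf-strict j Z V)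
  where
  cons : ∀ xs → All (a <_) xs → T (strictIncB xs) → T (strictIncB (a ∷ xs))
  cons [] _ _ = tt
  cons (x ∷ xs) (p ∷ _) h = T-∧⁺ {a <ᵇ x} (<⇒<ᵇ p) h

fac-strict : ∀ n Z → Valid 0 0 Z → All (λ r → T (strictIncB r)) (fac n Z)
fac-strict n Z V = go (range1 n)
  where
  go : ∀ js → All (λ r → T (strictIncB r)) (map (λ j → rowOf j Z) js)
  go [] = []
  go (j ∷ js) = rowOf-strict j Z V ∷ go js

fac-length : ∀ n Z → length (fac n Z) ≡ n
fac-length n Z = trans (length-map _ (range1 n)) (length-rangeFrom 1 n)

InRF-lift : ∀ {n i w Z Z'} → 1 ≤ i → i < n → Valid 0 0 Z → Valid 0 0 Z' → EStep i Z Z' → InRF n w (fac n Z') → InRF n w (fac n Z)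
InRF-lift {n} {Z = Z} 1≤i i<n V V' S (_ , _ , same , red) = fac-length n Z , fac-strict n Z V ,
    (λ x → trans (sym (same-perm x)) (same x)) , ≃ʷ-Reduced eq red
  where
  eq = EStep-≃ʷ 1≤i i<n V V' S
  open _≃ʷ_ eq

EStep-Ls : ∀ {i Z Z'} → EStep i Z Z' → length (Ls i Z) ≡ suc (length (Ls i Z'))
EStep-Ls {i} (estep {A} {B} {a} refl refl ra lb) = trans (cong length (Ls-split i A a B ra lb))
    (trans (length-++ (Ls i A)) (trans (+-comm _ 1) (cong (suc ∘ length) (sym eq))))
  where
  eq : Ls i (A ++ (a , i) ∷ B) ≡ Ls i A
  eq = trans (Ls-++ i A ((a , i) ∷ B)) (trans (cong₂ (λ R L → Ls i A ++ drop (length R) L) ra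
      (trans (Ls-lo B refl) (cong (drop 1) lb))) (++-identityʳ _))

EStep-Rs : ∀ {i Z Z'} → EStep i Z Z' → Rs i Z' ≢ []
EStep-Rs {i} (estep {A} {B} {a} refl refl ra lb) e with trans (sym (Rs-split i A a B ra lb)) e
... | q with Rs i B
EStep-Rs {i} (estep {A} {B} {a} refl refl ra lb) e | () | []
EStep-Rs {i} (estep {A} {B} {a} refl refl ra lb) e | () | _ ∷ _

-- Raising the flag of row `j` from `i` to `i + 1`. `below` serves to recover the old flag for
-- elements with `e_i = 0`, and `avoid`, which leaves no row with flag `i`, makes lowering possible
-- in the larger set.
record Bump (n C : ℕ) (α : List ℕ) (φ : ℕ → ℕ) (j : ℕ) : Set where
  field
    ok    : Ok n C α φ
    ok'   : Ok n C α (bumpAt (suc j) φ)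
    pos   : 1 ≤ φ (suc j)
    below : ∀ k → k < j → φ (suc k) < φ (suc j)
    small : φ (suc j) < n
    avoid : ∀ r → bumpAt (suc j) φ (suc r) ≢ φ (suc j)

module BumpStep {n C α φ j} (B : Bump n C α φ j) where
  open Bump B
  i = φ (suc j)
  φ' = bumpAt (suc j) φ

  weaken : ∀ {t} → SSKT α φ t → SSKT α φ' t
  weaken {t} h = SSKT-flag≤ {α} {φ} {φ'} {t} h (λ r _ → le r)
    where
    le : ∀ r → φ (suc r) ≤ φ' (suc r)
    le r with r ≡ᵇ j
    ... | true = n≤1+n _
    ... | false = ≤-refl

  highest : ∀ {t} → SSKT α φ' t → Ls i (marks n C (val t)) ≡ [] → SSKT α φ t
  highest {t} h e = KT⇒SSKT {α = α} {φ} {t} (Ok.len ok) (SSKT-shape {α = α} {φ'} {t} (Ok.len ok) h)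
    (highest-flag j (Crystal.kt ok' {t} h) pos below (Crystal.heights-of-none ok' {t = t} pos small h e))

  module _ (w : List ℕ) (X : Fac → Set) (X⇒ : ∀ {b} → X b → Im n C α φ b) (X⇐ : ∀ {b} → Im n C α φ b → X b)
      (XRF : ∀ {b} → X b → InRF n w b) where

    -- The raising path is retraced from its end. `eRF-preimage` exhibits each predecessor as a
    -- marked list, `lower` produces a tableau, and both are the value of `f_i` at the same
    -- factorization, so they agree.
    Dop⇒Im : ∀ {b} → Dop n w i X b → Im n C α φ' b
    Dop⇒Im {b} ((len , str , _) , k , c , it , xc) = back k b len (All-map (λ {r} → strictInc⇒Increasing r) str) it
      where
      back : ∀ k b → length b ≡ n → All Increasing b → iterM k (eRF n i) b ≡ just c → Im n C α φ' b
      back zero b _ _ refl with X⇒ xc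
      ... | t , h , e = t , weaken {t} h , e
      back (suc k) b len inc it with eRF n i b in eb
      ... | just b₁ with eRF-Increasing n i b b₁ eb inc
      ...   | len₁ , inc₁ with back k b₁ (trans len₁ len) inc₁ it
      ...     | t₁ , h₁ , refl with eRF-preimage pos small b (marks n C (val t₁)) len inc (marks-Valid n C (val t₁))
          (marks-Bounded n C (val t₁)) eb
      ...       | Z' , V' , _ , S , refl with Crystal.lower ok' {t = t₁} pos small h₁ (EStep-Rs S) (inj₁ avoid)
      ...         | t , h , S' = t , h , just-injective
          (trans (sym (fRF-fac pos small (marks-Valid n C (val t₁)) S')) (fRF-fac pos small (marks-Valid n C (val t₁)) S))

    -- The number of unmatched closing letters drops with each application of `e_i`. When none is
    -- left, `highest` gives the old flag; membership in `RF_n(w)` is carried back along the path by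
    -- commutations.
    Im⇒Dop : ∀ {b} → Im n C α φ' b → Dop n w i X b
    Im⇒Dop (t , h , refl) = down (length (Ls i (marks n C (val t)))) t h refl
      where
      down : ∀ m t → SSKT α φ' t → length (Ls i (marks n C (val t))) ≡ m → Dop n w i X (Φ n C t)
      down m t h e with Crystal.eView ok' {t = t} pos small h
      ... | none _ ls = XRF x , 0 , Φ n C t , refl , x
        where x = X⇐ (t , highest {t} h ls , refl)
      down zero t h e | some t' _ h' S with trans (sym (EStep-Ls S)) e
      ... | ()
      down (suc m) t h e | some t' _ h' S with down m t' h' (suc-injective (trans (sym (EStep-Ls S)) e))
      ... | rf , k , c , it , xc = InRF-lift {w = w} pos small (marks-Valid n C (val t)) (marks-Valid n C (val t')) S rf ,
            suc k , c , trans (iter-suc k (eRF-fac pos small (marks-Valid n C (val t)) S)) it , xc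
        where
        iter-suc : ∀ {A : Set} k {g : A → Maybe A} {a a'} → g a ≡ just a' → iterM (suc k) g a ≡ iterM k g a'
        iter-suc k e rewrite e = refl

module _ {n C : ℕ} where

  id-Ok : ∀ β → length β ≤ n → (∀ r → nthN0 β r ≤ C) → Ok n C β id
  id-Ok β l p = record { len = l ; parts = p ; bound = λ r q → ≤-trans q l ; mono = s≤s }

  id-Bump : ∀ β l → length β ≤ n → (∀ r → nthN0 β r ≤ C) → suc l < n → Bump n C β id l
  id-Bump β l le p l<n = record
    { ok = id-Ok β le p
    ; ok' = record { len = le ; parts = p ; bound = bd ; mono = mn }
    ; pos = s≤s z≤n
    ; below = λ k q → s≤s q
    ; small = l<n
    ; avoid = av }
    where
    bd : ∀ r → r < length β → bumpAt (suc l) id (suc r) ≤ n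
    bd r q with r ≟ l
    ... | yes refl rewrite ≡ᵇ-yes {l} refl = l<n
    ... | no ne rewrite ≡ᵇ-no ne = ≤-trans q le
    mn : ∀ {a b} → a ≤ b → bumpAt (suc l) id (suc a) ≤ bumpAt (suc l) id (suc b)
    mn {a} {b} q with a ≟ l | b ≟ l
    ... | yes refl | yes refl = ≤-refl
    ... | yes refl | no ne rewrite ≡ᵇ-yes {l} refl | ≡ᵇ-no ne = s≤s (≤∧≢⇒< q (ne ∘ sym))
    ... | no ne | yes refl rewrite ≡ᵇ-yes {l} refl | ≡ᵇ-no ne = s≤s (m≤n⇒m≤1+n q)
    ... | no ne | no ne' rewrite ≡ᵇ-no ne | ≡ᵇ-no ne' = s≤s q
    av : ∀ r → bumpAt (suc l) id (suc r) ≢ suc l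
    av r e with r ≟ l
    ... | yes refl rewrite ≡ᵇ-yes {l} refl = 1+n≢n e
    ... | no ne rewrite ≡ᵇ-no ne = ne (suc-injective e)

  Im-exchange⇒ : ∀ {β l b} → length β ≤ n → suc l < length β → nthN0 β l < nthN0 β (suc l) → Im n C (swapAt1 (suc l) β)
      (bumpAt (suc l) id) b → Im n C β id b
  Im-exchange⇒ {β} {l} le p q = Im-transfer {C = C} (subst (_≤ n) (sym (swap-length (suc l) β)) le) le λ {x} K → go
      (exchange-down l (<-≤-trans p le) dec K)
    where
    γ = swapAt1 (suc l) β
    dec : nthN0 γ (suc l) ≤ nthN0 γ l
    dec = subst₂ _≤_ (sym (trans (nthN0-swap l β (suc l) p) (cong (nthN0 β) (applyS-hi l))))
        (sym (trans (nthN0-swap l β l p) (cong (nthN0 β) (applyS-lo l)))) (<⇒≤ q)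
    go : ∀ {x} → (∃ λ y → KT n (nthN0 γ ∘ applyS l) suc y × (∀ c v → 1 ≤ v → occ n x c v ≡ occ n y c v)) →
         ∃ λ y → KT n (nthN0 β) (id ∘ suc) y × (∀ c v → 1 ≤ v → occ n x c v ≡ occ n y c v)
    go (y , K , oc) = y , KT-resp K (λ r → trans (nthN0-swap l β (applyS l r) p) (cong (nthN0 β) (applyS-invol l r)))
        (λ _ _ → refl) (KT.flag K) , oc

  Im-exchange⇐ : ∀ {β l b} → length β ≤ n → suc l < length β → nthN0 β l < nthN0 β (suc l) → Im n C β id b → Im n C
      (swapAt1 (suc l) β) (bumpAt (suc l) id) b
  Im-exchange⇐ {β} {l} le p q = Im-transfer {C = C} le (subst (_≤ n) (sym (swap-length (suc l) β)) le) λ {x} K → go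
      (exchange-up l (<-≤-trans p le) (<⇒≤ q) K)
    where
    γ = swapAt1 (suc l) β
    go : ∀ {x} → (∃ λ y → KT n (nthN0 β ∘ applyS l) (bumpAt l suc) y × (∀ c v → 1 ≤ v → occ n x c v ≡ occ n y c v)) →
         ∃ λ y → KT n (nthN0 γ) (bumpAt (suc l) id ∘ suc) y × (∀ c v → 1 ≤ v → occ n x c v ≡ occ n y c v)
    go (y , K , oc) = y , KT-resp K (λ r → sym (nthN0-swap l β r p)) (λ _ _ → refl) (KT.flag K) , oc

  swap-parts : ∀ l β → suc l < length β → (∀ r → nthN0 β r ≤ C) → ∀ r → nthN0 (swapAt1 (suc l) β) r ≤ C
  swap-parts l β p h r = subst (_≤ C) (sym (nthN0-swap l β r p)) (h (applyS l r))

  -- For a partition and the identity flag there is a single tableau. Its factorization is the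
  -- highest weight element `u`, and the word of `u` serves as `w`.
  module Base (lam : List ℕ) (len : length lam ≤ n) (dec : WeaklyDec lam) where
    private
      K₀ : KT n (nthN0 lam) suc (superstandard (nthN0 lam))
      K₀ = superstandard-KT (nthN0 lam) sp dec
        where
        sp : ∀ r → n ≤ r → nthN0 lam r ≡ 0
        sp r p with nth0 lam r | nthView lam r
        ... | _ | inside q = ⊥-elim (<⇒≱ (<-≤-trans q len) p)
        ... | _ | outside q = refl

    t₀ : Tab
    t₀ = mkTab (superstandard (nthN0 lam)) 0 lam

    t₀-val : ∀ r c → val t₀ r c ≡ superstandard (nthN0 lam) r c
    t₀-val = val-mkTab lam _ K₀

    t₀-SSKT : SSKT lam id t₀
    t₀-SSKT = KT⇒SSKT {α = lam} {id} {t₀} len (mkTab-shape _ 0 lam)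
        (KT-resp K₀ (λ _ → refl) (λ r c → sym (t₀-val r c)) (KT.flag K₀))

    t₀-unique : ∀ {t} → SSKT lam id t → t ≡ t₀
    t₀-unique {t} h = tab-ext t t₀ (trans (SSKT-shape {α = lam} {id} {t} len h) (sym (mkTab-shape _ 0 lam)))
      (λ r c → trans (superstandard-unique dec (SSKT⇒KT {α = lam} {id} {t} len h) r c) (sym (t₀-val r c)))

    u : Fac
    u = Φ n C t₀

    w : List ℕ
    w = concat (reverse u)

    u-RF : InRF n w u
    u-RF = fac-length n (marks n C (val t₀)) , fac-strict n _ (marks-Valid n C (val t₀)) , (λ _ → refl) , word-Reduced n
        (marks n C (val t₀)) (marks-Valid n C (val t₀))

    Dword-RF : ∀ σ {b} → Dword n w σ (_≡ u) b → InRF n w b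
    Dword-RF [] refl = u-RF
    Dword-RF (i ∷ σ) (rf , _) = rf

    -- Proved together with the converse, since `BumpStep` takes both inclusions for the smaller
    -- set. A letter `l + 1` of the sorting word raises the flag of row `l` on the exchanged shape,
    -- and the tail exchange turns this into the identity flag on `β`.
    Dword⇒Im : ∀ {σ β b} → length β ≤ n → (∀ r → nthN0 β r ≤ C) → Sorts lam σ β → Dword n w σ (_≡ u) b → Im n C β id b
    Im⇒Dword : ∀ {σ β b} → length β ≤ n → (∀ r → nthN0 β r ≤ C) → Sorts lam σ β → Im n C β id b → Dword n w σ (_≡ u) b
    Dword⇒Im le pt done refl = t₀ , t₀-SSKT , refl
    Dword⇒Im {β = β} le pt (step {l} {σ} p q S) d = Im-exchange⇒ le p q
        (BumpStep.Dop⇒Im B w _ (λ d → Dword⇒Im le' pt' S d) (λ m → Im⇒Dword le' pt' S m) (Dword-RF σ) d)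
      where
      le' = subst (_≤ n) (sym (swap-length (suc l) β)) le
      pt' = swap-parts l β p pt
      B = id-Bump (swapAt1 (suc l) β) l le' pt' (<-≤-trans p le)
    Im⇒Dword le pt done (t , h , refl) = cong (Φ n C) (t₀-unique {t} h)
    Im⇒Dword {β = β} le pt (step {l} {σ} p q S) m = BumpStep.Im⇒Dop B w _ (λ d → Dword⇒Im le' pt' S d)
        (λ m → Im⇒Dword le' pt' S m) (Dword-RF σ) (Im-exchange⇐ le p q m)
      where
      le' = subst (_≤ n) (sym (swap-length (suc l) β)) le
      pt' = swap-parts l β p pt
      B = id-Bump (swapAt1 (suc l) β) l le' pt' (<-≤-trans p le)

    -- A raised tableau would again be `t₀`, yet raising changes the number of unmatched closing
    -- letters.
    u-highest : (∀ r → nthN0 lam r ≤ C) → ∀ i → 1 ≤ i → i < n → eRF n i u ≡ nothing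
    u-highest pt i 1≤i i<n with Crystal.eView (id-Ok lam len pt) {t = t₀} 1≤i i<n t₀-SSKT
    ... | none _ ls = eRF-fac-none 1≤i i<n _ (marks-Valid n C (val t₀)) ls
    ... | some t' _ h' S with t₀-unique {t'} h'
    ...   | refl = ⊥-elim (1+n≢n (sym (EStep-Ls S)))

-- Polynomials and strings

0ℤ 1ℤ : ℤ
0ℤ = posℤ 0
1ℤ = posℤ 1

+ℤ-exch : ∀ a b c → a +ℤ (b +ℤ c) ≡ b +ℤ (a +ℤ c)
+ℤ-exch a b c = trans (sym (ℤₚ.+-assoc a b c)) (trans (cong (_+ℤ c) (ℤₚ.+-comm a b)) (ℤₚ.+-assoc b a c))

+ℤ-inter : ∀ a b c d → (a +ℤ b) +ℤ (c +ℤ d) ≡ (a +ℤ c) +ℤ (b +ℤ d)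
+ℤ-inter a b c d = trans (ℤₚ.+-assoc a b (c +ℤ d)) (trans (cong (a +ℤ_) (+ℤ-exch b c d)) (sym (ℤₚ.+-assoc a c (b +ℤ d))))

sumZ : {A : Set} → List A → (A → ℤ) → ℤ
sumZ [] F = 0ℤ
sumZ (x ∷ xs) F = F x +ℤ sumZ xs F

sumZ-cong : ∀ {A : Set} (xs : List A) {F G : A → ℤ} → (∀ a → F a ≡ G a) → sumZ xs F ≡ sumZ xs G
sumZ-cong [] h = refl
sumZ-cong (x ∷ xs) h = cong₂ _+ℤ_ (h x) (sumZ-cong xs h)

sumZ-+ : ∀ {A : Set} (xs : List A) (F G : A → ℤ) → sumZ xs (λ a → F a +ℤ G a) ≡ sumZ xs F +ℤ sumZ xs G
sumZ-+ [] F G = refl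
sumZ-+ (x ∷ xs) F G = trans (cong ((F x +ℤ G x) +ℤ_) (sumZ-+ xs F G)) (+ℤ-inter (F x) (G x) (sumZ xs F) (sumZ xs G))

sumZ-++ : ∀ {A : Set} (xs ys : List A) (F : A → ℤ) → sumZ (xs ++ ys) F ≡ sumZ xs F +ℤ sumZ ys F
sumZ-++ [] ys F = sym (ℤₚ.+-identityˡ _)
sumZ-++ (x ∷ xs) ys F = trans (cong (F x +ℤ_) (sumZ-++ xs ys F)) (sym (ℤₚ.+-assoc (F x) _ _))

sumZ-map : ∀ {A B : Set} (g : A → B) (xs : List A) (F : B → ℤ) → sumZ (map g xs) F ≡ sumZ xs (F ∘ g)
sumZ-map g [] F = refl
sumZ-map g (x ∷ xs) F = cong (F (g x) +ℤ_) (sumZ-map g xs F)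

sumZ-0 : ∀ {A : Set} (xs : List A) → sumZ xs (λ _ → 0ℤ) ≡ 0ℤ
sumZ-0 [] = refl
sumZ-0 (x ∷ xs) = trans (ℤₚ.+-identityˡ _) (sumZ-0 xs)

module _ {N : ℕ} where
  δ : Vec ℕ N → Vec ℕ N → ℤ
  δ b a = if does (≡-dec _≟_ b a) then 1ℤ else 0ℤ

  pairing : Poly N → (Vec ℕ N → ℤ) → ℤ
  pairing f k = sumZ f (λ { (c , b) → c *ℤ k b })

  coeff-pairing : ∀ f a → coeff f a ≡ pairing f (λ b → δ b a)
  coeff-pairing [] a = refl
  coeff-pairing ((c , b) ∷ f) a with does (≡-dec _≟_ b a)
  ... | true = cong₂ _+ℤ_ (sym (ℤₚ.*-identityʳ c)) (coeff-pairing f a)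
  ... | false = trans (coeff-pairing f a) (trans (sym (ℤₚ.+-identityˡ _))
      (cong (_+ℤ pairing f (λ b → δ b a)) (sym (ℤₚ.*-zeroʳ c))))

  coeff-++ : ∀ (f g : Poly N) a → coeff (f ++ g) a ≡ coeff f a +ℤ coeff g a
  coeff-++ [] g a = sym (ℤₚ.+-identityˡ _)
  coeff-++ ((c , b) ∷ f) g a with does (≡-dec _≟_ b a)
  ... | true = trans (cong (c +ℤ_) (coeff-++ f g a)) (sym (ℤₚ.+-assoc c _ _))
  ... | false = coeff-++ f g a

  coeff-scale : ∀ c (H : ℤ × Vec ℕ N → ℤ × Vec ℕ N) → (∀ d b → H (d , b) ≡ (c *ℤ d , b)) → ∀ f a → coeff (map H f) a ≡ c *ℤ coeff
      f a
  coeff-scale c H h [] a = sym (ℤₚ.*-zeroʳ c)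
  coeff-scale c H h ((d , b) ∷ f) a rewrite h d b with does (≡-dec _≟_ b a)
  ... | true = trans (cong ((c *ℤ d) +ℤ_) (coeff-scale c H h f a)) (sym (ℤₚ.*-distribˡ-+ c d (coeff f a)))
  ... | false = coeff-scale c H h f a

  strip : Vec ℕ N → Poly N → Poly N
  strip b [] = []
  strip b ((c , b') ∷ f) = if does (≡-dec _≟_ b' b) then strip b f else (c , b') ∷ strip b f

  strip-length : ∀ b f → length (strip b f) ≤ length f
  strip-length b [] = z≤n
  strip-length b ((c , b') ∷ f) with does (≡-dec _≟_ b' b)
  ... | true = m≤n⇒m≤1+n (strip-length b f)
  ... | false = s≤s (strip-length b f)

  strip-pairing : ∀ b f k → pairing f k ≡ coeff f b *ℤ k b +ℤ pairing (strip b f) k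
  strip-pairing b [] k = sym (trans (ℤₚ.+-identityʳ _) (ℤₚ.*-zeroˡ (k b)))
  strip-pairing b ((c , b') ∷ f) k with ≡-dec _≟_ b' b
  ... | yes refl = trans (cong ((c *ℤ k b) +ℤ_) (strip-pairing b f k))
      (trans (sym (ℤₚ.+-assoc (c *ℤ k b) _ _)) (cong (_+ℤ pairing (strip b f) k) (sym (ℤₚ.*-distribʳ-+ (k b) c (coeff f b)))))
  ... | no _ = trans (cong ((c *ℤ k b') +ℤ_) (strip-pairing b f k))
      (+ℤ-exch (c *ℤ k b') (coeff f b *ℤ k b) (pairing (strip b f) k))

  strip-coeff : ∀ b f a → coeff f a ≡ 0ℤ → coeff (strip b f) a ≡ 0ℤ
  strip-coeff b f a e with ≡-dec _≟_ b a
  ... | yes refl = same f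
    where
    same : ∀ f → coeff (strip b f) b ≡ 0ℤ
    same [] = refl
    same ((c , b') ∷ f) with ≡-dec _≟_ b' b in q
    ... | yes _ = same f
    ... | no _ rewrite q = same f
  ... | no ne = trans (other f) e
    where
    other : ∀ f → coeff (strip b f) a ≡ coeff f a
    other [] = refl
    other ((c , b') ∷ f) with ≡-dec _≟_ b' b
    ... | no _ with does (≡-dec _≟_ b' a)
    ...   | true = cong (c +ℤ_) (other f)
    ...   | false = other f
    other ((c , b') ∷ f) | yes refl with ≡-dec _≟_ b' a
    ... | yes q = ⊥-elim (ne q)
    ... | no _ = other f

  -- A formal sum may repeat exponents. All terms with the exponent of the head are stripped at
  -- once, their coefficients adding up to 0, and `m` bounds the recursion. It follows that `piOp`
  -- respects `≈P`.
  zero-pairing : ∀ m f k → length f ≤ m → (∀ a → coeff f a ≡ 0ℤ) → pairing f k ≡ 0ℤ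
  zero-pairing m [] k p h = refl
  zero-pairing (suc m) f@((c , b) ∷ f') k (s≤s p) h = trans (strip-pairing b f k)
    (trans (cong₂ _+ℤ_ (trans (cong (_*ℤ k b) (h b)) (ℤₚ.*-zeroˡ (k b)))
      (zero-pairing m (strip b f) k len (λ a → strip-coeff b f a (h a)))) refl)
    where
    len : length (strip b f) ≤ m
    len with ≡-dec _≟_ b b
    ... | yes _ = ≤-trans (strip-length b f') p
    ... | no q = ⊥-elim (q refl)

  negate : Poly N → Poly N
  negate [] = []
  negate ((c , b) ∷ f) = (-ℤ c , b) ∷ negate f

  negate-pairing : ∀ f k → pairing (negate f) k ≡ -ℤ (pairing f k)
  negate-pairing [] k = refl
  negate-pairing ((c , b) ∷ f) k = trans (cong₂ _+ℤ_ (sym (ℤₚ.neg-distribˡ-* c (k b))) (negate-pairing f k))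
      (sym (ℤₚ.neg-distrib-+ (c *ℤ k b) _))

  pairing-resp : ∀ {f g} → f ≈P g → ∀ k → pairing f k ≡ pairing g k
  pairing-resp {f} {g} e k = ℤₚ.i-j≡0⇒i≡j (pairing f k) (pairing g k) (trans (cong (pairing f k +ℤ_) (sym (negate-pairing g k)))
    (trans (sym (sumZ-++ f (negate g) _)) (zero-pairing _ (f ++ negate g) k ≤-refl z)))
    where
    z : ∀ a → coeff (f ++ negate g) a ≡ 0ℤ
    z a = trans (coeff-++ f (negate g) a) (trans (cong₂ _+ℤ_ (e a)
        (trans (coeff-pairing (negate g) a) (trans (negate-pairing g _) (cong -ℤ_ (sym (coeff-pairing g a))))))
        (ℤₚ.+-inverseʳ (coeff g a)))

  piMono : ℕ → Vec ℕ N → Poly N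
  piMono i b = divDiffMono i (mulXmono i b)

  piOp-coeff : ∀ i (f : Poly N) a → coeff (piOp i f) a ≡ pairing f (λ b → coeff (piMono i b) a)
  piOp-coeff i [] a = refl
  piOp-coeff i ((c , b) ∷ f) a = head _ (λ d b → refl)
    where
    head : ∀ (H : ℤ × Vec ℕ N → ℤ × Vec ℕ N) → (∀ d b → H (d , b) ≡ (c *ℤ d , b)) →
      coeff (map H (piMono i b) ++ piOp i f) a ≡ c *ℤ coeff (piMono i b) a +ℤ pairing f (λ b → coeff (piMono i b) a)
    head H h = trans (coeff-++ (map H (piMono i b)) (piOp i f) a)
        (cong₂ _+ℤ_ (coeff-scale c H h (piMono i b) a) (piOp-coeff i f a))

  piOp-cong : ∀ i {f g : Poly N} → f ≈P g → piOp i f ≈P piOp i g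
  piOp-cong i {f} {g} e a = trans (piOp-coeff i f a) (trans (pairing-resp {f} {g} e _) (sym (piOp-coeff i g a)))

  piWord-cong : ∀ v {f g : Poly N} → f ≈P g → piWord v f ≈P piWord v g
  piWord-cong [] e = e
  piWord-cong (i ∷ v) {f} {g} e = piOp-cong i {piWord v f} {piWord v g} (piWord-cong v {f} {g} e)

  monos : {A : Set} → (A → Vec ℕ N) → List A → Poly N
  monos wt = map (λ t → (1ℤ , wt t))

  monos-pairing : ∀ {A : Set} (wt : A → Vec ℕ N) L k → pairing (monos wt L) k ≡ sumZ L (k ∘ wt)
  monos-pairing wt [] k = refl
  monos-pairing wt (t ∷ L) k = cong₂ _+ℤ_ (ℤₚ.*-identityˡ (k (wt t))) (monos-pairing wt L k)

  monos-coeff : ∀ {A : Set} (wt : A → Vec ℕ N) L a → coeff (monos wt L) a ≡ sumZ L (λ t → δ (wt t) a)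
  monos-coeff wt L a = trans (coeff-pairing (monos wt L) a) (monos-pairing wt L _)

getV-set : ∀ {N} (a : Vec ℕ N) j y → j < N → getV (setV a j y) j ≡ y
getV-set (x ∷ᵛ a) zero y p = refl
getV-set (x ∷ᵛ a) (suc j) y (s≤s p) = getV-set a j y p

getV-set-other : ∀ {N} (a : Vec ℕ N) j k y → k ≢ j → getV (setV a j y) k ≡ getV a k
getV-set-other []ᵛ j k y ne = refl
getV-set-other (x ∷ᵛ a) zero zero y ne = ⊥-elim (ne refl)
getV-set-other (x ∷ᵛ a) zero (suc k) y ne = refl
getV-set-other (x ∷ᵛ a) (suc j) zero y ne = refl
getV-set-other (x ∷ᵛ a) (suc j) (suc k) y ne = getV-set-other a j k y (ne ∘ cong suc)

getV-ext : ∀ {N} (a b : Vec ℕ N) → (∀ j → j < N → getV a j ≡ getV b j) → a ≡ b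
getV-ext []ᵛ []ᵛ h = refl
getV-ext (x ∷ᵛ a) (y ∷ᵛ b) h = cong₂ _∷ᵛ_ (h 0 (s≤s z≤n)) (getV-ext a b (λ j p → h (suc j) (s≤s p)))

if-yes : ∀ {A : Set} {b} {x y : A} → b ≡ true → (if b then x else y) ≡ x
if-yes refl = refl

if-no : ∀ {A : Set} {b} {x y : A} → b ≡ false → (if b then x else y) ≡ y
if-no refl = refl

-- `mk` sets the exponents at the 0-based positions `l` and `l + 1`, those on which the operator of
-- index `suc l` acts.
module Strings {N : ℕ} (l : ℕ) (l<N : suc l < N) (base : Vec ℕ N) where
  mk : ℕ → ℕ → Vec ℕ N
  mk u v = setV (setV base l u) (suc l) v

  private
    l<N' : l < N
    l<N' = <-trans (n<1+n l) l<N

  mk-lo : ∀ u v → getV (mk u v) l ≡ u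
  mk-lo u v = trans (getV-set-other (setV base l u) (suc l) l v (1+n≢n ∘ sym)) (getV-set base l u l<N')

  mk-hi : ∀ u v → getV (mk u v) (suc l) ≡ v
  mk-hi u v = getV-set (setV base l u) (suc l) v l<N

  mk-other : ∀ u v j → j ≢ l → j ≢ suc l → getV (mk u v) j ≡ getV base j
  mk-other u v j p q = trans (getV-set-other (setV base l u) (suc l) j v q) (getV-set-other base l j u p)

  mk-unique : ∀ (b : Vec ℕ N) → (∀ j → j < N → j ≢ l → j ≢ suc l → getV b j ≡ getV base j) → b ≡ mk (getV b l) (getV b (suc l))
  mk-unique b h = getV-ext b _ go
    where
    go : ∀ j → j < N → getV b j ≡ getV (mk (getV b l) (getV b (suc l))) j
    go j p with j ≟ l | j ≟ suc l
    ... | yes refl | _ = sym (mk-lo _ _)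
    ... | no _ | yes refl = sym (mk-hi _ _)
    ... | no q | no q' = trans (h j p q q') (sym (mk-other _ _ j q q'))

  set-mk : ∀ u v u' v' → setV (setV (mk u v) l u') (suc l) v' ≡ mk u' v'
  set-mk u v u' v' = trans (mk-unique _ other) (cong₂ mk lo≡ hi≡)
    where
    s = setV (setV (mk u v) l u') (suc l) v'
    other : ∀ j → j < N → j ≢ l → j ≢ suc l → getV s j ≡ getV base j
    other j _ p q = trans (getV-set-other (setV (mk u v) l u') (suc l) j v' q)
        (trans (getV-set-other (mk u v) l j u' p) (mk-other u v j p q))
    lo≡ : getV s l ≡ u'
    lo≡ = trans (getV-set-other (setV (mk u v) l u') (suc l) l v' (1+n≢n ∘ sym)) (getV-set (mk u v) l u' l<N')
    hi≡ : getV s (suc l) ≡ v'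
    hi≡ = getV-set (setV (mk u v) l u') (suc l) v' l<N

  mulX-mk : ∀ u v → mulXmono (suc l) (mk u v) ≡ mk (suc u) v
  mulX-mk u v = trans (cong (λ z → setV (mk u v) l (suc z)) (mk-lo u v))
      (trans (mk-unique s other) (cong₂ mk (getV-set (mk u v) l (suc u) l<N')
      (trans (getV-set-other (mk u v) l (suc l) (suc u) 1+n≢n) (mk-hi u v))))
    where
    s = setV (mk u v) l (suc u)
    other : ∀ j → j < N → j ≢ l → j ≢ suc l → getV s j ≡ getV base j
    other j _ p q = trans (getV-set-other (mk u v) l j (suc u) p) (mk-other u v j p q)

  -- The k monomials of exponents (k - 1 + u , v), ..., (u , v + k - 1).
  string : ℕ → ℕ → ℕ → List (Vec ℕ N)
  string zero u v = []
  string (suc k) u v = mk (k + u) v ∷ string k u (suc v)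

  string-map : ∀ (c : ℤ) b T v₀ k s u → T + 1 ≡ s + (k + u) → (∀ p q → setV (setV b l p) (suc l) q ≡ mk p q) →
    map (λ j → (c , setV (setV b l (T ∸ j)) (suc l) (v₀ + j))) (rangeFrom s k) ≡ map (λ b → (c , b)) (string k u (v₀ + s))
  string-map c b T v₀ zero s u e h = refl
  string-map c b T v₀ (suc k) s u e h = cong₂ _∷_
      (cong (c ,_) (trans (h _ _) (cong (λ z → mk z (v₀ + s)) (trans (cong (_∸ s) T≡) (m+n∸m≡n s (k + u))))))
    (trans (string-map c b T v₀ k (suc s) u (trans e (+-suc s (k + u))) h)
      (cong (λ z → map (λ b → (c , b)) (string k u z)) (+-suc v₀ s)))
    where
    T≡ : T ≡ s + (k + u)
    T≡ = suc-injective (trans (+-comm 1 T) (trans e (+-suc s (k + u))))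

  private
    dd : ∀ p q → divDiffMono (suc l) (mk p q) ≡
      (if q <ᵇ p then map (λ j → (1ℤ , setV (setV (mk p q) l (p ∸ 1 ∸ j)) (suc l) (q + j))) (rangeFrom 0 (p ∸ q))
       else (if p <ᵇ q then map (λ j → (-[1+ 0 ] , setV (setV (mk p q) l (q ∸ 1 ∸ j)) (suc l) (p + j))) (rangeFrom 0 (q ∸ p)) else
           []))
    dd p q rewrite mk-lo p q | mk-hi p q = refl

  piMono-≥ : ∀ P V → V ≤ P → piMono (suc l) (mk P V) ≡ map (λ b → (1ℤ , b)) (string (suc P ∸ V) V V)
  piMono-≥ P V V≤P = trans (cong (divDiffMono (suc l)) (mulX-mk P V)) (trans (dd (suc P) V)
    (trans (if-yes (<ᵇ-yes (s≤s V≤P)))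
    (trans (string-map 1ℤ (mk (suc P) V) P V (suc P ∸ V) 0 V (trans (+-comm P 1) (sym (m∸n+n≡m (m≤n⇒m≤1+n V≤P))))
      (set-mk (suc P) V))
      (cong (λ z → map (λ b → (1ℤ , b)) (string (suc P ∸ V) V z)) (+-identityʳ V)))))

  -- The monomial is the lower end of a string and the result is minus its interior, which is empty
  -- for `V = P + 1`.
  piMono-< : ∀ P V → P < V → piMono (suc l) (mk P V) ≡ map (λ b → (-[1+ 0 ] , b)) (string (V ∸ suc P) (suc P) (suc P))
  piMono-< P V P<V = trans (cong (divDiffMono (suc l)) (mulX-mk P V)) (trans (dd (suc P) V)
    (trans (if-no (<ᵇ-no P<V)) (go (m≤n⇒m<n∨m≡n P<V))))
    where
    rest : Poly N
    rest = if suc P <ᵇ V then map (λ j → (-[1+ 0 ] , setV (setV (mk (suc P) V) l (V ∸ 1 ∸ j)) (suc l) (suc P + j)))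
        (rangeFrom 0 (V ∸ suc P)) else []
    go : suc P < V ⊎ suc P ≡ V → rest ≡ map (λ b → (-[1+ 0 ] , b)) (string (V ∸ suc P) (suc P) (suc P))
    go (inj₂ refl) rewrite <ᵇ-no (≤-refl {suc P}) | n∸n≡0 P = refl
    go (inj₁ q) = trans (if-yes (<ᵇ-yes q))
      (trans (string-map -[1+ 0 ] (mk (suc P) V) (V ∸ 1) (suc P) (V ∸ suc P) 0 (suc P)
        (trans (m∸n+n≡m (≤-trans (s≤s z≤n) P<V)) (sym (m∸n+n≡m P<V))) (set-mk (suc P) V))
        (cong (λ z → map (λ b → (-[1+ 0 ] , b)) (string (V ∸ suc P) (suc P) z)) (+-identityʳ (suc P))))

  string-snoc : ∀ (F : Vec ℕ N → ℤ) k u v → sumZ (string (suc k) u v) F ≡ F (mk u (k + v)) +ℤ sumZ (string k (suc u) v) F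
  string-snoc F zero u v = refl
  string-snoc F (suc k) u v = trans (cong (F (mk (suc k + u) v) +ℤ_) (string-snoc F k u (suc v)))
    (trans (+ℤ-exch (F (mk (suc k + u) v)) (F (mk u (k + suc v))) (sumZ (string k (suc u) (suc v)) F))
      (cong₂ _+ℤ_ (cong (λ z → F (mk u z)) (+-suc k v))
      (cong (λ z → F (mk z v) +ℤ sumZ (string k (suc u) (suc v)) F) (sym (+-suc k u)))))

  private
    coeff-ones : ∀ (L : List (Vec ℕ N)) a → coeff (map (λ b → (1ℤ , b)) L) a ≡ sumZ L (λ b → δ b a)
    coeff-ones L a = monos-coeff id L a

    coeff-neg : ∀ (L : List (Vec ℕ N)) a → coeff (map (λ b → (-[1+ 0 ] , b)) L) a ≡ -ℤ (sumZ L (λ b → δ b a))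
    coeff-neg [] a = refl
    coeff-neg (b ∷ L) a with does (≡-dec _≟_ b a)
    ... | true = trans (cong (-[1+ 0 ] +ℤ_) (coeff-neg L a)) (sym (ℤₚ.neg-distrib-+ 1ℤ (sumZ L (λ b → δ b a))))
    ... | false = trans (coeff-neg L a) (cong -ℤ_ (sym (ℤₚ.+-identityˡ _)))

  top-string : ∀ P V a → V ≤ P → coeff (piMono (suc l) (mk P V)) a ≡ sumZ (string (suc P ∸ V) V V) (λ b → δ b a)
  top-string P V a h = trans (cong (λ f → coeff f a) (piMono-≥ P V h)) (coeff-ones (string (suc P ∸ V) V V) a)

  -- Removing the two ends of a string: π of the upper end is the whole string, π of the lower end is minus the interior.
  full-string : ∀ k u a → sumZ (string k u u) (λ b → coeff (piMono (suc l) b) a) ≡ sumZ (string k u u) (λ b → δ b a)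
  full-string zero u a = refl
  full-string (suc zero) u a = trans (ℤₚ.+-identityʳ _)
      (trans (top-string u u a ≤-refl) (cong (λ z → sumZ (string z u u) (λ b → δ b a))
      (trans (+-∸-assoc 1 (≤-refl {u})) (cong suc (n∸n≡0 u)))))
  full-string (suc (suc k)) u a = begin
    F (mk (suc k + u) u) +ℤ sumZ (string (suc k) u (suc u)) F ≡⟨ cong₂ _+ℤ_ upper (string-snoc F k u (suc u)) ⟩
    S (suc (suc k)) u +ℤ (F (mk u (k + suc u)) +ℤ sumZ (string k (suc u) (suc u)) F) ≡⟨ cong (S (suc (suc k)) u +ℤ_)
        (cong₂ _+ℤ_ lowerEnd (full-string k (suc u) a)) ⟩
    S (suc (suc k)) u +ℤ (-ℤ (S k (suc u)) +ℤ S k (suc u)) ≡⟨ cong (S (suc (suc k)) u +ℤ_) (ℤₚ.+-inverseˡ (S k (suc u))) ⟩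
    S (suc (suc k)) u +ℤ 0ℤ ≡⟨ ℤₚ.+-identityʳ _ ⟩
    S (suc (suc k)) u ∎
    where
    open ≡-Reasoning
    F : Vec ℕ N → ℤ
    F b = coeff (piMono (suc l) b) a
    S : ℕ → ℕ → ℤ
    S k u = sumZ (string k u u) (λ b → δ b a)
    upper : F (mk (suc k + u) u) ≡ S (suc (suc k)) u
    upper = trans (top-string (suc k + u) u a (m≤n+m u (suc k))) (cong (λ z → S z u) (m+n∸n≡m (suc (suc k)) u))
    lowerEnd : F (mk u (k + suc u)) ≡ -ℤ (S k (suc u))
    lowerEnd = trans (cong (λ f → coeff f a) (piMono-< u (k + suc u) (m≤n+m (suc u) k)))
        (trans (coeff-neg (string (k + suc u ∸ suc u) (suc u) (suc u)) a) (cong (λ z → -ℤ (S z (suc u))) (m+n∸n≡m k (suc u))))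

-- Sums over the strings of a crystal

data Distinct {A : Set} : List A → Set where
  []  : Distinct []
  _∷_ : ∀ {x xs} → All (x ≢_) xs → Distinct xs → Distinct (x ∷ xs)

All-∈ : ∀ {A : Set} {P : A → Set} {xs a} → All P xs → a ∈ xs → P a
All-∈ (p ∷ ps) (here refl) = p
All-∈ (p ∷ ps) (there q) = All-∈ ps q

Distinct-mid : ∀ {A : Set} {a : A} ys {zs} → Distinct (ys ++ a ∷ zs) → All (a ≢_) (ys ++ zs) × Distinct (ys ++ zs)
Distinct-mid [] (p ∷ d) = p , d
Distinct-mid (y ∷ ys) (p ∷ d) with Distinct-mid ys d | ++⁻ ys p
... | q , d' | py , (pa ∷ pz) = ((pa ∘ sym) ∷ q) , (++⁺ py pz ∷ d')

∈-insert : ∀ {A : Set} {a b : A} ys {zs} → b ∈ ys ++ zs → b ∈ ys ++ a ∷ zs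
∈-insert [] p = there p
∈-insert (y ∷ ys) (here e) = here e
∈-insert (y ∷ ys) (there p) = there (∈-insert ys p)

sumZ-set : ∀ {A : Set} (xs ys : List A) (F : A → ℤ) → Distinct xs → Distinct ys → (∀ {a} → a ∈ xs → a ∈ ys) →
    (∀ {a} → a ∈ ys → a ∈ xs) → sumZ xs F ≡ sumZ ys F
sumZ-set [] [] F _ _ f g = refl
sumZ-set [] (y ∷ ys) F _ _ f g with g (here refl)
... | ()
sumZ-set (x ∷ xs) ys F (p ∷ d) d' f g with ∈-split (f (here refl))
... | ys₁ , ys₂ , refl with Distinct-mid ys₁ d'
...   | q , d'' = trans (cong (F x +ℤ_) (sumZ-set xs (ys₁ ++ ys₂) F d d'' f' g')) (sym mid)
  where
  f' : ∀ {a} → a ∈ xs → a ∈ ys₁ ++ ys₂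
  f' {a} m = ∈-remove ys₁ (f (there m)) (λ e → All-∈ p m (sym e))
  g' : ∀ {a} → a ∈ ys₁ ++ ys₂ → a ∈ xs
  g' {a} m with g (∈-insert ys₁ m)
  ... | here e = ⊥-elim (All-∈ q m (sym e))
  ... | there m' = m'
  mid : sumZ (ys₁ ++ x ∷ ys₂) F ≡ F x +ℤ sumZ (ys₁ ++ ys₂) F
  mid = trans (sumZ-++ ys₁ (x ∷ ys₂) F) (trans (+ℤ-exch (sumZ ys₁ F) (F x) (sumZ ys₂ F))
      (cong (F x +ℤ_) (sym (sumZ-++ ys₁ ys₂ F))))

sumZ-cong∈ : ∀ {A : Set} (xs : List A) {F G : A → ℤ} → (∀ a → a ∈ xs → F a ≡ G a) → sumZ xs F ≡ sumZ xs G
sumZ-cong∈ [] h = refl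
sumZ-cong∈ (x ∷ xs) h = cong₂ _+ℤ_ (h x (here refl)) (sumZ-cong∈ xs (λ a p → h a (there p)))

∈-map : ∀ {A B : Set} (f : A → B) {xs a} → a ∈ xs → f a ∈ map f xs
∈-map f (here refl) = here refl
∈-map f (there p) = there (∈-map f p)

map-∈ : ∀ {A B : Set} (f : A → B) xs {b} → b ∈ map f xs → ∃ λ a → a ∈ xs × b ≡ f a
map-∈ f (x ∷ xs) (here e) = x , here refl , e
map-∈ f (x ∷ xs) (there p) with map-∈ f xs p
... | a , q , e = a , there q , e

Distinct-map : ∀ {A B : Set} (f : A → B) xs → Distinct xs → (∀ a b → a ∈ xs → b ∈ xs → f a ≡ f b → a ≡ b) → Distinct (map f xs)
Distinct-map f [] _ inj = []
Distinct-map f (x ∷ xs) (p ∷ d) inj = fresh ∷ Distinct-map f xs d (λ a b m m' → inj a b (there m) (there m'))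
  where
  fresh : All (f x ≢_) (map f xs)
  fresh = ∈-All (map f xs) λ b m e → case map-∈ f xs m of λ
      { (a , q , e') → All-∈ p q (inj x a (here refl) (there q) (trans e e')) }

filterB-All : ∀ {A : Set} {P : A → Set} p xs → All P xs → All P (filterB p xs)
filterB-All p [] [] = []
filterB-All p (x ∷ xs) (q ∷ qs) with p x
... | true = q ∷ filterB-All p xs qs
... | false = filterB-All p xs qs

Distinct-filterB : ∀ {A : Set} p {xs : List A} → Distinct xs → Distinct (filterB p xs)
Distinct-filterB p [] = []
Distinct-filterB p {x ∷ xs} (q ∷ d) with p x
... | true = filterB-All p xs q ∷ Distinct-filterB p d
... | false = Distinct-filterB p d

filterB-∈ : ∀ {A : Set} p (xs : List A) {a} → a ∈ filterB p xs → a ∈ xs × T (p a)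
filterB-∈ p (x ∷ xs) m with p x in e
filterB-∈ p (x ∷ xs) (here refl) | true = here refl , ≡⇒T e
filterB-∈ p (x ∷ xs) (there m) | true with filterB-∈ p xs m
... | q , t = there q , t
filterB-∈ p (x ∷ xs) m | false with filterB-∈ p xs m
... | q , t = there q , t

∈-filterB : ∀ {A : Set} p {xs : List A} {a} → a ∈ xs → T (p a) → a ∈ filterB p xs
∈-filterB p {x ∷ xs} (here refl) t rewrite T⇒≡ t = here refl
∈-filterB p {x ∷ xs} (there m) t with p x
... | true = there (∈-filterB p m t)
... | false = ∈-filterB p m t

rangeFrom-∈ : ∀ s m {a} → a ∈ rangeFrom s m → s ≤ a × a < s + m
rangeFrom-∈ s (suc m) (here refl) = ≤-refl , m<m+n s (s≤s z≤n)
rangeFrom-∈ s (suc m) {a} (there p) with rangeFrom-∈ (suc s) m p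
... | l , u = <⇒≤ l , subst (a <_) (sym (+-suc s m)) u

∈-rangeFrom : ∀ s m {a} → s ≤ a → a < s + m → a ∈ rangeFrom s m
∈-rangeFrom s zero l u = ⊥-elim (<⇒≱ u (subst (_≤ _) (sym (+-identityʳ s)) l))
∈-rangeFrom s (suc m) {a} l u with m≤n⇒m<n∨m≡n l
... | inj₂ refl = here refl
... | inj₁ l' = there (∈-rangeFrom (suc s) m l' (subst (a <_) (+-suc s m) u))

Distinct-rangeFrom : ∀ s m → Distinct (rangeFrom s m)
Distinct-rangeFrom s zero = []
Distinct-rangeFrom s (suc m) = ∈-All (rangeFrom (suc s) m) (λ a p e → <-irrefl e (proj₁ (rangeFrom-∈ (suc s) m p))) ∷
    Distinct-rangeFrom (suc s) m

module Grouping {A : Set} (_≟A_ : ∀ (a b : A) → Dec (a ≡ b)) where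

  fibre : (A → A) → A → List A → List A
  fibre top h = filterB (λ t → does (top t ≟A h))

  private
    pick : ∀ H a (z : ℤ) → Distinct H → a ∈ H → sumZ H (λ h → if does (a ≟A h) then z else 0ℤ) ≡ z
    pick (h ∷ H) a z (p ∷ d) m with a ≟A h
    ... | yes refl = trans (cong (z +ℤ_) (trans (sumZ-cong∈ H (λ h' q → zero' h' (All-∈ p q))) (sumZ-0 H))) (ℤₚ.+-identityʳ z)
      where
      zero' : ∀ h' → a ≢ h' → (if does (a ≟A h') then z else 0ℤ) ≡ 0ℤ
      zero' h' ne with a ≟A h'
      ... | yes e = ⊥-elim (ne e)
      ... | no _ = refl
    pick (h ∷ H) a z (p ∷ d) (here e) | no ne = ⊥-elim (ne e)
    pick (h ∷ H) a z (p ∷ d) (there m) | no ne = trans (ℤₚ.+-identityˡ _) (pick H a z d m)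

  group : ∀ (top : A → A) H Y (F : A → ℤ) → Distinct H → (∀ {t} → t ∈ Y → top t ∈ H) → sumZ Y F ≡ sumZ H
      (λ h → sumZ (fibre top h Y) F)
  group top H [] F d m = sym (sumZ-0 H)
  group top H (y ∷ Y) F d m = sym (trans (sumZ-cong H cons-fibre)
      (trans (sumZ-+ H (λ h → if does (top y ≟A h) then F y else 0ℤ) (λ h → sumZ (fibre top h Y) F))
      (cong₂ _+ℤ_ (pick H (top y) (F y) d (m (here refl))) (sym (group top H Y F d (m ∘ there))))))
    where
    cons-fibre : ∀ h → sumZ (fibre top h (y ∷ Y)) F ≡ (if does (top y ≟A h) then F y else 0ℤ) +ℤ sumZ (fibre top h Y) F
    cons-fibre h with does (top y ≟A h)
    ... | true = refl
    ... | false = sym (ℤₚ.+-identityˡ _)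

-- What the character of a Demazure step requires. `ε` counts the possible raisings, and the excess
-- of `ε t + getV (wt t) l` over `getV (wt t) (suc l)` the possible lowerings. The last clause of
-- `raise` says that `X` is closed under `e`, that of `extend` that lowering leaves `X` only from
-- the top of a string.
record StringData {A : Set} {N : ℕ} (l : ℕ) (e : A → Maybe A) (ε : A → ℕ) (wt : A → Vec ℕ N) (InX InY : A → Set) : Set where
  field
    X⊂Y   : ∀ {t} → InX t → InY t
    tops  : ∀ {t} → InY t → ε t ≡ 0 → InX t
    raise : ∀ {t k} → InY t → ε t ≡ suc k → ∃ λ t' → e t ≡ just t' × InY t' × (InX t → InX t')
    drops : ∀ {t t'} → InY t → e t ≡ just t' → ε t ≡ suc (ε t')
    wt-other : ∀ {t t'} → InY t → e t ≡ just t' → ∀ j → j < N → j ≢ l → j ≢ suc l → getV (wt t) j ≡ getV (wt t') j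
    wt-lo : ∀ {t t'} → InY t → e t ≡ just t' → getV (wt t') l ≡ suc (getV (wt t) l)
    wt-hi : ∀ {t t'} → InY t → e t ≡ just t' → getV (wt t) (suc l) ≡ suc (getV (wt t') (suc l))
    e-inj : ∀ {t₁ t₂ t} → InY t₁ → InY t₂ → e t₁ ≡ just t → e t₂ ≡ just t → t₁ ≡ t₂
    bound : ∀ {t} → InY t → getV (wt t) (suc l) ≤ ε t + getV (wt t) l
    extend : ∀ {t} → InY t → getV (wt t) (suc l) < ε t + getV (wt t) l → ∃ λ t' → InY t' × e t' ≡ just t ×
        (InX t → ε t ≢ 0 → InX t')

module Character {A : Set} (_≟A_ : ∀ (a b : A) → Dec (a ≡ b)) {N l : ℕ} (l<N : suc l < N) {e : A → Maybe A} {ε : A → ℕ}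
    {wt : A → Vec ℕ N} {InX InY : A → Set}
    (SD : StringData l e ε wt InX InY) where
  open StringData SD
  open Grouping _≟A_

  topOf : ℕ → A → A
  topOf zero t = t
  topOf (suc k) t with e t
  ... | just t' = topOf k t'
  ... | nothing = t

  topOf-suc : ∀ k {t t'} → e t ≡ just t' → topOf (suc k) t ≡ topOf k t'
  topOf-suc k eq rewrite eq = refl

  top : A → A
  top t = topOf (ε t) t

  record IsTop (k : ℕ) (t h : A) : Set where
    field
      inY : InY h
      ε≡0 : ε h ≡ 0
      other : ∀ j → j < N → j ≢ l → j ≢ suc l → getV (wt t) j ≡ getV (wt h) j
      lows  : getV (wt h) l ≡ k + getV (wt t) l
      highs : getV (wt t) (suc l) ≡ k + getV (wt h) (suc l)

  isTop : ∀ k {t} → InY t → ε t ≡ k → IsTop k t (topOf k t)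
  isTop zero y z = record { inY = y ; ε≡0 = z ; other = λ _ _ _ _ → refl ; lows = refl ; highs = refl }
  isTop (suc k) {t} y z with raise y z
  ... | t' , eq , y' , _ = subst (IsTop (suc k) t) (sym (topOf-suc k eq)) (record
      { inY = inY ; ε≡0 = ε≡0
      ; other = λ j p q q' → trans (wt-other y eq j p q q') (other j p q q')
      ; lows = trans lows (trans (cong (k +_) (wt-lo y eq)) (+-suc k _))
      ; highs = trans (wt-hi y eq) (cong suc highs) })
    where open IsTop (isTop k y' (suc-injective (trans (sym (drops y eq)) z)))

  top-inj : ∀ k {t t'} → InY t → InY t' → ε t ≡ k → ε t' ≡ k → topOf k t ≡ topOf k t' → t ≡ t'
  top-inj zero y y' z z' q = q
  top-inj (suc k) y y' z z' q with raise y z | raise y' z'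
  ... | t₁ , e₁ , y₁ , _ | t₂ , e₂ , y₂ , _ = e-inj y y' e₁ (trans e₂ (cong just (sym
        (top-inj k y₁ y₂ (suc-injective (trans (sym (drops y e₁)) z)) (suc-injective (trans (sym (drops y' e₂)) z'))
          (trans (sym (topOf-suc k e₁)) (trans q (topOf-suc k e₂)))))))

  private
    room : ∀ {k h t} → InY t → ε t ≡ k → topOf k t ≡ h → suc k + getV (wt h) (suc l) ≤ getV (wt h) l → getV (wt t) (suc l) < ε t +
        getV (wt t) l
    room {k} {h} {t} y z q p = subst₂ _<_ (sym (trans I.highs (cong (λ h → k + getV (wt h) (suc l)) q)))
        (trans (trans (cong (λ h → getV (wt h) l) (sym q)) I.lows) (cong (_+ getV (wt t) l) (sym z))) p
      where module I = IsTop (isTop k y z)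

  -- Strings in `Y` are complete: lowering from the top goes on as long as the weight leaves room.
  down : ∀ {h} → InY h → ε h ≡ 0 → ∀ k → k + getV (wt h) (suc l) ≤ getV (wt h) l → ∃ λ t → InY t × ε t ≡ k × topOf k t ≡ h
  down {h} y z zero p = h , y , z , refl
  down {h} y z (suc k) p with down y z k (<⇒≤ p)
  ... | t , y' , z' , q with extend y' (room y' z' q p)
  ...   | t'' , y'' , eq , _ = t'' , y'' , trans (drops y'' eq) (cong suc z') , trans (topOf-suc k eq) q

  module _ (X Y : List A) (dX : Distinct X) (dY : Distinct Y) (X⇒ : ∀ {t} → t ∈ X → InX t) (X⇐ : ∀ {t} → InX t → t ∈ X)
           (Y⇒ : ∀ {t} → t ∈ Y → InY t) (Y⇐ : ∀ {t} → InY t → t ∈ Y) (a : Vec ℕ N) where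
    private
      κ δa : Vec ℕ N → ℤ
      κ b = coeff (piMono (suc l) b) a
      δa b = δ b a

      H : List A
      H = filterB (λ t → ε t ≡ᵇ 0) Y

      fibre-∈ : ∀ {h L t} → t ∈ fibre top h L → t ∈ L × top t ≡ h
      fibre-∈ {h} {L} {t} m with filterB-∈ (λ t → does (top t ≟A h)) L m
      ... | q , d with top t ≟A h
      ...   | yes eq = q , eq

      ∈-fibre : ∀ {h L t} → t ∈ L → top t ≡ h → t ∈ fibre top h L
      ∈-fibre {h} {L} {t} m eq = ∈-filterB _ m yes'
        where
        yes' : T (does (top t ≟A h))
        yes' with top t ≟A h
        ... | yes _ = tt
        ... | no ne = ⊥-elim (ne eq)

      module Fibre (h : A) (h∈ : h ∈ H) where
        fX : ∀ {t} → t ∈ fibre top h X → t ∈ X × top t ≡ h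
        fX = fibre-∈ {h} {X}
        fY : ∀ {t} → t ∈ fibre top h Y → t ∈ Y × top t ≡ h
        fY = fibre-∈ {h} {Y}
        gX : ∀ {t} → t ∈ X → top t ≡ h → t ∈ fibre top h X
        gX = ∈-fibre {h} {X}
        gY : ∀ {t} → t ∈ Y → top t ≡ h → t ∈ fibre top h Y
        gY = ∈-fibre {h} {Y}
        hY : InY h
        hY = Y⇒ (proj₁ (filterB-∈ (λ t → ε t ≡ᵇ 0) Y h∈))
        h0 : ε h ≡ 0
        h0 = ≡ᵇ⇒≡ (ε h) 0 (proj₂ (filterB-∈ (λ t → ε t ≡ᵇ 0) Y h∈))
        P = getV (wt h) l
        V = getV (wt h) (suc l)
        open Strings l l<N (wt h)
        V≤P : V ≤ P
        V≤P = subst (λ z → V ≤ z + P) h0 (bound hY)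
        top-h : top h ≡ h
        top-h = cong (λ k → topOf k h) h0

        wt≡ : ∀ {t} → InY t → top t ≡ h → wt t ≡ mk (P ∸ ε t) (V + ε t)
        wt≡ {t} y q = trans (mk-unique (wt t) (λ j p n n' → trans (I.other j p n n') (cong (λ h → getV (wt h) j) q))) (cong₂ mk
            (sym (trans (cong (_∸ ε t) (trans (cong (λ h → getV (wt h) l) (sym q)) I.lows)) (m+n∸m≡n (ε t) _)))
            (trans I.highs (trans (cong (λ h → ε t + getV (wt h) (suc l)) q) (+-comm (ε t) V))))
          where module I = IsTop (isTop (ε t) y refl)

        ε< : ∀ {t} → InY t → top t ≡ h → ε t < 0 + (suc P ∸ V)
        ε< {t} y q = m+n≤o⇒m≤o∸n (suc (ε t)) (s≤s (subst₂ _≤_ (trans I.highs (cong (λ h → ε t + getV (wt h) (suc l)) q))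
            (trans (sym I.lows) (cong (λ h → getV (wt h) l) q)) (bound y)))
          where module I = IsTop (isTop (ε t) y refl)

        string-sum : ∀ (F : Vec ℕ N → ℤ) k s → P + 1 ≡ s + (k + V) → sumZ (rangeFrom s k) (λ j → F (mk (P ∸ j) (V + j))) ≡ sumZ
            (string k V (V + s)) F
        string-sum F zero s q = refl
        string-sum F (suc k) s q = cong₂ _+ℤ_ (cong (λ z → F (mk z (V + s))) (trans (cong (_∸ s) P≡) (m+n∸m≡n s (k + V))))
            (trans (string-sum F k (suc s) (trans q (+-suc s (k + V)))) (cong (λ z → sumZ (string k V z) F) (+-suc V s)))
          where
          P≡ : P ≡ s + (k + V)
          P≡ = suc-injective (trans (+-comm 1 P) (trans q (+-suc s (k + V))))

        -- `ε` identifies the string below `h` with the numbers from 0 to `P - V`, injectively by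
        -- `top-inj` and onto by `down`; the element with `ε = k` has the exponents `P - k` and
        -- `V + k`.
        Y-sum : ∀ (F : Vec ℕ N → ℤ) → sumZ (fibre top h Y) (F ∘ wt) ≡ sumZ (string (suc P ∸ V) V V) F
        Y-sum F = trans (sumZ-cong∈ (fibre top h Y) (λ t m → cong F (wt≡ (Y⇒ (proj₁ (fY m))) (proj₂ (fY m)))))
          (trans (sym (sumZ-map ε (fibre top h Y) (λ k → F (mk (P ∸ k) (V + k)))))
          (trans (sumZ-set (map ε (fibre top h Y)) (rangeFrom 0 (suc P ∸ V)) _ (Distinct-map ε _ (Distinct-filterB _ dY) inj)
            (Distinct-rangeFrom 0 _) there' back)
          (trans (string-sum F (suc P ∸ V) 0 (trans (+-comm P 1) (sym (m∸n+n≡m (m≤n⇒m≤1+n V≤P)))))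
            (cong (λ z → sumZ (string (suc P ∸ V) V z) F) (+-identityʳ V)))))
          where
          inj : ∀ t t' → t ∈ fibre top h Y → t' ∈ fibre top h Y → ε t ≡ ε t' → t ≡ t'
          inj t t' m m' q = top-inj (ε t) (Y⇒ (proj₁ (fY m))) (Y⇒ (proj₁ (fY m'))) refl (sym q)
            (trans (proj₂ (fY m)) (trans (sym (proj₂ (fY m'))) (cong (λ k → topOf k t') (sym q))))
          there' : ∀ {k} → k ∈ map ε (fibre top h Y) → k ∈ rangeFrom 0 (suc P ∸ V)
          there' m with map-∈ ε (fibre top h Y) m
          ... | t , q , refl = ∈-rangeFrom 0 _ z≤n (ε< (Y⇒ (proj₁ (fY q))) (proj₂ (fY q)))
          back : ∀ {k} → k ∈ rangeFrom 0 (suc P ∸ V) → k ∈ map ε (fibre top h Y)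
          back {k} m with down hY h0 k (≤-pred (subst (suc k + V ≤_) (m∸n+n≡m (m≤n⇒m≤1+n V≤P))
              (+-monoˡ-≤ V (proj₂ (rangeFrom-∈ 0 _ m)))))
          ... | t , y , refl , q = ∈-map ε (gY (Y⇐ y) q)

        reach-one : ∀ k {t} → InX t → ε t ≡ suc k → top t ≡ h → ∃ λ t₁ → InX t₁ × ε t₁ ≡ 1 × topOf 1 t₁ ≡ h
        reach-one zero {t} x z q = t , x , z , trans (cong (λ k → topOf k t) (sym z)) q
        reach-one (suc k) {t} x z q with raise (X⊂Y x) z
        ... | t' , eq , y' , x' = reach-one k (x' x) ε'
            (trans (cong (λ j → topOf j t') ε') (trans (sym (topOf-suc (suc k) eq)) (trans (cong (λ j → topOf j t) (sym z)) q)))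
          where ε' = suc-injective (trans (sym (drops (X⊂Y x) eq)) z)

        -- Once `X` contains the element next to the top, lowering stays inside `X`, and injectivity
        -- of `e` identifies the result with the given element of `Y`.
        spread⁺ : ∀ {t₁} → InX t₁ → ε t₁ ≡ 1 → topOf 1 t₁ ≡ h → ∀ k {t} → InY t → ε t ≡ suc k → top t ≡ h → InX t
        spread⁺ x₁ z₁ q₁ zero {t} y z q = subst InX (top-inj 1 (X⊂Y x₁) y z₁ z
            (trans q₁ (sym (trans (cong (λ k → topOf k t) (sym z)) q)))) x₁
        spread⁺ x₁ z₁ q₁ (suc k) {t} y z q with raise y z
        ... | t' , eq , y' , _ = lowered
          where
          ε' = suc-injective (trans (sym (drops y eq)) z)
          x' : InX t'
          x' = spread⁺ x₁ z₁ q₁ k y' ε' (trans (cong (λ j → topOf j t') ε')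
              (trans (sym (topOf-suc (suc k) eq)) (trans (cong (λ j → topOf j t) (sym z)) q)))
          space : getV (wt t') (suc l) < ε t' + getV (wt t') l
          space = subst₂ _≤_ (wt-hi y eq) (trans (cong (_+ getV (wt t) l) (drops y eq))
              (trans (sym (+-suc (ε t') _)) (cong (ε t' +_) (sym (wt-lo y eq))))) (bound y)
          lowered : InX t
          lowered with extend y' space
          ... | t'' , y'' , eq' , x'' = subst InX (e-inj y'' y eq' eq) (x'' x' (λ z' → case trans (sym ε') z' of λ ()))

        spread : ∀ {t₁} → InX t₁ → ε t₁ ≡ 1 → topOf 1 t₁ ≡ h → ∀ {t} → InY t → top t ≡ h → InX t
        spread x₁ z₁ q₁ {t} y q with ε t in z
        ... | zero = tops y z
        ... | suc k = spread⁺ x₁ z₁ q₁ k y z (trans (cong (λ j → topOf j t) z) q)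

        scan : ∀ L → All (λ t → ε t ≡ 0) L ⊎ ∃ λ t → t ∈ L × ∃ λ k → ε t ≡ suc k
        scan [] = inj₁ []
        scan (t ∷ L) with ε t in z | scan L
        ... | suc k | _ = inj₂ (t , here refl , k , z)
        ... | zero | inj₁ h = inj₁ (z ∷ h)
        ... | zero | inj₂ (t' , m , k , z') = inj₂ (t' , there m , k , z')

        -- Either `X` meets the string in its top alone, whose image under the operator is the whole
        -- string, or it contains the whole string, whose sum is fixed by `full-string`.
        fibre-sum : sumZ (fibre top h X) (κ ∘ wt) ≡ sumZ (fibre top h Y) (δa ∘ wt)
        fibre-sum with scan (fibre top h X)
        ... | inj₁ zs = trans (sumZ-set (fibre top h X) [ h ] (κ ∘ wt) (Distinct-filterB _ dX) ([] ∷ []) only back)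
            (trans (ℤₚ.+-identityʳ _) (trans (cong κ (mk-unique (wt h) (λ _ _ _ _ → refl)))
              (trans (top-string P V a V≤P) (sym (Y-sum δa)))))
          where
          only : ∀ {t} → t ∈ fibre top h X → t ∈ [ h ]
          only {t} m = here (trans (cong (λ k → topOf k t) (sym (All-∈ zs m))) (proj₂ (fX m)))
          back : ∀ {t} → t ∈ [ h ] → t ∈ fibre top h X
          back (here refl) = gX (X⇐ (tops hY h0)) top-h
        ... | inj₂ (t , m , k , z) with reach-one k (X⇒ (proj₁ (fX m))) z (proj₂ (fX m))
        ...   | t₁ , x₁ , z₁ , q₁ = trans (sumZ-set (fibre top h X) (fibre top h Y) (κ ∘ wt) (Distinct-filterB _ dX)
            (Distinct-filterB _ dY)
                  (λ m → gY (Y⇐ (X⊂Y (X⇒ (proj₁ (fX m))))) (proj₂ (fX m)))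
                  (λ m → gX (X⇐ (spread x₁ z₁ q₁ (Y⇒ (proj₁ (fY m))) (proj₂ (fY m)))) (proj₂ (fY m))))
                (trans (Y-sum κ) (trans (full-string (suc P ∸ V) V a) (sym (Y-sum δa))))

      top∈H : ∀ {t} → InY t → top t ∈ H
      top∈H {t} y = ∈-filterB _ (Y⇐ (IsTop.inY I)) (≡⇒≡ᵇ (ε (top t)) 0 (IsTop.ε≡0 I))
        where I = isTop (ε t) y refl

    string-character : coeff (monos wt Y) a ≡ coeff (piOp (suc l) (monos wt X)) a
    string-character = trans (monos-coeff wt Y a) (trans (group top H Y (δa ∘ wt) dH (top∈H ∘ Y⇒))
      (trans (sumZ-cong∈ H (λ h m → sym (Fibre.fibre-sum h m))) (trans (sym (group top H X (κ ∘ wt) dH (top∈H ∘ X⊂Y ∘ X⇒)))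
        (sym (trans (piOp-coeff (suc l) (monos wt X) a) (monos-pairing wt X κ))))))
      where dH = Distinct-filterB _ dY

-- Flags and the Demazure crystal

≡ᵇ-sym : ∀ a b → (a ≡ᵇ b) ≡ (b ≡ᵇ a)
≡ᵇ-sym zero zero = refl
≡ᵇ-sym zero (suc b) = refl
≡ᵇ-sym (suc a) zero = refl
≡ᵇ-sym (suc a) (suc b) = ≡ᵇ-sym a b

+-exch : ∀ a b c → a + (b + c) ≡ b + (a + c)
+-exch a b c = trans (sym (+-assoc a b c)) (trans (cong (_+ c) (+-comm a b)) (+-assoc b a c))

cnt-front : ∀ f v k → cnt f v (suc k) ≡ b2n (f 0 ≡ᵇ v) + cnt (f ∘ suc) v k
cnt-front f v zero = refl
cnt-front f v (suc k) = trans (cong (b2n (f (suc k) ≡ᵇ v) +_) (cnt-front f v k))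
    (+-exch (b2n (f (suc k) ≡ᵇ v)) (b2n (f 0 ≡ᵇ v)) (cnt (f ∘ suc) v k))

cnt-const0 : ∀ v k → 1 ≤ v → cnt (λ _ → 0) v k ≡ 0
cnt-const0 v k p = cnt-zero (λ _ → 0) v k (λ _ _ → <⇒≢ p)

count-row : ∀ v row C → 1 ≤ v → length row ≤ C → count v row ≡ cnt (nthN0 row) v C
count-row v [] C p q = sym (cnt-const0 v C p)
count-row v (y ∷ row) (suc C) p (s≤s q) = trans (count-cons v y row)
    (trans (cong₂ _+_ (cong b2n (≡ᵇ-sym v y)) (count-row v row C p q)) (sym (cnt-front (nthN0 (y ∷ row)) v C)))

rowSum : (ℕ → ℕ → ℕ) → ℕ → ℕ → ℕ → ℕ
rowSum x v C zero = 0
rowSum x v C (suc n) = cnt (x n) v C + rowSum x v C n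

rowSum-front : ∀ x v C n → rowSum x v C (suc n) ≡ cnt (x 0) v C + rowSum (x ∘ suc) v C n
rowSum-front x v C zero = refl
rowSum-front x v C (suc n) = trans (cong (cnt (x (suc n)) v C +_) (rowSum-front x v C n))
    (+-exch (cnt (x (suc n)) v C) (cnt (x 0) v C) (rowSum (x ∘ suc) v C n))

count-concat : ∀ v t C n → 1 ≤ v → length t ≤ n → maxCol t ≤ C → count v (concat t) ≡ rowSum (val t) v C n
count-concat v [] C n p q m = sym (zeros n)
  where
  zeros : ∀ n → rowSum (val []) v C n ≡ 0
  zeros zero = refl
  zeros (suc n) = cong₂ _+_ (cnt-const0 v C p) (zeros n)
count-concat v (row ∷ t) C (suc n) p (s≤s q) m = trans (count-++ v row (concat t))
  (trans (cong₂ _+_ (count-row v row C p (≤-trans (m≤m⊔n (length row) (maxCol t)) m))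
    (count-concat v t C n p q (≤-trans (m≤n⊔m (length row) (maxCol t)) m)))
  (sym (rowSum-front (val (row ∷ t)) v C n)))

-- Double counting: the weight counts entries row by row, the brackets column by column.
rowSum-hgt : ∀ x v C n → rowSum x v C n ≡ hgt n x v C
rowSum-hgt x v zero n = zeros n
  where
  zeros : ∀ n → rowSum x v 0 n ≡ 0
  zeros zero = refl
  zeros (suc n) = zeros n
rowSum-hgt x v (suc C) n = trans (peel n) (cong (occ n x C v +_) (rowSum-hgt x v C n))
  where
  peel : ∀ n → rowSum x v (suc C) n ≡ cnt (λ r → x r C) v n + rowSum x v C n
  peel zero = refl
  peel (suc n) = trans (cong (cnt (x n) v (suc C) +_) (peel n))
      (lem (b2n (x n C ≡ᵇ v)) (cnt (x n) v C) (cnt (λ r → x r C) v n) (rowSum x v C n))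
    where
    lem : ∀ a b c d → (a + b) + (c + d) ≡ (a + c) + (b + d)
    lem a b c d = trans (+-assoc a b (c + d)) (trans
        (cong (a +_) (trans (sym (+-assoc b c d)) (trans (cong (_+ d) (+-comm b c)) (+-assoc c b d))))
        (sym (+-assoc a c (b + d))))

module _ {n C α φ} (ok : Ok n C α φ) where
  open Ok ok

  maxCol≤ : ∀ {t} → SSKT α φ t → maxCol t ≤ C
  maxCol≤ {t} h = bd t (λ r → subst (_≤ C) (trans (cong (λ z → nthN0 z r) (sym (SSKT-shape {α = α} {φ} {t} len h)))
      (rowLen-shape t r)) (parts r))
    where
    bd : ∀ t → (∀ r → rowLen t r ≤ C) → maxCol t ≤ C
    bd [] f = z≤n
    bd (row ∷ t) f = ⊔-lub (f 0) (bd t (f ∘ suc))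

  count-hgt : ∀ {t} → SSKT α φ t → ∀ v → 1 ≤ v → count v (concat t) ≡ hgt n (val t) v C
  count-hgt {t} h v p = trans (count-concat v t C n p tlen (maxCol≤ {t} h)) (rowSum-hgt (val t) v C n)
    where
    tlen : length t ≤ n
    tlen = subst (_≤ n) (trans (cong length (sym (SSKT-shape {α = α} {φ} {t} len h))) (length-map length t)) len

  wt-match : ∀ {t} → SSKT α φ t → wtRF n (Φ n C t) ≡ wtKey n t
  wt-match {t} h = tabulate-cong (λ j → trans (cong length (nthL-tab n _ (suc (toℕ j)) (s≤s z≤n) (toℕ<n j)))
    (trans (marks-row n C (val t) (suc (toℕ j)) (s≤s z≤n) (toℕ<n j) (λ c → occ≤1 (Crystal.kt ok {t} h) (s≤s z≤n)))
      (sym (count-hgt {t} h (suc (toℕ j)) (s≤s z≤n)))))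

  Φ-injective : ∀ {t t'} → SSKT α φ t → SSKT α φ t' → Φ n C t ≡ Φ n C t' → t ≡ t'
  Φ-injective {t} {t'} h h' e = marks-injective {t = t} {t'} ok ok h h'
    (fac-injective n _ _ (marks-Valid n C (val t)) (marks-Valid n C (val t')) (marks-Bounded n C (val t))
      (marks-Bounded n C (val t')) e)

  module _ {i} (1≤i : 1 ≤ i) (i<n : i < n) where
    private
      step⇒e : ∀ {t t'} → EStep i (marks n C (val t)) (marks n C (val t')) → eRF n i (Φ n C t) ≡ just (Φ n C t')
      step⇒e {t} = eRF-fac 1≤i i<n (marks-Valid n C (val t))
      step⇒f : ∀ {t t'} → EStep i (marks n C (val t')) (marks n C (val t)) → fRF n i (Φ n C t) ≡ just (Φ n C t')
      step⇒f {t} = fRF-fac 1≤i i<n (marks-Valid n C (val t))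

    eKey⇒SSKT : ∀ {t t'} → SSKT α φ t → eKey i t ≡ just t' → SSKT α φ t'
    eKey⇒SSKT {t} {t'} h e with Crystal.eView ok {t = t} 1≤i i<n h
    ... | none e' _ = case trans (sym e) e' of λ ()
    ... | some t₁ e' h' _ = subst (SSKT α φ) (just-injective (trans (sym e') e)) h'

    eKey⇒EStep : ∀ {t t'} → SSKT α φ t → eKey i t ≡ just t' → EStep i (marks n C (val t)) (marks n C (val t'))
    eKey⇒EStep {t} {t'} h e with Crystal.eView ok {t = t} 1≤i i<n h
    ... | none e' _ = case trans (sym e) e' of λ ()
    ... | some t₁ e' h' S = subst (λ z → EStep i (marks n C (val t)) (marks n C (val z))) (just-injective (trans (sym e') e)) S

    eRF⇒eKey : ∀ {t t'} → SSKT α φ t → SSKT α φ t' → eRF n i (Φ n C t) ≡ just (Φ n C t') → eKey i t ≡ just t'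
    eRF⇒eKey {t} {t'} h h' e with Crystal.eView ok {t = t} 1≤i i<n h
    ... | none _ ls = case trans (sym e) (eRF-fac-none 1≤i i<n _ (marks-Valid n C (val t)) ls) of λ ()
    ... | some t₁ e₁ h₁ S = trans e₁ (cong just (Φ-injective {t₁} {t'} h₁ h'
        (just-injective (trans (sym (step⇒e {t} {t₁} S)) e))))

    EStep⇒eKey : ∀ {t t'} → SSKT α φ t → SSKT α φ t' → EStep i (marks n C (val t)) (marks n C (val t')) → eKey i t ≡ just t'
    EStep⇒eKey {t} {t'} h h' S = eRF⇒eKey {t} {t'} h h' (step⇒e {t} {t'} S)

    eKey⇒eRF : ∀ {t t'} → SSKT α φ t → eKey i t ≡ just t' → eRF n i (Φ n C t) ≡ just (Φ n C t')
    eKey⇒eRF {t} {t'} h e = step⇒e {t} {t'} (eKey⇒EStep {t} {t'} h e)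

    eKey⇒fRF : ∀ {t t'} → SSKT α φ t' → eKey i t' ≡ just t → fRF n i (Φ n C t) ≡ just (Φ n C t')
    eKey⇒fRF {t} {t'} h e = step⇒f {t} {t'} (eKey⇒EStep {t'} {t} h e)

    -- `loSplit` shows which letter `f_i` moves, injectivity of `fac` identifies the result with the
    -- marked list of `t'`, and the splitting read backwards is a raising step.
    fRF⇒eKey : ∀ {t t'} → SSKT α φ t → SSKT α φ t' → fRF n i (Φ n C t) ≡ just (Φ n C t') → eKey i t' ≡ just t
    fRF⇒eKey {t} {t'} h h' e with loSplit i (marks n C (val t))
    ... | none rs = case trans (sym e) (fRF-fac-none 1≤i i<n _ (marks-Valid n C (val t)) rs) of λ ()
    ... | split A a B eq ra lb = EStep⇒eKey {t'} {t} h' h (estep (sym eq') eq ra lb)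
      where
      V : Valid 0 0 (A ++ (a , i) ∷ B)
      V = subst (Valid 0 0) eq (marks-Valid n C (val t))
      eq' : A ++ (a , suc i) ∷ B ≡ marks n C (val t')
      eq' = fac-injective n _ _ (Valid-flip-up A V (closing-free (Valid-tail A V) lb)) (marks-Valid n C (val t'))
        (Bounded-flip A (subst (Bounded n) eq (marks-Bounded n C (val t))) (s≤s z≤n) i<n) (marks-Bounded n C (val t'))
        (just-injective (trans (sym (fRF-fac 1≤i i<n (marks-Valid n C (val t)) (estep refl eq ra lb))) e))

-- `X(α, ψ)` as `X(β, id)`, with `σ` the sorting word of `β`. The length of `β` is `n`, so that
-- every index below `n` can exchange two of its rows.
record Stage (n C : ℕ) (lam α : List ℕ) (ψ : ℕ → ℕ) : Set where
  field
    {β σ} : List ℕ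
    β-len   : length β ≡ n
    β-parts : ∀ r → nthN0 β r ≤ C
    sorts   : Sorts lam σ β
    to      : ∀ {b} → Im n C α ψ b → Im n C β id b
    from    : ∀ {b} → Im n C β id b → Im n C α ψ b

-- v is the word of the successive steps which raise the flag of one row by one, the first step being the last letter.
data Climb (n C : ℕ) (α : List ℕ) : List ℕ → (ℕ → ℕ) → Set where
  base : ∀ {ψ} → (∀ r → r < length α → ψ (suc r) ≡ suc r) → Climb n C α [] ψ
  up   : ∀ {v ψ ψ' i} j → i ≡ ψ (suc j) → Climb n C α v ψ → Bump n C α ψ j →
         (∀ r → r < length α → ψ' (suc r) ≡ bumpAt (suc j) ψ (suc r)) → Climb n C α (i ∷ v) ψ'

Climb-resp : ∀ {n C α v ψ ψ'} → Climb n C α v ψ → (∀ r → r < length α → ψ (suc r) ≡ ψ' (suc r)) → Climb n C α v ψ'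
Climb-resp (base h) e = base (λ r p → trans (sym (e r p)) (h r p))
Climb-resp (up j i≡ c B h) e = up j i≡ c B (λ r p → trans (sym (e r p)) (h r p))

Im-flag : ∀ {n C α ψ ψ'} → (∀ r → r < length α → ψ (suc r) ≡ ψ' (suc r)) → ∀ {b} → Im n C α ψ b → Im n C α ψ' b
Im-flag {α = α} {ψ} {ψ'} e (t , h , q) = t , SSKT-flag≤ {α} {ψ} {ψ'} {t} h (λ r p → ≤-reflexive (e r p)) , q

swap-invol : ∀ l β → swapAt1 (suc l) (swapAt1 (suc l) β) ≡ β
swap-invol zero [] = refl
swap-invol zero (x ∷ []) = refl
swap-invol zero (x ∷ y ∷ β) = refl
swap-invol (suc l) [] = refl
swap-invol (suc l) (x ∷ β) = cong (x ∷_) (swap-invol l β)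

module FromBase {n C : ℕ} (lam : List ℕ) (len : length lam ≤ n) (dec : WeaklyDec lam) where
  open Base {n} {C} lam len dec

  -- With `i = ψ (suc j) = l + 1`, both `X(α, ψ)` raised in row `j` and `X(β, id)` raised in row `l`
  -- are obtained by the same operator from the same set. If the rows `l` and `l + 1` of `β` ascend
  -- weakly, nothing changes; otherwise they are exchanged and `σ` gains a letter in front.
  bump-stage : ∀ {α ψ j} → Bump n C α ψ j → Stage n C lam α ψ → Stage n C lam α (bumpAt (suc j) ψ)
  bump-stage {α} {ψ} {j} B st = raise (ψ (suc j)) refl
    where
    open Stage st
    module BS = BumpStep B
    β≤ : length β ≤ n
    β≤ = ≤-reflexive β-len
    D = Dword n w σ (_≡ u)
    toD : ∀ {b} → Im n C α ψ b → D b
    toD m = Im⇒Dword β≤ β-parts sorts (to m)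
    fromD : ∀ {b} → D b → Im n C α ψ b
    fromD d = from (Dword⇒Im β≤ β-parts sorts d)
    raise : ∀ i → i ≡ ψ (suc j) → Stage n C lam α (bumpAt (suc j) ψ)
    raise zero e = ⊥-elim (<-irrefl e (Bump.pos B))
    raise (suc l) e = finish (nthN0 β l ≤? nthN0 β (suc l))
      where
      l<n : suc l < n
      l<n = subst (_< n) (sym e) (Bump.small B)
      l<β : suc l < length β
      l<β = subst (suc l <_) (sym β-len) l<n
      B' = id-Bump β l β≤ β-parts l<n
      ahead : ∀ {b} → Im n C α (bumpAt (suc j) ψ) b → Im n C β (bumpAt (suc l) id) b
      ahead {b} m = BumpStep.Dop⇒Im B' w D (Dword⇒Im β≤ β-parts sorts) (Im⇒Dword β≤ β-parts sorts) (Dword-RF σ)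
                    (subst (λ z → Dop n w z D b) (sym e) (BS.Im⇒Dop w D fromD toD (Dword-RF σ) m))
      back : ∀ {b} → Im n C β (bumpAt (suc l) id) b → Im n C α (bumpAt (suc j) ψ) b
      back {b} m = BS.Dop⇒Im w D fromD toD (Dword-RF σ)
                   (subst (λ z → Dop n w z D b) e (BumpStep.Im⇒Dop B' w D (Dword⇒Im β≤ β-parts sorts) (Im⇒Dword β≤ β-parts sorts)
                     (Dword-RF σ) m))
      finish : Dec (nthN0 β l ≤ nthN0 β (suc l)) → Stage n C lam α (bumpAt (suc j) ψ)
      finish (yes inc) = record { β-len = β-len ; β-parts = β-parts ; sorts = sorts
        ; to = λ m → drop-flag (ahead m) ; from = λ m → back (add-flag m) }
        where
        drop-flag : ∀ {b} → Im n C β (bumpAt (suc l) id) b → Im n C β id b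
        drop-flag = Im-transfer {C = C} β≤ β≤ (λ {x} K → x , ascending-flag l inc K , λ _ _ _ → refl)
        add-flag : ∀ {b} → Im n C β id b → Im n C β (bumpAt (suc l) id) b
        add-flag (t , h , q) = t , BumpStep.weaken B' {t} h , q
      finish (no ninc) = record { β-len = trans (swap-length (suc l) β) β-len ; β-parts = swap-parts {n} {C} l β l<β β-parts
        ; sorts = step l<γ up-γ (subst (Sorts lam σ) (sym (swap-invol l β)) sorts)
        ; to = λ {b} m → Im-exchange⇒ {C = C} γ≤ l<γ up-γ
          (subst (λ z → Im n C z (bumpAt (suc l) id) b) (sym (swap-invol l β)) (ahead m))
        ; from = λ {b} m → back (subst (λ z → Im n C z (bumpAt (suc l) id) b) (swap-invol l β)
          (Im-exchange⇐ {C = C} γ≤ l<γ up-γ m)) }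
        where
        γ = swapAt1 (suc l) β
        γ≤ : length γ ≤ n
        γ≤ = subst (_≤ n) (sym (swap-length (suc l) β)) β≤
        l<γ : suc l < length γ
        l<γ = subst (suc l <_) (sym (swap-length (suc l) β)) l<β
        up-γ : nthN0 γ l < nthN0 γ (suc l)
        up-γ = subst₂ _<_ (sym (trans (nthN0-swap l β l l<β) (cong (nthN0 β) (applyS-lo l))))
            (sym (trans (nthN0-swap l β (suc l) l<β) (cong (nthN0 β) (applyS-hi l)))) (≰⇒> ninc)

  climb-stage : ∀ {α v ψ} → Climb n C α v ψ → (∀ {ψ} → (∀ r → r < length α → ψ (suc r) ≡ suc r) → Stage n C lam α ψ) → Stage n C
      lam α ψ
  climb-stage (base h) start = start h
  climb-stage {α} (up {ψ = ψ₀} j _ c B h) start = record { β-len = β-len ; β-parts = β-parts ; sorts = sorts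
      ; to = λ m → to (Im-flag {C = C} {α = α} h m) ; from = λ m → Im-flag {C = C} {α = α} (λ r p → sym (h r p)) (from m) }
    where open Stage (bump-stage B (climb-stage c start))

module FlagClimb {n C : ℕ} (α : List ℕ) (φ : ℕ → ℕ) (flag : IsFlag φ) (k≤ : φ (length α) ≤ n) (parts : ∀ r → nthN0 α r ≤ C) where
  private
    k = length α
    φ-mono : ∀ {l m} → l ≤ m → φ (suc l) ≤ φ (suc m)
    φ-mono {l} {m} p with m≤n⇒m<n∨m≡n p
    ... | inj₂ refl = ≤-refl
    φ-mono {l} {suc m} p | inj₁ q = ≤-trans (φ-mono (≤-pred q)) (proj₁ flag (suc m) (s≤s z≤n))
    φ-ge : ∀ r → suc r ≤ φ (suc r)
    φ-ge r = proj₂ flag (suc r) (s≤s z≤n)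
    φ≤n : ∀ r → r < k → φ (suc r) ≤ n
    φ≤n r p = ≤-trans (lift r k p) k≤
      where
      lift : ∀ r k → r < k → φ (suc r) ≤ φ k
      lift r (suc k) q = φ-mono (≤-pred q)
    k≤n : k ≤ n
    k≤n = go k refl
      where
      go : ∀ m → m ≡ k → m ≤ n
      go zero _ = z≤n
      go (suc m) e = ≤-trans (φ-ge m) (φ≤n m (≤-reflexive e))

    -- The flag in the middle of the climb: rows before `j` have the identity flag, row `j` has `m`,
    -- later rows already have `φ`. With the later rows raised first, the value `m` is free when row
    -- `j` leaves it, because their flags are at least `φ (suc j)`, which exceeds `m`.
    mix : ℕ → ℕ → ℕ → ℕ
    mix j m zero = 0
    mix j m (suc r) = if r <ᵇ j then suc r else (if r ≡ᵇ j then m else φ (suc r))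

    mix-lt : ∀ {j m r} → r < j → mix j m (suc r) ≡ suc r
    mix-lt p rewrite <ᵇ-yes p = refl
    mix-eq : ∀ {j m} → mix j m (suc j) ≡ m
    mix-eq {j} rewrite <ᵇ-no {j} ≤-refl | ≡ᵇ-yes {j} refl = refl
    mix-gt : ∀ {j m r} → j < r → mix j m (suc r) ≡ φ (suc r)
    mix-gt p rewrite <ᵇ-no (<⇒≤ p) | ≡ᵇ-no (λ e → <-irrefl (sym e) p) = refl

    mix-Ok : ∀ {j m} → j < k → suc j ≤ m → m ≤ φ (suc j) → Ok n C α (mix j m)
    mix-Ok {j} {m} j<k lo≤ ≤hi = record { len = k≤n ; parts = parts ; bound = bd ; mono = λ {a} {b} → mn {a} {b} }
      where
      bd : ∀ r → r < k → mix j m (suc r) ≤ n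
      bd r p with <-cmp r j
      ... | tri< q _ _ = subst (_≤ n) (sym (mix-lt q)) (≤-trans p k≤n)
      ... | tri≈ _ refl _ = subst (_≤ n) (sym (mix-eq {j} {m})) (≤-trans ≤hi (φ≤n j j<k))
      ... | tri> _ _ q = subst (_≤ n) (sym (mix-gt q)) (φ≤n r p)
      mn : ∀ {a b} → a ≤ b → mix j m (suc a) ≤ mix j m (suc b)
      mn {a} {b} p with <-cmp a j | <-cmp b j
      ... | tri< q _ _ | tri< q' _ _ = subst₂ _≤_ (sym (mix-lt q)) (sym (mix-lt q')) (s≤s p)
      ... | tri< q _ _ | tri≈ _ refl _ = subst₂ _≤_ (sym (mix-lt q)) (sym (mix-eq {j} {m})) (≤-trans (s≤s p) lo≤)
      ... | tri< q _ _ | tri> _ _ q' = subst₂ _≤_ (sym (mix-lt q)) (sym (mix-gt q')) (≤-trans (s≤s p) (φ-ge b))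
      ... | tri≈ _ refl _ | tri< q' _ _ = ⊥-elim (<⇒≱ q' p)
      ... | tri≈ _ refl _ | tri≈ _ refl _ = ≤-refl
      ... | tri≈ _ refl _ | tri> _ _ q' = subst₂ _≤_ (sym (mix-eq {j} {m})) (sym (mix-gt q')) (≤-trans ≤hi (φ-mono p))
      ... | tri> _ _ q | tri< q' _ _ = ⊥-elim (<-asym q' (<-≤-trans q p))
      ... | tri> _ _ q | tri≈ _ refl _ = ⊥-elim (<⇒≱ q p)
      ... | tri> _ _ q | tri> _ _ q' = subst₂ _≤_ (sym (mix-gt q)) (sym (mix-gt q')) (φ-mono p)

    mix-bump : ∀ j m r → mix j (suc m) (suc r) ≡ bumpAt (suc j) (mix j m) (suc r)
    mix-bump j m r with <-cmp r j
    ... | tri< q ne _ = trans (mix-lt q) (sym (trans (bumpAt-other (suc j) (mix j m) {suc r} (ne ∘ suc-injective)) (mix-lt q)))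
    ... | tri≈ _ refl _ = trans (mix-eq {j} {suc m}) (sym (trans (bumpAt-same (suc j) (mix j m)) (cong suc (mix-eq {j} {m}))))
    ... | tri> _ ne q = trans (mix-gt q) (sym (trans (bumpAt-other (suc j) (mix j m) {suc r} (ne ∘ suc-injective)) (mix-gt q)))

    Ok-resp : ∀ {ψ ψ'} → (∀ r → ψ (suc r) ≡ ψ' (suc r)) → Ok n C α ψ → Ok n C α ψ'
    Ok-resp e ok = record { len = Ok.len ok ; parts = Ok.parts ok ; bound = λ r p → subst (_≤ n) (e r) (Ok.bound ok r p) ; mono =
        λ {a} {b} p → subst₂ _≤_ (e a) (e b) (Ok.mono ok p) }

    mix-Bump : ∀ {j m} → j < k → suc j ≤ m → m < φ (suc j) → Bump n C α (mix j m) j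
    mix-Bump {j} {m} j<k lo≤ <hi = record
      { ok = mix-Ok j<k lo≤ (<⇒≤ <hi)
      ; ok' = Ok-resp (mix-bump j m) (mix-Ok j<k (m≤n⇒m≤1+n lo≤) <hi)
      ; pos = subst (1 ≤_) (sym (mix-eq {j} {m})) (≤-trans (s≤s z≤n) lo≤)
      ; below = λ r q → subst₂ _<_ (sym (mix-lt q)) (sym (mix-eq {j} {m})) (≤-trans (s≤s q) lo≤)
      ; small = subst (_< n) (sym (mix-eq {j} {m})) (<-≤-trans <hi (φ≤n j j<k))
      ; avoid = λ r e → av r (trans (mix-bump j m r) (trans e (mix-eq {j} {m}))) }
      where
      av : ∀ r → mix j (suc m) (suc r) ≢ m
      av r e with <-cmp r j
      ... | tri< q _ _ = <-irrefl (trans (sym (mix-lt q)) e) (≤-trans (s≤s q) lo≤)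
      ... | tri≈ _ refl _ = 1+n≢n (trans (sym (mix-eq {j} {suc m})) e)
      ... | tri> _ _ q = <-irrefl (trans (sym e) (mix-gt q)) (<-≤-trans <hi (φ-mono (<⇒≤ q)))

    reverse-rangeFrom : ∀ s e → reverse (rangeFrom s (suc e)) ≡ (s + e) ∷ reverse (rangeFrom s e)
    reverse-rangeFrom s e = trans (cong reverse (trans (cong (rangeFrom s) (+-comm 1 e)) (rangeFrom-++ s e 1)))
        (reverse-++ (rangeFrom s e) [ s + e ])

    inner : ∀ {j v} → j < k → Climb n C α v (mix j (suc j)) → ∀ e → suc j + e ≤ φ (suc j) → Climb n C α
        (reverse (rangeFrom (suc j) e) ++ v) (mix j (suc j + e))
    inner {j} {v} j<k c zero h = Climb-resp c (λ r _ → cong (λ m → mix j m (suc r)) (sym (+-identityʳ (suc j))))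
    inner {j} {v} j<k c (suc e) h = subst (λ z → Climb n C α (z ++ v) (mix j (suc j + suc e))) (sym (reverse-rangeFrom (suc j) e))
      (up j (sym (mix-eq {j} {suc j + e})) (inner j<k c e (≤-trans (+-monoʳ-≤ (suc j) (n≤1+n e)) h))
        (mix-Bump j<k (m≤m+n (suc j) e) (subst (_≤ φ (suc j)) (+-suc (suc j) e) h))
        (λ r _ → trans (cong (λ m → mix j m (suc r)) (+-suc (suc j) e)) (mix-bump j (suc j + e) r)))

    cut : ℕ → ℕ → ℕ
    cut j r = if r ≤ᵇ j then r else φ r

    -- The recursion raises the later rows first, since the rightmost factor of the operator product
    -- acts first.
    outer : ∀ d j → j + d ≡ k → Climb n C α (concatMap (λ j → downWord (φ j) j) (rangeFrom (suc j) d)) (cut j)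
    outer zero j e = base (λ r p → cong (λ b → if b then suc r else φ (suc r))
        (≤ᵇ-yes (subst (suc r ≤_) (trans (sym e) (+-identityʳ j)) p)))
    outer (suc d) j e = Climb-resp (inner j<k (Climb-resp (outer d (suc j) (trans (sym (+-suc j d)) e)) start) (φ (suc j) ∸ suc j)
        (≤-reflexive full)) finish
      where
      j<k : j < k
      j<k = subst (j <_) e (m<m+n j (s≤s z≤n))
      full : suc j + (φ (suc j) ∸ suc j) ≡ φ (suc j)
      full = m+[n∸m]≡n (φ-ge j)
      start : ∀ r → r < k → cut (suc j) (suc r) ≡ mix j (suc j) (suc r)
      start r _ with <-cmp r j
      ... | tri< q _ _ = trans (cong (λ b → if b then suc r else φ (suc r)) (≤ᵇ-yes (s≤s (<⇒≤ q)))) (sym (mix-lt q))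
      ... | tri≈ _ refl _ = trans (cong (λ b → if b then suc r else φ (suc r)) (≤ᵇ-yes (≤-refl {suc r})))
          (sym (mix-eq {j} {suc j}))
      ... | tri> _ _ q = trans (cong (λ b → if b then suc r else φ (suc r)) (≤ᵇ-no (s≤s q))) (sym (mix-gt q))
      finish : ∀ r → r < k → mix j (suc j + (φ (suc j) ∸ suc j)) (suc r) ≡ cut j (suc r)
      finish r _ with <-cmp r j
      ... | tri< q _ _ = trans (mix-lt q) (sym (cong (λ b → if b then suc r else φ (suc r)) (≤ᵇ-yes q)))
      ... | tri≈ _ refl _ = trans (mix-eq {j} {suc j + (φ (suc j) ∸ suc j)})
          (trans full (sym (cong (λ b → if b then suc r else φ (suc r)) (≤ᵇ-no (≤-refl {suc j})))))
      ... | tri> _ _ q = trans (mix-gt q) (sym (cong (λ b → if b then suc r else φ (suc r)) (≤ᵇ-no (m≤n⇒m≤1+n q))))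

  shape-len : length α ≤ n
  shape-len = k≤n

  flag-Ok : Ok n C α φ
  flag-Ok = record { len = k≤n ; parts = parts ; bound = φ≤n ; mono = φ-mono }

  flag-climb : Climb n C α (flagWord φ (length α)) φ
  flag-climb = Climb-resp (outer k 0 refl) (λ r _ → refl)

pad-nth : ∀ (α : List ℕ) m r → nthN0 (α ++ replicate m 0) r ≡ nthN0 α r
pad-nth [] zero r = refl
pad-nth [] (suc m) zero = refl
pad-nth [] (suc m) (suc r) = pad-nth [] m r
pad-nth (x ∷ α) m zero = refl
pad-nth (x ∷ α) m (suc r) = pad-nth α m r

part≤max : ∀ α r → nthN0 α r ≤ foldr _⊔_ 0 α
part≤max [] r = z≤n
part≤max (a ∷ α) zero = m≤m⊔n a _
part≤max (a ∷ α) (suc r) = ≤-trans (part≤max α r) (m≤n⊔m a _)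

demazure : ∀ α φ → IsFlag φ → ∀ n → φ (length α) ≤ n → IsDemazureSSKT n α φ
demazure α φ flag n k≤ with bubble (inv (α ++ replicate (n ∸ length α) 0)) (α ++ replicate (n ∸ length α) 0) ≤-refl
... | σ₀ , lam , S₀ , dec = (λ i p q t t' h e → eKey⇒SSKT ok p q {t} {t'} h e) , w , u , σ , u-RF , u-highest lam-parts ,
    subst (λ m → All (λ j → 1 ≤ j × j < m) σ) β-len (Sorts-letters sorts) , Sorts-Reduced sorts , Φ n C ,
    (λ t h → Im⇒Dword β≤ β-parts sorts (to (t , h , refl))) ,
    (λ t t' h h' e → Φ-injective ok {t} {t'} h h' e) ,
    (λ b d → from (Dword⇒Im β≤ β-parts sorts d)) ,
    (λ t h → wt-match ok {t} h) ,
    (λ i p q t t' h h' → eKey⇒eRF ok p q {t} {t'} h , eRF⇒eKey ok p q {t} {t'} h h') ,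
    (λ i p q t t' h h' → eKey⇒fRF ok p q {t} {t'} h' , fRF⇒eKey ok p q {t} {t'} h h')
  where
  C = foldr _⊔_ 0 α
  -- Empty rows up to `n` change no tableau but let the rearrangement `β` use all `n` positions.
  α⁺ = α ++ replicate (n ∸ length α) 0
  open FlagClimb {n} {C} α φ flag k≤ (part≤max α)
  ok = flag-Ok
  α⁺-len : length α⁺ ≡ n
  α⁺-len = trans (length-++ α) (trans (cong (length α +_) (length-replicate (n ∸ length α))) (m+[n∸m]≡n shape-len))
  lam-len : length lam ≤ n
  lam-len = ≤-reflexive (trans (proj₁ (Sorts-same S₀)) α⁺-len)
  α⁺-parts : ∀ r → nthN0 α⁺ r ≤ C
  α⁺-parts r = subst (_≤ C) (sym (pad-nth α (n ∸ length α) r)) (part≤max α r)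
  lam-parts : ∀ r → nthN0 lam r ≤ C
  lam-parts r = subst (_≤ C) (sym (proj₂ (proj₂ (Sorts-same S₀) r))) (α⁺-parts _)
  open Base {n} {C} lam lam-len dec
  start : ∀ {ψ} → (∀ r → r < length α → ψ (suc r) ≡ suc r) → Stage n C lam α ψ
  start {ψ} e = record { β-len = α⁺-len ; β-parts = α⁺-parts ; sorts = S₀
    ; to = Im-transfer {C = C} shape-len (≤-reflexive α⁺-len)
      (λ {x} K → x , KT-resp K (λ r → sym (pad-nth α (n ∸ length α) r)) (λ _ _ → refl) (fl K) , λ _ _ _ → refl)
    ; from = Im-transfer {C = C} (≤-reflexive α⁺-len) shape-len
      (λ {x} K → x , KT-resp K (pad-nth α (n ∸ length α)) (λ _ _ → refl) (fl' K) , λ _ _ _ → refl) }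
    where
    beyond : ∀ r → ¬ (r < length α) → nthN0 α r ≡ 0
    beyond r p with nth0 α r | nthView α r
    ... | _ | inside q = ⊥-elim (p q)
    ... | _ | outside _ = refl
    fl : ∀ {x} → KT n (nthN0 α) (ψ ∘ suc) x → ∀ r → x r 0 ≤ suc r
    fl {x} K r with r <? length α
    ... | yes p = subst (x r 0 ≤_) (e r p) (KT.flag K r)
    ... | no p = subst (_≤ suc r) (sym (KT.out K r 0 (≤-reflexive (beyond r p)))) z≤n
    fl' : ∀ {x} → KT n (nthN0 α⁺) suc x → ∀ r → x r 0 ≤ ψ (suc r)
    fl' {x} K r with r <? length α
    ... | yes p = subst (x r 0 ≤_) (sym (e r p)) (KT.flag K r)
    ... | no p = subst (_≤ ψ (suc r)) (sym (KT.out K r 0 (≤-reflexive (trans (pad-nth α (n ∸ length α) r) (beyond r p))))) z≤n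
  open Stage (FromBase.climb-stage lam lam-len dec flag-climb start)
  β≤ : length β ≤ n
  β≤ = ≤-reflexive β-len

-- Characters of key tableaux

module _ {A : Set} where
  consAll : List A → List (List A) → List (List A)
  consAll vs L = concatMap (λ v → map (v ∷_) L) vs

  ∈-++ˡ : ∀ {B : Set} {b : B} {xs ys} → b ∈ xs → b ∈ xs ++ ys
  ∈-++ˡ (here e) = here e
  ∈-++ˡ (there p) = there (∈-++ˡ p)

  ∈-++ʳ : ∀ {B : Set} {b : B} xs {ys} → b ∈ ys → b ∈ xs ++ ys
  ∈-++ʳ [] p = p
  ∈-++ʳ (x ∷ xs) p = there (∈-++ʳ xs p)

  ++-∈ : ∀ {B : Set} {b : B} xs {ys} → b ∈ xs ++ ys → b ∈ xs ⊎ b ∈ ys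
  ++-∈ [] p = inj₂ p
  ++-∈ (x ∷ xs) (here e) = inj₁ (here e)
  ++-∈ (x ∷ xs) (there p) with ++-∈ xs p
  ... | inj₁ q = inj₁ (there q)
  ... | inj₂ q = inj₂ q

  Distinct-++ : ∀ {B : Set} (xs ys : List B) → Distinct xs → Distinct ys → (∀ b → b ∈ xs → b ∈ ys → ⊥) → Distinct (xs ++ ys)
  Distinct-++ [] ys _ d h = d
  Distinct-++ (x ∷ xs) ys (p ∷ d) d' h = ++⁺ p (∈-All ys (λ b m e → h x (here refl) (subst (_∈ ys) (sym e) m))) ∷ Distinct-++ xs
      ys d d' (λ b m m' → h b (there m) m')

  ∈-consAll : ∀ {vs L v xs} → v ∈ vs → xs ∈ L → v ∷ xs ∈ consAll vs L
  ∈-consAll {v ∷ vs} {L} (here refl) q = ∈-++ˡ (∈-map (v ∷_) q)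
  ∈-consAll {v ∷ vs} {L} (there p) q = ∈-++ʳ (map (v ∷_) L) (∈-consAll p q)

  consAll-∈ : ∀ vs {L y} → y ∈ consAll vs L → ∃ λ v → v ∈ vs × ∃ λ xs → y ≡ v ∷ xs
  consAll-∈ (v ∷ vs) {L} m with ++-∈ (map (v ∷_) L) m
  ... | inj₁ p with map-∈ (v ∷_) L p
  ...   | xs , _ , e = v , here refl , xs , e
  consAll-∈ (v ∷ vs) {L} m | inj₂ p with consAll-∈ vs p
  ... | v' , q , xs , e = v' , there q , xs , e

  Distinct-consAll : ∀ vs L → Distinct vs → Distinct L → Distinct (consAll vs L)
  Distinct-consAll [] L _ _ = []
  Distinct-consAll (v ∷ vs) L (p ∷ d) dL = Distinct-++ (map (v ∷_) L) (consAll vs L)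
      (Distinct-map (v ∷_) L dL (λ _ _ _ _ → ∷-injectiveʳ)) (Distinct-consAll vs L d dL) disjoint
    where
    disjoint : ∀ b → b ∈ map (v ∷_) L → b ∈ consAll vs L → ⊥
    disjoint b m m' with map-∈ (v ∷_) L m | consAll-∈ vs m'
    ... | xs , _ , refl | v' , q , _ , e = All-∈ p q (∷-injectiveˡ e)

Distinct-fillRow : ∀ a M → Distinct (fillRow a M)
Distinct-fillRow zero M = [] ∷ []
Distinct-fillRow (suc a) M = Distinct-consAll (range1 M) (fillRow a M) (Distinct-rangeFrom 1 M) (Distinct-fillRow a M)

Distinct-fillings : ∀ α M → Distinct (fillings α M)
Distinct-fillings [] M = [] ∷ []
Distinct-fillings (a ∷ α) M = Distinct-consAll (fillRow a M) (fillings α M) (Distinct-fillRow a M) (Distinct-fillings α M)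

∈-fillRow : ∀ M row → (∀ c → c < length row → 1 ≤ nthN0 row c × nthN0 row c ≤ M) → row ∈ fillRow (length row) M
∈-fillRow M [] h = here refl
∈-fillRow M (v ∷ row) h = ∈-consAll (∈-rangeFrom 1 M (proj₁ (h 0 (s≤s z≤n))) (s≤s (proj₂ (h 0 (s≤s z≤n)))))
  (∈-fillRow M row (λ c p → h (suc c) (s≤s p)))

∈-fillings : ∀ M t → (∀ r c → c < rowLen t r → 1 ≤ val t r c × val t r c ≤ M) → t ∈ fillings (map length t) M
∈-fillings M [] h = here refl
∈-fillings M (row ∷ t) h = ∈-consAll (∈-fillRow M row (h 0)) (∈-fillings M t (h ∘ suc))

enum : ℕ → List ℕ → (ℕ → ℕ) → List Tab
enum N α φ = filterB (isSSKT α φ) (fillings α N)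

enum-∈ : ∀ {N α φ t} → t ∈ enum N α φ → SSKT α φ t
enum-∈ {N} {α} {φ} m = proj₂ (filterB-∈ (isSSKT α φ) (fillings α N) m)

∈-enum : ∀ {N C α φ} → Ok N C α φ → ∀ {t} → SSKT α φ t → t ∈ enum N α φ
∈-enum {N} {C} {α} {φ} ok {t} h = ∈-filterB (isSSKT α φ) (subst (λ z → t ∈ fillings z N) sh (∈-fillings N t entries)) h
  where
  sh = SSKT-shape {α = α} {φ} {t} (Ok.len ok) h
  K = Crystal.kt ok {t} h
  entries : ∀ r c → c < rowLen t r → 1 ≤ val t r c × val t r c ≤ N
  entries r c p = KT.box K r c (subst (c <_) (sym (trans (cong (λ z → nthN0 z r) (sym sh)) (rowLen-shape t r))) p) ,
      Crystal.val-bound ok {t} h r c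

Distinct-enum : ∀ N α φ → Distinct (enum N α φ)
Distinct-enum N α φ = Distinct-filterB (isSSKT α φ) (Distinct-fillings α N)

enum-cong : ∀ N α {φ φ'} → (∀ r → r < length α → φ (suc r) ≡ φ' (suc r)) → enum N α φ ≡ enum N α φ'
enum-cong N α {φ} {φ'} e = filterB-cong (fillings α N)
  where
  same : ∀ t → isSSKT α φ t ≡ isSSKT α φ' t
  same t with isSSKT α φ t in p | isSSKT α φ' t in q
  ... | true | true = refl
  ... | false | false = refl
  ... | true | false = trans (sym (T⇒≡ (SSKT-flag≤ {α} {φ} {φ'} {t} (≡⇒T p) (λ r l → ≤-reflexive (e r l))))) q
  ... | false | true = trans (sym p) (T⇒≡ (SSKT-flag≤ {α} {φ'} {φ} {t} (≡⇒T q) (λ r l → ≤-reflexive (sym (e r l)))))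
  filterB-cong : ∀ L → filterB (isSSKT α φ) L ≡ filterB (isSSKT α φ') L
  filterB-cong [] = refl
  filterB-cong (t ∷ L) rewrite same t with isSSKT α φ' t
  ... | true = cong (t ∷_) (filterB-cong L)
  ... | false = filterB-cong L

char : ∀ N → List ℕ → (ℕ → ℕ) → Poly N
char N α φ = monos (wtKey N) (enum N α φ)

-- The weight is read off from the factorization and `Φ` is injective, so both characters are sums
-- over the same set of factorizations.
char-Im : ∀ {N C α φ α' φ'} → Ok N C α φ → Ok N C α' φ' → (∀ {b} → Im N C α φ b → Im N C α' φ' b) →
    (∀ {b} → Im N C α' φ' b → Im N C α φ b) →
  char N α φ ≈P char N α' φ'
char-Im {N} {C} {α} {φ} {α'} {φ'} ok ok' f g a = trans (through ok)
    (trans (sumZ-set _ _ G (dist ok) (dist ok') (move ok ok' f) (move ok' ok g)) (sym (through ok')))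
  where
  G : Fac → ℤ
  G b = δ (wtRF N b) a
  through : ∀ {α φ} → Ok N C α φ → coeff (char N α φ) a ≡ sumZ (map (Φ N C) (enum N α φ)) G
  through {α} {φ} ok = trans (monos-coeff (wtKey N) (enum N α φ) a)
      (trans (sumZ-cong∈ (enum N α φ) (λ t m → cong (λ z → δ z a) (sym (wt-match ok {t} (enum-∈ {N} {α} {φ} {t} m)))))
    (sym (sumZ-map (Φ N C) (enum N α φ) G)))
  dist : ∀ {α φ} → Ok N C α φ → Distinct (map (Φ N C) (enum N α φ))
  dist {α} {φ} ok = Distinct-map (Φ N C) (enum N α φ) (Distinct-enum N α φ)
      (λ t t' m m' → Φ-injective ok {t} {t'} (enum-∈ {N} {α} {φ} {t} m) (enum-∈ {N} {α} {φ} {t'} m'))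
  move : ∀ {α φ α' φ'} → Ok N C α φ → Ok N C α' φ' → (∀ {b} → Im N C α φ b → Im N C α' φ' b) → ∀ {b} → b ∈ map (Φ N C)
      (enum N α φ) → b ∈ map (Φ N C) (enum N α' φ')
  move {α} {φ} ok ok' f m with map-∈ (Φ N C) (enum N α φ) m
  ... | t , q , e with f (t , enum-∈ {N} {α} {φ} {t} q , sym e)
  ...   | t' , h' , e' = subst (_∈ _) e' (∈-map (Φ N C) (∈-enum ok' {t'} h'))

getV-tabulate : ∀ {N} (g : ℕ → ℕ) m → m < N → getV (tabulate {n = N} (λ j → g (toℕ j))) m ≡ g m
getV-tabulate {suc N} g zero p = refl
getV-tabulate {suc N} g (suc m) (s≤s p) = getV-tabulate (g ∘ suc) m p

tab≟ : ∀ (t t' : Tab) → Dec (t ≡ t')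
tab≟ = Listₚ.≡-dec (Listₚ.≡-dec _≟_)

module _ {N C α φ} (ok : Ok N C α φ) where
  wt-row : ∀ {t} → SSKT α φ t → ∀ m → m < N → getV (wtKey N t) m ≡ length (rowOf (suc m) (marks N C (val t)))
  wt-row {t} h m p = trans (getV-tabulate (λ j → count (suc j) (concat t)) m p) (trans (count-hgt ok {t} h (suc m) (s≤s z≤n))
    (sym (marks-row N C (val t) (suc m) (s≤s z≤n) p (λ c → occ≤1 (Crystal.kt ok {t} h) (s≤s z≤n)))))

  -- The usual relation between the lengths of the two ends of a string and the weight, from the
  -- balance of brackets.
  marks-balance : ∀ {t i} → 1 ≤ i → i < N → SSKT α φ t →
    length (Ls i (marks N C (val t))) + length (rowOf i (marks N C (val t))) ≡ length (Rs i (marks N C (val t))) + length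
        (rowOf (suc i) (marks N C (val t)))
  marks-balance {t} {i} 1≤i i<N h = trans (cong₂ _+_ (Zfrom-lc 1≤i i<N x occ≤ 0 C)
      (trans (marks-row N C x i 1≤i (<⇒≤ i<N) (λ c → occ≤ c i 1≤i)) (sym (+-identityʳ _))))
    (trans (Sig.balance N x i 0 C) (sym (cong₂ _+_ (Zfrom-rc 1≤i i<N x occ≤ 0 C)
      (trans (marks-row N C x (suc i) (s≤s z≤n) i<N (λ c → occ≤ c (suc i) (s≤s z≤n))) (sym (+-identityʳ _))))))
    where
    x = val t
    occ≤ : ∀ c v → 1 ≤ v → occ N x c v ≤ 1
    occ≤ c v p = occ≤1 (Crystal.kt ok {t} h) p

EStep-row-lo : ∀ {i Z Z'} → EStep i Z Z' → length (rowOf i Z') ≡ suc (length (rowOf i Z))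
EStep-row-lo {i} (estep {A} {B} {a} refl refl _ _) = trans (cong length (flip-tgt-lo i A a B))
    (trans (length-++ (rowOf i A)) (trans (+-suc _ _)
    (cong suc (sym (trans (cong length (flip-src-lo i A a B)) (length-++ (rowOf i A)))))))

EStep-row-hi : ∀ {i Z Z'} → EStep i Z Z' → length (rowOf (suc i) Z) ≡ suc (length (rowOf (suc i) Z'))
EStep-row-hi {i} (estep {A} {B} {a} refl refl _ _) = trans (cong length (flip-src-hi i A a B))
    (trans (length-++ (rowOf (suc i) A)) (trans (+-suc _ _)
    (cong suc (sym (trans (cong length (flip-tgt-hi i A a B)) (length-++ (rowOf (suc i) A)))))))

EStep-row-other : ∀ {i Z Z'} → EStep i Z Z' → ∀ j → j ≢ i → j ≢ suc i → rowOf j Z ≡ rowOf j Z'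
EStep-row-other {i} (estep {A} {B} {a} refl refl _ _) = flip-other i A a B

module _ {N C α φ j} (B : Bump N C α φ j) where
  open Bump B
  private
    φ' = bumpAt (suc j) φ
    module BS = BumpStep B

  bump-strings : ∀ {l} → φ (suc j) ≡ suc l → StringData l (eKey (suc l)) (λ t → length (Ls (suc l) (marks N C (val t)))) (wtKey N)
      (SSKT α φ) (SSKT α φ')
  bump-strings {l} i≡ = record
    { X⊂Y = λ {t} → BS.weaken {t}
    ; tops = λ {t} h z → BS.highest {t} h (subst (λ i → Ls i (marks N C (val t)) ≡ []) (sym i≡) (length≡0 z))
    ; raise = λ {t} h z → raise' {t} h z
    ; drops = λ {t} {t'} h e → EStep-Ls (st {t} {t'} h e)
    ; wt-other = λ {t} {t'} h e m p q q' → trans (wt-row ok' {t} h m p)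
      (trans (cong length (EStep-row-other (st {t} {t'} h e) (suc m) (q ∘ suc-injective) (q' ∘ suc-injective)))
      (sym (wt-row ok' {t'} (cl {t} {t'} h e) m p)))
    ; wt-lo = λ {t} {t'} h e → trans (wt-row ok' {t'} (cl {t} {t'} h e) l l<N')
      (trans (EStep-row-lo (st {t} {t'} h e)) (cong suc (sym (wt-row ok' {t} h l l<N'))))
    ; wt-hi = λ {t} {t'} h e → trans (wt-row ok' {t} h (suc l) l<N)
      (trans (EStep-row-hi (st {t} {t'} h e)) (cong suc (sym (wt-row ok' {t'} (cl {t} {t'} h e) (suc l) l<N))))
    ; e-inj = λ {t₁} {t₂} {t} h₁ h₂ e₁ e₂ → inj {t₁} {t₂} {t} h₁ h₂ e₁ e₂
    ; bound = λ {t} h → subst₂ _≤_ (sym (wt-row ok' {t} h (suc l) l<N))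
      (cong (length (Ls i (marks N C (val t))) +_) (sym (wt-row ok' {t} h l l<N')))
        (≤-trans (m≤n+m _ (length (Rs i (marks N C (val t))))) (≤-reflexive (sym (marks-balance ok' {t} 1≤i l<N h))))
    ; extend = λ {t} h lt → extend' {t} h lt }
    where
    i = suc l
    1≤i : 1 ≤ i
    1≤i = s≤s z≤n
    l<N : suc l < N
    l<N = subst (_< N) i≡ small
    l<N' : l < N
    l<N' = <-trans (n<1+n l) l<N
    st : ∀ {t t'} → SSKT α φ' t → eKey i t ≡ just t' → EStep i (marks N C (val t)) (marks N C (val t'))
    st {t} {t'} = eKey⇒EStep ok' 1≤i l<N {t} {t'}
    cl : ∀ {t t'} → SSKT α φ' t → eKey i t ≡ just t' → SSKT α φ' t'
    cl {t} {t'} = eKey⇒SSKT ok' 1≤i l<N {t} {t'}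
    raise' : ∀ {t k} → SSKT α φ' t → length (Ls i (marks N C (val t))) ≡ suc k → ∃ λ t' → eKey i t ≡ just t' × SSKT α φ' t' ×
        (SSKT α φ t → SSKT α φ t')
    raise' {t} h z with Crystal.eView ok' {t = t} 1≤i l<N h
    ... | none _ ls = case trans (sym z) (cong length ls) of λ ()
    ... | some t' e h' _ = t' , e , h' , λ x → eKey⇒SSKT ok 1≤i l<N {t} {t'} x e
    inj : ∀ {t₁ t₂ t} → SSKT α φ' t₁ → SSKT α φ' t₂ → eKey i t₁ ≡ just t → eKey i t₂ ≡ just t → t₁ ≡ t₂
    inj {t₁} {t₂} {t} h₁ h₂ e₁ e₂ = Φ-injective ok' {t₁} {t₂} h₁ h₂
        (just-injective (trans (sym (eKey⇒fRF ok' 1≤i l<N {t} {t₁} h₁ e₁)) (eKey⇒fRF ok' 1≤i l<N {t} {t₂} h₂ e₂)))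
    opens : ∀ {t} → SSKT α φ' t → getV (wtKey N t) (suc l) < length (Ls i (marks N C (val t))) + getV (wtKey N t) l → Rs i
        (marks N C (val t)) ≢ []
    opens {t} h lt e = <-irrefl (trans (sym (cong (_+ length (rowOf (suc i) (marks N C (val t)))) (cong length e)))
        (sym (marks-balance ok' {t} 1≤i l<N h)))
      (subst₂ _<_ (wt-row ok' {t} h (suc l) l<N) (cong (length (Ls i (marks N C (val t))) +_) (wt-row ok' {t} h l l<N')) lt)
    extend' : ∀ {t} → SSKT α φ' t → getV (wtKey N t) (suc l) < length (Ls i (marks N C (val t))) + getV (wtKey N t) l →
      ∃ λ t' → SSKT α φ' t' × eKey i t' ≡ just t × (SSKT α φ t → length (Ls i (marks N C (val t))) ≢ 0 → SSKT α φ t')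
    extend' {t} h lt with Crystal.lower ok' {t = t} 1≤i l<N h (opens {t} h lt) (inj₁ (λ r e → avoid r (trans e (sym i≡))))
    ... | t' , h' , S = t' , h' , EStep⇒eKey ok' 1≤i l<N {t'} {t} h' h S , stays
      where
      stays : SSKT α φ t → length (Ls i (marks N C (val t))) ≢ 0 → SSKT α φ t'
      -- An unmatched closing letter allows lowering within the smaller flag as well; both lowered
      -- tableaux are raised to `t`, hence they coincide.
      stays x ne with Crystal.lower ok {t = t} 1≤i l<N x (EStep-Rs S) (inj₂ (ne ∘ cong length))
      ... | t'' , x'' , S'' = subst (SSKT α φ) (inj {t''} {t'} {t} (BS.weaken {t''} x'') h'
          (EStep⇒eKey ok' 1≤i l<N {t''} {t} (BS.weaken {t''} x'') h S'') (EStep⇒eKey ok' 1≤i l<N {t'} {t} h' h S)) x''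

  char-bump : char N α φ' ≈P piOp (φ (suc j)) (char N α φ)
  char-bump a = go (φ (suc j)) refl
    where
    go : ∀ i → φ (suc j) ≡ i → coeff (char N α φ') a ≡ coeff (piOp i (char N α φ)) a
    go zero e = ⊥-elim (<-irrefl (sym e) pos)
    go (suc l) e = Character.string-character tab≟ (subst (_< N) e small) (bump-strings e) (enum N α φ) (enum N α φ')
        (Distinct-enum N α φ) (Distinct-enum N α φ')
      (λ {t} → enum-∈ {N} {α} {φ} {t}) (λ {t} → ∈-enum ok {t}) (λ {t} → enum-∈ {N} {α} {φ'} {t}) (λ {t} → ∈-enum ok' {t}) a

superstandard-row : ∀ α C r v → cnt (superstandard α r) (suc v) C ≡ (if r ≡ᵇ v then α r + 0 else 0) ⊎ C < α r
superstandard-row α C r v with α r ≤? C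
... | no p = inj₂ (≰⇒> p)
... | yes p with r ≟ v
...   | no ne = inj₁ (trans (cnt-zero _ (suc v) C (λ c _ → off-row c)) (sym (cong (λ b → if b then α r + 0 else 0) (≡ᵇ-no ne))))
  where
  off-row : ∀ c → superstandard α r c ≢ suc v
  off-row c e with c <ᵇ α r
  ... | true = ne (suc-injective e)
  ... | false = case e of λ ()
...   | yes refl = inj₁ (trans (upto C p) (sym
    (trans (cong (λ b → if b then α r + 0 else 0) (≡ᵇ-yes {r} refl)) (+-identityʳ (α r)))))
  where
  within : ∀ C → C ≤ α r → cnt (superstandard α r) (suc r) C ≡ C
  within zero _ = refl
  within (suc C) q = trans (cong (λ z → (if z ≡ᵇ suc r then 1 else 0) + cnt (superstandard α r) (suc r) C)
      (superstandard-in α {r} q))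
    (trans (cong (λ b → (if b then 1 else 0) + cnt (superstandard α r) (suc r) C) (≡ᵇ-yes {r} refl))
      (cong suc (within C (<⇒≤ q))))
  upto : ∀ C → α r ≤ C → cnt (superstandard α r) (suc r) C ≡ α r
  upto C q with m≤n⇒m<n∨m≡n q
  ... | inj₂ e = trans (within C (≤-reflexive (sym e))) (sym e)
  upto (suc C) q | inj₁ q' = trans (cong (λ z → (if z ≡ᵇ suc r then 1 else 0) + cnt (superstandard α r) (suc r) C)
      (superstandard-out α {r} (≤-pred q'))) (upto C (≤-pred q'))

rowSum-superstandard : ∀ α C v n → (∀ r → α r ≤ C) → v < n → rowSum (superstandard α) (suc v) C n ≡ α v
rowSum-superstandard α C v (suc n) h p with superstandard-row α C n v
... | inj₂ q = ⊥-elim (<⇒≱ q (h n))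
... | inj₁ e with n ≟ v
...   | yes refl = trans (cong₂ _+_ (trans e (trans (cong (λ b → if b then α n + 0 else 0) (≡ᵇ-yes {n} refl)) (+-identityʳ _)))
    (above n ≤-refl)) (+-identityʳ _)
  where
  above : ∀ m → m ≤ v → rowSum (superstandard α) (suc v) C m ≡ 0
  above zero _ = refl
  above (suc m) q with superstandard-row α C m v
  ... | inj₂ q' = ⊥-elim (<⇒≱ q' (h m))
  ... | inj₁ e' = cong₂ _+_ (trans e' (cong (λ b → if b then α m + 0 else 0) (≡ᵇ-no (<⇒≢ q)))) (above m (<⇒≤ q))
...   | no ne = trans (cong₂ _+_ (trans e (cong (λ b → if b then α n + 0 else 0) (≡ᵇ-no ne)))
    (rowSum-superstandard α C v n h (≤∧≢⇒< (≤-pred p) (ne ∘ sym)))) refl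

module _ {N C : ℕ} (lam : List ℕ) (len : length lam ≤ N) (dec : WeaklyDec lam) (parts : ∀ r → nthN0 lam r ≤ C) where
  open Base {N} {C} lam len dec

  char-base : char N lam id ≈P ((1ℤ , padV N lam) ∷ [])
  char-base a = trans (monos-coeff (wtKey N) (enum N lam id) a)
      (trans (sumZ-set (enum N lam id) [ t₀ ] _ (Distinct-enum N lam id) ([] ∷ [])
      (λ {t} m → here (t₀-unique {t} (enum-∈ {N} {lam} {id} {t} m))) (λ { (here refl) → ∈-enum ok {t₀} t₀-SSKT }))
      (trans (cong (λ z → δ z a +ℤ 0ℤ) wt₀) (sym (monos-coeff id [ padV N lam ] a))))
    where
    ok = id-Ok {N} {C} lam len parts
    wt₀ : wtKey N t₀ ≡ padV N lam
    wt₀ = tabulate-cong (λ j → trans (count-hgt ok {t₀} t₀-SSKT (suc (toℕ j)) (s≤s z≤n))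
        (trans (sym (rowSum-hgt (val t₀) (suc (toℕ j)) C N))
      (trans (same N) (rowSum-superstandard (nthN0 lam) C (toℕ j) N parts (toℕ<n j)))))
      where
      same : ∀ {v} n → rowSum (val t₀) v C n ≡ rowSum (superstandard (nthN0 lam)) v C n
      same zero = refl
      same {v} (suc n) = cong₂ _+_ (cnt-cong _ _ v v C
          (λ c _ → (λ e → trans (sym (t₀-val n c)) e) , (λ e → trans (t₀-val n c) e))) (same n)

  -- The recursion of `Dword⇒Im` on characters, with `piOp` in the place of the Demazure operator.
  char-sorts : ∀ {σ β} → length β ≤ N → (∀ r → nthN0 β r ≤ C) → Sorts lam σ β → char N β id ≈P piWord σ ((1ℤ , padV N lam) ∷ [])
  char-sorts _ _ done = char-base
  char-sorts {β = β} le pt (step {l} {σ} p q S) a = trans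
      (char-Im (id-Ok β le pt) (Bump.ok' B) (Im-exchange⇐ {C = C} le p q) (Im-exchange⇒ {C = C} le p q) a)
    (trans (char-bump B a) (piOp-cong (suc l) {char N γ id} {piWord σ ((1ℤ , padV N lam) ∷ [])} (char-sorts le' pt' S) a))
    where
    γ = swapAt1 (suc l) β
    le' = subst (_≤ N) (sym (swap-length (suc l) β)) le
    pt' = swap-parts {N} {C} l β p pt
    B = id-Bump γ l le' pt' (<-≤-trans p le)

char-climb : ∀ {N C α v ψ} → Climb N C α v ψ → char N α ψ ≈P piWord v (char N α id)
char-climb {N} {C} {α} (base h) a = cong (λ L → coeff (monos (wtKey N) L) a) (enum-cong N α h)
char-climb {N} {C} {α} (up {v} {ψ} {ψ'} j refl c B h) a = trans (cong (λ L → coeff (monos (wtKey N) L) a) (enum-cong N α h))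
  (trans (char-bump B a) (piOp-cong (ψ (suc j)) {char N α ψ} {piWord v (char N α id)} (char-climb c) a))

character : ∀ α φ → IsFlag φ → ∀ ws → MinSortWord α ws → kappaFlag α φ ≈P piWord (flagWord φ (length α))
    (kappa (φ (length α)) α ws)
-- `kappaFlag α φ` unfolds to `char N α φ` for `N = φ (length α)`, and `kappa` to the sorting word
-- applied to the monomial of `lam`; so the climb and the sorting word compose directly.
character α φ flag ws mw a = trans (char-climb flag-climb a)
    (piWord-cong (flagWord φ (length α)) {char N α id} {kappa N α ws}
    (char-sorts {N} {C} lam lam-len (proj₂ S) lam-parts shape-len (part≤max α) (proj₁ S)) a)
  where
  N = φ (length α)
  C = foldr _⊔_ 0 α
  lam = actW ws α
  S = MinSortWord⇒Sorts α ws mw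
  open FlagClimb {N} {C} α φ flag ≤-refl (part≤max α)
  lam-len : length lam ≤ N
  lam-len = ≤-trans (≤-reflexive (proj₁ (Sorts-same (proj₁ S)))) shape-len
  lam-parts : ∀ r → nthN0 lam r ≤ C
  lam-parts r = subst (_≤ C) (sym (proj₂ (proj₂ (Sorts-same (proj₁ S)) r))) (part≤max α _)

theorem4p13 : (α : List ℕ) (φ : ℕ → ℕ) → HasLength α → IsFlag φ →
    ((n : ℕ) → φ (length α) ≤ n → IsDemazureSSKT n α φ)
    × ((ws : List ℕ) → MinSortWord α ws →
    kappaFlag α φ ≈P piWord (flagWord φ (length α)) (kappa (φ (length α)) α ws))
theorem4p13 α φ _ flag = demazure α φ flag , character α φ flag
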